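{- Let $a\geq 1$ be an integer, let $\mathcal{F}_a(x)=\sum_{k\ge 0}\overline{g}^{(k)}_{(k^a), (k^a)}x^k$, and let $\ell$ be the least common multiple of $1,2,\ldots,a,a+1$. \begin{enumerate} \item $\mathcal{F}_{a}= \frac{P_a(x)}{(1-x^{\ell})^{2a}}$, where $P_a(x)$ is a polynomial that is a product of cyclotomic polynomials, and $\deg P_a =2\ell a - (a+2)a< 2a\ell-1$. \item $P_a$ is the generating function for coloured partitions with parts in $\{1, 2, \bar 2, 3, \bar 3, \ldots, a, \bar a, a+1 \}$ (where a part $j$ or $\bar j$ has size $j$) in which each part $j$ and each part $\bar j$ appears with multiplicity less than $\ell/j$. \item The coefficients of $P_a$ are positive and form a palindromic sequence, but in general (i.e. not for every $a$) they do not form a concave sequence. \item The function $k\mapsto \overline{g}^{(k)}_{(k^a), (k^a)}$ is a quasipolynomial of degree $2a-1$ whose period divides $\ell$; moreover, for $a<10$ the period equals $\ell$. \item As rational functions, $x^{a(a+2)}\mathcal{F}_a(x)= \mathcal{F}_a(1/x)$. \end{enumerate}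
   Context: For partitions $\lambda,\mu,\nu$ of $n$, the Kronecker coefficient $g_{\mu,\nu}^{\lambda}$ is the multiplicity of the irreducible character $\chi^\lambda$ of $S_n$ in $\chi^\mu\otimes\chi^\nu$. For a partition $\alpha$ and $n\ge |\alpha|+\alpha_1$, let $\alpha[n]=(n-|\alpha|,\alpha_1,\alpha_2,\dots)$. The reduced Kronecker coefficient $\overline{g}_{\alpha,\beta}^{\gamma}$ is the eventual (stable) value of $g_{\alpha[n],\beta[n]}^{\gamma[n]}$ as $n\to\infty$. $(k^a)$ is the partition with $a$ parts equal to $k$, and $(k)$ the one-row partition of $k$. A quasipolynomial of degree $d$ and period $p$ is a function $f:\mathbb{Z}_{\ge0}\to\mathbb{Q}$ of the form $f(k)=c_d(k)k^d+\dots+c_1(k)k+c_0(k)$ where each $c_i$ is a periodic function with period dividing $p$ and $c_d$ is not identically zero. -}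

module Defs where

open import Data.Bool using (Bool; true; false; if_then_else_; _∧_; _∨_; not)
open import Data.Nat as ℕ using (ℕ; zero; suc; _+_; _*_; _∸_; _≤_; _<_; _≡ᵇ_; _<ᵇ_; _≤ᵇ_; _!; pred)
open import Data.Nat.Divisibility using (_∣_; _∣?_)
open import Data.Nat.LCM using (lcm)
open import Data.Integer as ℤ using (ℤ; +_; -_)
open import Data.Rational as ℚ using (ℚ)
open import Data.Rational.Unnormalised as ℚᵘ using (ℚᵘ; mkℚᵘ; _≃_)
open import Data.List using (List; []; _∷_; _++_; map; foldr; filter; length; upTo; replicate; concatMap; reverse)
open import Data.Product using (Σ; Σ-syntax; ∃; ∃-syntax; _×_; _,_)
open import Relation.Nullary using (¬_; does)
open import Relation.Binary.PropositionalEquality using (_≡_; _≢_)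

-- Partitions are lists of natural numbers in weakly decreasing order.
-- Trailing zero parts are allowed and harmless everywhere below.

sumℕ : List ℕ → ℕ
sumℕ = foldr _+_ 0

sumℤ : List ℤ → ℤ
sumℤ = foldr ℤ._+_ (+ 0)

range1 : ℕ → List ℕ
range1 n = map suc (upTo n)

partsF : ℕ → ℕ → ℕ → List (List ℕ)
partsF zero    zero    m = [] ∷ []
partsF zero    (suc n) m = []
partsF (suc f) zero    m = [] ∷ []
partsF (suc f) (suc n) m =
  concatMap (λ p → map (p ∷_) (partsF f (suc n ∸ p) p))
            (reverse (filter (λ p → p ℕ.≤? m) (range1 (suc n))))

partitions : ℕ → List (List ℕ)
partitions n = partsF n n n

-- Irreducible characters of S_n via the Murnaghan–Nakayama rule,
-- in the beta-set (first column hook length) formulation.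

beta : List ℕ → List ℕ
beta []       = []
beta (x ∷ xs) = (x + length xs) ∷ beta xs

memb : ℕ → List ℕ → Bool
memb c B = foldr (λ x r → (x ≡ᵇ c) ∨ r) false B

between : ℕ → ℕ → List ℕ → ℕ
between lo hi B = length (filter (λ b → (lo ℕ.<? b)) (filter (λ b → b ℕ.<? hi) B))

signℤ : ℕ → ℤ
signℤ h = if (h ℕ.% 2) ≡ᵇ 0 then + 1 else - (+ 1)

replaceBeta : ℕ → ℕ → List ℕ → List ℕ
replaceBeta b b' B = map (λ x → if x ≡ᵇ b then b' else x) B

-- χ(B , ρ): character of the partition with beta-set B at cycle type ρ
-- (removal of an r-rim hook = replacing b by b - r ∉ B, sign (-1)^leg)
chiβ : List ℕ → List ℕ → ℤ
chiβ B []      = + 1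
chiβ B (r ∷ ρ) =
  sumℤ (map (λ b → if (r ≤ᵇ b) ∧ not (memb (b ∸ r) B)
                   then signℤ (between (b ∸ r) b B) ℤ.* chiβ (replaceBeta b (b ∸ r) B) ρ
                   else + 0) B)

chi : List ℕ → List ℕ → ℤ
chi λ' ρ = chiβ (beta λ') ρ

mult : ℕ → List ℕ → ℕ
mult i ρ = length (filter (λ x → x ℕ.≟ i) ρ)

zee : List ℕ → ℕ
zee ρ = foldr _*_ 1 (map (λ i → (i ℕ.^ mult i ρ) * (mult i ρ) !) (range1 (sumℕ ρ)))

-- 1 / z_ρ  (denominator-minus-one representation; z_ρ ≥ 1)
invZee : List ℕ → ℚᵘ
invZee ρ = mkℚᵘ (+ 1) (pred (zee ρ))

kron : List ℕ → List ℕ → List ℕ → ℚᵘ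
kron λ' μ ν =
  foldr ℚᵘ._+_ ℚᵘ.0ℚᵘ
    (map (λ ρ → mkℚᵘ (chi λ' ρ ℤ.* chi μ ρ ℤ.* chi ν ρ) 0 ℚᵘ.* invZee ρ)
         (partitions (sumℕ λ')))

pad : ℕ → List ℕ → List ℕ
pad n α = (n ∸ sumℕ α) ∷ α

IsReducedKron : List ℕ → List ℕ → List ℕ → ℤ → Set
IsReducedKron α β γ v =
  ∃[ N ] (∀ n → N ≤ n → kron (pad n γ) (pad n α) (pad n β) ≃ mkℚᵘ v 0)

rect : ℕ → ℕ → List ℕ
rect k a = replicate a k

-- Polynomials over ℤ as coefficient lists (constant term first).

Poly : Set
Poly = List ℤ

coeffP : Poly → ℕ → ℤ
coeffP []       _       = + 0
coeffP (x ∷ p)  zero    = x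
coeffP (x ∷ p)  (suc k) = coeffP p k

addP : Poly → Poly → Poly
addP []       q        = q
addP (x ∷ p)  []       = x ∷ p
addP (x ∷ p)  (y ∷ q)  = (x ℤ.+ y) ∷ addP p q

scaleP : ℤ → Poly → Poly
scaleP c = map (c ℤ.*_)

mulP : Poly → Poly → Poly
mulP []      q = []
mulP (x ∷ p) q = addP (scaleP x q) (+ 0 ∷ mulP p q)

prodP : List Poly → Poly
prodP = foldr mulP (+ 1 ∷ [])

powP : Poly → ℕ → Poly
powP p zero    = + 1 ∷ []
powP p (suc n) = mulP p (powP p n)

monomial : ℕ → ℤ → Poly
monomial n c = replicate n (+ 0) ++ (c ∷ [])

dropHead : Poly → Poly
dropHead []       = []
dropHead (_ ∷ xs) = xs

-- first `len` coefficients of the power series N / D, for D(0) = ±1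
seriesDiv : ℕ → Poly → Poly → Poly
seriesDiv zero    R D = []
seriesDiv (suc f) R D =
  let q = coeffP R 0 ℤ.* coeffP D 0 in
  q ∷ seriesDiv f (dropHead (addP R (scaleP (- q) D))) D

properDivisors : ℕ → List ℕ
properDivisors n = filter (λ d → d ∣? n) (range1 (n ∸ 1))

cycF : ℕ → ℕ → Poly
cycF zero    n = + 1 ∷ []
cycF (suc f) n =
  seriesDiv (suc n) (addP (- (+ 1) ∷ []) (monomial n (+ 1)))
                    (prodP (map (cycF f) (properDivisors n)))

cyclotomic : ℕ → Poly
cyclotomic n = cycF n n

IsDegree : (ℕ → ℤ) → ℕ → Set
IsDegree c d = (c d ≢ + 0) × (∀ k → d < k → c k ≡ + 0)

lcmUpTo : ℕ → ℕ
lcmUpTo a = foldr lcm 1 (range1 (suc a))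

denom : ℕ → Poly
denom a = powP (addP (+ 1 ∷ []) (monomial (lcmUpTo a) (- (+ 1)))) (2 * a)

convP : Poly → (ℕ → ℤ) → ℕ → ℤ
convP D g k = sumℤ (map (λ j → coeffP D j ℤ.* g (k ∸ j)) (upTo (suc k)))

Pcoef : (ℕ → ℤ) → ℕ → ℕ → ℤ
Pcoef F a = convP (denom a) F

degP : ℕ → ℕ
degP a = 2 * lcmUpTo a * a ∸ (a + 2) * a

-- sizes of the coloured parts 1, 2, 2̄, 3, 3̄, …, a, ā, a+1
colouredParts : ℕ → List ℕ
colouredParts a = 1 ∷ (concatMap (λ j → j ∷ j ∷ []) (map (λ i → 2 + i) (upTo (a ∸ 1))) ++ (suc a ∷ []))

-- number of coloured partitions of k using parts of the given list of sizes
-- (one list entry per colour), each part of size j used with multiplicity m, m·j < ℓ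
countColoured : ℕ → List ℕ → ℕ → ℕ
countColoured ℓ []       k = if k ≡ᵇ 0 then 1 else 0
countColoured ℓ (j ∷ js) k =
  sumℕ (map (λ m → if (m * j ≤ᵇ k) ∧ (m * j <ᵇ ℓ) then countColoured ℓ js (k ∸ m * j) else 0)
            (upTo (suc k)))

Concave : (ℕ → ℤ) → ℕ → Set
Concave c d = ∀ k → 1 ≤ k → k + 1 ≤ d → (c (k ∸ 1) ℤ.+ c (suc k)) ℤ.≤ (+ 2) ℤ.* c k

sumℚ : List ℚ → ℚ
sumℚ = foldr ℚ._+_ ℚ.0ℚ

powℚ : ℚ → ℕ → ℚ
powℚ q zero    = ℚ.1ℚ
powℚ q (suc n) = q ℚ.* powℚ q n

toℚ : ℤ → ℚ
toℚ z = z ℚ./ 1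

IsQuasiPoly : (ℕ → ℚ) → ℕ → ℕ → Set
IsQuasiPoly f d p =
  1 ≤ p ×
  Σ[ c ∈ (ℕ → ℕ → ℚ) ]
    ( (∀ i k → c i (k + p) ≡ c i k)
    × (∃[ k ] (c d k ≢ ℚ.0ℚ))
    × (∀ k → f k ≡ sumℚ (map (λ i → c i k ℚ.* powℚ (+ k ℚ./ 1) i) (upTo (suc d)))) )

HasPeriod : (ℕ → ℚ) → ℕ → ℕ → Set
HasPeriod f d p = IsQuasiPoly f d p × (∀ q → IsQuasiPoly f d q → p ≤ q)

-- Rational functions: N/D with N, D polynomials.
-- x^M·p(1/x) for M ≥ deg p
revP : ℕ → Poly → ℕ → ℤ
revP M p k = if k ≤ᵇ M then coeffP p (M ∸ k) else + 0

convF : (ℕ → ℤ) → (ℕ → ℤ) → ℕ → ℤ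
convF c e k = sumℤ (map (λ j → c j ℤ.* e (k ∸ j)) (upTo (suc k)))

shiftF : ℕ → (ℕ → ℤ) → ℕ → ℤ
shiftF s c k = if s ≤ᵇ k then c (k ∸ s) else + 0

-- The power series G(x) = Σ g(k) x^k equals the rational function N/D (D ≠ 0),
-- and as rational functions x^s·G(x) = G(1/x), i.e.
--   x^s N(x) / D(x) = N(1/x) / D(1/x) = (x^M N(1/x)) / (x^M D(1/x))
RatFunSymmetry : (ℕ → ℤ) → ℕ → Set
RatFunSymmetry g s =
  Σ[ N ∈ Poly ] Σ[ D ∈ Poly ]
    ( (∃[ j ] (coeffP D j ≢ + 0))
    × (∀ k → convP D g k ≡ coeffP N k)
    × (∀ k → convF (shiftF s (coeffP N)) (revP (length N + length D) D) k
             ≡ convF (revP (length N + length D) N) (coeffP D) k) )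

-- Write β for the beta-set of (n − ka, k^a). In terms of the operators D r (subtract r from one entry, in all
-- possible ways) the Murnaghan–Nakayama rule says that χ^λ(ρ) is, up to sign, D_ρ applied to the antisymmetric
-- delta function at (0, 1, 2, …). Since χ^{(n−k,k)} is a difference of permutation characters φ_k − φ_{k−1},
-- the Kronecker coefficient is H(k) − H(k−1), where H(k) = Σ_ρ φ_k(ρ) χ^β(ρ)² / z_ρ. The functional Σ_ρ f(ρ)/z_ρ
-- is determined by n L_n f = Σ_r L_{n−r} f(r ∷ ·), which gives orthogonality of the characters and splits φ_k off
-- as a double sum over σ ⊢ k and τ ⊢ n − k. For large n the long first row only absorbs whole parts of σ, and
-- the rectangle is replaced by the complement of what is left of it; by the Pieri rule H(k) then counts chains
-- 0 ≤ κ₀ ≤ ν₁ < κ₁ ≤ … ≤ ν_a < κ_a with Σκ fixed, that is Σ_k H(k) x^k = 1 / ((1−x)² (1−x²)² … (1−x^a)² (1−x^{a+1})).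
-- Hence 𝓕_a is 1 / ∏ (1 − x^j) over the coloured part sizes j.
--
-- From this P_a = ∏ (1 − x^ℓ)/(1 − x^j), where each factor is a product of cyclotomic polynomials and a geometric sum.
-- Reversing coefficients turns 1 − x^j into its negative, which gives the two symmetries. Newton interpolation in
-- steps of ℓ gives the quasipolynomial. Conversely, if q is a period then (1 − x^q)^{2a} annihilates 𝓕_a up to a
-- polynomial, hence also 1/(1 − x^m) for each part size m; along steps of q the latter is both periodic and
-- eventually polynomial, so it is constant and m divides q. In particular the period is always ℓ.
module Submission where

open import Defs
open import Algebra using (IsCommutativeRing; CommutativeRing)
open import Algebra.Properties.Ring using (-0#≈0#)
import Algebra.Solver.Ring as RingSolver
import Algebra.Solver.Ring.AlmostCommutativeRing as ACR
open import Data.Bool using (true; false; if_then_else_; _∧_; not)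
open import Data.Empty using (⊥-elim)
open import Data.Integer as ℤ using (ℤ)
import Data.Integer.Properties as ℤP
open import Data.Integer.Tactic.RingSolver using () renaming (solve-∀ to solve-∀-ℤ)
open import Data.List using (List; []; _∷_; _++_; length; map; filter; reverse; upTo; applyUpTo; concatMap; foldr; replicate; drop)
open import Data.List.Membership.Propositional using (_∈_)
open import Data.List.Membership.Propositional.Properties using (∈-∃++)
import Data.List.Properties as ListP
open import Data.List.Relation.Binary.Permutation.Propositional as Perm using (_↭_; ↭-refl; ↭-trans; ↭-sym)
import Data.List.Relation.Binary.Permutation.Propositional.Properties as PermP
open import Data.List.Relation.Unary.All as All using (All; []; _∷_)
import Data.List.Relation.Unary.All.Properties as AllP
open import Data.List.Relation.Unary.AllPairs using ([]; _∷_)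
open import Data.List.Relation.Unary.Any using (here; there)
open import Data.List.Relation.Unary.Unique.Propositional using (Unique)
import Data.Maybe
open import Data.Nat as ℕ using (ℕ; zero; suc; _∸_; _≤_; _<_; z≤n; s≤s)
open import Data.Nat.Divisibility as Div using (_∣_; _∣?_; divides)
open import Data.Nat.DivMod using (_%_; _/_; m/n*n≡m; m≡m%n+[m/n]*n; [m+n]%n≡m%n; m%n<n)
import Data.Nat.GCD as GCD
open import Data.Nat.LCM using (lcm; m∣lcm[m,n]; n∣lcm[m,n]; lcm-least)
open import Data.Nat.ListAction using (sum)
open import Data.Nat.ListAction.Properties using (sum-↭)
import Data.Nat.Properties as ℕP
open import Data.Nat.Tactic.RingSolver using (solve-∀)
open import Data.Product using (_×_; _,_; proj₁; proj₂; ∃-syntax)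
open import Data.Rational as ℚ using (ℚ)
import Data.Rational.Properties as ℚP
open import Data.Rational.Unnormalised as ℚᵘ using (ℚᵘ; mkℚᵘ; *≡*)
import Data.Rational.Unnormalised.Properties as ℚᵘP
open import Data.Sum using (_⊎_; inj₁; inj₂)
open import Function using (_∘_; flip)
open import Relation.Binary.Definitions using (tri<; tri≈; tri>)
open import Relation.Binary.PropositionalEquality using (_≡_; _≢_; refl; sym; trans; cong; cong₂; subst; subst₂; module ≡-Reasoning)
import Relation.Binary.Reasoning.Setoid
open import Relation.Nullary using (¬_; Dec; yes; no)
open import Relation.Nullary.Decidable using (dec⇒maybe; ¬?)
open import Relation.Unary using (Decidable)

-- Neither symmetric groups nor symmetric functions occur: a character is a function of an integer
-- list. The obstacle is that removing hooks produces unsorted lists and colliding entries.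
-- Characters are therefore extended antisymmetrically to all lists, so that collisions vanish and
-- signs need no bookkeeping until the comparison with the given Murnaghan-Nakayama rule. The
-- recursion for n L_n determines L_n only after division by n, and antisymmetry kills repeated
-- entries only if 2 can be cancelled; hence the rings in which positive integers cancel. Two of
-- them are used: ℚ, which contains the weights 1/z_ρ, and ℤ, for the counts and the power series. A
-- second obstacle is that cyclotomic polynomials are given by a truncated division. That it is
-- exact, i.e. that the product of the Φ_d over the proper divisors d of n divides x^n - 1, is
-- proved by induction: Bézout relations make the Φ_d coprime up to a nonzero integer, and an
-- integral quotient series that becomes a polynomial after multiplication by this integer is one
-- itself.

record CharZeroRing : Set₁ where
  infixl 6 _+_
  infixl 7 _*_
  infix  8 -_
  field
    A       : Set
    _+_ _*_ : A → A → A
    -_      : A → A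
    0# 1#   : A
    isCommutativeRing : IsCommutativeRing _≡_ _+_ _*_ -_ 0# 1#
    ι       : ℤ → A
    ι-0     : ι (ℤ.+ 0) ≡ 0#
    ι-1     : ι (ℤ.+ 1) ≡ 1#
    ι-+     : ∀ x y → ι (x ℤ.+ y) ≡ ι x + ι y
    ι-*     : ∀ x y → ι (x ℤ.* y) ≡ ι x * ι y
    ι-neg   : ∀ x → ι (ℤ.- x) ≡ - ι x
    ι-cancel : ∀ n x y → ι (ℤ.+ suc n) * x ≡ ι (ℤ.+ suc n) * y → x ≡ y

  commutativeRing : CommutativeRing _ _
  commutativeRing = record { isCommutativeRing = isCommutativeRing }

-- Lowering and raising operators on functions of integer lists

module Alternants (K : CharZeroRing) where
  open CharZeroRing K public
  open IsCommutativeRing isCommutativeRing public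
    using (+-assoc; +-comm; +-identityˡ; +-identityʳ; *-assoc; *-comm; *-identityˡ; *-identityʳ;
           distribˡ; distribʳ; zeroˡ; zeroʳ; -‿inverseʳ)
  open CommutativeRing commutativeRing public using (ring)
  open ≡-Reasoning

  acr : ACR.AlmostCommutativeRing _ _
  acr = ACR.fromCommutativeRing commutativeRing

  ι-morphism : CommutativeRing.rawRing ℤP.+-*-commutativeRing ACR.-Raw-AlmostCommutative⟶ acr
  ι-morphism = record
    { ⟦_⟧ = ι ; +-homo = ι-+ ; *-homo = ι-* ; -‿homo = ι-neg ; 0-homo = ι-0 ; 1-homo = ι-1 }

  open RingSolver (CommutativeRing.rawRing ℤP.+-*-commutativeRing) acr ι-morphism
    (λ x y → Data.Maybe.map (cong ι) (dec⇒maybe (x ℤ.≟ y))) public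
    using (solve; _:=_; _:+_; _:*_; :-_; con)

  +-congˡ : ∀ {a b c} → b ≡ c → a + b ≡ a + c
  +-congˡ = cong (_+_ _)

  +-congʳ : ∀ {a b c} → b ≡ c → b + a ≡ c + a
  +-congʳ {a} = cong (λ z → z + a)

  *-congˡ : ∀ {a b c} → b ≡ c → a * b ≡ a * c
  *-congˡ = cong (_*_ _)

  *-congʳ : ∀ {a b c} → b ≡ c → b * a ≡ c * a
  *-congʳ {a} = cong (λ z → z * a)

  nat : ℕ → A
  nat n = ι (ℤ.+ n)

  nat-suc : ∀ n → nat (suc n) ≡ 1# + nat n
  nat-suc n = trans (ι-+ (ℤ.+ 1) (ℤ.+ n)) (cong (_+ nat n) ι-1)

  nat-+ : ∀ m n → nat (m ℕ.+ n) ≡ nat m + nat n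
  nat-+ m n = ι-+ (ℤ.+ m) (ℤ.+ n)

  -0≡0 : - 0# ≡ 0#
  -0≡0 = -0#≈0# ring

  +-interchange : ∀ a b c d → (a + b) + (c + d) ≡ (a + c) + (b + d)
  +-interchange = solve 4 (λ a b c d → (a :+ b) :+ (c :+ d) := (a :+ c) :+ (b :+ d)) refl

  neg-+ : ∀ a b → - (a + b) ≡ - a + - b
  neg-+ = solve 2 (λ a b → :- (a :+ b) := :- a :+ :- b) refl

  x≡-x⇒x≡0 : ∀ x → x ≡ - x → x ≡ 0#
  x≡-x⇒x≡0 x e = ι-cancel 1 x 0# (begin
    nat 2 * x      ≡⟨ cong (_* x) (trans (nat-suc 1) (cong (1# +_) ι-1)) ⟩
    (1# + 1#) * x  ≡⟨ distribʳ x 1# 1# ⟩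
    1# * x + 1# * x ≡⟨ cong₂ _+_ (*-identityˡ x) (*-identityˡ x) ⟩
    x + x          ≡⟨ cong (x +_) e ⟩
    x + - x        ≡⟨ -‿inverseʳ x ⟩
    0#             ≡⟨ zeroʳ _ ⟨
    nat 2 * 0# ∎)

  x-y≡0⇒x≡y : ∀ x y → x + - y ≡ 0# → x ≡ y
  x-y≡0⇒x≡y x y e = begin
    x              ≡⟨ solve 2 (λ x y → x := (x :+ :- y) :+ y) refl x y ⟩
    x + - y + y    ≡⟨ cong (_+ y) e ⟩
    0# + y         ≡⟨ +-identityˡ y ⟩
    y ∎

  -- The value of `g` at x - r, read as 0 when r > x. The recursion on both numbers, instead of a
  -- comparison and a truncated subtraction, lets shifts compose and commute by plain induction.
  sub : ℕ → ℕ → (ℕ → A) → A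
  sub zero    x       g = g x
  sub (suc r) zero    g = 0#
  sub (suc r) (suc x) g = sub r x g

  sub-cong : ∀ r x {f g} → (∀ y → r ℕ.+ y ≡ x → f y ≡ g y) → sub r x f ≡ sub r x g
  sub-cong zero    x       h = h x refl
  sub-cong (suc r) zero    h = refl
  sub-cong (suc r) (suc x) h = sub-cong r x (λ y e → h y (cong suc e))

  sub-0 : ∀ r x → sub r x (λ _ → 0#) ≡ 0#
  sub-0 zero    x       = refl
  sub-0 (suc r) zero    = refl
  sub-0 (suc r) (suc x) = sub-0 r x

  sub-+ : ∀ r x f g → sub r x (λ y → f y + g y) ≡ sub r x f + sub r x g
  sub-+ zero    x       f g = refl
  sub-+ (suc r) zero    f g = sym (+-identityˡ 0#)
  sub-+ (suc r) (suc x) f g = sub-+ r x f g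

  sub-* : ∀ c r x f → sub r x (λ y → c * f y) ≡ c * sub r x f
  sub-* c zero    x       f = refl
  sub-* c (suc r) zero    f = sym (zeroʳ c)
  sub-* c (suc r) (suc x) f = sub-* c r x f

  sub-neg : ∀ r x f → sub r x (λ y → - f y) ≡ - sub r x f
  sub-neg zero    x       f = refl
  sub-neg (suc r) zero    f = sym -0≡0
  sub-neg (suc r) (suc x) f = sub-neg r x f

  sub-swap : ∀ r x s y (f : ℕ → ℕ → A) → sub r x (λ x′ → sub s y (λ y′ → f x′ y′)) ≡ sub s y (λ y′ → sub r x (λ x′ → f x′ y′))
  sub-swap zero    x       s y f = refl
  sub-swap (suc r) zero    s y f = sym (sub-0 s y)
  sub-swap (suc r) (suc x) s y f = sub-swap r x s y f

  sub-sub : ∀ r s x f → sub r x (λ y → sub s y f) ≡ sub (r ℕ.+ s) x f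
  sub-sub zero    s x       f = refl
  sub-sub (suc r) s zero    f = refl
  sub-sub (suc r) s (suc x) f = sub-sub r s x f

  sub-sub-comm : ∀ r s x f → sub r x (λ y → sub s y f) ≡ sub s x (λ y → sub r y f)
  sub-sub-comm r s x f = begin
    sub r x (λ y → sub s y f)  ≡⟨ sub-sub r s x f ⟩
    sub (r ℕ.+ s) x f          ≡⟨ cong (λ t → sub t x f) (ℕP.+-comm r s) ⟩
    sub (s ℕ.+ r) x f          ≡⟨ sub-sub s r x f ⟨
    sub s x (λ y → sub r y f)  ∎

  sub-< : ∀ {r x} f → x < r → sub r x f ≡ 0#
  sub-< {suc r} {zero}  f _       = refl
  sub-< {suc r} {suc x} f (s≤s p) = sub-< f p

  sub-≡ : ∀ r x f → sub r (r ℕ.+ x) f ≡ f x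
  sub-≡ zero    x f = refl
  sub-≡ (suc r) x f = sub-≡ r x f

  sub-at : ∀ {r n x} {f : ℕ → A} → n ≡ r ℕ.+ x → sub r n f ≡ f x
  sub-at {r} {x = x} {f} refl = sub-≡ r x f

  ∑ : ℕ → (ℕ → A) → A
  ∑ zero    f = 0#
  ∑ (suc n) f = f 0 + ∑ n (f ∘ suc)

  ∑-cong< : ∀ n {f g} → (∀ i → i < n → f i ≡ g i) → ∑ n f ≡ ∑ n g
  ∑-cong< zero    h = refl
  ∑-cong< (suc n) h = cong₂ _+_ (h 0 (s≤s z≤n)) (∑-cong< n (λ i p → h (suc i) (s≤s p)))

  ∑-cong : ∀ n {f g} → (∀ i → f i ≡ g i) → ∑ n f ≡ ∑ n g
  ∑-cong n h = ∑-cong< n (λ i _ → h i)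

  ∑-0 : ∀ n → ∑ n (λ _ → 0#) ≡ 0#
  ∑-0 zero    = refl
  ∑-0 (suc n) = trans (+-identityˡ _) (∑-0 n)

  ∑-+ : ∀ n f g → ∑ n (λ i → f i + g i) ≡ ∑ n f + ∑ n g
  ∑-+ zero    f g = sym (+-identityˡ 0#)
  ∑-+ (suc n) f g = trans (+-congˡ (∑-+ n (f ∘ suc) (g ∘ suc))) (+-interchange _ _ _ _)

  ∑-* : ∀ c n f → ∑ n (λ i → c * f i) ≡ c * ∑ n f
  ∑-* c zero    f = sym (zeroʳ c)
  ∑-* c (suc n) f = trans (+-congˡ (∑-* c n (f ∘ suc))) (sym (distribˡ c _ _))

  ∑-neg : ∀ n f → ∑ n (λ i → - f i) ≡ - ∑ n f
  ∑-neg zero    f = sym -0≡0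
  ∑-neg (suc n) f = trans (+-congˡ (∑-neg n (f ∘ suc))) (sym (neg-+ _ _))

  ∑-swap : ∀ m n (f : ℕ → ℕ → A) → ∑ m (λ i → ∑ n (λ j → f i j)) ≡ ∑ n (λ j → ∑ m (λ i → f i j))
  ∑-swap zero    n f = sym (∑-0 n)
  ∑-swap (suc m) n f = trans (+-congˡ (∑-swap m n (f ∘ suc))) (sym (∑-+ n _ _))

  ∑-extend : ∀ n R f → n ≤ R → (∀ i → n ≤ i → f i ≡ 0#) → ∑ R f ≡ ∑ n f
  ∑-extend zero    R       f p       h = trans (∑-cong R (λ i → h i z≤n)) (∑-0 R)
  ∑-extend (suc n) (suc R) f (s≤s p) h = +-congˡ (∑-extend n R (f ∘ suc) p (λ i q → h (suc i) (s≤s q)))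

  D : ℕ → (List ℕ → A) → List ℕ → A
  D r f []      = 0#
  D r f (x ∷ v) = sub r x (λ y → f (y ∷ v)) + D r (f ∘ (x ∷_)) v

  U : ℕ → (List ℕ → A) → List ℕ → A
  U r f []      = 0#
  U r f (x ∷ v) = f (x ℕ.+ r ∷ v) + U r (f ∘ (x ∷_)) v

  -- Only the lists reached by removing r matter. Their length and sum are recorded because the
  -- inductions on the size need them.
  D-cong : ∀ r v {f g} → (∀ w → length w ≡ length v → r ℕ.+ sum w ≡ sum v → f w ≡ g w) → D r f v ≡ D r g v
  D-cong r []      h = refl
  D-cong r (x ∷ v) h = cong₂ _+_
    (sub-cong r x (λ y e → h (y ∷ v) refl (trans (sym (ℕP.+-assoc r y (sum v))) (cong (ℕ._+ sum v) e))))
    (D-cong r v (λ w l e → h (x ∷ w) (cong suc l) (begin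
      r ℕ.+ (x ℕ.+ sum w) ≡⟨ ℕP.+-assoc r x _ ⟨
      r ℕ.+ x ℕ.+ sum w   ≡⟨ cong (ℕ._+ sum w) (ℕP.+-comm r x) ⟩
      x ℕ.+ r ℕ.+ sum w   ≡⟨ ℕP.+-assoc x r _ ⟩
      x ℕ.+ (r ℕ.+ sum w) ≡⟨ cong (x ℕ.+_) e ⟩
      x ℕ.+ sum v ∎)))

  D-cong′ : ∀ r v {f g} → (∀ w → f w ≡ g w) → D r f v ≡ D r g v
  D-cong′ r v h = D-cong r v (λ w _ _ → h w)

  D-+ : ∀ r v f g → D r (λ w → f w + g w) v ≡ D r f v + D r g v
  D-+ r []      f g = sym (+-identityˡ 0#)
  D-+ r (x ∷ v) f g = trans (cong₂ _+_ (sub-+ r x _ _) (D-+ r v _ _)) (+-interchange _ _ _ _)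

  D-0 : ∀ r v → D r (λ _ → 0#) v ≡ 0#
  D-0 r []      = refl
  D-0 r (x ∷ v) = trans (cong₂ _+_ (sub-0 r x) (D-0 r v)) (+-identityˡ 0#)

  D-* : ∀ c r v f → D r (λ w → c * f w) v ≡ c * D r f v
  D-* c r []      f = sym (zeroʳ c)
  D-* c r (x ∷ v) f = trans (cong₂ _+_ (sub-* c r x _) (D-* c r v _)) (sym (distribˡ c _ _))

  D-neg : ∀ r v f → D r (λ w → - f w) v ≡ - D r f v
  D-neg r []      f = sym -0≡0
  D-neg r (x ∷ v) f = trans (cong₂ _+_ (sub-neg r x _) (D-neg r v _)) (sym (neg-+ _ _))

  D-sub : ∀ r v s x (f : ℕ → List ℕ → A) → D r (λ w → sub s x (λ z → f z w)) v ≡ sub s x (λ z → D r (f z) v)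
  D-sub r []      s x f = sym (sub-0 s x)
  D-sub r (y ∷ v) s x f = trans
    (cong₂ _+_ (sub-swap r y s x _) (D-sub r v s x _)) (sym (sub-+ s x _ _))

  -- Removals from different entries are independent, and two removals from the same entry subtract
  -- r + s in either order.
  D-comm : ∀ r s f v → D r (D s f) v ≡ D s (D r f) v
  D-comm r s f []      = refl
  D-comm r s f (x ∷ v) = begin
    sub r x (λ y → D s f (y ∷ v)) + D r (λ w → D s f (x ∷ w)) v
      ≡⟨ cong₂ _+_ (sub-+ r x _ _) (trans (D-+ r v _ _) (+-congʳ (D-sub r v s x (λ z w → f (z ∷ w))))) ⟩
    (sub r x (λ y → sub s y (λ z → f (z ∷ v))) + sub r x (λ y → D s (λ w → f (y ∷ w)) v))
      + (sub s x (λ y → D r (λ w → f (y ∷ w)) v) + D r (D s (λ w → f (x ∷ w))) v)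
      ≡⟨ cong₂ _+_ (+-congʳ (sub-sub-comm r s x _)) (+-congˡ (D-comm r s _ v)) ⟩
    (sub s x (λ y → sub r y (λ z → f (z ∷ v))) + sub r x (λ y → D s (λ w → f (y ∷ w)) v))
      + (sub s x (λ y → D r (λ w → f (y ∷ w)) v) + D s (D r (λ w → f (x ∷ w))) v)
      ≡⟨ +-interchange _ _ _ _ ⟩
    (sub s x (λ y → sub r y (λ z → f (z ∷ v))) + sub s x (λ y → D r (λ w → f (y ∷ w)) v))
      + (sub r x (λ y → D s (λ w → f (y ∷ w)) v) + D s (D r (λ w → f (x ∷ w))) v)
      ≡⟨ cong₂ _+_ (sub-+ s x _ _) (trans (D-+ s v _ _) (+-congʳ (D-sub s v r x (λ z w → f (z ∷ w))))) ⟨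
    sub s x (λ y → D r f (y ∷ v)) + D s (λ w → D r f (x ∷ w)) v ∎

  U-cong : ∀ r v {f g} → (∀ w → f w ≡ g w) → U r f v ≡ U r g v
  U-cong r []      h = refl
  U-cong r (x ∷ v) h = cong₂ _+_ (h _) (U-cong r v (λ w → h (x ∷ w)))

  U-+ : ∀ r v f g → U r (λ w → f w + g w) v ≡ U r f v + U r g v
  U-+ r []      f g = sym (+-identityˡ 0#)
  U-+ r (x ∷ v) f g = trans (+-congˡ (U-+ r v _ _)) (+-interchange _ _ _ _)

  U-neg : ∀ r v f → U r (λ w → - f w) v ≡ - U r f v
  U-neg r []      f = sym -0≡0
  U-neg r (x ∷ v) f = trans (+-congˡ (U-neg r v _)) (sym (neg-+ _ _))

  U-* : ∀ c r v f → U r (λ w → c * f w) v ≡ c * U r f v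
  U-* c r []      f = sym (zeroʳ c)
  U-* c r (x ∷ v) f = trans (+-congˡ (U-* c r v _)) (sym (distribˡ c _ _))

  D-U-swap : ∀ r s v u (f : List ℕ → List ℕ → A) → D r (λ w → U s (λ z → f z w) v) u ≡ U s (λ z → D r (f z) u) v
  D-U-swap r s []      u f = D-0 r u
  D-U-swap r s (x ∷ v) u f = trans (D-+ r u _ _) (+-congˡ (D-U-swap r s v u _))

  Antisymmetric : (List ℕ → A) → Set
  Antisymmetric f = ∀ p x y v → f (p ++ y ∷ x ∷ v) ≡ - f (p ++ x ∷ y ∷ v)

  antisym-∷ : ∀ {f} x → Antisymmetric f → Antisymmetric (f ∘ (x ∷_))
  antisym-∷ x h p = h (x ∷ p)

  antisym-D : ∀ r {f} → Antisymmetric f → Antisymmetric (D r f)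
  antisym-D r {f} h []      x y v = begin
    sub r y (λ y′ → f (y′ ∷ x ∷ v)) + (sub r x (λ x′ → f (y ∷ x′ ∷ v)) + D r (λ w → f (y ∷ x ∷ w)) v)
      ≡⟨ cong₂ _+_ (trans (sub-cong r y (λ y′ _ → h [] x y′ v)) (sub-neg r y _))
          (cong₂ _+_ (trans (sub-cong r x (λ x′ _ → h [] x′ y v)) (sub-neg r x _))
                     (trans (D-cong′ r v (λ w → h [] x y w)) (D-neg r v _))) ⟩
    - sub r y (λ y′ → f (x ∷ y′ ∷ v)) + (- sub r x (λ x′ → f (x′ ∷ y ∷ v)) + - D r (λ w → f (x ∷ y ∷ w)) v)
      ≡⟨ solve 3 (λ a b c → :- a :+ (:- b :+ :- c) := :- (b :+ (a :+ c))) refl _ _ _ ⟩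
    - (sub r x (λ x′ → f (x′ ∷ y ∷ v)) + (sub r y (λ y′ → f (x ∷ y′ ∷ v)) + D r (λ w → f (x ∷ y ∷ w)) v)) ∎
  antisym-D r {f} h (z ∷ p) x y v = trans
    (cong₂ _+_ (trans (sub-cong r z (λ z′ _ → h (z′ ∷ p) x y v)) (sub-neg r z _))
               (antisym-D r (antisym-∷ {f} z h) p x y v))
    (sym (neg-+ _ _))

  antisym-equal : ∀ {f} → Antisymmetric f → ∀ x v → f (x ∷ x ∷ v) ≡ 0#
  antisym-equal h x v = x≡-x⇒x≡0 _ (h [] x x v)

-- Determinants as antisymmetric delta functions

-- n(n - 1)/2 = 0 + 1 + ... + (n - 1), the sum of the beta-set of the empty partition with n rows. A
-- beta-set of length n that belongs to a partition of m has sum m + `tri n`.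
tri : ℕ → ℕ
tri zero    = 0
tri (suc n) = n ℕ.+ tri n

All-≤-sum : ∀ v → All (_≤ sum v) v
All-≤-sum []      = []
All-≤-sum (x ∷ v) = ℕP.m≤m+n x (sum v) ∷ All.map (λ q → ℕP.≤-trans q (ℕP.m≤n+m (sum v) x)) (All-≤-sum v)

module Determinants (K : CharZeroRing) where
  open Alternants K public
  open ≡-Reasoning

  eq : ℕ → ℕ → A
  eq zero    zero    = 1#
  eq zero    (suc _) = 0#
  eq (suc _) zero    = 0#
  eq (suc x) (suc y) = eq x y

  eq-refl : ∀ x → eq x x ≡ 1#
  eq-refl zero    = refl
  eq-refl (suc x) = eq-refl x

  eq-≢ : ∀ {x y} → x ≢ y → eq x y ≡ 0#
  eq-≢ {zero}  {zero}  n = ⊥-elim (n refl)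
  eq-≢ {zero}  {suc y} n = refl
  eq-≢ {suc x} {zero}  n = refl
  eq-≢ {suc x} {suc y} n = eq-≢ (n ∘ cong suc)

  eq-sub : ∀ x r z → eq (x ℕ.+ r) z ≡ sub r z (eq x)
  eq-sub x zero    z       = cong (λ t → eq t z) (ℕP.+-identityʳ x)
  eq-sub x (suc r) zero    = cong (λ t → eq t 0) (ℕP.+-suc x r)
  eq-sub x (suc r) (suc z) = trans (cong (λ t → eq t (suc z)) (ℕP.+-suc x r)) (eq-sub x r z)

  -- Laplace expansion: Σ_j (-1)^j f(u_j, u without u_j)
  Lap : (ℕ → List ℕ → A) → List ℕ → A
  Lap f []      = 0#
  Lap f (y ∷ u) = f y u + - Lap (λ z w → f z (y ∷ w)) u

  Lap-cong : ∀ u {f g} → (∀ z w → z ∷ w ↭ u → f z w ≡ g z w) → Lap f u ≡ Lap g u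
  Lap-cong []      h = refl
  Lap-cong (y ∷ u) h = cong₂ _+_ (h y u ↭-refl)
    (cong -_ (Lap-cong u (λ z w p → h z (y ∷ w) (↭-trans (Perm.swap z y ↭-refl) (Perm.prep y p)))))

  Lap-0 : ∀ u → Lap (λ _ _ → 0#) u ≡ 0#
  Lap-0 []      = refl
  Lap-0 (y ∷ u) = trans (+-identityˡ _) (trans (cong -_ (Lap-0 u)) -0≡0)

  Lap-+ : ∀ u f g → Lap (λ z w → f z w + g z w) u ≡ Lap f u + Lap g u
  Lap-+ []      f g = sym (+-identityˡ 0#)
  Lap-+ (y ∷ u) f g = trans (+-congˡ (cong -_ (Lap-+ u _ _)))
    (solve 4 (λ a b c d → (a :+ b) :+ :- (c :+ d) := (a :+ :- c) :+ (b :+ :- d)) refl _ _ _ _)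

  Lap-neg : ∀ u f → Lap (λ z w → - f z w) u ≡ - Lap f u
  Lap-neg []      f = sym -0≡0
  Lap-neg (y ∷ u) f = trans (+-congˡ (cong -_ (Lap-neg u _))) (sym (neg-+ _ _))

  Lap-* : ∀ c u f → Lap (λ z w → c * f z w) u ≡ c * Lap f u
  Lap-* c []      f = sym (zeroʳ c)
  Lap-* c (y ∷ u) f = trans (+-congˡ (cong -_ (Lap-* c u _)))
    (solve 3 (λ c a b → c :* a :+ :- (c :* b) := c :* (a :+ :- b)) refl _ _ _)

  Lap-sub : ∀ u r x (f : ℕ → ℕ → List ℕ → A) →
    Lap (λ z w → sub r x (λ y → f y z w)) u ≡ sub r x (λ y → Lap (f y) u)
  Lap-sub []      r x f = sym (sub-0 r x)
  Lap-sub (y ∷ u) r x f = trans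
    (+-congˡ (trans (cong -_ (Lap-sub u r x (λ t z w → f t z (y ∷ w)))) (sym (sub-neg r x _))))
    (sym (sub-+ r x _ _))

  Lap-U : ∀ u r v (f : List ℕ → ℕ → List ℕ → A) →
    Lap (λ z w → U r (λ v′ → f v′ z w) v) u ≡ U r (λ v′ → Lap (f v′) u) v
  Lap-U u r []      f = Lap-0 u
  Lap-U u r (x ∷ v) f = trans (Lap-+ u _ _) (+-congˡ (Lap-U u r v (λ v′ → f (x ∷ v′))))

  -- The product rule: a removal hits either the entry singled out by the expansion or the list that
  -- remains.
  D-Lap : ∀ r u f → D r (Lap f) u ≡ Lap (λ z w → sub r z (λ y → f y w) + D r (f z) w) u
  D-Lap r []      f = refl
  D-Lap r (y ∷ u) f = begin
    sub r y (λ y′ → f y′ u + - Lap (λ z w → f z (y′ ∷ w)) u) + D r (λ w → f y w + - Lap fy w) u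
      ≡⟨ cong₂ _+_ (trans (sub-+ r y _ _) (+-congˡ (sub-neg r y _)))
                   (trans (D-+ r u _ _) (+-congˡ (trans (D-neg r u _) (cong -_ (D-Lap r u fy))))) ⟩
    (sub r y (λ y′ → f y′ u) + - sub r y (λ y′ → Lap (λ z w → f z (y′ ∷ w)) u)) + (D r (f y) u + - Lap _ u)
      ≡⟨ solve 4 (λ a b c d → (a :+ :- b) :+ (c :+ :- d) := (a :+ c) :+ :- (d :+ b)) refl _ _ _ _ ⟩
    (sub r y (λ y′ → f y′ u) + D r (f y) u) + - (Lap _ u + sub r y (λ y′ → Lap (λ z w → f z (y′ ∷ w)) u))
      ≡⟨ +-congˡ (cong -_ (trans (+-congˡ (sym (Lap-sub u r y (λ y′ z w → f z (y′ ∷ w))))) (trans (sym (Lap-+ u _ _))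
           (Lap-cong u (λ z w _ → solve 3 (λ a b c → (a :+ b) :+ c := a :+ (c :+ b)) refl _ _ _))))) ⟩
    (sub r y (λ y′ → f y′ u) + D r (f y) u) + - Lap (λ z w → sub r z (λ y′ → f y′ (y ∷ w)) + D r (f z) (y ∷ w)) u ∎
    where
    fy : ℕ → List ℕ → A
    fy z w = f z (y ∷ w)

  -- Expanding twice picks an ordered pair of entries, and exchanging their order reverses the sign.
  -- This is why a determinant is antisymmetric in its rows.
  Lap-Lap : ∀ u (g : ℕ → ℕ → List ℕ → A) →
    Lap (λ z → Lap (g z)) u ≡ - Lap (λ z → Lap (λ z′ → g z′ z)) u
  Lap-Lap []      g = sym -0≡0
  Lap-Lap (y ∷ u) g = begin
    Lap (g y) u + - Lap (λ z w → g z y w + - Lap (λ z′ w′ → g z z′ (y ∷ w′)) w) u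
      ≡⟨ +-congˡ (cong -_ (trans (Lap-+ u _ _) (+-congˡ (Lap-neg u _)))) ⟩
    Lap (g y) u + - (Lap (λ z → g z y) u + - Lap (λ z → Lap (λ z′ w′ → g z z′ (y ∷ w′))) u)
      ≡⟨ +-congˡ (cong -_ (+-congˡ (cong -_ (Lap-Lap u (λ z z′ w → g z z′ (y ∷ w)))))) ⟩
    Lap (g y) u + - (Lap (λ z → g z y) u + - (- Lap (λ z → Lap (λ z′ w′ → g z′ z (y ∷ w′))) u))
      ≡⟨ solve 3 (λ a b c → a :+ :- (b :+ :- (:- c)) := :- (b :+ :- (a :+ :- c))) refl _ _ _ ⟩
    - (Lap (λ z → g z y) u + - (Lap (g y) u + - Lap (λ z → Lap (λ z′ w′ → g z′ z (y ∷ w′))) u))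
      ≡⟨ cong -_ (+-congˡ (cong -_ (trans (Lap-+ u _ _) (+-congˡ (Lap-neg u _))))) ⟨
    - (Lap (λ z → g z y) u + - Lap (λ z w → g y z w + - Lap (λ z′ w′ → g z′ z (y ∷ w′)) w) u) ∎

  antisym-Lap : ∀ {f} → (∀ z → Antisymmetric (f z)) → Antisymmetric (Lap f)
  antisym-Lap {f} h []      x y v = begin
    f y (x ∷ v) + - (f x (y ∷ v) + - Lap (λ z w → f z (y ∷ x ∷ w)) v)
      ≡⟨ +-congˡ (cong -_ (+-congˡ (cong -_ (trans (Lap-cong v (λ z w _ → h z [] x y w)) (Lap-neg v _))))) ⟩
    f y (x ∷ v) + - (f x (y ∷ v) + - (- Lap (λ z w → f z (x ∷ y ∷ w)) v))
      ≡⟨ solve 3 (λ a b c → a :+ :- (b :+ :- (:- c)) := :- (b :+ :- (a :+ :- c))) refl _ _ _ ⟩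
    - (f x (y ∷ v) + - (f y (x ∷ v) + - Lap (λ z w → f z (x ∷ y ∷ w)) v)) ∎
  antisym-Lap {f} h (q ∷ p) x y v = trans
    (cong₂ _+_ (h q p x y v) (cong -_ (antisym-Lap (λ z → antisym-∷ {f z} q (h z)) p x y v)))
    (sym (neg-+ _ _))

  -- The determinant of the matrix with entries eq v_i u_j: the signed number of rearrangements of u equal to v.
  det : List ℕ → List ℕ → A
  det []      []      = 1#
  det []      (_ ∷ _) = 0#
  det (x ∷ v) u       = Lap (λ z w → eq x z * det v w) u

  antisym-detʳ : ∀ v → Antisymmetric (det v)
  antisym-detʳ []      []      x y u = sym -0≡0
  antisym-detʳ []      (_ ∷ p) x y u = sym -0≡0
  antisym-detʳ (z ∷ v) p       x y u = antisym-Lap {λ z′ w → eq z z′ * det v w}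
    (λ z′ p x y u → trans (*-congˡ (antisym-detʳ v p x y u))
       (solve 2 (λ a b → a :* (:- b) := :- (a :* b)) refl _ _)) p x y u

  antisym-detˡ : ∀ u → Antisymmetric (λ v → det v u)
  antisym-detˡ u []      x y v = begin
    Lap (λ z w → eq y z * Lap (λ z′ w′ → eq x z′ * det v w′) w) u
      ≡⟨ Lap-cong u (λ z w _ → Lap-* (eq y z) w _) ⟨
    Lap (λ z → Lap (λ z′ w′ → eq y z * (eq x z′ * det v w′))) u
      ≡⟨ Lap-Lap u _ ⟩
    - Lap (λ z → Lap (λ z′ w′ → eq y z′ * (eq x z * det v w′))) u
      ≡⟨ cong -_ (Lap-cong u (λ z w _ → trans
           (Lap-cong w (λ z′ w′ _ → solve 3 (λ a b c → a :* (b :* c) := b :* (a :* c)) refl _ _ _))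
           (Lap-* (eq x z) w _))) ⟩
    - Lap (λ z w → eq x z * Lap (λ z′ w′ → eq y z′ * det v w′) w) u ∎
  antisym-detˡ u (q ∷ p) x y v = trans
    (Lap-cong u (λ z w _ → trans (*-congˡ (antisym-detˡ w p x y v))
      (solve 2 (λ a b → a :* (:- b) := :- (a :* b)) refl _ _)))
    (Lap-neg u _)

  -- For single entries `eq-sub` says that lowering the column index by r amounts to raising the row
  -- index by r; the product rule `D-Lap` carries this through the expansion.
  adjoint : ∀ r v u → D r (det v) u ≡ U r (λ v′ → det v′ u) v
  adjoint r []      []      = refl
  adjoint r []      (y ∷ u) = trans (cong₂ _+_ (sub-0 r y) (D-0 r u)) (+-identityˡ 0#)
  adjoint r (x ∷ v) u       = begin
    D r (Lap (λ z w → eq x z * det v w)) u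
      ≡⟨ D-Lap r u _ ⟩
    Lap (λ z w → sub r z (λ y → eq x y * det v w) + D r (λ w → eq x z * det v w) w) u
      ≡⟨ Lap-cong u (λ z w _ → cong₂ _+_
           (trans (sub-cong r z (λ y _ → *-comm _ _)) (trans (sub-* _ r z _) (trans (*-comm _ _) (*-congʳ (sym (eq-sub x r z))))))
           (trans (D-* _ r w _) (trans (*-congˡ (adjoint r v w)) (sym (U-* _ r v _))))) ⟩
    Lap (λ z w → eq (x ℕ.+ r) z * det v w + U r (λ v′ → eq x z * det v′ w) v) u
      ≡⟨ trans (Lap-+ u _ _) (+-congˡ (Lap-U u r v _)) ⟩
    det (x ℕ.+ r ∷ v) u + U r (λ v′ → det (x ∷ v′) u) v ∎

  -- left h x q = Σ_{0≤i<x} h i (x+q−i)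
  left : (ℕ → ℕ → A) → ℕ → ℕ → A
  left h zero    q = 0#
  left h (suc x) q = h x (suc q) + left h x (suc q)

  left-neg : ∀ {g h} → (∀ x q → g x q ≡ - h x q) → ∀ x q → left g x q ≡ - left h x q
  left-neg e zero    q = sym -0≡0
  left-neg e (suc x) q = trans (cong₂ _+_ (e _ _) (left-neg e x (suc q))) (sym (neg-+ _ _))

  ∑-left : ∀ h R x q → x ≤ R → ∑ R (λ r → sub (suc r) x (λ y → h y (q ℕ.+ suc r))) ≡ left h x q
  ∑-left h R       zero    q p       = ∑-0 R
  ∑-left h (suc R) (suc x) q (s≤s p) = cong₂ _+_
    (cong (h x) (ℕP.+-comm q 1))
    (trans (∑-cong R (λ r → sub-cong (suc r) x (λ y _ → cong (h y) (ℕP.+-suc q (suc r))))) (∑-left h R x (suc q) p))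

  -- The sum of h over all pairs with sum x + q, split at the pair (x, q) itself.
  antidiagonal : (ℕ → ℕ → A) → ℕ → ℕ → A
  antidiagonal h x q = left h x q + h x q + left (flip h) q x

  antidiagonal-shift : ∀ h x q → antidiagonal h x q ≡ antidiagonal h 0 (x ℕ.+ q)
  antidiagonal-shift h zero    q = refl
  antidiagonal-shift h (suc x) q = begin
    (h x (suc q) + left h x (suc q)) + h (suc x) q + left (flip h) q (suc x)
      ≡⟨ solve 4 (λ a b c d → (a :+ b) :+ c :+ d := b :+ a :+ (c :+ d)) refl _ _ _ _ ⟩
    antidiagonal h x (suc q) ≡⟨ antidiagonal-shift h x (suc q) ⟩
    antidiagonal h 0 (x ℕ.+ suc q) ≡⟨ cong (antidiagonal h 0) (ℕP.+-suc x q) ⟩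
    antidiagonal h 0 (suc x ℕ.+ q) ∎

  -- Reflection maps the whole antidiagonal sum to its negative, so it vanishes, and the terms away
  -- from (x, q) must cancel the one at (x, q).
  antidiagonal-0 : ∀ h → (∀ x y → h y x ≡ - h x y) → ∀ x q → left h x q + left (flip h) q x ≡ - h x q
  antidiagonal-0 h a x q = begin
    left h x q + left (flip h) q x
      ≡⟨ solve 3 (λ a b c → a :+ c := :- b :+ (a :+ b :+ c)) refl _ _ _ ⟩
    - h x q + antidiagonal h x q ≡⟨ +-congˡ (x≡-x⇒x≡0 _ self) ⟩
    - h x q + 0#                 ≡⟨ +-identityʳ _ ⟩
    - h x q ∎
    where
    self : antidiagonal h x q ≡ - antidiagonal h x q
    self = begin
      antidiagonal h x q ≡⟨ trans (antidiagonal-shift h x q) (trans (cong (antidiagonal h 0) (ℕP.+-comm x q)) (sym (antidiagonal-shift h q x))) ⟩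
      left h q x + h q x + left (flip h) x q
        ≡⟨ cong₂ _+_ (cong₂ _+_ (left-neg {h} {flip h} (λ x y → a y x) q x) (a x q)) (left-neg {flip h} {h} (λ x y → a x y) x q) ⟩
      - left (flip h) q x + - h x q + - left h x q
        ≡⟨ solve 3 (λ a b c → :- c :+ :- b :+ :- a := :- (a :+ b :+ c)) refl _ _ _ ⟩
      - antidiagonal h x q ∎

  -- A hook moves from x to another row or from there to x. For one row q the two directions
  -- together run over the antidiagonal through (x, q) without that point, so each row of v
  -- contributes -f (x ∷ v).
  ∑D∑U-cross : ∀ R x v {f} → Antisymmetric f → x ≤ R → All (_≤ R) v →
    ∑ R (λ r → sub (suc r) x (λ y → U (suc r) (f ∘ (y ∷_)) v)) + ∑ R (λ r → D (suc r) (λ w → f (x ℕ.+ suc r ∷ w)) v)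
      ≡ - (nat (length v) * f (x ∷ v))
  ∑D∑U-cross R x []      {f} a p _ = begin
    ∑ R (λ r → sub (suc r) x (λ y → 0#)) + ∑ R (λ r → 0#)
      ≡⟨ cong₂ _+_ (trans (∑-cong R (λ r → sub-0 (suc r) x)) (∑-0 R)) (∑-0 R) ⟩
    0# + 0#
      ≡⟨ trans (+-identityʳ 0#) (trans (sym -0≡0) (cong -_ (sym (trans (*-congʳ ι-0) (zeroˡ _))))) ⟩
    - (nat 0 * f (x ∷ [])) ∎
  ∑D∑U-cross R x (q ∷ v) {f} a p (p′ ∷ ps) = begin
    ∑ R (λ r → sub (suc r) x (λ y → f (y ∷ q ℕ.+ suc r ∷ v) + U (suc r) (λ w → f (y ∷ q ∷ w)) v))
      + ∑ R (λ r → sub (suc r) q (λ q′ → f (x ℕ.+ suc r ∷ q′ ∷ v)) + D (suc r) (λ w → f (x ℕ.+ suc r ∷ q ∷ w)) v)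
      ≡⟨ cong₂ _+_ (trans (∑-cong R (λ r → sub-+ (suc r) x _ _)) (∑-+ R _ _)) (∑-+ R _ _) ⟩
    (∑ R (λ r → sub (suc r) x (λ y → f (y ∷ q ℕ.+ suc r ∷ v))) + ∑ R (λ r → sub (suc r) x (λ y → U (suc r) (λ w → f (y ∷ q ∷ w)) v)))
      + (∑ R (λ r → sub (suc r) q (λ q′ → f (x ℕ.+ suc r ∷ q′ ∷ v))) + ∑ R (λ r → D (suc r) (λ w → f (x ℕ.+ suc r ∷ q ∷ w)) v))
      ≡⟨ +-interchange _ _ _ _ ⟩
    (∑ R (λ r → sub (suc r) x (λ y → f (y ∷ q ℕ.+ suc r ∷ v))) + ∑ R (λ r → sub (suc r) q (λ q′ → f (x ℕ.+ suc r ∷ q′ ∷ v))))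
      + (∑ R (λ r → sub (suc r) x (λ y → U (suc r) (λ w → f (y ∷ q ∷ w)) v)) + ∑ R (λ r → D (suc r) (λ w → f (x ℕ.+ suc r ∷ q ∷ w)) v))
      ≡⟨ cong₂ _+_
           (trans (cong₂ _+_ (∑-left h R x q p) (∑-left (flip h) R q x p′)) (antidiagonal-0 h (λ x y → a [] x y v) x q))
           (cong₂ _+_
             (trans (∑-cong R (λ r → trans (sub-cong (suc r) x (λ y _ → trans (U-cong (suc r) v (λ w → a [] q y w)) (U-neg (suc r) v _))) (sub-neg (suc r) x _))) (∑-neg R _))
             (trans (∑-cong R (λ r → trans (D-cong′ (suc r) v (λ w → a [] q _ w)) (D-neg (suc r) v _))) (∑-neg R _))) ⟩
    - f (x ∷ q ∷ v)
      + (- ∑ R (λ r → sub (suc r) x (λ y → U (suc r) (λ w → f (q ∷ y ∷ w)) v)) + - ∑ R (λ r → D (suc r) (λ w → f (q ∷ x ℕ.+ suc r ∷ w)) v))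
      ≡⟨ +-congˡ (trans (sym (neg-+ _ _)) (cong -_ (trans (∑D∑U-cross R x v {f ∘ (q ∷_)} (antisym-∷ {f} q a) p ps) (cong -_ (*-congˡ (a [] x q v)))))) ⟩
    - f (x ∷ q ∷ v) + - (- (nat (length v) * - f (x ∷ q ∷ v)))
      ≡⟨ solve 2 (λ a n → :- a :+ :- (:- (n :* :- a)) := :- ((con (ℤ.+ 1) :+ n) :* a)) refl _ _ ⟩
    - ((ι (ℤ.+ 1) + nat (length v)) * f (x ∷ q ∷ v))
      ≡⟨ cong -_ (*-congʳ (sym (nat-+ 1 (length v)))) ⟩
    - (nat (suc (length v)) * f (x ∷ q ∷ v)) ∎
    where
    h : ℕ → ℕ → A
    h s t = f (s ∷ t ∷ v)

  sub-const : ∀ r x (h : ℕ → A) → sub r x (λ y → h (y ℕ.+ r)) ≡ sub r x (λ _ → h x)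
  sub-const r x h = sub-cong r x (λ y e → cong h (trans (ℕP.+-comm y r) e))

  ∑-sub-const : ∀ R x c → x ≤ R → ∑ R (λ r → sub (suc r) x (λ _ → c)) ≡ nat x * c
  ∑-sub-const R       zero    c p       = trans (∑-0 R) (sym (trans (*-congʳ ι-0) (zeroˡ c)))
  ∑-sub-const (suc R) (suc x) c (s≤s p) = begin
    c + ∑ R (λ r → sub (suc r) x (λ _ → c)) ≡⟨ +-congˡ (∑-sub-const R x c p) ⟩
    c + nat x * c                           ≡⟨ +-congʳ (*-identityˡ c) ⟨
    1# * c + nat x * c                      ≡⟨ distribʳ c _ _ ⟨
    (1# + nat x) * c                        ≡⟨ *-congʳ (nat-suc x) ⟨
    nat (suc x) * c ∎

  -- Putting a hook back on the row it came from gives `sum v` terms, and each pair of different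
  -- rows contributes -1 by `∑D∑U-cross`. On a beta-set the eigenvalue is therefore the size of the
  -- partition.
  ∑DU : ∀ R v {f} → Antisymmetric f → All (_≤ R) v →
    ∑ R (λ r → D (suc r) (U (suc r) f) v) ≡ (nat (sum v) + - nat (tri (length v))) * f v
  ∑DU R []      {f} a ps = trans (∑-0 R) (sym (trans (*-congʳ (-‿inverseʳ _)) (zeroˡ _)))
  ∑DU R (x ∷ v) {f} a (p ∷ ps) = begin
    ∑ R (λ r → sub (suc r) x (λ y → f (y ℕ.+ suc r ∷ v) + U (suc r) (λ w → f (y ∷ w)) v)
             + D (suc r) (λ w → f (x ℕ.+ suc r ∷ w) + U (suc r) (λ w → f (x ∷ w)) w) v)
      ≡⟨ trans (∑-cong R (λ r → trans (cong₂ _+_ (sub-+ (suc r) x _ _) (D-+ (suc r) v _ _))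
           (solve 4 (λ a b c d → (a :+ b) :+ (c :+ d) := a :+ ((b :+ c) :+ d)) refl _ _ _ _)))
           (trans (∑-+ R _ _) (+-congˡ (trans (∑-+ R _ _) (+-congʳ (∑-+ R _ _))))) ⟩
    ∑ R (λ r → sub (suc r) x (λ y → f (y ℕ.+ suc r ∷ v)))
      + ((∑ R (λ r → sub (suc r) x (λ y → U (suc r) (λ w → f (y ∷ w)) v)) + ∑ R (λ r → D (suc r) (λ w → f (x ℕ.+ suc r ∷ w)) v))
         + ∑ R (λ r → D (suc r) (U (suc r) (λ w → f (x ∷ w))) v))
      ≡⟨ cong₂ _+_ (trans (∑-cong R (λ r → sub-const (suc r) x (λ y → f (y ∷ v)))) (∑-sub-const R x _ p))
           (cong₂ _+_ (∑D∑U-cross R x v {f} a p ps) (∑DU R v (antisym-∷ {f} x a) ps)) ⟩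
    nat x * f (x ∷ v) + (- (nat (length v) * f (x ∷ v)) + (nat (sum v) + - nat (tri (length v))) * f (x ∷ v))
      ≡⟨ solve 5 (λ x n s t f → x :* f :+ (:- (n :* f) :+ (s :+ :- t) :* f) := ((x :+ s) :+ :- (n :+ t)) :* f) refl _ _ _ _ _ ⟩
    ((nat x + nat (sum v)) + - (nat (length v) + nat (tri (length v)))) * f (x ∷ v)
      ≡⟨ *-congʳ (cong₂ (λ s t → s + - t) (sym (nat-+ x (sum v))) (sym (nat-+ (length v) _))) ⟩
    (nat (sum (x ∷ v)) + - nat (tri (length (x ∷ v)))) * f (x ∷ v) ∎

  data Incr : ℕ → List ℕ → Set where
    []  : ∀ {b} → Incr b []
    _∷_ : ∀ {b x v} → b ≤ x → Incr (suc x) v → Incr b (x ∷ v)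

  Incr-weaken : ∀ {b c v} → b ≤ c → Incr c v → Incr b v
  Incr-weaken p []       = []
  Incr-weaken p (q ∷ qs) = ℕP.≤-trans p q ∷ qs

  -- Insertion into a sorted list: every exchange only changes the sign, and meeting an equal entry
  -- gives 0.
  antisym-insert : ∀ {f} → Antisymmetric f → ∀ b x v → b ≤ x → Incr b v →
    (∀ w → w ↭ x ∷ v → Incr b w → f w ≡ 0#) → f (x ∷ v) ≡ 0#
  antisym-insert a b x []      p _        h = h (x ∷ []) ↭-refl (p ∷ [])
  antisym-insert {f} a b x (y ∷ v) p (q ∷ i) h with ℕP.<-cmp x y
  ... | tri< x<y _ _    = h (x ∷ y ∷ v) ↭-refl (p ∷ x<y ∷ i)
  ... | tri≈ _ refl _   = antisym-equal {f} a x v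
  ... | tri> _ _ y<x    = trans (a [] y x v) (trans (cong -_ (antisym-insert (antisym-∷ {f} y a) (suc y) x v y<x i
          (λ w π j → h (y ∷ w) (↭-trans (Perm.prep y π) (Perm.swap y x ↭-refl)) (q ∷ j)))) -0≡0)

  antisym-vanishes : ∀ {f} → Antisymmetric f → ∀ v → (∀ w → w ↭ v → Incr 0 w → f w ≡ 0#) → f v ≡ 0#
  antisym-vanishes a []      h = h [] ↭-refl []
  antisym-vanishes {f} a (x ∷ v) h = antisym-vanishes (antisym-∷ {f} x a) v
    (λ w π i → antisym-insert a 0 x w z≤n i (λ w′ π′ → h w′ (↭-trans π′ (Perm.prep x π))))

  -- Applied to the difference of f and g. Identities of antisymmetric functions are thereby reduced
  -- to strictly increasing lists, on which `det` is a plain Kronecker delta.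
  antisym-≡ : ∀ {f g} → Antisymmetric f → Antisymmetric g → ∀ v → (∀ w → w ↭ v → Incr 0 w → f w ≡ g w) → f v ≡ g v
  antisym-≡ {f} {g} a b v h = x-y≡0⇒x≡y _ _ (antisym-vanishes {λ w → f w + - g w}
    (λ p x y w → trans (cong₂ (λ s t → s + - t) (a p x y w) (b p x y w)) (sym (neg-+ _ _))) v
    (λ w π i → trans (+-congʳ (h w π i)) (-‿inverseʳ _)))

  ∉-det : ∀ x v u → All (x ≢_) u → det (x ∷ v) u ≡ 0#
  ∉-det x v u n = trans (Lap-cong u (λ z w π → trans (*-congʳ (eq-≢ (All.head (PermP.All-resp-↭ (↭-sym π) n)))) (zeroˡ _))) (Lap-0 u)

  det-∉ : ∀ v y u → All (_≢ y) v → det v (y ∷ u) ≡ 0#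
  det-∉ []      y u _        = refl
  det-∉ (x ∷ v) y u (n ∷ ns) = trans
    (cong₂ _+_ (trans (*-congʳ (eq-≢ n)) (zeroˡ _))
      (trans (cong -_ (trans (Lap-cong u (λ z w _ → trans (*-congˡ (det-∉ v y w ns)) (zeroʳ _))) (Lap-0 u))) -0≡0))
    (+-identityˡ 0#)

  det-head : ∀ x v y u → All (x ≢_) u → det (x ∷ v) (y ∷ u) ≡ eq x y * det v u
  det-head x v y u n = trans (+-congˡ (trans (cong -_ (trans (Lap-cong u
      (λ z w π → trans (*-congʳ (eq-≢ (All.head (PermP.All-resp-↭ (↭-sym π) n)))) (zeroˡ _))) (Lap-0 u))) -0≡0))
    (+-identityʳ _)

  det-head′ : ∀ x v u → All (x ≢_) u → det (x ∷ v) (x ∷ u) ≡ det v u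
  det-head′ x v u n = trans (det-head x v x u n) (trans (*-congʳ (eq-refl x)) (*-identityˡ _))

  det-sum : ∀ v u → sum v ≢ sum u → det v u ≡ 0#
  det-sum []      []      n = ⊥-elim (n refl)
  det-sum []      (_ ∷ _) n = refl
  det-sum (x ∷ v) u       n = trans (Lap-cong u step) (Lap-0 u)
    where
    step : ∀ z w → z ∷ w ↭ u → eq x z * det v w ≡ 0#
    step z w π with x ℕ.≟ z
    ... | yes refl = trans (*-congˡ (det-sum v w (λ e → n (trans (cong (x ℕ.+_) e) (sum-↭ π))))) (zeroʳ _)
    ... | no x≢z   = trans (*-congʳ (eq-≢ x≢z)) (zeroˡ _)

  -- For b = 0 this is the beta-set of the empty partition, increasing rather than decreasing as in
  -- `beta`; the difference only affects signs.
  iota : ℕ → ℕ → List ℕ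
  iota b zero    = []
  iota b (suc n) = b ∷ iota (suc b) n

  Incr-≥ : ∀ {b v} → Incr b v → All (b ≤_) v
  Incr-≥ []       = []
  Incr-≥ (p ∷ ps) = p ∷ All.map (λ q → ℕP.≤-trans p (ℕP.≤-trans (ℕP.n≤1+n _) q)) (Incr-≥ ps)

  Incr-iota : ∀ b n → Incr b (iota b n)
  Incr-iota b zero    = []
  Incr-iota b (suc n) = ℕP.≤-refl ∷ Incr-iota (suc b) n

  length-iota : ∀ b n → length (iota b n) ≡ n
  length-iota b zero    = refl
  length-iota b (suc n) = cong suc (length-iota (suc b) n)

  ≥⇒≢ : ∀ {x v} → All (suc x ≤_) v → All (x ≢_) v
  ≥⇒≢ = All.map ℕP.<⇒≢

  det-iota : ∀ b n → det (iota b n) (iota b n) ≡ 1#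
  det-iota b zero    = refl
  det-iota b (suc n) = trans (det-head′ b (iota (suc b) n) _ (≥⇒≢ (Incr-≥ (Incr-iota (suc b) n)))) (det-iota (suc b) n)

  tri-shift : ∀ b n t → b ℕ.* suc n ℕ.+ (n ℕ.+ t) ≡ b ℕ.+ (suc b ℕ.* n ℕ.+ t)
  tri-shift = solve-∀

  Incr-sum : ∀ {b v} → Incr b v → b ℕ.* length v ℕ.+ tri (length v) ≤ sum v
  Incr-tail : ∀ {b x v} → b ≤ x → Incr (suc x) v → suc b ℕ.* length v ℕ.+ tri (length v) ≤ sum v

  Incr-tail {v = v} p ps = ℕP.≤-trans (ℕP.+-monoˡ-≤ (tri (length v)) (ℕP.*-monoˡ-≤ (length v) (s≤s p))) (Incr-sum ps)

  Incr-sum {b} []                    = ℕP.≤-reflexive (trans (ℕP.+-identityʳ _) (ℕP.*-zeroʳ b))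
  Incr-sum {b} (_∷_ {v = v} p ps) = ℕP.≤-trans (ℕP.≤-reflexive (tri-shift b (length v) _)) (ℕP.+-mono-≤ p (Incr-tail p ps))

  Incr-sum-≡ : ∀ {b v} → Incr b v → sum v ≡ b ℕ.* length v ℕ.+ tri (length v) → v ≡ iota b (length v)
  Incr-sum-≡ []      e = refl
  Incr-sum-≡ {b} (_∷_ {v = v} p ps) e with ℕP.m≤n⇒m<n∨m≡n p
  ... | inj₂ refl = cong (b ∷_) (Incr-sum-≡ ps (ℕP.+-cancelˡ-≡ b _ _ (trans e (tri-shift b (length v) _))))
  ... | inj₁ b<x  = ⊥-elim (ℕP.<-irrefl (sym (trans e (tri-shift b (length v) _))) (ℕP.+-mono-<-≤ b<x (Incr-tail p ps)))

-- The functional Σ f(ρ)/z_ρ: orthogonality and splitting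

module CycleIndexFunctionals (K : CharZeroRing) where
  open Determinants K public
  open ≡-Reasoning

  Symmetric : (List ℕ → A) → Set
  Symmetric f = ∀ {ρ σ} → ρ ↭ σ → f ρ ≡ f σ

  -- The functionals f ↦ Σ_{ρ⊢n} f(ρ)/z_ρ, characterised by their recursion on symmetric f.
  record CycleIndex : Set where
    field
      L      : ℕ → (List ℕ → A) → A
      L-cong : ∀ n {f g} → (∀ ρ → All (1 ≤_) ρ → sum ρ ≡ n → f ρ ≡ g ρ) → L n f ≡ L n g
      L-+    : ∀ n f g → L n (λ ρ → f ρ + g ρ) ≡ L n f + L n g
      L-*    : ∀ c n f → L n (λ ρ → c * f ρ) ≡ c * L n f
      L-zero : ∀ f → L 0 f ≡ f []
      L-suc  : ∀ n R f → n ≤ R → Symmetric f →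
        nat n * L n f ≡ ∑ R (λ r → sub (suc r) n (λ m → L m (f ∘ (suc r ∷_))))

  D* : List ℕ → (List ℕ → A) → List ℕ → A
  D* []      f = f
  D* (r ∷ ρ) f = D r (D* ρ f)

  D*-antisym : ∀ ρ {f} → Antisymmetric f → Antisymmetric (D* ρ f)
  D*-antisym []      a = a
  D*-antisym (r ∷ ρ) {f} a = antisym-D r {D* ρ f} (D*-antisym ρ a)

  D*-↭ : ∀ {ρ σ} f v → ρ ↭ σ → D* ρ f v ≡ D* σ f v
  D*-↭ f v Perm.refl         = refl
  D*-↭ f v (Perm.prep r p)   = D-cong′ r v (λ w → D*-↭ f w p)
  D*-↭ f v (Perm.swap {xs} {ys} r s p) = trans (D-cong′ r v (λ w → D-cong′ s w (λ w → D*-↭ f w p))) (D-comm r s (D* ys f) v)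
  D*-↭ f v (Perm.trans p q)  = trans (D*-↭ f v p) (D*-↭ f v q)

  D*-cong : ∀ ρ v {f g} → (∀ w → length w ≡ length v → sum ρ ℕ.+ sum w ≡ sum v → f w ≡ g w) → D* ρ f v ≡ D* ρ g v
  D*-cong []      v h = h v refl refl
  D*-cong (r ∷ ρ) v h = D-cong r v (λ w l e → D*-cong ρ w (λ w′ l′ e′ → h w′ (trans l′ l)
    (trans (ℕP.+-assoc r (sum ρ) (sum w′)) (trans (cong (r ℕ.+_) e′) e))))

  D*-0 : ∀ ρ v → D* ρ (λ _ → 0#) v ≡ 0#
  D*-0 []      v = refl
  D*-0 (r ∷ ρ) v = trans (D-cong′ r v (D*-0 ρ)) (D-0 r v)

  X : ℕ → List ℕ → List ℕ → A
  X N ρ = D* ρ (det (iota 0 N))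

  X-antisym : ∀ N ρ → Antisymmetric (X N ρ)
  X-antisym N ρ = D*-antisym ρ (antisym-detʳ (iota 0 N))

  sum-iota : ∀ b n → sum (iota b n) ≡ b ℕ.* n ℕ.+ tri n
  sum-iota b zero    = sym (trans (ℕP.+-identityʳ _) (ℕP.*-zeroʳ b))
  sum-iota b (suc n) = trans (cong (b ℕ.+_) (sum-iota (suc b) n)) (sym (tri-shift b n (tri n)))

  X-sum : ∀ N ρ v → sum v ≢ sum ρ ℕ.+ tri N → X N ρ v ≡ 0#
  X-sum N ρ v n = trans (D*-cong ρ v (λ w _ e → det-sum (iota 0 N) w
      (λ e′ → n (trans (sym e) (cong (sum ρ ℕ.+_) (trans (sym e′) (sum-iota 0 N))))))) (D*-0 ρ v)

  -- Of length N and sum `tri N` there is only one strictly increasing list, so the antisymmetric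
  -- functions of this degree form a line and `det` is a form of rank one on it. This is
  -- orthogonality for n = 0.
  det-tri : ∀ N v u → length v ≡ N → sum v ≡ tri N → det v u ≡ det (iota 0 N) v * det (iota 0 N) u
  det-tri N v u l s = antisym-≡ {λ v → det v u} {λ v → det (iota 0 N) v * det (iota 0 N) u} (antisym-detˡ u)
    (λ p x y w → trans (*-congʳ (antisym-detʳ (iota 0 N) p x y w)) (solve 2 (λ a b → :- a :* b := :- (a :* b)) refl _ _)) v step
    where
    step : ∀ w → w ↭ v → Incr 0 w → det w u ≡ det (iota 0 N) w * det (iota 0 N) u
    step w π i = begin
      det w u                          ≡⟨ cong (λ t → det t u) w≡ ⟩
      det (iota 0 N) u                 ≡⟨ *-identityˡ _ ⟨
      1# * det (iota 0 N) u            ≡⟨ *-congʳ (trans (cong (det (iota 0 N)) w≡) (det-iota 0 N)) ⟨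
      det (iota 0 N) w * det (iota 0 N) u ∎
      where
      lw : length w ≡ N
      lw = trans (PermP.↭-length π) l
      w≡ : w ≡ iota 0 N
      w≡ = trans (Incr-sum-≡ i (trans (sum-↭ π) (trans s (cong tri (sym lw))))) (cong (iota 0) lw)

  -- A strictly increasing list of this length cannot have so small a sum: there is no partition of
  -- negative size.
  det-small : ∀ v u → sum v < tri (length v) → det v u ≡ 0#
  det-small v u p = antisym-vanishes {λ v → det v u} (antisym-detˡ u) v
    (λ w π i → ⊥-elim (ℕP.<⇒≱ p (subst (_≤ sum v) (cong tri (PermP.↭-length π))
      (subst (_ ≤_) (sum-↭ π) (Incr-sum i)))))

  D*D : ∀ r (f g : List ℕ → A) v u → D r f v * D r g u ≡ D r (λ v′ → D r (λ u′ → f v′ * g u′) u) v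
  D*D r f g v u = begin
    D r f v * D r g u                      ≡⟨ *-comm _ _ ⟩
    D r g u * D r f v                      ≡⟨ D-* (D r g u) r v f ⟨
    D r (λ v′ → D r g u * f v′) v          ≡⟨ D-cong′ r v (λ v′ → trans (*-comm _ _) (sym (D-* (f v′) r u g))) ⟩
    D r (λ v′ → D r (λ u′ → f v′ * g u′) u) v ∎

  module Functional (I : CycleIndex) where
    open CycleIndex I public

    L-cong′ : ∀ n {f g} → (∀ ρ → f ρ ≡ g ρ) → L n f ≡ L n g
    L-cong′ n h = L-cong n (λ ρ _ _ → h ρ)

    L-0 : ∀ n → L n (λ _ → 0#) ≡ 0#
    L-0 n = trans (L-cong′ n (λ _ → sym (zeroˡ 0#))) (trans (L-* 0# n _) (zeroˡ _))

    L-neg : ∀ n f → L n (λ ρ → - f ρ) ≡ - L n f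
    L-neg n f = trans (L-cong′ n (λ ρ → solve 1 (λ x → :- x := (:- con (ℤ.+ 1)) :* x) refl _))
      (trans (L-* _ n f) (solve 1 (λ x → (:- con (ℤ.+ 1)) :* x := :- x) refl _))

    L-sub : ∀ n r x (f : ℕ → List ℕ → A) → L n (λ ρ → sub r x (λ y → f y ρ)) ≡ sub r x (λ y → L n (f y))
    L-sub n zero    x       f = refl
    L-sub n (suc r) zero    f = L-0 n
    L-sub n (suc r) (suc x) f = L-sub n r x f

    L-∑ : ∀ n R (f : ℕ → List ℕ → A) → L n (λ ρ → ∑ R (λ i → f i ρ)) ≡ ∑ R (λ i → L n (f i))
    L-∑ n zero    f = L-0 n
    L-∑ n (suc R) f = trans (L-+ n _ _) (+-congˡ (L-∑ n R (f ∘ suc)))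

    L-D : ∀ n r v (f : List ℕ → List ℕ → A) → L n (λ ρ → D r (λ w → f w ρ) v) ≡ D r (λ w → L n (f w)) v
    L-D n r []      f = L-0 n
    L-D n r (x ∷ v) f = trans (L-+ n _ _) (cong₂ _+_ (L-sub n r x _) (L-D n r v _))

    L-D-D : ∀ n r v u (f g : List ℕ → List ℕ → A) →
      L n (λ ρ → D r (f ρ) v * D r (g ρ) u) ≡ D r (λ v′ → D r (λ u′ → L n (λ ρ → f ρ v′ * g ρ u′)) u) v
    L-D-D n r v u f g = trans (L-cong′ n (λ ρ → D*D r (f ρ) (g ρ) v u))
      (trans (L-D n r v _) (D-cong′ r v (λ v′ → L-D n r u _)))

    private
      -- The recursion removes the same r from both arguments. By induction the smaller value is
      -- `det`, adjointness turns the removal from u into an addition to v, and the eigenvalue in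
      -- `∑DU` is n, which is then cancelled.
      orthogonality-fuel : ∀ b n N v u → n ≤ b → length v ≡ N → length u ≡ N →
        sum v ≡ n ℕ.+ tri N → sum u ≡ n ℕ.+ tri N → L n (λ ρ → X N ρ v * X N ρ u) ≡ det v u
      orthogonality-fuel b zero N v u _ lv lu sv su = trans (L-zero _) (sym (det-tri N v u lv sv))
      orthogonality-fuel (suc b) n@(suc n′) N v u (s≤s p) lv lu sv su = ι-cancel n′ _ _ (begin
        nat n * L n (λ ρ → X N ρ v * X N ρ u)
          ≡⟨ L-suc n n _ ℕP.≤-refl (λ π → cong₂ _*_ (D*-↭ (det (iota 0 N)) v π) (D*-↭ (det (iota 0 N)) u π)) ⟩
        ∑ n (λ r → sub (suc r) n (λ m → L m (λ ρ → D (suc r) (X N ρ) v * D (suc r) (X N ρ) u)))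
          ≡⟨ ∑-cong< n term ⟩
        ∑ n (λ r → D (suc r) (U (suc r) (λ v″ → det v″ u)) v)
          -- Hooks longer than n leave a list whose sum is too small, so the range of r may be
          -- enlarged to the one that `∑DU` requires.
          ≡⟨ ∑-extend n (sum v) _ (ℕP.≤-trans (ℕP.m≤m+n n (tri N)) (ℕP.≤-reflexive (sym sv))) vanish ⟨
        ∑ (sum v) (λ r → D (suc r) (U (suc r) (λ v″ → det v″ u)) v)
          ≡⟨ ∑DU (sum v) v (antisym-detˡ u) (All-≤-sum v) ⟩
        (nat (sum v) + - nat (tri (length v))) * det v u
          ≡⟨ *-congʳ (trans (cong₂ (λ s t → nat s + - nat (tri t)) sv lv) (trans (+-congʳ (nat-+ n (tri N)))
               (solve 2 (λ a b → (a :+ b) :+ :- b := a) refl _ _))) ⟩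
        nat n * det v u ∎)
        where
        term : ∀ r → r < n → sub (suc r) n (λ m → L m (λ ρ → D (suc r) (X N ρ) v * D (suc r) (X N ρ) u))
                             ≡ D (suc r) (U (suc r) (λ v″ → det v″ u)) v
        term r r<n = begin
          sub (suc r) n (λ m → L m (λ ρ → D (suc r) (X N ρ) v * D (suc r) (X N ρ) u))
            ≡⟨ sub-cong (suc r) n inner ⟩
          sub (suc r) n (λ _ → D (suc r) (U (suc r) (λ v″ → det v″ u)) v)
            ≡⟨ sub-at {suc r} {n} (sym (ℕP.m+[n∸m]≡n r<n)) ⟩
          D (suc r) (U (suc r) (λ v″ → det v″ u)) v ∎
          where
          inner : ∀ m → suc r ℕ.+ m ≡ n → L m (λ ρ → D (suc r) (X N ρ) v * D (suc r) (X N ρ) u)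
                                          ≡ D (suc r) (U (suc r) (λ v″ → det v″ u)) v
          inner m e = trans (L-D-D m (suc r) v u (X N) (X N))
            (D-cong (suc r) v (λ v′ lv′ sv′ → trans
              (D-cong (suc r) u (λ u′ lu′ su′ → orthogonality-fuel b m N v′ u′
                 (ℕP.≤-trans (ℕP.m≤n+m m r) (ℕP.≤-trans (ℕP.≤-reflexive (ℕP.suc-injective e)) p)) (trans lv′ lv) (trans lu′ lu)
                 (shift sv′ sv) (shift su′ su)))
              (adjoint (suc r) v′ u)))
            where
            shift : ∀ {s t} → suc r ℕ.+ s ≡ t → t ≡ n ℕ.+ tri N → s ≡ m ℕ.+ tri N
            shift {s} e₁ e₂ = ℕP.+-cancelˡ-≡ (suc r) s _ (trans e₁ (trans e₂ (trans (cong (ℕ._+ tri N) (sym e)) (ℕP.+-assoc (suc r) m (tri N)))))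
        vanish : ∀ r → n ≤ r → D (suc r) (U (suc r) (λ v″ → det v″ u)) v ≡ 0#
        vanish r n≤r = trans (D-cong (suc r) v (λ v′ l e → trans (sym (adjoint (suc r) v′ u))
          (trans (D-cong′ (suc r) u (λ w → det-small v′ w (small v′ l e))) (D-0 (suc r) u)))) (D-0 (suc r) v)
          where
          small : ∀ v′ → length v′ ≡ length v → suc r ℕ.+ sum v′ ≡ sum v → sum v′ < tri (length v′)
          small v′ l e = ℕP.+-cancelˡ-< r _ _ (ℕP.≤-trans (ℕP.≤-reflexive (trans e (trans sv (cong (λ t → n ℕ.+ tri t) (sym (trans l lv))))))
            (ℕP.+-monoˡ-≤ (tri (length v′)) n≤r))

    orthogonality : ∀ n N v u → length v ≡ N → length u ≡ N →
      sum v ≡ n ℕ.+ tri N → sum u ≡ n ℕ.+ tri N → L n (λ ρ → X N ρ v * X N ρ u) ≡ det v u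
    orthogonality n N v u = orthogonality-fuel n n N v u ℕP.≤-refl

    -- The permutation character of S_n on the k-subsets, at cycle type ρ.
    φ : List ℕ → ℕ → A
    φ []      k = eq 0 k
    φ (r ∷ ρ) k = φ ρ k + sub r k (φ ρ)

    φ-↭ : ∀ {ρ σ} k → ρ ↭ σ → φ ρ k ≡ φ σ k
    φ-↭ k Perm.refl         = refl
    φ-↭ k (Perm.prep r p)   = cong₂ _+_ (φ-↭ k p) (sub-cong r k (λ y _ → φ-↭ y p))
    φ-↭ k (Perm.swap {xs} {ys} r s p) = begin
      (φ xs k + sub s k (φ xs)) + sub r k (λ y → φ xs y + sub s y (φ xs))
        ≡⟨ +-congˡ (sub-+ r k _ _) ⟩
      (φ xs k + sub s k (φ xs)) + (sub r k (φ xs) + sub r k (λ y → sub s y (φ xs)))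
        ≡⟨ trans (+-interchange _ _ _ _) (+-congˡ (+-congˡ (sub-sub-comm r s k _))) ⟩
      (φ xs k + sub r k (φ xs)) + (sub s k (φ xs) + sub s k (λ y → sub r y (φ xs)))
        ≡⟨ +-congˡ (sub-+ s k _ _) ⟨
      (φ xs k + sub r k (φ xs)) + sub s k (λ y → φ xs y + sub r y (φ xs))
        ≡⟨ cong₂ _+_ (cong₂ _+_ (φ-↭ k p) (sub-cong r k (λ y _ → φ-↭ y p)))
             (sub-cong s k (λ y _ → cong₂ _+_ (φ-↭ y p) (sub-cong r y (λ z _ → φ-↭ z p)))) ⟩
      (φ ys k + sub r k (φ ys)) + sub s k (λ y → φ ys y + sub r y (φ ys)) ∎
    φ-↭ k (Perm.trans p q)  = trans (φ-↭ k p) (φ-↭ k q)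

    φ-large : ∀ ρ k → sum ρ < k → φ ρ k ≡ 0#
    φ-large []      (suc k) p = refl
    φ-large (r ∷ ρ) k       p = trans (cong₂ _+_ (φ-large ρ k (ℕP.≤-<-trans (ℕP.m≤n+m (sum ρ) r) p))
      (trans (sub-cong r k (λ y e → φ-large ρ y (ℕP.+-cancelˡ-< r _ _ (subst (r ℕ.+ sum ρ <_) (sym e) p)))) (sub-0 r k))) (+-identityˡ 0#)

    private
      -- Frobenius reciprocity for the trivial character of S_k × S_m, by the recursion for n = k +
      -- m. A cycle outside the chosen subset lowers m and a cycle inside lowers k; on the other
      -- side n = m + k distributes over the two functionals.
      split-fuel : ∀ b k m f → k ℕ.+ m ≤ b → Symmetric f →
        L (k ℕ.+ m) (λ ρ → φ ρ k * f ρ) ≡ L k (λ σ → L m (λ τ → f (σ ++ τ)))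
      split-fuel b k m f p s with k ℕ.+ m in eqn
      split-fuel b k m f p s | zero with k | m | eqn
      ... | zero | zero | refl = trans (L-zero _) (trans (*-identityˡ _) (sym (trans (L-zero _) (L-zero _))))
      split-fuel (suc b) k m f (s≤s p) s | suc n′ = ι-cancel n′ _ _ (begin
        nat n * L n (λ ρ → φ ρ k * f ρ)
          ≡⟨ L-suc n n _ ℕP.≤-refl (λ π → cong₂ _*_ (φ-↭ k π) (s π)) ⟩
        ∑ n (λ r → sub (suc r) n (λ n″ → L n″ (λ ρ → φ (suc r ∷ ρ) k * f (suc r ∷ ρ))))
          ≡⟨ ∑-cong n (λ r → trans (sub-cong (suc r) n (λ n″ _ → trans (L-cong′ n″ (λ ρ → distribʳ _ _ _)) (L-+ n″ _ _)))
               (trans (sub-+ (suc r) n _ _) (cong₂ _+_ (first r) (second r)))) ⟩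
        ∑ n (λ r → sub (suc r) m (λ m″ → L k (λ σ → L m″ (λ τ → f (suc r ∷ σ ++ τ))))
                 + sub (suc r) k (λ k″ → L k″ (λ σ → L m (λ τ → f (suc r ∷ σ ++ τ)))))
          ≡⟨ ∑-+ n (λ r → sub (suc r) m (λ m″ → L k (λ σ → L m″ (λ τ → f (suc r ∷ σ ++ τ)))))
                   (λ r → sub (suc r) k (λ k″ → L k″ (λ σ → L m (λ τ → f (suc r ∷ σ ++ τ))))) ⟩
        ∑ n (λ r → sub (suc r) m (λ m″ → L k (λ σ → L m″ (λ τ → f (suc r ∷ σ ++ τ)))))
          + ∑ n (λ r → sub (suc r) k (λ k″ → L k″ (λ σ → L m (λ τ → f (suc r ∷ σ ++ τ)))))
          ≡⟨ cong₂ _+_ right-m right-k ⟨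
        nat m * L k (λ σ → L m (λ τ → f (σ ++ τ))) + nat k * L k (λ σ → L m (λ τ → f (σ ++ τ)))
          ≡⟨ trans (sym (distribʳ _ _ _)) (*-congʳ (trans (+-comm _ _) (trans (sym (nat-+ k m)) (cong nat eqn)))) ⟩
        nat n * L k (λ σ → L m (λ τ → f (σ ++ τ))) ∎)
        where
        n = suc n′
        k≤n : k ≤ n
        k≤n = subst (k ≤_) eqn (ℕP.m≤m+n k m)
        m≤n : m ≤ n
        m≤n = subst (m ≤_) eqn (ℕP.m≤n+m m k)
        s′ : ∀ r → Symmetric (f ∘ (r ∷_))
        s′ r π = s (Perm.prep r π)
        right-k : nat k * L k (λ σ → L m (λ τ → f (σ ++ τ))) ≡ ∑ n (λ r → sub (suc r) k (λ k″ → L k″ (λ σ → L m (λ τ → f (suc r ∷ σ ++ τ)))))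
        right-k = L-suc k n _ k≤n (λ π → L-cong′ m (λ τ → s (PermP.++⁺ʳ τ π)))
        right-m : nat m * L k (λ σ → L m (λ τ → f (σ ++ τ))) ≡ ∑ n (λ r → sub (suc r) m (λ m″ → L k (λ σ → L m″ (λ τ → f (suc r ∷ σ ++ τ)))))
        right-m = begin
          nat m * L k (λ σ → L m (λ τ → f (σ ++ τ)))
            ≡⟨ L-* (nat m) k _ ⟨
          L k (λ σ → nat m * L m (λ τ → f (σ ++ τ)))
            ≡⟨ L-cong′ k (λ σ → L-suc m n (λ τ → f (σ ++ τ)) m≤n (λ π → s (PermP.++⁺ˡ σ π))) ⟩
          L k (λ σ → ∑ n (λ r → sub (suc r) m (λ m″ → L m″ (λ τ → f (σ ++ suc r ∷ τ)))))
            ≡⟨ trans (L-∑ k n (λ r σ → sub (suc r) m (λ m″ → L m″ (λ τ → f (σ ++ suc r ∷ τ)))))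
                 (∑-cong n (λ r → L-sub k (suc r) m (λ m″ σ → L m″ (λ τ → f (σ ++ suc r ∷ τ))))) ⟩
          ∑ n (λ r → sub (suc r) m (λ m″ → L k (λ σ → L m″ (λ τ → f (σ ++ suc r ∷ τ)))))
            ≡⟨ ∑-cong n (λ r → sub-cong (suc r) m (λ m″ _ → L-cong′ k (λ σ → L-cong′ m″ (λ τ → s (PermP.shift (suc r) σ τ))))) ⟩
          ∑ n (λ r → sub (suc r) m (λ m″ → L k (λ σ → L m″ (λ τ → f (suc r ∷ σ ++ τ))))) ∎
        first : ∀ r → sub (suc r) n (λ n″ → L n″ (λ ρ → φ ρ k * f (suc r ∷ ρ)))
                      ≡ sub (suc r) m (λ m″ → L k (λ σ → L m″ (λ τ → f (suc r ∷ σ ++ τ))))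
        first r with suc r ℕ.≤? m
        -- A cycle longer than m cannot avoid the subset: fewer than k points would be left, and φ
        -- vanishes.
        ... | no r≰m = trans (trans (sub-cong (suc r) n (λ n″ e → trans (L-cong n″ (λ ρ _ sρ →
                  trans (*-congʳ (φ-large ρ k (ℕP.≤-<-trans (ℕP.≤-reflexive sρ) (ℕP.+-cancelʳ-< (suc r) _ _ (ℕP.≤-<-trans
                    (ℕP.≤-reflexive (trans (ℕP.+-comm n″ (suc r)) (trans e (sym eqn)))) (ℕP.+-monoʳ-< k (ℕP.≰⇒> r≰m))))))) (zeroˡ _)))
                  (L-0 n″))) (sub-0 (suc r) n)) (sym (sub-< {suc r} {m} _ (ℕP.≰⇒> r≰m)))
        ... | yes r≤m = begin
          sub (suc r) n (λ n″ → L n″ (λ ρ → φ ρ k * f (suc r ∷ ρ)))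
            ≡⟨ sub-at {suc r} {n} n≡ ⟩
          L (k ℕ.+ (m ∸ suc r)) (λ ρ → φ ρ k * f (suc r ∷ ρ))
            ≡⟨ split-fuel b k (m ∸ suc r) _ (ℕP.≤-trans (ℕP.m≤n+m _ r) (ℕP.≤-trans (ℕP.≤-reflexive (ℕP.suc-injective (sym n≡))) p)) (s′ (suc r)) ⟩
          L k (λ σ → L (m ∸ suc r) (λ τ → f (suc r ∷ σ ++ τ)))
            ≡⟨ sub-at {suc r} {m} (sym (ℕP.m+[n∸m]≡n r≤m)) ⟨
          sub (suc r) m (λ m″ → L k (λ σ → L m″ (λ τ → f (suc r ∷ σ ++ τ)))) ∎
          where
          n≡ : n ≡ suc r ℕ.+ (k ℕ.+ (m ∸ suc r))
          n≡ = begin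
            n ≡⟨ eqn ⟨
            k ℕ.+ m ≡⟨ cong (k ℕ.+_) (ℕP.m+[n∸m]≡n r≤m) ⟨
            k ℕ.+ (suc r ℕ.+ (m ∸ suc r)) ≡⟨ ℕP.+-assoc k (suc r) _ ⟨
            k ℕ.+ suc r ℕ.+ (m ∸ suc r) ≡⟨ cong (ℕ._+ (m ∸ suc r)) (ℕP.+-comm k (suc r)) ⟩
            suc r ℕ.+ k ℕ.+ (m ∸ suc r) ≡⟨ ℕP.+-assoc (suc r) k _ ⟩
            suc r ℕ.+ (k ℕ.+ (m ∸ suc r)) ∎
        second : ∀ r → sub (suc r) n (λ n″ → L n″ (λ ρ → sub (suc r) k (φ ρ) * f (suc r ∷ ρ)))
                       ≡ sub (suc r) k (λ k″ → L k″ (λ σ → L m (λ τ → f (suc r ∷ σ ++ τ))))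
        second r = begin
          sub (suc r) n (λ n″ → L n″ (λ ρ → sub (suc r) k (φ ρ) * f (suc r ∷ ρ)))
            ≡⟨ sub-cong (suc r) n (λ n″ _ → trans (L-cong′ n″ (λ ρ → trans (*-comm _ _) (trans (sym (sub-* _ (suc r) k _))
                 (sub-cong (suc r) k (λ k″ _ → *-comm _ _))))) (L-sub n″ (suc r) k (λ k″ ρ → φ ρ k″ * f (suc r ∷ ρ)))) ⟩
          sub (suc r) n (λ n″ → sub (suc r) k (λ k″ → L n″ (λ ρ → φ ρ k″ * f (suc r ∷ ρ))))
            ≡⟨ sub-swap (suc r) n (suc r) k _ ⟩
          sub (suc r) k (λ k″ → sub (suc r) n (λ n″ → L n″ (λ ρ → φ ρ k″ * f (suc r ∷ ρ))))
            ≡⟨ sub-cong (suc r) k (λ k″ e → let n≡ = trans (sym eqn) (trans (cong (ℕ._+ m) (sym e)) (ℕP.+-assoc (suc r) k″ m)) in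
                 trans (sub-at {suc r} {n} n≡)
                   (split-fuel b k″ m _ (ℕP.≤-trans (ℕP.m≤n+m _ r) (ℕP.≤-trans (ℕP.≤-reflexive (ℕP.suc-injective (sym n≡))) p)) (s′ (suc r)))) ⟩
          sub (suc r) k (λ k″ → L k″ (λ σ → L m (λ τ → f (suc r ∷ σ ++ τ)))) ∎

    L-φ-split : ∀ k m f → Symmetric f → L (k ℕ.+ m) (λ ρ → φ ρ k * f ρ) ≡ L k (λ σ → L m (λ τ → f (σ ++ τ)))
    L-φ-split k m f = split-fuel (k ℕ.+ m) k m f ℕP.≤-refl

-- Removing the long first row and passing to complements

module Reduction (K : CharZeroRing) where
  open CycleIndexFunctionals K public
  open ≡-Reasoning

  +-left-comm : ∀ r x s → r ℕ.+ (x ℕ.+ s) ≡ x ℕ.+ (r ℕ.+ s)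
  +-left-comm = solve-∀

  D-cong-All : ∀ {P : ℕ → Set} → (∀ {y z} → y ≤ z → P z → P y) → ∀ r v {f g} → All P v →
    (∀ w → All P w → length w ≡ length v → r ℕ.+ sum w ≡ sum v → f w ≡ g w) → D r f v ≡ D r g v
  D-cong-All mono r []      _        h = refl
  D-cong-All mono r (x ∷ v) (q ∷ qs) h = cong₂ _+_
    (sub-cong r x (λ y e → h (y ∷ v) (mono (ℕP.≤-trans (ℕP.m≤n+m y r) (ℕP.≤-reflexive e)) q ∷ qs) refl
      (trans (sym (ℕP.+-assoc r y (sum v))) (cong (ℕ._+ sum v) e))))
    (D-cong-All mono r v qs (λ w qs′ l e → h (x ∷ w) (q ∷ qs′) (cong suc l)
      (trans (+-left-comm r x (sum w)) (cong (x ℕ.+_) e))))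

  -- What is left of `X N (σ ++ τ) v * X N (σ ++ τ) u` once τ has been summed out by orthogonality.
  G : List ℕ → List ℕ → List ℕ → A
  G []      v u = det v u
  G (r ∷ σ) v u = D r (λ v′ → D r (G σ v′) u) v

  module _ (I : CycleIndex) where
    open Functional I

    L-X-G : ∀ σ m N v u → length v ≡ N → length u ≡ N → sum v ≡ sum σ ℕ.+ (m ℕ.+ tri N) → sum u ≡ sum σ ℕ.+ (m ℕ.+ tri N) →
      L m (λ τ → X N (σ ++ τ) v * X N (σ ++ τ) u) ≡ G σ v u
    L-X-G []      m N v u lv lu sv su = orthogonality m N v u lv lu sv su
    L-X-G (r ∷ σ) m N v u lv lu sv su = trans (L-D-D m r v u (λ τ → X N (σ ++ τ)) (λ τ → X N (σ ++ τ)))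
      (D-cong r v (λ v′ lv′ sv′ → D-cong r u (λ u′ lu′ su′ →
        L-X-G σ m N v′ u′ (trans lv′ lv) (trans lu′ lu) (shift sv′ sv) (shift su′ su))))
      where
      shift : ∀ {s t} → r ℕ.+ s ≡ t → t ≡ r ℕ.+ sum σ ℕ.+ (m ℕ.+ tri N) → s ≡ sum σ ℕ.+ (m ℕ.+ tri N)
      shift {s} e₁ e₂ = ℕP.+-cancelˡ-≡ r s _ (trans e₁ (trans e₂ (ℕP.+-assoc r (sum σ) _)))

  -- The effect of D r on lists with an additional, very long first row, once that row is forgotten.
  E : ℕ → (List ℕ → A) → List ℕ → A
  E r f v = f v + D r f v

  EE : List ℕ → List ℕ → List ℕ → A
  EE []      v u = det v u
  EE (r ∷ σ) v u = E r (λ v′ → E r (EE σ v′) u) v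

  -- A first row longer than everything else only loses whole parts of σ, on both sides alike.
  G-first-row : ∀ σ x y v u → sum (x ∷ v) ≡ sum (y ∷ u) → sum σ ≤ x → sum σ ≤ y → All (λ z → z ℕ.+ sum σ < x) u →
    G σ (x ∷ v) (y ∷ u) ≡ EE σ v u
  G-first-row [] x y v u e _ _ ps = trans (det-head x v y u (All.map (λ {z} p q → ℕP.<⇒≢ (subst (_< x) (ℕP.+-identityʳ z) p) (sym q)) ps)) same
    where
    same : eq x y * det v u ≡ det v u
    same with x ℕ.≟ y
    ... | yes refl = trans (*-congʳ (eq-refl x)) (*-identityˡ _)
    -- If the first rows differ then so do the sums of the remaining rows, and `det v u` vanishes as
    -- well.
    ... | no x≢y   = trans (*-congˡ d0) (trans (zeroʳ _) (sym d0))
      where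
      d0 : det v u ≡ 0#
      d0 = det-sum v u (λ s → x≢y (ℕP.+-cancelʳ-≡ (sum u) x y (trans (cong (x ℕ.+_) (sym s)) e)))
  G-first-row (r ∷ σ) x y v u e p q ps = cong₂ _+_
    -- Four terms: on each side the part r leaves either the long row or the short ones. All of them
    -- reduce to the same statement for σ, since the total sums stay equal.
    (trans (sub-at {r} {x} (sym x≡)) (cong₂ _+_
      (trans (sub-at {r} {y} (sym y≡)) (G-first-row σ (x ∸ r) (y ∸ r) v u (both e x≡ y≡) x-r y-r ps-x-r))
      (D-cong-All (λ z≤ w< → ℕP.≤-trans (s≤s (ℕP.+-monoˡ-≤ (sum σ) z≤)) w<) r u ps-x-r (λ u′ ps′ l s →
        G-first-row σ (x ∸ r) y v u′ (left-only e x≡ s) x-r (ℕP.≤-trans (ℕP.m≤n+m _ r) q) ps′))))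
    (D-cong r v (λ v′ l s → cong₂ _+_
      (trans (sub-at {r} {y} (sym y≡)) (G-first-row σ x (y ∸ r) v′ u (sym (left-only (sym e) y≡ s)) (ℕP.≤-trans (ℕP.m≤n+m _ r) p) y-r ps-x))
      (D-cong-All (λ z≤ w< → ℕP.≤-trans (s≤s (ℕP.+-monoˡ-≤ (sum σ) z≤)) w<) r u ps-x (λ u′ ps′ l′ s′ →
        G-first-row σ x y v′ u′ (neither e s s′) (ℕP.≤-trans (ℕP.m≤n+m _ r) p) (ℕP.≤-trans (ℕP.m≤n+m _ r) q) ps′))))
    where
    x≡ : r ℕ.+ (x ∸ r) ≡ x
    x≡ = ℕP.m+[n∸m]≡n (ℕP.≤-trans (ℕP.m≤m+n r _) p)
    y≡ : r ℕ.+ (y ∸ r) ≡ y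
    y≡ = ℕP.m+[n∸m]≡n (ℕP.≤-trans (ℕP.m≤m+n r _) q)
    x-r : sum σ ≤ x ∸ r
    x-r = ℕP.+-cancelˡ-≤ r _ _ (ℕP.≤-trans p (ℕP.≤-reflexive (sym x≡)))
    y-r : sum σ ≤ y ∸ r
    y-r = ℕP.+-cancelˡ-≤ r _ _ (ℕP.≤-trans q (ℕP.≤-reflexive (sym y≡)))
    ps-x-r : All (λ z → z ℕ.+ sum σ < x ∸ r) u
    ps-x-r = All.map (λ {z} b → ℕP.+-cancelˡ-< r _ _ (subst₂ _<_ (+-left-comm z r (sum σ)) (sym x≡) b)) ps
    ps-x : All (λ z → z ℕ.+ sum σ < x) u
    ps-x = All.map (λ {z} b → ℕP.≤-<-trans (ℕP.+-monoʳ-≤ z (ℕP.m≤n+m (sum σ) r)) b) ps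
    both : ∀ {x y x′ y′ s t} → x ℕ.+ s ≡ y ℕ.+ t → r ℕ.+ x′ ≡ x → r ℕ.+ y′ ≡ y → x′ ℕ.+ s ≡ y′ ℕ.+ t
    both {x′ = x′} {y′} {s} {t} e refl refl = ℕP.+-cancelˡ-≡ r _ _ (trans (sym (ℕP.+-assoc r x′ s)) (trans e (ℕP.+-assoc r y′ t)))
    left-only : ∀ {x y x′ s t t′} → x ℕ.+ s ≡ y ℕ.+ t → r ℕ.+ x′ ≡ x → r ℕ.+ t′ ≡ t → x′ ℕ.+ s ≡ y ℕ.+ t′
    left-only {y = y} {x′} {s} {t′ = t′} e refl refl = ℕP.+-cancelˡ-≡ r _ _ (trans (sym (ℕP.+-assoc r x′ s)) (trans e (+-left-comm y r t′)))
    neither : ∀ {x y s s′ t t′} → x ℕ.+ s ≡ y ℕ.+ t → r ℕ.+ s′ ≡ s → r ℕ.+ t′ ≡ t → x ℕ.+ s′ ≡ y ℕ.+ t′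
    neither {x} {y} {s′ = s′} {t′ = t′} e refl refl = ℕP.+-cancelˡ-≡ r _ _ (trans (sym (+-left-comm x r s′)) (trans e (+-left-comm y r t′)))

  -- E r seen through the complement v ↦ M − v: removing hooks inside a rectangle is adding them to the complement.
  W : ℕ → (List ℕ → A) → List ℕ → A
  W r f v = f v + U r f v

  WW : List ℕ → List ℕ → List ℕ → A
  WW []      v u = det v u
  WW (r ∷ σ) v u = W r (λ v′ → W r (WW σ v′) u) v

  Lap-map : ∀ h u f → Lap f (map h u) ≡ Lap (λ z w → f (h z) (map h w)) u
  Lap-map h []      f = refl
  Lap-map h (y ∷ u) f = +-congˡ (cong -_ (Lap-map h u (λ z w → f z (h y ∷ w))))

  eq-reflect : ∀ M x z → x ≤ M → z ≤ M → eq (M ∸ x) (M ∸ z) ≡ eq x z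
  eq-reflect M x z p q with x ℕ.≟ z
  ... | yes refl = trans (eq-refl (M ∸ x)) (sym (eq-refl x))
  ... | no x≢z   = trans (eq-≢ (λ e → x≢z (ℕP.∸-cancelˡ-≡ p q e))) (sym (eq-≢ x≢z))

  det-reflect : ∀ M v u → All (_≤ M) v → All (_≤ M) u → det (map (M ∸_) v) (map (M ∸_) u) ≡ det v u
  det-reflect M []      []      _        _  = refl
  det-reflect M []      (_ ∷ _) _        _  = refl
  det-reflect M (x ∷ v) u       (p ∷ ps) qs = trans (Lap-map (M ∸_) u _) (Lap-cong u (λ z w π →
    let q = PermP.All-resp-↭ (↭-sym π) qs in
    cong₂ _*_ (eq-reflect M x z p (All.head q)) (det-reflect M v w ps (All.tail q))))

  -- M - (x - r) = (M - x) + r as long as the removal does not get stuck. The lower bound r + s on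
  -- the entries leaves room for s further cells.
  D-reflect : ∀ M r s v {f g} → All (λ z → r ℕ.+ s ≤ z × z ≤ M) v →
    (∀ w → All (λ z → s ≤ z × z ≤ M) w → f w ≡ g (map (M ∸_) w)) → D r f v ≡ U r g (map (M ∸_) v)
  D-reflect M r s []      ps h = refl
  D-reflect M r s (x ∷ v) {f} {g} ((p , q) ∷ ps) h = cong₂ _+_
    (trans (sub-at {r} {x} (sym x≡)) (trans (h (x ∸ r ∷ v) ((s≤ , ℕP.≤-trans (ℕP.m∸n≤m x r) q) ∷ ps′))
      (cong (λ t → g (t ∷ map (M ∸_) v)) (ℕP.+-cancelˡ-≡ (x ∸ r) _ _ (trans (ℕP.m+[n∸m]≡n (ℕP.≤-trans (ℕP.m∸n≤m x r) q))
        (sym (trans (sym (ℕP.+-assoc (x ∸ r) (M ∸ x) r)) (trans (reorder (x ∸ r) (M ∸ x) r) (trans (cong (ℕ._+ (M ∸ x)) x≡) (ℕP.m+[n∸m]≡n q)))))))) ))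
    (D-reflect M r s v ps (λ w qs → h (x ∷ w) ((ℕP.≤-trans (ℕP.m≤n+m s r) p , q) ∷ qs)))
    where
    x≡ : r ℕ.+ (x ∸ r) ≡ x
    x≡ = ℕP.m+[n∸m]≡n (ℕP.≤-trans (ℕP.m≤m+n r s) p)
    s≤ : s ≤ x ∸ r
    s≤ = ℕP.+-cancelˡ-≤ r _ _ (ℕP.≤-trans p (ℕP.≤-reflexive (sym x≡)))
    ps′ : All (λ z → s ≤ z × z ≤ M) v
    ps′ = All.map (λ (a , b) → ℕP.≤-trans (ℕP.m≤n+m s r) a , b) ps
    reorder : ∀ a b c → a ℕ.+ b ℕ.+ c ≡ c ℕ.+ a ℕ.+ b
    reorder = solve-∀

  EE-reflect : ∀ M σ v u → All (λ z → sum σ ≤ z × z ≤ M) v → All (λ z → sum σ ≤ z × z ≤ M) u →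
    EE σ v u ≡ WW σ (map (M ∸_) v) (map (M ∸_) u)
  EE-reflect M []      v u ps qs = sym (det-reflect M v u (All.map proj₂ ps) (All.map proj₂ qs))
  EE-reflect M (r ∷ σ) v u ps qs = cong₂ _+_ (inner v (weaken ps))
    (D-reflect M r (sum σ) v ps (λ w ps′ → inner w ps′))
    where
    weaken : ∀ {v} → All (λ z → r ℕ.+ sum σ ≤ z × z ≤ M) v → All (λ z → sum σ ≤ z × z ≤ M) v
    weaken = All.map (λ (a , b) → ℕP.≤-trans (ℕP.m≤n+m (sum σ) r) a , b)
    inner : ∀ v → All (λ z → sum σ ≤ z × z ≤ M) v → E r (EE σ v) u ≡ W r (WW σ (map (M ∸_) v)) (map (M ∸_) u)
    inner v ps = cong₂ _+_ (EE-reflect M σ v u ps (weaken qs)) (D-reflect M r (sum σ) u qs (λ w qs′ → EE-reflect M σ v w ps qs′))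

  -- SS n b m g is the sum of g over the strictly increasing lists of length n with entries in [b, b + m).
  SS : ℕ → ℕ → ℕ → (List ℕ → A) → A
  SS zero    b m       g = g []
  SS (suc n) b zero    g = 0#
  SS (suc n) b (suc m) g = SS n (suc b) m (g ∘ (b ∷_)) + SS (suc n) (suc b) m g

  SS-cong : ∀ n b m {f g} → (∀ w → Incr b w → length w ≡ n → All (_< b ℕ.+ m) w → f w ≡ g w) → SS n b m f ≡ SS n b m g
  SS-cong zero    b m       h = h [] [] refl []
  SS-cong (suc n) b zero    h = refl
  SS-cong (suc n) b (suc m) h = cong₂ _+_
    (SS-cong n (suc b) m (λ w i l q → h (b ∷ w) (ℕP.≤-refl ∷ i) (cong suc l) (ℕP.m<m+n b (s≤s z≤n) ∷ up q)))
    (SS-cong (suc n) (suc b) m (λ w i l q → h w (Incr-weaken (ℕP.n≤1+n b) i) l (up q)))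
    where
    up : ∀ {w} → All (_< suc (b ℕ.+ m)) w → All (_< b ℕ.+ suc m) w
    up = All.map (λ p → ℕP.≤-trans p (ℕP.≤-reflexive (sym (ℕP.+-suc b m))))

  SS-0 : ∀ n b m → SS n b m (λ _ → 0#) ≡ 0#
  SS-0 zero    b m       = refl
  SS-0 (suc n) b zero    = refl
  SS-0 (suc n) b (suc m) = trans (cong₂ _+_ (SS-0 n (suc b) m) (SS-0 (suc n) (suc b) m)) (+-identityˡ 0#)

  SS-+ : ∀ n b m f g → SS n b m (λ w → f w + g w) ≡ SS n b m f + SS n b m g
  SS-+ zero    b m       f g = refl
  SS-+ (suc n) b zero    f g = sym (+-identityˡ 0#)
  SS-+ (suc n) b (suc m) f g = trans (cong₂ _+_ (SS-+ n (suc b) m _ _) (SS-+ (suc n) (suc b) m _ _)) (+-interchange _ _ _ _)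

  SS-neg : ∀ n b m f → SS n b m (λ w → - f w) ≡ - SS n b m f
  SS-neg zero    b m       f = refl
  SS-neg (suc n) b zero    f = sym -0≡0
  SS-neg (suc n) b (suc m) f = trans (cong₂ _+_ (SS-neg n (suc b) m _) (SS-neg (suc n) (suc b) m _)) (sym (neg-+ _ _))

  SS-sub : ∀ n b m r x (f : ℕ → List ℕ → A) → SS n b m (λ w → sub r x (λ y → f y w)) ≡ sub r x (λ y → SS n b m (f y))
  SS-sub n b m zero    x       f = refl
  SS-sub n b m (suc r) zero    f = SS-0 n b m
  SS-sub n b m (suc r) (suc x) f = SS-sub n b m r x f

  SS-U : ∀ n b m r v (f : List ℕ → List ℕ → A) → U r (λ v′ → SS n b m (f v′)) v ≡ SS n b m (λ ν → U r (λ v′ → f v′ ν) v)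
  SS-U n b m r []      f = sym (SS-0 n b m)
  SS-U n b m r (x ∷ v) f = trans (+-congˡ (SS-U n b m r v (λ w → f (x ∷ w)))) (sym (SS-+ n b m _ _))

  SS-det : ∀ b m w (g : List ℕ → A) → Incr b w → All (_< b ℕ.+ m) w → SS (length w) b m (λ ν → det w ν * g ν) ≡ g w
  SS-det b m       []      g _        _        = *-identityˡ _
  SS-det b zero    (x ∷ w) g (p ∷ i)  (q ∷ qs) = ⊥-elim (ℕP.<⇒≱ q (subst (_≤ x) (sym (ℕP.+-identityʳ b)) p))
  SS-det b (suc m) (x ∷ w) g (p ∷ i)  (q ∷ qs) with ℕP.m≤n⇒m<n∨m≡n p
  ... | inj₂ refl = begin
    SS (length w) (suc b) m (λ ν → det (b ∷ w) (b ∷ ν) * g (b ∷ ν)) + SS (suc (length w)) (suc b) m (λ ν → det (b ∷ w) ν * g ν)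
      ≡⟨ cong₂ _+_
           (trans (SS-cong (length w) (suc b) m (λ ν j _ _ → *-congʳ (det-head′ b w ν (≥⇒≢ (Incr-≥ j)))))
                  (SS-det (suc b) m w (g ∘ (b ∷_)) i (All.map (λ r → ℕP.≤-trans r (ℕP.≤-reflexive (ℕP.+-suc b m))) qs)))
           (trans (SS-cong (suc (length w)) (suc b) m (λ ν j _ _ → trans (*-congʳ (∉-det b w ν (≥⇒≢ (Incr-≥ j)))) (zeroˡ _))) (SS-0 (suc (length w)) (suc b) m)) ⟩
    g (b ∷ w) + 0# ≡⟨ +-identityʳ _ ⟩
    g (b ∷ w) ∎
  ... | inj₁ b<x = trans (cong₂ _+_
      (trans (SS-cong (length w) (suc b) m (λ ν j _ _ → trans (*-congʳ (det-∉ (x ∷ w) b ν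
          (All.map (λ c e → ℕP.<⇒≢ c (sym e)) (Incr-≥ {suc b} (b<x ∷ i))))) (zeroˡ _))) (SS-0 (length w) (suc b) m))
      (SS-det (suc b) m (x ∷ w) g (b<x ∷ i) (All.map (λ r → ℕP.≤-trans r (ℕP.≤-reflexive (ℕP.+-suc b m))) (q ∷ qs))))
    (+-identityˡ _)

  -- A resolution of the identity: both sides are antisymmetric in v, and for an increasing v with
  -- entries below m exactly one ν survives.
  det-complete′ : ∀ n m v u → length v ≡ n → All (_< m) v → SS n 0 m (λ ν → det v ν * det u ν) ≡ det u v
  det-complete′ n m v u l q = antisym-≡ {λ v → SS n 0 m (λ ν → det v ν * det u ν)} {det u}
    (λ p x y w → trans (SS-cong n 0 m (λ ν _ _ _ → trans (*-congʳ (antisym-detˡ ν p x y w)) (solve 2 (λ a b → :- a :* b := :- (a :* b)) refl _ _))) (SS-neg n 0 m _))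
    (antisym-detʳ u) v
    (λ w π i → trans (cong (λ t → SS t 0 m (λ ν → det w ν * det u ν)) (sym (trans (PermP.↭-length π) l)))
      (SS-det 0 m w (det u) i (PermP.All-resp-↭ (↭-sym π) q)))

  det-complete : ∀ n m v u → length u ≡ n → All (_< m) u → SS n 0 m (λ ν → det v ν * det u ν) ≡ det v u
  det-complete n m v u l q = trans (SS-cong n 0 m (λ ν _ _ _ → *-comm _ _)) (det-complete′ n m u v l q)

  E* : List ℕ → (List ℕ → A) → List ℕ → A
  E* []      f = f
  E* (r ∷ σ) f = E r (E* σ f)

  E-comm : ∀ r s f v → E r (E s f) v ≡ E s (E r f) v
  E-comm r s f v = begin
    (f v + D s f v) + D r (λ w → f w + D s f w) v       ≡⟨ +-congˡ (D-+ r v f (D s f)) ⟩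
    (f v + D s f v) + (D r f v + D r (D s f) v)         ≡⟨ +-congˡ (+-congˡ (D-comm r s f v)) ⟩
    (f v + D s f v) + (D r f v + D s (D r f) v)         ≡⟨ +-interchange _ _ _ _ ⟩
    (f v + D r f v) + (D s f v + D s (D r f) v)         ≡⟨ +-congˡ (D-+ s v f (D r f)) ⟨
    (f v + D r f v) + D s (λ w → f w + D r f w) v ∎

  E-cong : ∀ r v {f g} → (∀ w → f w ≡ g w) → E r f v ≡ E r g v
  E-cong r v h = cong₂ _+_ (h v) (D-cong′ r v h)

  W-cong : ∀ r v {f g} → (∀ w → f w ≡ g w) → W r f v ≡ W r g v
  W-cong r v h = cong₂ _+_ (h v) (U-cong r v h)

  W-E-swap : ∀ r s v ν (f : List ℕ → List ℕ → A) → W r (λ v′ → E s (f v′) ν) v ≡ E s (λ ν′ → W r (λ v′ → f v′ ν′) v) ν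
  W-E-swap r s v ν f = begin
    (f v ν + D s (f v) ν) + U r (λ v′ → f v′ ν + D s (f v′) ν) v
      ≡⟨ +-congˡ (trans (U-+ r v _ _) (+-congˡ (sym (D-U-swap s r v ν f)))) ⟩
    (f v ν + D s (f v) ν) + (U r (λ v′ → f v′ ν) v + D s (λ ν′ → U r (λ v′ → f v′ ν′) v) ν)
      ≡⟨ +-interchange _ _ _ _ ⟩
    (f v ν + U r (λ v′ → f v′ ν) v) + (D s (f v) ν + D s (λ ν′ → U r (λ v′ → f v′ ν′) v) ν)
      ≡⟨ +-congˡ (D-+ s ν _ _) ⟨
    E s (λ ν′ → W r (λ v′ → f v′ ν′) v) ν ∎

  -- `W` acts on the index v and `E` on the argument ν, so they pass each other. Next to `det` the
  -- operator `W r` becomes `E r` by adjointness, and the commuting `E` bring it to the front.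
  W-E*-adjoint : ∀ r σ v ν → W r (λ v′ → E* σ (det v′) ν) v ≡ E* (r ∷ σ) (det v) ν
  W-E*-adjoint r []      v ν = +-congˡ (sym (adjoint r v ν))
  W-E*-adjoint r (s ∷ σ) v ν = begin
    W r (λ v′ → E s (E* σ (det v′)) ν) v         ≡⟨ W-E-swap r s v ν (λ v′ → E* σ (det v′)) ⟩
    E s (λ ν′ → W r (λ v′ → E* σ (det v′) ν′) v) ν ≡⟨ E-cong s ν (W-E*-adjoint r σ v) ⟩
    E s (E r (E* σ (det v))) ν                   ≡⟨ E-comm s r (E* σ (det v)) ν ⟩
    E r (E s (E* σ (det v))) ν ∎

  SS-W : ∀ n b m r v (f : List ℕ → List ℕ → A) → W r (λ v′ → SS n b m (f v′)) v ≡ SS n b m (λ ν → W r (λ v′ → f v′ ν) v)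
  SS-W n b m r v f = trans (+-congˡ (SS-U n b m r v f)) (sym (SS-+ n b m _ _))

  W-* : ∀ c r v f → W r (λ w → c * f w) v ≡ c * W r f v
  W-* c r v f = trans (+-congˡ (U-* c r v f)) (sym (distribˡ c _ _))

  W-cong-< : ∀ m r s v {f g} → All (λ z → z ℕ.+ (r ℕ.+ s) < m) v →
    (∀ w → length w ≡ length v → All (λ z → z ℕ.+ s < m) w → f w ≡ g w) → W r f v ≡ W r g v
  W-cong-< m r s v {f} {g} ps h = cong₂ _+_ (h v refl (weaken ps)) (U-part v ps h)
    where
    weaken : ∀ {v} → All (λ z → z ℕ.+ (r ℕ.+ s) < m) v → All (λ z → z ℕ.+ s < m) v
    weaken = All.map (λ {z} p → ℕP.≤-<-trans (ℕP.+-monoʳ-≤ z (ℕP.m≤n+m s r)) p)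
    U-part : ∀ v {f g} → All (λ z → z ℕ.+ (r ℕ.+ s) < m) v →
      (∀ w → length w ≡ length v → All (λ z → z ℕ.+ s < m) w → f w ≡ g w) → U r f v ≡ U r g v
    U-part []      _        h = refl
    U-part (x ∷ v) (p ∷ ps) h = cong₂ _+_
      (h (x ℕ.+ r ∷ v) refl (subst (_< m) (sym (ℕP.+-assoc x r s)) p ∷ weaken ps))
      (U-part v ps (λ w l qs → h (x ∷ w) (cong suc l) (All.head (weaken (p ∷ [])) ∷ qs)))

  -- Inserting the resolution of the identity at the innermost `det` separates v from u, so that
  -- each summand factors. The bound m has to exceed every entry that can arise by adding the parts
  -- of σ.
  WW-expand : ∀ m σ v u → length v ≡ length u → All (λ z → z ℕ.+ sum σ < m) v → All (λ z → z ℕ.+ sum σ < m) u →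
    WW σ v u ≡ SS (length v) 0 m (λ ν → E* σ (det v) ν * E* σ (det u) ν)
  WW-expand m []      v u l ps qs = sym (det-complete (length v) m v u (sym l) (All.map (λ {z} → subst (_< m) (ℕP.+-identityʳ z)) qs))
  WW-expand m (r ∷ σ) v u l ps qs = begin
    W r (λ v′ → W r (WW σ v′) u) v
      ≡⟨ W-cong-< m r (sum σ) v ps (λ v′ lv ps′ → W-cong-< m r (sum σ) u qs (λ u′ lu qs′ →
           trans (WW-expand m σ v′ u′ (trans lv (trans l (sym lu))) ps′ qs′)
             (cong (λ t → SS t 0 m (λ ν → E* σ (det v′) ν * E* σ (det u′) ν)) lv))) ⟩
    W r (λ v′ → W r (λ u′ → SS (length v) 0 m (λ ν → E* σ (det v′) ν * E* σ (det u′) ν)) u) v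
      ≡⟨ W-cong r v (λ v′ → trans (SS-W (length v) 0 m r u _)
           (SS-cong (length v) 0 m (λ ν _ _ _ → trans (W-* _ r u _) (trans (*-congˡ (W-E*-adjoint r σ u ν)) (*-comm _ _))))) ⟩
    W r (λ v′ → SS (length v) 0 m (λ ν → E* (r ∷ σ) (det u) ν * E* σ (det v′) ν)) v
      ≡⟨ trans (SS-W (length v) 0 m r v _) (SS-cong (length v) 0 m (λ ν _ _ _ →
           trans (W-* _ r v _) (trans (*-congˡ (W-E*-adjoint r σ v ν)) (*-comm _ _)))) ⟩
    SS (length v) 0 m (λ ν → E* (r ∷ σ) (det v) ν * E* (r ∷ σ) (det u) ν) ∎

-- Box sums, interlacing and the Pieri rule

module Pieri (K : CharZeroRing) where
  open Reduction K public
  open ≡-Reasoning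

  -- from b R f = Σ_{b ≤ i < R} f i
  from : ℕ → ℕ → (ℕ → A) → A
  from zero    R       f = ∑ R f
  from (suc b) zero    f = 0#
  from (suc b) (suc R) f = from b R (f ∘ suc)

  from-cong : ∀ b R {f g} → (∀ i → b ≤ i → i < R → f i ≡ g i) → from b R f ≡ from b R g
  from-cong zero    R       h = ∑-cong< R (λ i p → h i z≤n p)
  from-cong (suc b) zero    h = refl
  from-cong (suc b) (suc R) h = from-cong b R (λ i p q → h (suc i) (s≤s p) (s≤s q))

  from-0 : ∀ b R → from b R (λ _ → 0#) ≡ 0#
  from-0 zero    R       = ∑-0 R
  from-0 (suc b) zero    = refl
  from-0 (suc b) (suc R) = from-0 b R

  from-+ : ∀ b R f g → from b R (λ i → f i + g i) ≡ from b R f + from b R g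
  from-+ zero    R       f g = ∑-+ R f g
  from-+ (suc b) zero    f g = sym (+-identityˡ 0#)
  from-+ (suc b) (suc R) f g = from-+ b R _ _

  from-* : ∀ c b R f → from b R (λ i → c * f i) ≡ c * from b R f
  from-* c zero    R       f = ∑-* c R f
  from-* c (suc b) zero    f = sym (zeroʳ c)
  from-* c (suc b) (suc R) f = from-* c b R _

  from-neg : ∀ b R f → from b R (λ i → - f i) ≡ - from b R f
  from-neg zero    R       f = ∑-neg R f
  from-neg (suc b) zero    f = sym -0≡0
  from-neg (suc b) (suc R) f = from-neg b R _

  from-∑ : ∀ b R n (f : ℕ → ℕ → A) → from b R (λ i → ∑ n (f i)) ≡ ∑ n (λ j → from b R (λ i → f i j))
  from-∑ b R zero    f = from-0 b R
  from-∑ b R (suc n) f = trans (from-+ b R _ _) (+-congˡ (from-∑ b R n (λ i → f i ∘ suc)))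

  from-swap : ∀ b R c S (f : ℕ → ℕ → A) → from b R (λ i → from c S (f i)) ≡ from c S (λ j → from b R (λ i → f i j))
  from-swap b R zero    S       f = from-∑ b R S f
  from-swap b R (suc c) zero    f = from-0 b R
  from-swap b R (suc c) (suc S) f = from-swap b R c S (λ i → f i ∘ suc)

  from-sub : ∀ b R r x (f : ℕ → ℕ → A) → from b R (λ i → sub r x (λ y → f y i)) ≡ sub r x (λ y → from b R (f y))
  from-sub b R zero    x       f = refl
  from-sub b R (suc r) zero    f = from-0 b R
  from-sub b R (suc r) (suc x) f = from-sub b R r x f

  from-D : ∀ b R r v (f : ℕ → List ℕ → A) → from b R (λ i → D r (f i) v) ≡ D r (λ w → from b R (λ i → f i w)) v
  from-D b R r []      f = from-0 b R
  from-D b R r (x ∷ v) f = trans (from-+ b R _ _) (cong₂ _+_ (from-sub b R r x _) (from-D b R r v _))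

  from-empty : ∀ b f → from b b f ≡ 0#
  from-empty zero    f = refl
  from-empty (suc b) f = from-empty b _

  from-split : ∀ b c R f → b ≤ c → c ≤ R → from b R f ≡ from b c f + from c R f
  from-split zero    zero    R       f p q = sym (+-identityˡ _)
  from-split zero    (suc c) (suc R) f p (s≤s q) = trans (+-congˡ (from-split zero c R (f ∘ suc) z≤n q)) (sym (+-assoc _ _ _))
  from-split (suc b) (suc c) (suc R) f (s≤s p) (s≤s q) = from-split b c R (f ∘ suc) p q

  from-first : ∀ b R f → b < R → from b R f ≡ f b + from (suc b) R f
  from-first zero    (suc R) f p       = refl
  from-first (suc b) (suc R) f (s≤s p) = from-first b R (f ∘ suc) p

  from-last : ∀ b c f → b ≤ c → from b (suc c) f ≡ from b c f + f c
  from-last b c f p = trans (from-split b c (suc c) f p (ℕP.n≤1+n c))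
    (+-congˡ (trans (from-first c (suc c) f ℕP.≤-refl) (trans (+-congˡ (from-empty (suc c) f)) (+-identityʳ _))))

  from-eq : ∀ b R x (h : ℕ → A) → b ≤ x → x < R → from b R (λ i → eq x i * h i) ≡ h x
  from-eq zero    (suc R) zero    h p       q       = trans (cong₂ _+_ (*-identityˡ _)
    (trans (∑-cong R (λ i → zeroˡ _)) (∑-0 R))) (+-identityʳ _)
  from-eq zero    (suc R) (suc x) h p       (s≤s q) = trans (+-congʳ (zeroˡ _)) (trans (+-identityˡ _) (from-eq zero R x (h ∘ suc) z≤n q))
  from-eq (suc b) (suc R) (suc x) h (s≤s p) (s≤s q) = from-eq b R x (h ∘ suc) p q

  from-antisym : ∀ b R (f : ℕ → ℕ → A) → (∀ i j → f i j ≡ - f j i) → from b R (λ i → from b R (f i)) ≡ 0#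
  from-antisym b R f a = x≡-x⇒x≡0 _ (begin
    from b R (λ i → from b R (f i))           ≡⟨ from-swap b R b R f ⟩
    from b R (λ j → from b R (λ i → f i j))   ≡⟨ from-cong b R (λ j _ _ → trans (from-cong b R (λ i _ _ → a i j)) (from-neg b R _)) ⟩
    from b R (λ j → - from b R (f j))         ≡⟨ from-neg b R _ ⟩
    - from b R (λ j → from b R (f j)) ∎)

  from-drop-last : ∀ b R f → f R ≡ 0# → from b (suc R) f ≡ from b R f
  from-drop-last zero    zero    f e = trans (+-congʳ e) (+-identityˡ _)
  from-drop-last zero    (suc R) f e = +-congˡ (from-drop-last zero R (f ∘ suc) e)
  from-drop-last (suc b) zero    f e = from-b0 b (f ∘ suc)
    where
    from-b0 : ∀ b f → from b 0 f ≡ 0#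
    from-b0 zero    f = refl
    from-b0 (suc b) f = refl
  from-drop-last (suc b) (suc R) f e = from-drop-last b R (f ∘ suc) e

  -- The shift by r also moves the upper end of the range; the hypothesis makes g vanish on the r
  -- values lost there.
  from-shift : ∀ r x R g → (∀ κ → R ≤ κ ℕ.+ r → g κ ≡ 0#) → from (r ℕ.+ x) R (λ κ → sub r κ g) ≡ from x R g
  from-shift zero    x       R       g h = refl
  from-shift (suc r) zero    zero    g h = refl
  from-shift (suc r) (suc x) zero    g h = refl
  from-shift (suc r) x       (suc R) g h = trans
    (from-shift r x R g (λ κ p → h κ (ℕP.≤-trans (s≤s p) (ℕP.≤-reflexive (sym (ℕP.+-suc κ r))))))
    (sym (from-drop-last x R g (h R (ℕP.≤-trans (s≤s (ℕP.m≤m+n R r)) (ℕP.≤-reflexive (sym (ℕP.+-suc R r)))))))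

  from-low : ∀ x R h → (∀ κ → κ < x → h κ ≡ 0#) → from x R h ≡ from 0 R h
  from-low zero    R       h e = refl
  from-low (suc x) zero    h e = refl
  from-low (suc x) (suc R) h e = trans (from-low x R (h ∘ suc) (λ κ p → e (suc κ) (s≤s p))) (trans (sym (+-identityˡ _)) (+-congʳ (sym (e 0 (s≤s z≤n)))))

  -- Σ of f over all κ with ν_i < κ_i < R
  box : ℕ → List ℕ → (List ℕ → A) → A
  box R []      f = f []
  box R (x ∷ ν) f = from (suc x) R (λ κ → box R ν (f ∘ (κ ∷_)))

  box-cong : ∀ R ν {f g} → (∀ w → length w ≡ length ν → f w ≡ g w) → box R ν f ≡ box R ν g
  box-cong R []      h = h [] refl
  box-cong R (x ∷ ν) h = from-cong (suc x) R (λ κ _ _ → box-cong R ν (λ w l → h (κ ∷ w) (cong suc l)))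

  box-0 : ∀ R ν → box R ν (λ _ → 0#) ≡ 0#
  box-0 R []      = refl
  box-0 R (x ∷ ν) = trans (from-cong (suc x) R (λ _ _ _ → box-0 R ν)) (from-0 (suc x) R)

  box-+ : ∀ R ν f g → box R ν (λ w → f w + g w) ≡ box R ν f + box R ν g
  box-+ R []      f g = refl
  box-+ R (x ∷ ν) f g = trans (from-cong (suc x) R (λ κ _ _ → box-+ R ν _ _)) (from-+ (suc x) R _ _)

  box-neg : ∀ R ν f → box R ν (λ w → - f w) ≡ - box R ν f
  box-neg R []      f = refl
  box-neg R (x ∷ ν) f = trans (from-cong (suc x) R (λ κ _ _ → box-neg R ν _)) (from-neg (suc x) R _)

  box-sub : ∀ R ν r x (f : ℕ → List ℕ → A) → box R ν (λ w → sub r x (λ y → f y w)) ≡ sub r x (λ y → box R ν (f y))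
  box-sub R []      r x f = refl
  box-sub R (z ∷ ν) r x f = trans (from-cong (suc z) R (λ κ _ _ → box-sub R ν r x _)) (from-sub (suc z) R r x _)

  box-antisym : ∀ R {f} → Antisymmetric f → Antisymmetric (λ ν → box R ν f)
  box-antisym R {f} a []      x y ν = begin
    from (suc y) R (λ κ → from (suc x) R (λ κ′ → box R ν (λ w → f (κ ∷ κ′ ∷ w))))
      ≡⟨ from-swap (suc y) R (suc x) R _ ⟩
    from (suc x) R (λ κ′ → from (suc y) R (λ κ → box R ν (λ w → f (κ ∷ κ′ ∷ w))))
      ≡⟨ from-cong (suc x) R (λ κ′ _ _ → trans (from-cong (suc y) R (λ κ _ _ → trans (box-cong R ν (λ w _ → a [] κ′ κ w)) (box-neg R ν _))) (from-neg (suc y) R _)) ⟩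
    from (suc x) R (λ κ′ → - from (suc y) R (λ κ → box R ν (λ w → f (κ′ ∷ κ ∷ w))))
      ≡⟨ from-neg (suc x) R _ ⟩
    - from (suc x) R (λ κ′ → from (suc y) R (λ κ → box R ν (λ w → f (κ′ ∷ κ ∷ w)))) ∎
  box-antisym R {f} a (z ∷ p) x y ν = trans
    (from-cong (suc z) R (λ κ _ _ → box-antisym R (antisym-∷ {f} κ a) p x y ν)) (from-neg (suc z) R _)

  -- Antisymmetry between the distinguished entry κ₀ and every other entry. Unlike adjacent
  -- exchanges alone, this form survives when an entry in between is fixed, as happens in the
  -- induction of `box-D`.
  Exchange : (ℕ → List ℕ → A) → Set
  Exchange f = ∀ p x y w → f x (p ++ y ∷ w) ≡ - f y (p ++ x ∷ w)

  antisym-exchange : ∀ {f} → Antisymmetric f → Exchange (λ x w → f (x ∷ w))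
  antisym-exchange a []      x y w = a [] y x w
  antisym-exchange {f} a (q ∷ p) x y w = begin
    f (x ∷ q ∷ p ++ y ∷ w)       ≡⟨ a [] q x _ ⟩
    - f (q ∷ x ∷ p ++ y ∷ w)     ≡⟨ cong -_ (antisym-exchange {f ∘ (q ∷_)} (antisym-∷ {f} q a) p x y w) ⟩
    - (- f (q ∷ y ∷ p ++ x ∷ w)) ≡⟨ cong -_ (a [] q y _) ⟨
    - f (y ∷ q ∷ p ++ x ∷ w) ∎

  -- Multiplication by the sum of all complete symmetric functions commutes with D r up to the extra variable 1;
  -- the boundary terms are full antidiagonal box sums and cancel by antisymmetry.
  box-D : ∀ R r B ν f → B ℕ.+ r ≤ R → Exchange f → (∀ κ w → ¬ All (_< B) w → f κ w ≡ 0#) →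
    from 0 R (λ κ₀ → box R ν (D r (f κ₀))) ≡ D r (λ ν′ → from 0 R (λ κ₀ → box R ν′ (f κ₀))) ν
  box-D R r B []      f B≤ ex h = from-0 0 R
  box-D R r B (x ∷ ν) f B≤ ex h = begin
    from 0 R (λ κ₀ → from (suc x) R (λ κ → box R ν (λ w → sub r κ (λ κ′ → f κ₀ (κ′ ∷ w)) + D r (f κ₀ ∘ (κ ∷_)) w)))
      ≡⟨ from-cong 0 R (λ κ₀ _ _ → trans (from-cong (suc x) R (λ κ _ _ → trans (box-+ R ν _ _) (+-congʳ (box-sub R ν r κ _)))) (from-+ (suc x) R _ _)) ⟩
    from 0 R (λ κ₀ → from (suc x) R (λ κ → sub r κ (g κ₀)) + from (suc x) R (λ κ → box R ν (D r (f κ₀ ∘ (κ ∷_)))))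
      ≡⟨ from-+ 0 R _ _ ⟩
    from 0 R (λ κ₀ → from (suc x) R (λ κ → sub r κ (g κ₀))) + from 0 R (λ κ₀ → from (suc x) R (λ κ → box R ν (D r (f κ₀ ∘ (κ ∷_)))))
      ≡⟨ cong₂ _+_ head-part tail-part ⟩
    sub r x (λ y → from 0 R (λ κ₀ → box R (y ∷ ν) (f κ₀))) + D r (λ ν′ → from 0 R (λ κ₀ → box R (x ∷ ν′) (f κ₀))) ν ∎
    where
    g : ℕ → ℕ → A
    g κ₀ κ = box R ν (f κ₀ ∘ (κ ∷_))
    g-0 : ∀ κ₀ κ → R ≤ κ ℕ.+ r → g κ₀ κ ≡ 0#
    g-0 κ₀ κ p = trans (box-cong R ν (λ w _ → h κ₀ (κ ∷ w) (λ { (q ∷ _) → ℕP.<⇒≱ (ℕP.+-monoˡ-< r q) (ℕP.≤-trans B≤ p) }))) (box-0 R ν)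
    head-part : from 0 R (λ κ₀ → from (suc x) R (λ κ → sub r κ (g κ₀))) ≡ sub r x (λ y → from 0 R (λ κ₀ → from (suc y) R (g κ₀)))
    head-part with r ℕ.≤? x
    ... | yes r≤x = trans (from-cong 0 R (λ κ₀ _ _ → trans (cong (λ t → from t R (λ κ → sub r κ (g κ₀)))
                      (sym (trans (ℕP.+-suc r (x ∸ r)) (cong suc (ℕP.m+[n∸m]≡n r≤x))))) (from-shift r (suc (x ∸ r)) R (g κ₀) (g-0 κ₀))))
                    (sym (sub-at {r} {x} (sym (ℕP.m+[n∸m]≡n r≤x))))
    -- For r > x the shifted range starts at 0, so κ₀ and κ run over the same full range and
    -- antisymmetry cancels the sum; on the other side x is too small to lose r.
    ... | no r≰x  = trans (trans (from-cong 0 R (λ κ₀ _ _ → trans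
                        (trans (from-low (suc x) R _ (λ κ q → sub-< {r} {κ} _ (ℕP.≤-trans q (ℕP.≰⇒> r≰x))))
                               (sym (from-low (r ℕ.+ 0) R _ (λ κ q → sub-< {r} {κ} _ (subst (κ <_) (ℕP.+-identityʳ r) q)))))
                        (from-shift r 0 R (g κ₀) (g-0 κ₀))))
                      (from-antisym 0 R g (λ κ₀ κ → trans (box-cong R ν (λ w _ → ex [] κ₀ κ w)) (box-neg R ν _))))
                    (sym (sub-< {r} {x} _ (ℕP.≰⇒> r≰x)))
    tail-part : from 0 R (λ κ₀ → from (suc x) R (λ κ → box R ν (D r (f κ₀ ∘ (κ ∷_))))) ≡ D r (λ ν′ → from 0 R (λ κ₀ → box R (x ∷ ν′) (f κ₀))) ν
    tail-part = begin
      from 0 R (λ κ₀ → from (suc x) R (λ κ → box R ν (D r (f κ₀ ∘ (κ ∷_)))))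
        ≡⟨ from-swap 0 R (suc x) R _ ⟩
      from (suc x) R (λ κ → from 0 R (λ κ₀ → box R ν (D r (f κ₀ ∘ (κ ∷_)))))
        ≡⟨ from-cong (suc x) R (λ κ _ _ → box-D R r B ν (λ κ₀ w → f κ₀ (κ ∷ w)) B≤ (λ p → ex (κ ∷ p))
             (λ κ₀ w n → h κ₀ (κ ∷ w) (λ { (_ ∷ q) → n q }))) ⟩
      from (suc x) R (λ κ → D r (λ ν′ → from 0 R (λ κ₀ → box R ν′ (f κ₀ ∘ (κ ∷_)))) ν)
        ≡⟨ from-D (suc x) R r ν _ ⟩
      D r (λ ν′ → from (suc x) R (λ κ → from 0 R (λ κ₀ → box R ν′ (f κ₀ ∘ (κ ∷_))))) ν
        ≡⟨ D-cong′ r ν (λ ν′ → from-swap (suc x) R 0 R _) ⟩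
      D r (λ ν′ → from 0 R (λ κ₀ → box R (x ∷ ν′) (f κ₀))) ν ∎

  -- Σ of f over the κ with b ≤ κ₀ ≤ ν₁ < κ₁ ≤ ν₂ < … ≤ ν_a < κ_a < R
  inter : ℕ → ℕ → List ℕ → (List ℕ → A) → A
  inter b R []      f = from b R (λ κ → f (κ ∷ []))
  inter b R (x ∷ ν) f = from b (suc x) (λ κ → inter (suc x) R ν (f ∘ (κ ∷_)))

  inter-cong : ∀ b R ν {f g} → (∀ w → Incr b w → length w ≡ suc (length ν) → f w ≡ g w) → inter b R ν f ≡ inter b R ν g
  inter-cong b R []      h = from-cong b R (λ κ p _ → h (κ ∷ []) (p ∷ []) refl)
  inter-cong b R (x ∷ ν) h = from-cong b (suc x) (λ κ p q → inter-cong (suc x) R ν (λ w i l → h (κ ∷ w) (p ∷ Incr-weaken q i) (cong suc l)))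

  inter-0 : ∀ b R ν → inter b R ν (λ _ → 0#) ≡ 0#
  inter-0 b R []      = from-0 b R
  inter-0 b R (x ∷ ν) = trans (from-cong b (suc x) (λ _ _ _ → inter-0 (suc x) R ν)) (from-0 b (suc x))

  inter-* : ∀ c b R ν f → inter b R ν (λ w → c * f w) ≡ c * inter b R ν f
  inter-* c b R []      f = from-* c b R _
  inter-* c b R (x ∷ ν) f = trans (from-cong b (suc x) (λ _ _ _ → inter-* c (suc x) R ν _)) (from-* c b (suc x) _)

  inter-sub : ∀ b R ν r x (f : ℕ → List ℕ → A) → inter b R ν (λ w → sub r x (λ y → f y w)) ≡ sub r x (λ y → inter b R ν (f y))
  inter-sub b R []      r x f = from-sub b R r x _
  inter-sub b R (z ∷ ν) r x f = trans (from-cong b (suc z) (λ _ _ _ → inter-sub (suc z) R ν r x _)) (from-sub b (suc z) r x _)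

  -- The part of the box with κ₀ > ν₁ is a full square in the first two variables, on which an
  -- antisymmetric function sums to 0. What remains is κ₀ ≤ ν₁, and so on along ν.
  box-inter : ∀ b R ν f → Antisymmetric f → Incr b ν → All (_< R) ν → from b R (λ κ → box R ν (f ∘ (κ ∷_))) ≡ inter b R ν f
  box-inter b R []      f a i       ps       = refl
  box-inter b R (x ∷ ν) f a (p ∷ i) (q ∷ qs) = begin
    from b R (λ κ → from (suc x) R (λ κ′ → box R ν (λ w → f (κ ∷ κ′ ∷ w))))
      ≡⟨ from-split b (suc x) R _ (ℕP.≤-trans p (ℕP.n≤1+n x)) q ⟩
    from b (suc x) (λ κ → from (suc x) R (λ κ′ → box R ν (λ w → f (κ ∷ κ′ ∷ w))))
      + from (suc x) R (λ κ → from (suc x) R (λ κ′ → box R ν (λ w → f (κ ∷ κ′ ∷ w))))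
      ≡⟨ cong₂ _+_ (from-cong b (suc x) (λ κ _ _ → box-inter (suc x) R ν (f ∘ (κ ∷_)) (antisym-∷ {f} κ a) i qs))
           (from-antisym (suc x) R _ (λ κ κ′ → trans (box-cong R ν (λ w _ → a [] κ′ κ w)) (box-neg R ν _))) ⟩
    inter b R (x ∷ ν) f + 0# ≡⟨ +-identityʳ _ ⟩
    inter b R (x ∷ ν) f ∎

  -- Only κ = (b, ..., b + n) contributes, and b ≤ ν₁ < b + 1 ≤ ν₂ < ... leaves a single possible ν.
  inter-det : ∀ b R n ν → Incr b ν → length ν ≡ n → All (_< R) ν → b ℕ.+ n < R →
    inter b R ν (det (iota b (suc n))) ≡ det (iota b n) ν
  inter-det b R zero    []      i       l ps       b<R = trans (from-cong b R (λ κ _ _ → det-head b [] κ [] [])) (from-eq b R b (λ _ → 1#) ℕP.≤-refl (subst (_< R) (ℕP.+-identityʳ b) b<R))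
  inter-det b R (suc n) (x ∷ ν) (p ∷ i) l (q ∷ qs) b<R = trans step (finish (ℕP.m≤n⇒m<n∨m≡n p))
    where
    step : inter b R (x ∷ ν) (det (iota b (suc (suc n)))) ≡ inter (suc x) R ν (det (iota (suc b) (suc n)))
    step = begin
      inter b R (x ∷ ν) (det (iota b (suc (suc n))))
        ≡⟨ from-cong b (suc x) (λ κ _ _ → trans (inter-cong (suc x) R ν (λ w j _ → det-head b (iota (suc b) (suc n)) κ w
             (All.map (λ s → ℕP.<⇒≢ (ℕP.≤-trans (s≤s p) s)) (Incr-≥ j)))) (inter-* (eq b κ) (suc x) R ν _)) ⟩
      from b (suc x) (λ κ → eq b κ * inter (suc x) R ν (det (iota (suc b) (suc n))))
        ≡⟨ from-eq b (suc x) b _ ℕP.≤-refl (s≤s p) ⟩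
      inter (suc x) R ν (det (iota (suc b) (suc n))) ∎
    finish : b < x ⊎ b ≡ x → inter (suc x) R ν (det (iota (suc b) (suc n))) ≡ det (iota b (suc n)) (x ∷ ν)
    finish (inj₂ refl) = trans (inter-det (suc b) R n ν i (ℕP.suc-injective l) qs (subst (_< R) (ℕP.+-suc b n) b<R))
      (sym (det-head′ b (iota (suc b) n) ν (≥⇒≢ (Incr-≥ i))))
    finish (inj₁ b<x)  = trans
      (trans (inter-cong (suc x) R ν (λ w j _ → ∉-det (suc b) (iota (suc (suc b)) n) w (All.map (λ s → ℕP.<⇒≢ (ℕP.≤-trans (s≤s b<x) s)) (Incr-≥ j)))) (inter-0 (suc x) R ν))
      (sym (∉-det b (iota (suc b) n) (x ∷ ν) (≥⇒≢ (Incr-≥ (b<x ∷ i)))))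

  -- On strictly increasing lists det is a Kronecker delta.
  inter-inter-det : ∀ b R ν (g : List ℕ → List ℕ → A) →
    inter b R ν (λ κ → inter b R ν (λ w → det κ w * g κ w)) ≡ inter b R ν (λ κ → g κ κ)
  inter-inter-det b R []      g = from-cong b R (λ κ p q → trans
    (from-cong b R (λ κ′ _ _ → *-congʳ (trans (det-head κ [] κ′ [] []) (*-identityʳ _))))
    (from-eq b R κ (λ κ′ → g (κ ∷ []) (κ′ ∷ [])) p q))
  inter-inter-det b R (x ∷ ν) g = from-cong b (suc x) (λ κ p q → begin
    inter (suc x) R ν (λ κs → from b (suc x) (λ κ′ → inter (suc x) R ν (λ w → det (κ ∷ κs) (κ′ ∷ w) * g (κ ∷ κs) (κ′ ∷ w))))
      ≡⟨ inter-cong (suc x) R ν (λ κs _ _ → begin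
           from b (suc x) (λ κ′ → inter (suc x) R ν (λ w → det (κ ∷ κs) (κ′ ∷ w) * g (κ ∷ κs) (κ′ ∷ w)))
             ≡⟨ from-cong b (suc x) (λ κ′ _ _ → trans (inter-cong (suc x) R ν (λ w i _ → trans
                  (*-congʳ (det-head κ κs κ′ w (All.map (λ s → ℕP.<⇒≢ (ℕP.≤-trans q s)) (Incr-≥ i)))) (*-assoc _ _ _)))
                  (inter-* (eq κ κ′) (suc x) R ν _)) ⟩
           from b (suc x) (λ κ′ → eq κ κ′ * inter (suc x) R ν (λ w → det κs w * g (κ ∷ κs) (κ′ ∷ w)))
             ≡⟨ from-eq b (suc x) κ _ p q ⟩
           inter (suc x) R ν (λ w → det κs w * g (κ ∷ κs) (κ ∷ w)) ∎) ⟩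
    inter (suc x) R ν (λ κs → inter (suc x) R ν (λ w → det κs w * g (κ ∷ κs) (κ ∷ w)))
      ≡⟨ inter-inter-det (suc x) R ν (λ κs w → g (κ ∷ κs) (κ ∷ w)) ⟩
    inter (suc x) R ν (λ κs → g (κ ∷ κs) (κ ∷ κs)) ∎)

-- Counting interlacing chains

-- The sizes a + 1, a, a, ..., 1, 1. The two alternating lists follow the alternation of κ and ν in
-- a chain: raising everything from a given entry onwards by one raises Σκ by the number of κ
-- entries among them, which is the size at the head.
interParts interParts′ : ℕ → List ℕ
interParts a = suc a ∷ interParts′ a
interParts′ zero    = []
interParts′ (suc a) = suc a ∷ interParts a

module Interlacing (K : CharZeroRing) where
  open Pieri K public
  open ≡-Reasoning

  Y : ℕ → List ℕ → List ℕ → A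
  Y a σ = E* σ (det (iota 0 a))

  n≤tri-suc : ∀ n → n ≤ tri (suc n)
  n≤tri-suc n = ℕP.m≤m+n n (tri n)

  X-bounded : ∀ N σ v → ¬ All (_< suc (sum σ ℕ.+ tri N)) v → X N σ v ≡ 0#
  X-bounded N σ v n = X-sum N σ v (λ e → n (subst (λ t → All (_< suc t) v) e (All.map s≤s (All-≤-sum v))))

  -- The row hidden in `E r` becomes visible as κ₀: its summand 1 is a removal from κ₀, absorbed by
  -- the full range of κ₀, and its summand `D r` passes through the box sum by `box-D`. For empty σ
  -- the box sum is evaluated by interlacing.
  Y-box : ∀ a σ R ν → length ν ≡ a → All (_< R) ν → sum σ ℕ.+ tri (suc a) < R →
    Y a σ ν ≡ from 0 R (λ κ₀ → box R ν (X (suc a) σ ∘ (κ₀ ∷_)))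
  Y-box a [] R ν l ps q = sym (antisym-≡ {λ ν → from 0 R (λ κ₀ → box R ν (X (suc a) [] ∘ (κ₀ ∷_)))} {det (iota 0 a)}
    (λ p x y w → trans (from-cong 0 R (λ κ₀ _ _ → box-antisym R {X (suc a) [] ∘ (κ₀ ∷_)} (antisym-∷ {X (suc a) []} κ₀ (X-antisym (suc a) [])) p x y w)) (from-neg 0 R _))
    (antisym-detʳ (iota 0 a)) ν
    (λ w π i → trans (box-inter 0 R w (X (suc a) []) (X-antisym (suc a) []) i (PermP.All-resp-↭ (↭-sym π) ps))
      (inter-det 0 R a w i (trans (PermP.↭-length π) l) (PermP.All-resp-↭ (↭-sym π) ps) (ℕP.≤-<-trans (n≤tri-suc a) q))))
  Y-box a (r ∷ σ) R ν l ps q = begin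
    Y a σ ν + D r (Y a σ) ν
      ≡⟨ cong₂ _+_ (Y-box a σ R ν l ps q′)
           (D-cong-All (λ y≤z z< → ℕP.≤-<-trans y≤z z<) r ν ps (λ w qs lw _ → Y-box a σ R w (trans lw l) qs q′)) ⟩
    from 0 R (λ κ₀ → box R ν (f κ₀)) + D r (λ ν′ → from 0 R (λ κ₀ → box R ν′ (f κ₀))) ν
      ≡⟨ cong₂ _+_ (from-shift r 0 R (λ κ → box R ν (f κ)) f-0)
           (box-D R r B ν f B≤R (antisym-exchange {X (suc a) σ} (X-antisym (suc a) σ)) (λ κ w n → X-bounded (suc a) σ (κ ∷ w) (λ { (_ ∷ t) → n t }))) ⟨
    from (r ℕ.+ 0) R (λ κ₀ → sub r κ₀ (λ κ → box R ν (f κ))) + from 0 R (λ κ₀ → box R ν (D r (f κ₀)))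
      ≡⟨ +-congʳ (from-zero r) ⟩
    from 0 R (λ κ₀ → sub r κ₀ (λ κ → box R ν (f κ))) + from 0 R (λ κ₀ → box R ν (D r (f κ₀)))
      ≡⟨ from-+ 0 R _ _ ⟨
    from 0 R (λ κ₀ → sub r κ₀ (λ κ → box R ν (f κ)) + box R ν (D r (f κ₀)))
      ≡⟨ from-cong 0 R (λ κ₀ _ _ → trans (box-+ R ν _ _) (+-congʳ (box-sub R ν r κ₀ f))) ⟨
    from 0 R (λ κ₀ → box R ν (X (suc a) (r ∷ σ) ∘ (κ₀ ∷_))) ∎
    where
    f : ℕ → List ℕ → A
    f κ₀ w = X (suc a) σ (κ₀ ∷ w)
    B = suc (sum σ ℕ.+ tri (suc a))
    B≤R : B ℕ.+ r ≤ R
    B≤R = ℕP.≤-trans (ℕP.≤-reflexive (cong suc (trans (ℕP.+-comm _ r) (sym (ℕP.+-assoc r (sum σ) _))))) q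
    q′ : sum σ ℕ.+ tri (suc a) < R
    q′ = ℕP.≤-trans (ℕP.m≤m+n B r) B≤R
    f-0 : ∀ κ → R ≤ κ ℕ.+ r → box R ν (f κ) ≡ 0#
    f-0 κ p = trans (box-cong R ν (λ w _ → X-bounded (suc a) σ (κ ∷ w) (λ { (t ∷ _) → ℕP.<⇒≱ (ℕP.+-monoˡ-< r t) (ℕP.≤-trans B≤R p) }))) (box-0 R ν)
    from-zero : ∀ r {h} → from (r ℕ.+ 0) R (λ κ₀ → sub r κ₀ h) ≡ from 0 R (λ κ₀ → sub r κ₀ h)
    from-zero r {h} = trans (cong (λ t → from t R (λ κ₀ → sub r κ₀ h)) (ℕP.+-identityʳ r)) (from-low r R _ (λ κ t → sub-< {r} {κ} h t))

  -- P js n is the number of partitions of n into parts from js, parts at different positions being distinguished.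
  P : List ℕ → ℕ → A
  P []       n = eq 0 n
  P (j ∷ js) n = ∑ (suc n) (λ m → sub (m ℕ.* j) n (P js))

  ∑-sub : ∀ R r x (f : ℕ → ℕ → A) → ∑ R (λ i → sub r x (f i)) ≡ sub r x (λ y → ∑ R (λ i → f i y))
  ∑-sub zero    r x f = sym (sub-0 r x)
  ∑-sub (suc R) r x f = trans (+-congˡ (∑-sub R r x (f ∘ suc))) (sym (sub-+ r x _ _))

  P-step : ∀ j js n → P (suc j ∷ js) n ≡ P js n + sub (suc j) n (P (suc j ∷ js))
  P-step j js n = +-congˡ (begin
    ∑ n (λ m → sub (suc m ℕ.* suc j) n (P js))
      ≡⟨ ∑-cong n (λ m → sub-sub (suc j) (m ℕ.* suc j) n (P js)) ⟨
    ∑ n (λ m → sub (suc j) n (λ y → sub (m ℕ.* suc j) y (P js)))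
      ≡⟨ ∑-sub n (suc j) n (λ m y → sub (m ℕ.* suc j) y (P js)) ⟩
    sub (suc j) n (λ y → ∑ n (λ m → sub (m ℕ.* suc j) y (P js)))
      ≡⟨ sub-cong (suc j) n (λ y e → ∑-extend (suc y) n _ (ℕP.≤-trans (s≤s (ℕP.m≤n+m y j)) (ℕP.≤-reflexive e))
           (λ m y<m → sub-< {m ℕ.* suc j} {y} (P js) (ℕP.≤-trans y<m (ℕP.m≤m*n m (suc j))))) ⟩
    sub (suc j) n (P (suc j ∷ js)) ∎)

  -- chainsκ a b s counts chains b ≤ κ₀ ≤ ν₁ < κ₁ ≤ … ≤ ν_a < κ_a with Σκ = s, and chainsν a b s
  -- counts chains b ≤ ν₁ < κ₁ ≤ … ≤ ν_a < κ_a; the smallest possible sums have been split off.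
  chainsκ chainsν : ℕ → ℕ → ℕ → A
  chainsκ a b s = sub (suc a ℕ.* b ℕ.+ tri (suc a)) s (P (interParts a))
  chainsν a b s = sub (a ℕ.* b ℕ.+ tri (suc a)) s (P (interParts′ a))

  sub-P-step : ∀ t j js s → sub t s (P (suc j ∷ js)) ≡ sub t s (P js) + sub (suc j ℕ.+ t) s (P (suc j ∷ js))
  sub-P-step t j js s = trans (sub-cong t s (λ y _ → P-step j js y))
    (trans (sub-+ t s _ _) (+-congˡ (trans (sub-sub t (suc j) s _) (cong (λ z → sub z s (P (suc j ∷ js))) (ℕP.+-comm t (suc j))))))

  -- Either κ₀ = b or every entry exceeds b; for partitions this asks whether the part a + 1 occurs.
  chainsκ-step : ∀ a b s → chainsκ a b s ≡ sub b s (chainsν a b) + chainsκ a (suc b) s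
  chainsκ-step a b s = trans (sub-P-step (suc a ℕ.* b ℕ.+ tri (suc a)) a (interParts′ a) s) (cong₂ _+_
    (trans (cong (λ z → sub z s (P (interParts′ a))) (ℕP.+-assoc b (a ℕ.* b) _)) (sym (sub-sub b _ s _)))
    (cong (λ z → sub z s (P (interParts a))) (arith a b (tri (suc a)))))
    where
    arith : ∀ a b t → suc a ℕ.+ (suc a ℕ.* b ℕ.+ t) ≡ suc a ℕ.* suc b ℕ.+ t
    arith = solve-∀

  -- Either ν₁ = b, which forces κ₁ > b and leaves a chain that starts with κ₁, or every entry
  -- exceeds b.
  chainsν-step : ∀ a b s → chainsν (suc a) b s ≡ chainsκ a (suc b) s + chainsν (suc a) (suc b) s
  chainsν-step a b s = trans (sub-P-step (suc a ℕ.* b ℕ.+ tri (suc (suc a))) a (interParts a) s) (cong₂ _+_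
    (cong (λ z → sub z s (P (interParts a))) (arith₁ a b (tri (suc a))))
    (cong (λ z → sub z s (P (interParts′ (suc a)))) (arith₂ a b (tri (suc (suc a))))))
    where
    arith₁ : ∀ a b t → suc a ℕ.* b ℕ.+ (suc a ℕ.+ t) ≡ suc a ℕ.* suc b ℕ.+ t
    arith₁ = solve-∀
    arith₂ : ∀ a b t → suc a ℕ.+ (suc a ℕ.* b ℕ.+ t) ≡ suc a ℕ.* suc b ℕ.+ t
    arith₂ = solve-∀

  chainsκ-0 : ∀ a b s → s < b → chainsκ a b s ≡ 0#
  chainsκ-0 a b s p = sub-< {suc a ℕ.* b ℕ.+ tri (suc a)} {s} _ (ℕP.<-≤-trans p (ℕP.≤-trans (ℕP.m≤m+n b _) (ℕP.m≤m+n _ (tri (suc a)))))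

  chainsν-0 : ∀ a b s → s < b → chainsν (suc a) b s ≡ 0#
  chainsν-0 a b s p = sub-< {suc a ℕ.* b ℕ.+ tri (suc (suc a))} {s} _ (ℕP.<-≤-trans p (ℕP.≤-trans (ℕP.m≤m+n b _) (ℕP.m≤m+n _ (tri (suc (suc a))))))

  sub-chainsν-0 : ∀ a b s κ → s < b → sub κ s (chainsν (suc a) b) ≡ 0#
  sub-chainsν-0 a b s κ p = trans (sub-cong κ s (λ y e → chainsν-0 a b y (ℕP.≤-<-trans (ℕP.≤-trans (ℕP.m≤n+m y κ) (ℕP.≤-reflexive e)) p))) (sub-0 κ s)

  eq-sub-0 : ∀ κ s → eq κ s ≡ sub κ s (eq 0)
  eq-sub-0 κ s = eq-sub 0 κ s

  from-eq-chains : ∀ m b s → s < b ℕ.+ m → from b (b ℕ.+ m) (λ κ → eq κ s) ≡ chainsκ 0 b s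
  from-eq-chains zero    b s p = trans (trans (cong (λ t → from b t (λ κ → eq κ s)) (ℕP.+-identityʳ b)) (from-empty b _)) (sym (chainsκ-0 0 b s (subst (s <_) (ℕP.+-identityʳ b) p)))
  from-eq-chains (suc m) b s p = begin
    from b (b ℕ.+ suc m) (λ κ → eq κ s)                 ≡⟨ cong (λ t → from b t (λ κ → eq κ s)) (ℕP.+-suc b m) ⟩
    from b (suc b ℕ.+ m) (λ κ → eq κ s)                 ≡⟨ from-first b _ _ (s≤s (ℕP.m≤m+n b m)) ⟩
    eq b s + from (suc b) (suc b ℕ.+ m) (λ κ → eq κ s)  ≡⟨ cong₂ _+_ (eq-sub-0 b s) (from-eq-chains m (suc b) s (subst (s <_) (ℕP.+-suc b m) p)) ⟩
    sub b s (eq 0) + chainsκ 0 (suc b) s                ≡⟨ chainsκ-step 0 b s ⟨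
    chainsκ 0 b s ∎

  eq-+ : ∀ κ t s → eq (κ ℕ.+ t) s ≡ sub κ s (eq t)
  eq-+ κ t s = trans (cong (λ z → eq z s) (ℕP.+-comm κ t)) (eq-sub t κ s)

  SS-from : ∀ n b m c S (f : ℕ → List ℕ → A) → SS n b m (λ w → from c S (λ i → f i w)) ≡ from c S (λ i → SS n b m (f i))
  SS-from zero    b m       c S f = refl
  SS-from (suc n) b zero    c S f = sym (from-0 c S)
  SS-from (suc n) b (suc m) c S f = trans (cong₂ _+_ (SS-from n (suc b) m c S _) (SS-from (suc n) (suc b) m c S _)) (sym (from-+ c S _ _))

  -- Two lower bounds are kept, c for κ₀ and b for ν, since running through ν₁ raises b while κ₀ may
  -- stay behind; the summands belong to κ₀ < b and κ₀ ≥ b. Because s < R the cut-off R excludes no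
  -- chain of sum s.
  count : ∀ a b m c R s → c ≤ b → b ℕ.+ m ≡ R → s < R →
    SS a b m (λ ν → inter c R ν (λ κ → eq (sum κ) s)) ≡ from c b (λ κ → sub κ s (chainsν a b)) + chainsκ a b s
  count zero b m c R s p refl q = begin
    from c (b ℕ.+ m) (λ κ → eq (κ ℕ.+ 0) s)
      ≡⟨ trans (from-cong c (b ℕ.+ m) (λ κ _ _ → cong (λ t → eq t s) (ℕP.+-identityʳ κ))) (from-split c b _ _ p (ℕP.m≤m+n b m)) ⟩
    from c b (λ κ → eq κ s) + from b (b ℕ.+ m) (λ κ → eq κ s)
      ≡⟨ cong₂ _+_ (from-cong c b (λ κ _ _ → eq-sub-0 κ s)) (from-eq-chains m b s q) ⟩
    from c b (λ κ → sub κ s (eq 0)) + chainsκ 0 b s ∎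
  count (suc a) b zero c R s p refl q = sym (trans (cong₂ _+_
    (trans (from-cong c b (λ κ _ _ → sub-chainsν-0 a b s κ s<b)) (from-0 c b))
    (chainsκ-0 (suc a) b s s<b)) (+-identityˡ 0#))
    where
    s<b : s < b
    s<b = subst (s <_) (ℕP.+-identityʳ b) q
  count (suc a) b (suc m) c R s p e q = begin
    SS a (suc b) m (λ ν → from c (suc b) (λ κ → inter (suc b) R ν (λ w → eq (κ ℕ.+ sum w) s)))
      + SS (suc a) (suc b) m (λ ν → inter c R ν (λ κ → eq (sum κ) s))
      ≡⟨ cong₂ _+_ first (count (suc a) (suc b) m c R s (ℕP.≤-trans p (ℕP.n≤1+n b)) e′ q) ⟩
    from c (suc b) (λ κ → sub κ s (chainsκ a (suc b))) + (from c (suc b) (λ κ → sub κ s (chainsν (suc a) (suc b))) + chainsκ (suc a) (suc b) s)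
      ≡⟨ +-assoc _ _ _ ⟨
    from c (suc b) (λ κ → sub κ s (chainsκ a (suc b))) + from c (suc b) (λ κ → sub κ s (chainsν (suc a) (suc b))) + chainsκ (suc a) (suc b) s
      ≡⟨ +-congʳ (trans (sym (from-+ c (suc b) _ _)) (from-cong c (suc b) (λ κ _ _ →
           trans (sym (sub-+ κ s _ _)) (sub-cong κ s (λ y _ → sym (chainsν-step a b y)))))) ⟩
    from c (suc b) (λ κ → sub κ s (chainsν (suc a) b)) + chainsκ (suc a) (suc b) s
      ≡⟨ trans (+-congʳ (from-last c b _ p)) (+-assoc _ _ _) ⟩
    from c b (λ κ → sub κ s (chainsν (suc a) b)) + (sub b s (chainsν (suc a) b) + chainsκ (suc a) (suc b) s)
      ≡⟨ +-congˡ (chainsκ-step (suc a) b s) ⟨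
    from c b (λ κ → sub κ s (chainsν (suc a) b)) + chainsκ (suc a) b s ∎
    where
    e′ : suc b ℕ.+ m ≡ R
    e′ = trans (sym (ℕP.+-suc b m)) e
    first : SS a (suc b) m (λ ν → from c (suc b) (λ κ → inter (suc b) R ν (λ w → eq (κ ℕ.+ sum w) s)))
            ≡ from c (suc b) (λ κ → sub κ s (chainsκ a (suc b)))
    first = trans (SS-from a (suc b) m c (suc b) (λ κ ν → inter (suc b) R ν (λ w → eq (κ ℕ.+ sum w) s)))
      (from-cong c (suc b) (λ κ _ _ → begin
        SS a (suc b) m (λ ν → inter (suc b) R ν (λ w → eq (κ ℕ.+ sum w) s))
          ≡⟨ SS-cong a (suc b) m (λ ν _ _ _ → trans (inter-cong (suc b) R ν (λ w _ _ → eq-+ κ (sum w) s)) (inter-sub (suc b) R ν κ s (λ t w → eq (sum w) t))) ⟩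
        SS a (suc b) m (λ ν → sub κ s (λ t → inter (suc b) R ν (λ w → eq (sum w) t)))
          ≡⟨ SS-sub a (suc b) m κ s (λ t ν → inter (suc b) R ν (λ w → eq (sum w) t)) ⟩
        sub κ s (λ t → SS a (suc b) m (λ ν → inter (suc b) R ν (λ w → eq (sum w) t)))
          ≡⟨ sub-cong κ s (λ t et → trans (count a (suc b) m (suc b) R t ℕP.≤-refl e′ (ℕP.≤-<-trans (ℕP.≤-trans (ℕP.m≤n+m t κ) (ℕP.≤-reflexive et)) q))
               (trans (+-congʳ (from-empty (suc b) (λ κ → sub κ t (chainsν a (suc b))))) (+-identityˡ _))) ⟩
        sub κ s (chainsκ a (suc b)) ∎))

  module _ (I : CycleIndex) where
    open Functional I

    L-from : ∀ n b R (f : ℕ → List ℕ → A) → L n (λ ρ → from b R (λ i → f i ρ)) ≡ from b R (λ i → L n (f i))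
    L-from n zero    R       f = L-∑ n R f
    L-from n (suc b) zero    f = L-0 n
    L-from n (suc b) (suc R) f = L-from n b R (f ∘ suc)

    L-inter : ∀ n b R ν (f : List ℕ → List ℕ → A) → L n (λ ρ → inter b R ν (λ w → f w ρ)) ≡ inter b R ν (λ w → L n (f w))
    L-inter n b R []      f = L-from n b R _
    L-inter n b R (x ∷ ν) f = trans (L-from n b (suc x) _) (from-cong b (suc x) (λ κ _ _ → L-inter n (suc x) R ν _))

    L-SS : ∀ n a b m (f : List ℕ → List ℕ → A) → L n (λ ρ → SS a b m (λ w → f w ρ)) ≡ SS a b m (λ w → L n (f w))
    L-SS n zero    b m       f = refl
    L-SS n (suc a) b zero    f = L-0 n
    L-SS n (suc a) b (suc m) f = trans (L-+ n _ _) (cong₂ _+_ (L-SS n a (suc b) m _) (L-SS n (suc a) (suc b) m _))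

    -- Orthogonality without a condition on the sums: a list of the wrong sum makes `X` vanish, and
    -- the factor `eq` records the degree.
    L-X-X : ∀ k N κ w → length κ ≡ N → length w ≡ N → L k (λ σ → X N σ κ * X N σ w) ≡ det κ w * eq (sum κ) (k ℕ.+ tri N)
    L-X-X k N κ w lκ lw with sum κ ℕ.≟ k ℕ.+ tri N
    ... | no n = trans (trans (L-cong k (λ σ _ e → trans (*-congʳ (X-sum N σ κ (λ e′ → n (trans e′ (cong (ℕ._+ tri N) e))))) (zeroˡ _))) (L-0 k))
                   (sym (trans (*-congˡ (eq-≢ n)) (zeroʳ _)))
    ... | yes e₁ with sum w ℕ.≟ k ℕ.+ tri N
    ...   | yes e₂ = trans (orthogonality k N κ w lκ lw e₁ e₂) (sym (trans (*-congˡ (trans (cong (λ t → eq t (k ℕ.+ tri N)) e₁) (eq-refl (k ℕ.+ tri N)))) (*-identityʳ _)))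
    ...   | no n   = trans (trans (L-cong k (λ σ _ e → trans (*-congˡ (X-sum N σ w (λ e′ → n (trans e′ (cong (ℕ._+ tri N) e))))) (zeroʳ _))) (L-0 k))
                       (sym (trans (*-congʳ (det-sum κ w (λ e → n (trans (sym e) e₁)))) (zeroˡ _)))

    -- Both factors are expanded by the Pieri rule. Orthogonality over σ then leaves only equal κ,
    -- which turns a signed sum into a count.
    L-Y-Y : ∀ a k R ν → Incr 0 ν → length ν ≡ a → All (_< R) ν → k ℕ.+ tri (suc a) < R →
      L k (λ σ → Y a σ ν * Y a σ ν) ≡ inter 0 R ν (λ κ → eq (sum κ) (k ℕ.+ tri (suc a)))
    L-Y-Y a k R ν i l ps q = begin
      L k (λ σ → Y a σ ν * Y a σ ν)
        ≡⟨ L-cong k (λ σ _ e → trans (cong₂ _*_ (Y-inter σ e) (Y-inter σ e)) (trans (sym (inter-* _ 0 R ν _))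
             (inter-cong 0 R ν (λ w _ _ → trans (*-comm _ _) (sym (inter-* _ 0 R ν _)))))) ⟩
      L k (λ σ → inter 0 R ν (λ κ → inter 0 R ν (λ w → X (suc a) σ κ * X (suc a) σ w)))
        ≡⟨ trans (L-inter k 0 R ν _) (inter-cong 0 R ν (λ κ _ lκ → trans (L-inter k 0 R ν _) (inter-cong 0 R ν (λ w _ lw →
             L-X-X k (suc a) κ w (trans lκ (cong suc l)) (trans lw (cong suc l)))))) ⟩
      inter 0 R ν (λ κ → inter 0 R ν (λ w → det κ w * eq (sum κ) (k ℕ.+ tri (suc a))))
        ≡⟨ inter-inter-det 0 R ν (λ κ w → eq (sum κ) (k ℕ.+ tri (suc a))) ⟩
      inter 0 R ν (λ κ → eq (sum κ) (k ℕ.+ tri (suc a))) ∎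
      where
      Y-inter : ∀ σ → sum σ ≡ k → Y a σ ν ≡ inter 0 R ν (X (suc a) σ)
      Y-inter σ e = trans (Y-box a σ R ν l ps (subst (λ t → t ℕ.+ tri (suc a) < R) (sym e) q))
        (box-inter 0 R ν (X (suc a) σ) (X-antisym (suc a) σ) i ps)

    iota-< : ∀ b n → All (_< b ℕ.+ n) (iota b n)
    iota-< b zero    = []
    iota-< b (suc n) = ℕP.m<m+n b (s≤s z≤n) ∷ All.map (λ p → ℕP.≤-trans p (ℕP.≤-reflexive (sym (ℕP.+-suc b n)))) (iota-< (suc b) n)

    -- The hypotheses describe a nearly rectangular beta-set: v is the complement of the empty
    -- partition inside [0, M] with room for k cells below, and x exceeds every entry of v by more
    -- than k, so that the first row never meets the others.
    L-φ-X-X : ∀ a k m M x v → length v ≡ a → All (λ z → k ≤ z × z ≤ M) v → map (M ∸_) v ≡ iota 0 a →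
      k ≤ x → All (λ z → z ℕ.+ k < x) v → sum (x ∷ v) ≡ k ℕ.+ (m ℕ.+ tri (suc a)) →
      L (k ℕ.+ m) (λ ρ → φ ρ k * (X (suc a) ρ (x ∷ v) * X (suc a) ρ (x ∷ v))) ≡ P (interParts a) k
    L-φ-X-X a k m M x v lv bounds reflect k≤x ps e = begin
      L (k ℕ.+ m) (λ ρ → φ ρ k * (X (suc a) ρ (x ∷ v) * X (suc a) ρ (x ∷ v)))
        ≡⟨ L-φ-split k m _ (λ π → cong₂ _*_ (D*-↭ (det (iota 0 (suc a))) (x ∷ v) π) (D*-↭ (det (iota 0 (suc a))) (x ∷ v) π)) ⟩
      L k (λ σ → L m (λ τ → X (suc a) (σ ++ τ) (x ∷ v) * X (suc a) (σ ++ τ) (x ∷ v)))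
        ≡⟨ L-cong k (λ σ _ s → strip σ s) ⟩
      L k (λ σ → SS a 0 R (λ ν → Y a σ ν * Y a σ ν))
        ≡⟨ L-SS k a 0 R _ ⟩
      SS a 0 R (λ ν → L k (λ σ → Y a σ ν * Y a σ ν))
        ≡⟨ SS-cong a 0 R (λ ν i l q → L-Y-Y a k R ν i l q ℕP.≤-refl) ⟩
      SS a 0 R (λ ν → inter 0 R ν (λ κ → eq (sum κ) (k ℕ.+ tri (suc a))))
        ≡⟨ count a 0 R 0 R (k ℕ.+ tri (suc a)) z≤n refl ℕP.≤-refl ⟩
      0# + chainsκ a 0 (k ℕ.+ tri (suc a))
        ≡⟨ +-identityˡ _ ⟩
      chainsκ a 0 (k ℕ.+ tri (suc a))
        ≡⟨ sub-at {suc a ℕ.* 0 ℕ.+ tri (suc a)} {k ℕ.+ tri (suc a)} (trans (ℕP.+-comm k _) (cong (λ t → t ℕ.+ tri (suc a) ℕ.+ k) (sym (ℕP.*-zeroʳ a)))) ⟩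
      P (interParts a) k ∎
      where
      R = suc (k ℕ.+ tri (suc a))
      strip : ∀ σ → sum σ ≡ k → L m (λ τ → X (suc a) (σ ++ τ) (x ∷ v) * X (suc a) (σ ++ τ) (x ∷ v)) ≡ SS a 0 R (λ ν → Y a σ ν * Y a σ ν)
      strip σ refl = begin
        L m (λ τ → X (suc a) (σ ++ τ) (x ∷ v) * X (suc a) (σ ++ τ) (x ∷ v))
          ≡⟨ L-X-G I σ m (suc a) (x ∷ v) (x ∷ v) (cong suc lv) (cong suc lv) e e ⟩
        G σ (x ∷ v) (x ∷ v)
          ≡⟨ G-first-row σ x x v v refl k≤x k≤x ps ⟩
        EE σ v v
          ≡⟨ EE-reflect M σ v v bounds bounds ⟩
        WW σ (map (M ∸_) v) (map (M ∸_) v)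
          ≡⟨ cong₂ (WW σ) reflect reflect ⟩
        WW σ (iota 0 a) (iota 0 a)
          ≡⟨ WW-expand R σ (iota 0 a) (iota 0 a) refl small small ⟩
        SS (length (iota 0 a)) 0 R (λ ν → Y a σ ν * Y a σ ν)
          ≡⟨ cong (λ t → SS t 0 R (λ ν → Y a σ ν * Y a σ ν)) (length-iota 0 a) ⟩
        SS a 0 R (λ ν → Y a σ ν * Y a σ ν) ∎
        where
        small : All (λ z → z ℕ.+ sum σ < R) (iota 0 a)
        small = All.map (λ {z} p → ℕP.≤-trans (ℕP.+-monoˡ-< (sum σ) p) (ℕP.≤-trans (ℕP.≤-reflexive (ℕP.+-comm a (sum σ)))
          (ℕP.≤-trans (ℕP.+-monoʳ-≤ (sum σ) (n≤tri-suc a)) (ℕP.n≤1+n _)))) (iota-< 0 a)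

-- Membership, replacement and leg lengths in beta-sets

signℤ-suc : ∀ n → signℤ (suc n) ≡ ℤ.- signℤ n
signℤ-suc zero          = refl
signℤ-suc (suc zero)    = refl
signℤ-suc (suc (suc n)) = signℤ-suc n

≡ᵇ-refl : ∀ x → (x ℕ.≡ᵇ x) ≡ true
≡ᵇ-refl zero    = refl
≡ᵇ-refl (suc x) = ≡ᵇ-refl x

≡ᵇ-≢ : ∀ {x y} → x ≢ y → (x ℕ.≡ᵇ y) ≡ false
≡ᵇ-≢ {zero}  {zero}  n = ⊥-elim (n refl)
≡ᵇ-≢ {zero}  {suc y} n = refl
≡ᵇ-≢ {suc x} {zero}  n = refl
≡ᵇ-≢ {suc x} {suc y} n = ≡ᵇ-≢ (n ∘ cong suc)

≤ᵇ-true : ∀ {m n} → m ≤ n → (m ℕ.≤ᵇ n) ≡ true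
≤ᵇ-true {m} {n} p with m ℕ.≤ᵇ n | ℕP.≤⇒≤ᵇ p
... | true | _ = refl

≤ᵇ-false : ∀ {m n} → n < m → (m ℕ.≤ᵇ n) ≡ false
≤ᵇ-false {m} {n} p with m ℕ.≤ᵇ n | ℕP.≤ᵇ⇒≤ m n
... | false | _ = refl
... | true  | h = ⊥-elim (ℕP.<⇒≱ p (h _))

memb-split : ∀ c B → memb c B ≡ true → ∃[ p ] ∃[ s ] B ≡ p ++ c ∷ s
memb-split c (x ∷ B) e with x ℕ.≟ c
... | yes refl = [] , B , refl
... | no n rewrite ≡ᵇ-≢ n with memb-split c B e
...   | p , s , refl = x ∷ p , s , refl

true≢false : true ≢ false
true≢false ()

memb-false : ∀ c B → memb c B ≡ false → All (_≢ c) B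
memb-false c []      e = []
memb-false c (x ∷ B) e with x ℕ.≟ c
... | yes refl rewrite ≡ᵇ-refl x = ⊥-elim (true≢false e)
... | no n rewrite ≡ᵇ-≢ n = n ∷ memb-false c B e

between-in : ∀ {lo hi z} B → lo < z → z < hi → between lo hi (z ∷ B) ≡ suc (between lo hi B)
between-in {lo} {hi} {z} B p q = cong length (trans
  (cong (filter (lo ℕ.<?_)) (ListP.filter-accept (ℕ._<? hi) {xs = B} q)) (ListP.filter-accept (lo ℕ.<?_) p))

between-out : ∀ {lo hi z} B → ¬ (lo < z × z < hi) → between lo hi (z ∷ B) ≡ between lo hi B
between-out {lo} {hi} {z} B n with z ℕ.<? hi
... | no q  = cong (λ t → length (filter (lo ℕ.<?_) t)) (ListP.filter-reject (ℕ._<? hi) {xs = B} q)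
... | yes q = cong length (trans
    (cong (filter (lo ℕ.<?_)) (ListP.filter-accept (ℕ._<? hi) {xs = B} q)) (ListP.filter-reject (lo ℕ.<?_) (λ p → n (p , q))))

between-delete : ∀ lo hi p s → between lo hi (p ++ hi ∷ s) ≡ between lo hi (p ++ s)
between-delete lo hi []      s = between-out {lo} {hi} s (λ (_ , q) → ℕP.<-irrefl refl q)
between-delete lo hi (x ∷ p) s = cons (lo ℕ.<? x) (x ℕ.<? hi)
  where
  cons : Dec (lo < x) → Dec (x < hi) → between lo hi (x ∷ p ++ hi ∷ s) ≡ between lo hi (x ∷ p ++ s)
  cons (yes a) (yes b) = trans (between-in {lo} {hi} (p ++ hi ∷ s) a b) (trans (cong suc (between-delete lo hi p s)) (sym (between-in {lo} {hi} (p ++ s) a b)))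
  cons (no a)  _       = trans (between-out {lo} {hi} (p ++ hi ∷ s) (a ∘ proj₁)) (trans (between-delete lo hi p s) (sym (between-out {lo} {hi} (p ++ s) (a ∘ proj₁))))
  cons (yes _) (no b)  = trans (between-out {lo} {hi} (p ++ hi ∷ s) (b ∘ proj₂)) (trans (between-delete lo hi p s) (sym (between-out {lo} {hi} (p ++ s) (b ∘ proj₂))))

replaceBeta-≢ : ∀ b c s → All (_≢ b) s → replaceBeta b c s ≡ s
replaceBeta-≢ b c []      []       = refl
replaceBeta-≢ b c (x ∷ s) (n ∷ ns) = cong₂ _∷_ (cong (if_then c else x) (≡ᵇ-≢ n)) (replaceBeta-≢ b c s ns)

unique-mid : ∀ (p : List ℕ) b s → Unique (p ++ b ∷ s) → All (_≢ b) (p ++ s)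
unique-mid []      b s (n ∷ _)  = All.map (λ m e → m (sym e)) n
unique-mid (x ∷ p) b s (n ∷ u) = All.head (AllP.++⁻ʳ p n) ∷ unique-mid p b s u

replaceBeta-mid : ∀ p b c s → All (_≢ b) (p ++ s) → replaceBeta b c (p ++ b ∷ s) ≡ p ++ c ∷ s
replaceBeta-mid []      b c s ns       = cong₂ _∷_ (cong (if_then c else b) (≡ᵇ-refl b)) (replaceBeta-≢ b c s ns)
replaceBeta-mid (x ∷ p) b c s (n ∷ ns) = cong₂ _∷_ (cong (if_then c else x) (≡ᵇ-≢ n)) (replaceBeta-mid p b c s ns)

unique-replace : ∀ (p : List ℕ) b c s → Unique (p ++ b ∷ s) → All (_≢ c) (p ++ b ∷ s) → Unique (p ++ c ∷ s)
unique-replace []      b c s (n ∷ u) (_ ∷ ms) = All.map (λ m e → m (sym e)) ms ∷ u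
unique-replace (x ∷ p) b c s (n ∷ u) (m ∷ ms) =
  AllP.++⁺ (AllP.++⁻ˡ p n) (m ∷ All.tail (AllP.++⁻ʳ p n)) ∷ unique-replace p b c s u ms

-- Sorting signs and the Murnaghan-Nakayama rule

module Characters (K : CharZeroRing) where
  open Interlacing K public
  open ≡-Reasoning

  sg : ℕ → ℕ → A
  sg zero    zero    = 0#
  sg zero    (suc y) = 1#
  sg (suc x) zero    = - 1#
  sg (suc x) (suc y) = sg x y

  sg-antisym : ∀ x y → sg y x ≡ - sg x y
  sg-antisym zero    zero    = sym -0≡0
  sg-antisym zero    (suc y) = refl
  sg-antisym (suc x) zero    = solve 1 (λ a → a := :- (:- a)) refl 1#
  sg-antisym (suc x) (suc y) = sg-antisym x y

  sg-< : ∀ {x y} → x < y → sg x y ≡ 1#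
  sg-< {zero}  {suc y} _       = refl
  sg-< {suc x} {suc y} (s≤s p) = sg-< p

  sg-> : ∀ {x y} → y < x → sg x y ≡ - 1#
  sg-> {x} {y} p = trans (sg-antisym y x) (cong -_ (sg-< p))

  sgs : ℕ → List ℕ → A
  sgs x []      = 1#
  sgs x (y ∷ v) = sg x y * sgs x v

  -- The sign of the permutation sorting v increasingly, 0 if v has a repeated entry.
  ε : List ℕ → A
  ε []      = 1#
  ε (x ∷ v) = sgs x v * ε v

  sgs-swap : ∀ z p x y v → sgs z (p ++ y ∷ x ∷ v) ≡ sgs z (p ++ x ∷ y ∷ v)
  sgs-swap z []      x y v = solve 3 (λ a b c → a :* (b :* c) := b :* (a :* c)) refl _ _ _
  sgs-swap z (q ∷ p) x y v = *-congˡ (sgs-swap z p x y v)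

  ε-antisym : Antisymmetric ε
  ε-antisym []      x y v = trans (*-congʳ (*-congʳ (sg-antisym x y)))
    (solve 4 (λ a b c d → :- a :* b :* (c :* d) := :- (a :* c :* (b :* d))) refl _ _ _ _)
  ε-antisym (z ∷ p) x y v = trans (cong₂ _*_ (sgs-swap z p x y v) (ε-antisym p x y v))
    (solve 2 (λ a b → a :* :- b := :- (a :* b)) refl _ _)

  sgs-< : ∀ x v → All (x <_) v → sgs x v ≡ 1#
  sgs-< x []      []       = refl
  sgs-< x (y ∷ v) (p ∷ ps) = trans (cong₂ _*_ (sg-< p) (sgs-< x v ps)) (*-identityˡ 1#)

  ε-Incr : ∀ {b v} → Incr b v → ε v ≡ 1#
  ε-Incr []              = refl
  ε-Incr (_∷_ {v = v} p i) = trans (cong₂ _*_ (sgs-< _ v (Incr-≥ i)) (ε-Incr i)) (*-identityˡ 1#)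

  -- With this sum only rearrangements of 0, ..., N - 1 have distinct entries, and on those both
  -- antisymmetric functions are the sorting sign.
  ε-det : ∀ N v → length v ≡ N → sum v ≡ tri N → ε v ≡ det (iota 0 N) v
  ε-det N v l s = antisym-≡ {ε} {det (iota 0 N)} ε-antisym (antisym-detʳ (iota 0 N)) v
    (λ w π i → trans (ε-Incr i) (sym (trans (cong (det (iota 0 N)) (w≡ w π i)) (det-iota 0 N))))
    where
    w≡ : ∀ w → w ↭ v → Incr 0 w → w ≡ iota 0 N
    w≡ w π i = trans (Incr-sum-≡ i (trans (sum-↭ π) (trans s (cong tri (sym lw))))) (cong (iota 0) lw)
      where
      lw : length w ≡ N
      lw = trans (PermP.↭-length π) l

  sg² : ∀ {x y} → x ≢ y → sg x y * sg x y ≡ 1#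
  sg² {x} {y} n with ℕP.<-cmp x y
  ... | tri< p _ _ = trans (cong₂ _*_ (sg-< p) (sg-< p)) (*-identityˡ 1#)
  ... | tri≈ _ e _ = ⊥-elim (n e)
  ... | tri> _ _ p = trans (cong₂ _*_ (sg-> p) (sg-> p)) (trans (solve 1 (λ a → :- a :* :- a := a :* a) refl 1#) (*-identityˡ 1#))

  sgs² : ∀ x v → All (x ≢_) v → sgs x v * sgs x v ≡ 1#
  sgs² x []      []       = *-identityˡ 1#
  sgs² x (y ∷ v) (n ∷ ns) = trans (solve 2 (λ a b → a :* b :* (a :* b) := a :* a :* (b :* b)) refl _ _)
    (trans (cong₂ _*_ (sg² n) (sgs² x v ns)) (*-identityˡ 1#))

  ε² : ∀ v → Unique v → ε v * ε v ≡ 1#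
  ε² []      []      = *-identityˡ 1#
  ε² (x ∷ v) (n ∷ u) = trans (solve 2 (λ a b → a :* b :* (a :* b) := a :* a :* (b :* b)) refl _ _)
    (trans (cong₂ _*_ (sgs² x v n) (ε² v u)) (*-identityˡ 1#))

  -- Lowering b to c changes the order only relative to the entries strictly in between, and their
  -- number is the leg length of the hook.
  sgs-between : ∀ c b q → c < b → All (_≢ c) q → All (_≢ b) q → sgs c q ≡ ι (signℤ (between c b q)) * sgs b q
  sgs-between c b []      p _        _        = sym (trans (*-identityʳ _) ι-1)
  sgs-between c b (z ∷ q) p (n ∷ ns) (m ∷ ms) with c ℕ.<? z | z ℕ.<? b
  ... | yes c<z | yes z<b = begin
    sg c z * sgs c q
      ≡⟨ cong₂ _*_ (sg-< c<z) (sgs-between c b q p ns ms) ⟩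
    1# * (ι (signℤ (between c b q)) * sgs b q)
      ≡⟨ solve 3 (λ o a s → o :* (a :* s) := :- a :* (:- o :* s)) refl _ _ _ ⟩
    - ι (signℤ (between c b q)) * (- 1# * sgs b q)
      ≡⟨ cong₂ _*_ (trans (sym (ι-neg _)) (cong ι (sym (trans (cong signℤ (between-in q c<z z<b)) (signℤ-suc (between c b q))))))
                   (*-congʳ (sym (sg-> z<b))) ⟩
    ι (signℤ (between c b (z ∷ q))) * (sg b z * sgs b q) ∎
  ... | no c≮z | _ = trans (cong₂ _*_ (trans (sg-> z<c) (sym (sg-> (ℕP.<-trans z<c p)))) (sgs-between c b q p ns ms))
      (trans (solve 3 (λ o a s → o :* (a :* s) := a :* (o :* s)) refl _ _ _)
        (*-congʳ (cong (ι ∘ signℤ) (sym (between-out q (c≮z ∘ proj₁))))))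
    where
    z<c : z < c
    z<c = ℕP.≤∧≢⇒< (ℕP.≮⇒≥ c≮z) n
  ... | yes c<z | no z≮b = trans (cong₂ _*_ (trans (sg-< c<z) (sym (sg-< b<z))) (sgs-between c b q p ns ms))
      (trans (solve 3 (λ o a s → o :* (a :* s) := a :* (o :* s)) refl _ _ _)
        (*-congʳ (cong (ι ∘ signℤ) (sym (between-out q (z≮b ∘ proj₂))))))
    where
    b<z : b < z
    b<z = ℕP.≤∧≢⇒< (ℕP.≮⇒≥ z≮b) (λ e → m (sym e))

  parity : List ℕ → A
  parity []      = 1#
  parity (_ ∷ p) = - parity p

  antisym-front : ∀ {f} → Antisymmetric f → ∀ p c s → f (p ++ c ∷ s) ≡ parity p * f (c ∷ p ++ s)
  antisym-front a []      c s = sym (*-identityˡ _)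
  antisym-front {f} a (x ∷ p) c s = begin
    f (x ∷ p ++ c ∷ s)                ≡⟨ antisym-front {f ∘ (x ∷_)} (antisym-∷ {f} x a) p c s ⟩
    parity p * f (x ∷ c ∷ p ++ s)     ≡⟨ *-congˡ (a [] c x _) ⟩
    parity p * - f (c ∷ x ∷ p ++ s)   ≡⟨ solve 2 (λ a b → a :* :- b := :- a :* b) refl _ _ ⟩
    - parity p * f (c ∷ x ∷ p ++ s) ∎

  antisym-repeat : ∀ {f} → Antisymmetric f → ∀ c q s → f (c ∷ q ++ c ∷ s) ≡ 0#
  antisym-repeat {f} a c q s = x≡-x⇒x≡0 _ (antisym-exchange {f} a q c c s)

  -- Bringing b or c to the front costs the same parity, so only the comparison with the other
  -- entries is left, which is `sgs-between`.
  ε-replace : ∀ p b c s → c < b → All (_≢ b) (p ++ s) → All (_≢ c) (p ++ s) →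
    ε (p ++ c ∷ s) ≡ ι (signℤ (between c b (p ++ b ∷ s))) * ε (p ++ b ∷ s)
  ε-replace p b c s c<b nb nc = begin
    ε (p ++ c ∷ s)                           ≡⟨ antisym-front {ε} ε-antisym p c s ⟩
    parity p * (sgs c (p ++ s) * ε (p ++ s)) ≡⟨ *-congˡ (*-congʳ (trans (sgs-between c b (p ++ s) c<b nc nb)
                                                 (*-congʳ (cong (ι ∘ signℤ) (sym (between-delete c b p s)))))) ⟩
    parity p * (i * sgs b (p ++ s) * ε (p ++ s)) ≡⟨ solve 4 (λ a i b c → a :* (i :* b :* c) := i :* (a :* (b :* c))) refl _ _ _ _ ⟩
    i * (parity p * (sgs b (p ++ s) * ε (p ++ s))) ≡⟨ *-congˡ (antisym-front {ε} ε-antisym p b s) ⟨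
    i * ε (p ++ b ∷ s) ∎
    where
    i = ι (signℤ (between c b (p ++ b ∷ s)))

  all-delete : ∀ {Q : ℕ → Set} p {b s} → All Q (p ++ b ∷ s) → All Q (p ++ s)
  all-delete p h = AllP.++⁺ (AllP.++⁻ˡ p h) (All.tail (AllP.++⁻ʳ p h))

  -- The Murnaghan–Nakayama rule: the sign of a hook removal is the sign of re-sorting the beta-set.
  chiβ-X : ∀ ρ B → All (1 ≤_) ρ → Unique B → D* ρ ε B ≡ ι (chiβ B ρ) * ε B
  chiβ-X []      B _        u = sym (trans (*-congʳ ι-1) (*-identityˡ _))
  chiβ-X (r ∷ ρ) B (1≤r ∷ ps) u = go [] B refl
    where
    term : ℕ → ℤ
    term b = if (r ℕ.≤ᵇ b) ∧ not (memb (b ∸ r) B) then signℤ (between (b ∸ r) b B) ℤ.* chiβ (replaceBeta b (b ∸ r) B) ρ else ℤ.+ 0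
    one : ∀ p b s → p ++ b ∷ s ≡ B → sub r b (λ c → D* ρ ε (p ++ c ∷ s)) ≡ ι (term b) * ε B
    one p b s refl with r ℕ.≤? b
    ... | no r≰b rewrite ≤ᵇ-false (ℕP.≰⇒> r≰b) = trans (sub-< {r} {b} _ (ℕP.≰⇒> r≰b)) (sym (trans (*-congʳ ι-0) (zeroˡ _)))
    ... | yes r≤b rewrite ≤ᵇ-true r≤b = trans (sub-at {r} {b} (sym (ℕP.m+[n∸m]≡n r≤b))) rest
      where
      c = b ∸ r
      c<b : c < b
      c<b = ℕP.∸-monoʳ-< {b} {r} {0} 1≤r r≤b
      rest : D* ρ ε (p ++ c ∷ s) ≡ ι (if not (memb c B) then signℤ (between c b B) ℤ.* chiβ (replaceBeta b c B) ρ else ℤ.+ 0) * ε B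
      rest with memb c B in eqn
      ... | false = begin
        D* ρ ε (p ++ c ∷ s)
          ≡⟨ chiβ-X ρ (p ++ c ∷ s) ps (unique-replace p b c s u (memb-false c B eqn)) ⟩
        ι (chiβ (p ++ c ∷ s) ρ) * ε (p ++ c ∷ s)
          ≡⟨ cong₂ _*_ (cong (λ t → ι (chiβ t ρ)) (sym (replaceBeta-mid p b c s (unique-mid p b s u))))
               (ε-replace p b c s c<b (unique-mid p b s u) (all-delete p (memb-false c B eqn))) ⟩
        ι (chiβ (replaceBeta b c B) ρ) * (ι (signℤ (between c b B)) * ε B)
          ≡⟨ trans (solve 3 (λ a b c → a :* (b :* c) := b :* a :* c) refl _ _ _) (*-congʳ (sym (ι-* _ _))) ⟩
        ι (signℤ (between c b B) ℤ.* chiβ (replaceBeta b c B) ρ) * ε B ∎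
      -- The lowered entry collides with another one: the rule contributes 0, and the antisymmetric
      -- function vanishes on a repeated entry.
      ... | true with memb c (p ++ s) in eqn′
      ...   | true = trans (trans (antisym-front {D* ρ ε} (D*-antisym ρ ε-antisym) p c s) (trans (*-congˡ zero′) (zeroʳ _)))
                       (sym (trans (*-congʳ ι-0) (zeroˡ _)))
        where
        zero′ : D* ρ ε (c ∷ p ++ s) ≡ 0#
        zero′ with memb-split c (p ++ s) eqn′
        ... | p′ , s′ , e = trans (cong (λ t → D* ρ ε (c ∷ t)) e) (antisym-repeat {D* ρ ε} (D*-antisym ρ ε-antisym) c p′ s′)
      -- Here c could only be the entry b itself, which r ≥ 1 excludes.
      ...   | false with memb-split c B eqn
      ...     | p′ , s′ , e = ⊥-elim (All.head (AllP.++⁻ʳ p′ (subst (All (_≢ c)) e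
                  (AllP.++⁺ (AllP.++⁻ˡ p (memb-false c (p ++ s) eqn′)) ((λ b≡c → ℕP.<-irrefl (sym b≡c) c<b) ∷ AllP.++⁻ʳ p (memb-false c (p ++ s) eqn′))))) refl)
    go : ∀ p s → p ++ s ≡ B → D r (λ w → D* ρ ε (p ++ w)) s ≡ ι (sumℤ (map term s)) * ε B
    go p []      e = sym (trans (*-congʳ ι-0) (zeroˡ _))
    go p (b ∷ s) e = begin
      sub r b (λ c → D* ρ ε (p ++ c ∷ s)) + D r (λ w → D* ρ ε (p ++ b ∷ w)) s
        ≡⟨ cong₂ _+_ (one p b s e) (trans (D-cong′ r s (λ w → cong (D* ρ ε) (sym (ListP.++-assoc p (b ∷ []) w))))
             (go (p ++ b ∷ []) s (trans (ListP.++-assoc p (b ∷ []) s) e))) ⟩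
      ι (term b) * ε B + ι (sumℤ (map term s)) * ε B
        ≡⟨ trans (sym (distribʳ _ _ _)) (*-congʳ (sym (ι-+ _ _))) ⟩
      ι (term b ℤ.+ sumℤ (map term s)) * ε B ∎

  -- Multiplying by ε(B)² = 1 moves the sign to the other side. After all of ρ has been removed the
  -- sum of the entries is `tri N`, where ε agrees with the delta function that defines `X`.
  ι-chiβ : ∀ N ρ B → All (1 ≤_) ρ → Unique B → length B ≡ N → sum B ≡ sum ρ ℕ.+ tri N → ι (chiβ B ρ) ≡ X N ρ B * ε B
  ι-chiβ N ρ B ps u l s = begin
    ι (chiβ B ρ)               ≡⟨ trans (*-congˡ (ε² B u)) (*-identityʳ _) ⟨
    ι (chiβ B ρ) * (ε B * ε B) ≡⟨ *-assoc _ _ _ ⟨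
    ι (chiβ B ρ) * ε B * ε B   ≡⟨ *-congʳ (chiβ-X ρ B ps u) ⟨
    D* ρ ε B * ε B             ≡⟨ *-congʳ (D*-cong ρ B (λ w lw e → ε-det N w (trans lw l)
                                   (ℕP.+-cancelˡ-≡ (sum ρ) _ _ (trans e s)))) ⟩
    X N ρ B * ε B ∎

  module _ (I : CycleIndex) where
    open Functional I

    -- The two-row determinantal formula, here φ_{y-1} - φ_y: the order is reversed because `iota`
    -- increases while a beta-set decreases. It holds for unsorted pairs as well, so removing a part
    -- from either entry stays within the statement.
    X-two-row : ∀ ρ x y → x ℕ.+ y ≡ sum ρ ℕ.+ 1 → X 2 ρ (x ∷ y ∷ []) ≡ sub 1 y (φ ρ) + - φ ρ y
    X-two-row [] zero          (suc zero) refl = trans (det-iota 0 2) (sym (trans (+-congˡ -0≡0) (+-identityʳ _)))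
    X-two-row [] (suc zero)    zero       refl = trans (antisym-detʳ (iota 0 2) [] 0 1 []) (trans (cong -_ (det-iota 0 2)) (sym (+-identityˡ _)))
    X-two-row (r ∷ ρ) x y e = begin
      sub r x (λ x′ → X 2 ρ (x′ ∷ y ∷ [])) + (sub r y (λ y′ → X 2 ρ (x ∷ y′ ∷ [])) + 0#)
        ≡⟨ cong₂ _+_ first (trans (+-identityʳ _) second) ⟩
      (sub 1 y (φ ρ) + - φ ρ y) + (sub 1 y (λ t → sub r t (φ ρ)) + - sub r y (φ ρ))
        ≡⟨ solve 4 (λ a b c d → (a :+ :- b) :+ (c :+ :- d) := (a :+ c) :+ :- (b :+ d)) refl _ _ _ _ ⟩
      (sub 1 y (φ ρ) + sub 1 y (λ t → sub r t (φ ρ))) + - (φ ρ y + sub r y (φ ρ))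
        ≡⟨ +-congʳ (sub-+ 1 y _ _) ⟨
      sub 1 y (φ (r ∷ ρ)) + - φ (r ∷ ρ) y ∎
      where
      second : sub r y (λ y′ → X 2 ρ (x ∷ y′ ∷ [])) ≡ sub 1 y (λ t → sub r t (φ ρ)) + - sub r y (φ ρ)
      second = trans (sub-cong r y (λ y′ e′ → X-two-row ρ x y′ (ℕP.+-cancelˡ-≡ r _ _ (trans (+-left-comm r x y′)
          (trans (cong (x ℕ.+_) e′) (trans e (ℕP.+-assoc r (sum ρ) 1)))))))
        (trans (sub-+ r y _ _) (cong₂ _+_ (sub-sub-comm r 1 y (φ ρ)) (sub-neg r y (φ ρ))))
      first : sub r x (λ x′ → X 2 ρ (x′ ∷ y ∷ [])) ≡ sub 1 y (φ ρ) + - φ ρ y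
      first with r ℕ.≤? x
      ... | yes r≤x = trans (sub-at {r} {x} (sym x≡)) (X-two-row ρ (x ∸ r) y (ℕP.+-cancelˡ-≡ r _ _
            (trans (sym (ℕP.+-assoc r (x ∸ r) y)) (trans (cong (ℕ._+ y) x≡) (trans e (ℕP.+-assoc r (sum ρ) 1))))))
        where
        x≡ : r ℕ.+ (x ∸ r) ≡ x
        x≡ = ℕP.m+[n∸m]≡n r≤x
      -- Now y exceeds the size of the remaining ρ by more than one, so both subset counts on the
      -- right vanish.
      ... | no r≰x  = trans (sub-< {r} {x} _ (ℕP.≰⇒> r≰x)) (sym (trans (cong₂ (λ s t → s + - t)
            (trans (sub-cong 1 y (λ t e′ → φ-large ρ t (ℕP.+-cancelˡ-< 1 _ _ (subst₂ _<_ (ℕP.+-comm (sum ρ) 1) (sym e′) large)))) (sub-0 1 y))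
            (φ-large ρ y (ℕP.<-trans (ℕP.m<m+n (sum ρ) (s≤s z≤n)) large))) (trans (+-congˡ -0≡0) (+-identityʳ _))))
        where
        large : sum ρ ℕ.+ 1 < y
        large = ℕP.+-cancelˡ-< r _ _ (ℕP.≤-<-trans (ℕP.≤-reflexive (trans (sym (ℕP.+-assoc r (sum ρ) 1)) (sym e))) (ℕP.+-monoˡ-< y (ℕP.≰⇒> r≰x)))

-- Part sizes, multiplicities and the numbers z_ρ

descending : ℕ → List ℕ
descending zero    = []
descending (suc n) = suc n ∷ descending n

range1-suc : ∀ n → range1 (suc n) ≡ range1 n ++ suc n ∷ []
range1-suc n = trans (cong (map suc) (sym (ListP.upTo-∷ʳ n))) (ListP.map-++ suc (upTo n) (n ∷ []))

reverse-range1 : ∀ n → reverse (range1 n) ≡ descending n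
reverse-range1 zero    = refl
reverse-range1 (suc n) = trans (cong reverse (range1-suc n)) (trans (ListP.reverse-++ (range1 n) (suc n ∷ [])) (cong (suc n ∷_) (reverse-range1 n)))

filter-range1 : ∀ m n → filter (ℕ._≤? m) (range1 n) ≡ range1 (m ℕ.⊓ n)
filter-range1 m zero    = cong range1 (sym (ℕP.⊓-zeroʳ m))
filter-range1 m (suc n) = trans (cong (filter (ℕ._≤? m)) (range1-suc n))
  (trans (ListP.filter-++ (ℕ._≤? m) (range1 n) (suc n ∷ [])) (trans (cong (_++ filter (ℕ._≤? m) (suc n ∷ [])) (filter-range1 m n)) (last (suc n ℕ.≤? m))))
  where
  last : Dec (suc n ≤ m) → range1 (m ℕ.⊓ n) ++ filter (ℕ._≤? m) (suc n ∷ []) ≡ range1 (m ℕ.⊓ suc n)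
  last (yes p) = trans (cong₂ (λ s t → range1 s ++ t) (ℕP.m≥n⇒m⊓n≡n (ℕP.≤-trans (ℕP.n≤1+n n) p)) (ListP.filter-accept (ℕ._≤? m) p))
    (trans (sym (range1-suc n)) (cong range1 (sym (ℕP.m≥n⇒m⊓n≡n p))))
  last (no ¬p) = trans (cong₂ (λ s t → range1 s ++ t) (ℕP.m≤n⇒m⊓n≡m m≤n) (ListP.filter-reject (ℕ._≤? m) ¬p))
    (trans (ListP.++-identityʳ _) (cong range1 (sym (ℕP.m≤n⇒m⊓n≡m (ℕP.≤-trans m≤n (ℕP.n≤1+n n))))))
    where
    m≤n : m ≤ n
    m≤n = ℕP.≤-pred (ℕP.≰⇒> ¬p)

mult-≡ : ∀ i ρ → mult i (i ∷ ρ) ≡ suc (mult i ρ)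
mult-≡ i ρ = cong length (ListP.filter-accept (ℕ._≟ i) {xs = ρ} refl)

mult-≢ : ∀ {i x} ρ → x ≢ i → mult i (x ∷ ρ) ≡ mult i ρ
mult-≢ {i} ρ n = cong length (ListP.filter-reject (ℕ._≟ i) {xs = ρ} n)

mult-∉ : ∀ i ρ → All (_≢ i) ρ → mult i ρ ≡ 0
mult-∉ i []      []       = refl
mult-∉ i (x ∷ ρ) (n ∷ ns) = trans (mult-≢ ρ n) (mult-∉ i ρ ns)

mult-↭ : ∀ i {ρ σ} → ρ ↭ σ → mult i ρ ≡ mult i σ
mult-↭ i π = PermP.↭-length (PermP.filter-↭ (ℕ._≟ i) π)

-- The product in `zee ρ` stops at the sum of ρ, which changes when a part is added. A bound
-- independent of ρ makes the two products comparable.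
zeeUpTo : ℕ → List ℕ → ℕ
zeeUpTo zero    ρ = 1
zeeUpTo (suc R) ρ = zeeUpTo R ρ ℕ.* (suc R ℕ.^ mult (suc R) ρ ℕ.* (mult (suc R) ρ) ℕ.!)

foldr-*-snoc : ∀ xs y → foldr ℕ._*_ 1 (xs ++ y ∷ []) ≡ foldr ℕ._*_ 1 xs ℕ.* y
foldr-*-snoc []       y = trans (ℕP.*-identityʳ y) (sym (ℕP.*-identityˡ y))
foldr-*-snoc (x ∷ xs) y = trans (cong (x ℕ.*_) (foldr-*-snoc xs y)) (sym (ℕP.*-assoc x _ y))

zeeUpTo-range1 : ∀ R ρ → foldr ℕ._*_ 1 (map (λ i → (i ℕ.^ mult i ρ) ℕ.* (mult i ρ) ℕ.!) (range1 R)) ≡ zeeUpTo R ρ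
zeeUpTo-range1 zero    ρ = refl
zeeUpTo-range1 (suc R) ρ = trans (cong (λ t → foldr ℕ._*_ 1 (map (λ i → (i ℕ.^ mult i ρ) ℕ.* (mult i ρ) ℕ.!) t)) (range1-suc R))
  (trans (cong (foldr ℕ._*_ 1) (ListP.map-++ _ (range1 R) (suc R ∷ []))) (trans (foldr-*-snoc (map _ (range1 R)) _) (cong (λ t → t ℕ.* (suc R ℕ.^ mult (suc R) ρ ℕ.* (mult (suc R) ρ) ℕ.!)) (zeeUpTo-range1 R ρ))))

zeeUpTo-↭ : ∀ R {ρ σ} → ρ ↭ σ → zeeUpTo R ρ ≡ zeeUpTo R σ
zeeUpTo-↭ zero    π = refl
zeeUpTo-↭ (suc R) π = cong₂ ℕ._*_ (zeeUpTo-↭ R π) (cong (λ t → suc R ℕ.^ t ℕ.* t ℕ.!) (mult-↭ (suc R) π))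

zeeUpTo-extend : ∀ R k ρ → All (_≤ R) ρ → zeeUpTo (k ℕ.+ R) ρ ≡ zeeUpTo R ρ
zeeUpTo-extend R zero    ρ ps = refl
zeeUpTo-extend R (suc k) ρ ps = trans (cong (λ t → zeeUpTo (k ℕ.+ R) ρ ℕ.* (suc (k ℕ.+ R) ℕ.^ t ℕ.* t ℕ.!))
    (mult-∉ _ ρ (All.map (λ p e → ℕP.<⇒≱ (s≤s (ℕP.m≤n+m R k)) (subst (_≤ R) e p)) ps)))
  (trans (ℕP.*-identityʳ _) (zeeUpTo-extend R k ρ ps))

zeeUpTo-∷-large : ∀ R {r} ρ → R < r → zeeUpTo R (r ∷ ρ) ≡ zeeUpTo R ρ
zeeUpTo-∷-large zero    ρ p = refl
zeeUpTo-∷-large (suc R) ρ p = cong₂ ℕ._*_ (zeeUpTo-∷-large R ρ (ℕP.<-trans ℕP.≤-refl p))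
  (cong (λ t → suc R ℕ.^ t ℕ.* t ℕ.!) (mult-≢ ρ (λ e → ℕP.<-irrefl (sym e) p)))

zeeUpTo-∷ : ∀ R r ρ → suc r ≤ R → zeeUpTo R (suc r ∷ ρ) ≡ suc r ℕ.* mult (suc r) (suc r ∷ ρ) ℕ.* zeeUpTo R ρ
zeeUpTo-∷ (suc R) r ρ p with ℕP.m≤n⇒m<n∨m≡n p
... | inj₁ r<R = trans (cong₂ ℕ._*_ (zeeUpTo-∷ R r ρ (ℕP.≤-pred r<R))
      (cong (λ t → suc R ℕ.^ t ℕ.* t ℕ.!) (mult-≢ ρ (λ e → ℕP.<-irrefl e r<R))))
    (ℕP.*-assoc (suc r ℕ.* mult (suc r) (suc r ∷ ρ)) (zeeUpTo R ρ) _)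
... | inj₂ refl = trans (cong₂ ℕ._*_ (zeeUpTo-∷-large R ρ ℕP.≤-refl)
      (cong (λ t → suc R ℕ.^ t ℕ.* t ℕ.!) (mult-≡ (suc R) ρ)))
    (trans (arith (zeeUpTo R ρ) (suc R) (suc R ℕ.^ mult (suc R) ρ) (suc (mult (suc R) ρ)) ((mult (suc R) ρ) ℕ.!))
      (cong (λ t → suc R ℕ.* t ℕ.* zeeUpTo (suc R) ρ) (sym (mult-≡ (suc R) ρ))))
  where
  arith : ∀ z a b c d → z ℕ.* (a ℕ.* b ℕ.* (c ℕ.* d)) ≡ a ℕ.* c ℕ.* (z ℕ.* (b ℕ.* d))
  arith = solve-∀

-- Only the factor of i = r + 1 changes, from i^m m! to i^(m+1) (m+1)!, that is by i(m + 1).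
zee-∷ : ∀ r ρ → zee (suc r ∷ ρ) ≡ suc r ℕ.* mult (suc r) (suc r ∷ ρ) ℕ.* zee ρ
zee-∷ r ρ = trans (zeeUpTo-range1 (suc r ℕ.+ sum ρ) (suc r ∷ ρ))
  (trans (zeeUpTo-∷ (suc r ℕ.+ sum ρ) r ρ (ℕP.m≤m+n (suc r) (sum ρ)))
    (cong (suc r ℕ.* mult (suc r) (suc r ∷ ρ) ℕ.*_) (trans (zeeUpTo-extend (sum ρ) (suc r) ρ (All-≤-sum ρ)) (sym (zeeUpTo-range1 (sum ρ) ρ)))))

zee-↭ : ∀ {ρ σ} → ρ ↭ σ → zee ρ ≡ zee σ
zee-↭ {ρ} {σ} π = trans (zeeUpTo-range1 (sum ρ) ρ) (trans (zeeUpTo-↭ (sum ρ) π) (trans (cong (λ t → zeeUpTo t σ) (sum-↭ π)) (sym (zeeUpTo-range1 (sum σ) σ))))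

insert : ℕ → List ℕ → List ℕ
insert r []      = r ∷ []
insert r (x ∷ ρ) with r ℕ.<? x
... | yes _ = x ∷ insert r ρ
... | no _  = r ∷ x ∷ ρ

insert-↭ : ∀ r ρ → insert r ρ ↭ r ∷ ρ
insert-↭ r []      = ↭-refl
insert-↭ r (x ∷ ρ) with r ℕ.<? x
... | yes _ = ↭-trans (Perm.prep x (insert-↭ r ρ)) (Perm.swap x r ↭-refl)
... | no _  = ↭-refl

insert-≥ : ∀ r ρ → All (_≤ r) ρ → insert r ρ ≡ r ∷ ρ
insert-≥ r []      _       = refl
insert-≥ r (x ∷ ρ) (p ∷ _) with r ℕ.<? x
... | yes q = ⊥-elim (ℕP.<⇒≱ q p)
... | no _  = refl

insert-< : ∀ {r x} ρ → r < x → insert r (x ∷ ρ) ≡ x ∷ insert r ρ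
insert-< {r} {x} ρ p with r ℕ.<? x
... | yes _ = refl
... | no q  = ⊥-elim (q p)

-- Sums over partitions satisfy the recursion of the functional

module PartitionSums (K : CharZeroRing) where
  open Characters K public
  open ≡-Reasoning

  sumL : List (List ℕ) → (List ℕ → A) → A
  sumL []       g = 0#
  sumL (ρ ∷ ρs) g = g ρ + sumL ρs g

  sumL-++ : ∀ ρs σs g → sumL (ρs ++ σs) g ≡ sumL ρs g + sumL σs g
  sumL-++ []       σs g = sym (+-identityˡ _)
  sumL-++ (ρ ∷ ρs) σs g = trans (+-congˡ (sumL-++ ρs σs g)) (sym (+-assoc _ _ _))

  sumL-map : ∀ p ρs g → sumL (map (p ∷_) ρs) g ≡ sumL ρs (g ∘ (p ∷_))
  sumL-map p []       g = refl
  sumL-map p (ρ ∷ ρs) g = +-congˡ (sumL-map p ρs g)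

  S : ℕ → ℕ → ℕ → (List ℕ → A) → A
  S f n m = sumL (partsF f n m)

  Sd : ℕ → ℕ → ℕ → (List ℕ → A) → A
  Sd f n zero    g = 0#
  Sd f n (suc k) g = S f (n ∸ k) (suc k) (g ∘ (suc k ∷_)) + Sd f n k g

  S-unfold : ∀ f n m g → S (suc f) (suc n) m g ≡ Sd f n (m ℕ.⊓ suc n) g
  S-unfold f n m g = trans (cong (λ t → sumL (concatMap (λ p → map (p ∷_) (partsF f (suc n ∸ p) p)) t) g)
      (trans (cong reverse (filter-range1 m (suc n))) (reverse-range1 (m ℕ.⊓ suc n)))) (go (m ℕ.⊓ suc n))
    where
    go : ∀ k → sumL (concatMap (λ p → map (p ∷_) (partsF f (suc n ∸ p) p)) (descending k)) g ≡ Sd f n k g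
    go zero    = refl
    go (suc k) = trans (sumL-++ (map (suc k ∷_) (partsF f (n ∸ k) (suc k))) _ g) (cong₂ _+_ (sumL-map (suc k) (partsF f (n ∸ k) (suc k)) g) (go k))

  S-0 : ∀ f m g → S f 0 m g ≡ g []
  S-0 zero    m g = +-identityʳ _
  S-0 (suc f) m g = +-identityʳ _

  S-fuel : ∀ f f′ n m g → n ≤ f → n ≤ f′ → S f n m g ≡ S f′ n m g
  S-fuel f       f′       zero    m g p       q       = trans (S-0 f m g) (sym (S-0 f′ m g))
  S-fuel (suc f) (suc f′) (suc n) m g (s≤s p) (s≤s q) = trans (S-unfold f n m g) (trans (go (m ℕ.⊓ suc n)) (sym (S-unfold f′ n m g)))
    where
    go : ∀ k → Sd f n k g ≡ Sd f′ n k g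
    go zero    = refl
    go (suc k) = cong₂ _+_ (S-fuel f f′ (n ∸ k) (suc k) _ (ℕP.≤-trans (ℕP.m∸n≤m n k) p) (ℕP.≤-trans (ℕP.m∸n≤m n k) q)) (go k)

  Σp : ℕ → ℕ → (List ℕ → A) → A
  Σp n m = S n n m

  Σp-zero : ∀ n g → Σp (suc n) 0 g ≡ 0#
  Σp-zero n g = S-unfold n n 0 g

  -- Either the largest permitted part m + 1 comes first, or all parts are at most m. This two-term
  -- recursion hides fuel, filtering and reversal of the enumeration.
  Σp-suc : ∀ n m g → Σp n (suc m) g ≡ sub (suc m) n (λ n′ → Σp n′ (suc m) (g ∘ (suc m ∷_))) + Σp n m g
  Σp-suc zero    m g = sym (+-identityˡ _)
  Σp-suc (suc n) m g with suc m ℕ.≤? suc n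
  ... | yes p@(s≤s m≤n) = begin
    Σp (suc n) (suc m) g
      ≡⟨ trans (S-unfold n n (suc m) g) (cong (λ t → Sd n n t g) (ℕP.m≤n⇒m⊓n≡m p)) ⟩
    S n (n ∸ m) (suc m) (g ∘ (suc m ∷_)) + Sd n n m g
      ≡⟨ cong₂ _+_ (trans (S-fuel n (n ∸ m) (n ∸ m) (suc m) _ (ℕP.m∸n≤m n m) ℕP.≤-refl) (sym (sub-at {suc m} {suc n} (cong suc (sym (ℕP.m+[n∸m]≡n m≤n))))))
           (sym (trans (S-unfold n n m g) (cong (λ t → Sd n n t g) (ℕP.m≤n⇒m⊓n≡m (ℕP.≤-trans m≤n (ℕP.n≤1+n n)))))) ⟩
    sub (suc m) (suc n) (λ n′ → Σp n′ (suc m) (g ∘ (suc m ∷_))) + Σp (suc n) m g ∎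
  ... | no ¬p = begin
    Σp (suc n) (suc m) g
      ≡⟨ trans (S-unfold n n (suc m) g) (cong (λ t → Sd n n t g) (ℕP.m≥n⇒m⊓n≡n (ℕP.<⇒≤ (ℕP.≰⇒> ¬p)))) ⟩
    Sd n n (suc n) g
      ≡⟨ trans (S-unfold n n m g) (cong (λ t → Sd n n t g) (ℕP.m≥n⇒m⊓n≡n (ℕP.≤-pred (ℕP.≰⇒> ¬p)))) ⟨
    Σp (suc n) m g
      ≡⟨ trans (+-congʳ (sub-< {suc m} {suc n} _ (ℕP.≰⇒> ¬p))) (+-identityˡ _) ⟨
    sub (suc m) (suc n) (λ n′ → Σp n′ (suc m) (g ∘ (suc m ∷_))) + Σp (suc n) m g ∎

  private
    Σp-cong-fuel : ∀ b n m {f g} → n ≤ b → (∀ ρ → All (1 ≤_) ρ → All (_≤ m) ρ → sum ρ ≡ n → f ρ ≡ g ρ) → Σp n m f ≡ Σp n m g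
    Σp-cong-fuel b       zero    m       p h = cong (_+ 0#) (h [] [] [] refl)
    Σp-cong-fuel (suc b) (suc n) zero    p h = trans (Σp-zero n _) (sym (Σp-zero n _))
    Σp-cong-fuel (suc b) (suc n) (suc m) (s≤s p) h = trans (Σp-suc (suc n) m _) (trans (cong₂ _+_
      (sub-cong (suc m) (suc n) (λ n′ e → Σp-cong-fuel b n′ (suc m) (ℕP.≤-trans (ℕP.≤-trans (ℕP.m≤n+m n′ m) (ℕP.≤-reflexive (ℕP.suc-injective e))) p)
        (λ ρ ps qs s → h (suc m ∷ ρ) (s≤s z≤n ∷ ps) (ℕP.≤-refl ∷ qs) (trans (cong (suc m ℕ.+_) s) e))))
      (Σp-cong-fuel (suc b) (suc n) m (s≤s p) (λ ρ ps qs s → h ρ ps (All.map (λ q → ℕP.≤-trans q (ℕP.n≤1+n m)) qs) s)))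
      (sym (Σp-suc (suc n) m _)))

  Σp-cong : ∀ n m {f g} → (∀ ρ → All (1 ≤_) ρ → All (_≤ m) ρ → sum ρ ≡ n → f ρ ≡ g ρ) → Σp n m f ≡ Σp n m g
  Σp-cong n m = Σp-cong-fuel n n m ℕP.≤-refl

  sumL-+ : ∀ ρs f g → sumL ρs (λ ρ → f ρ + g ρ) ≡ sumL ρs f + sumL ρs g
  sumL-+ []       f g = sym (+-identityˡ 0#)
  sumL-+ (ρ ∷ ρs) f g = trans (+-congˡ (sumL-+ ρs f g)) (+-interchange _ _ _ _)

  sumL-* : ∀ c ρs f → sumL ρs (λ ρ → c * f ρ) ≡ c * sumL ρs f
  sumL-* c []       f = sym (zeroʳ c)
  sumL-* c (ρ ∷ ρs) f = trans (+-congˡ (sumL-* c ρs f)) (sym (distribˡ c _ _))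

  sumL-0 : ∀ ρs → sumL ρs (λ _ → 0#) ≡ 0#
  sumL-0 []       = refl
  sumL-0 (ρ ∷ ρs) = trans (+-identityˡ _) (sumL-0 ρs)

  sumL-∑ : ∀ ρs R (f : ℕ → List ℕ → A) → sumL ρs (λ ρ → ∑ R (λ i → f i ρ)) ≡ ∑ R (λ i → sumL ρs (f i))
  sumL-∑ ρs zero    f = sumL-0 ρs
  sumL-∑ ρs (suc R) f = trans (sumL-+ ρs _ _) (+-congˡ (sumL-∑ ρs R (f ∘ suc)))

  -- Partitions of n containing the part r correspond to partitions of n − r.
  private
    Σp-insert-fuel : ∀ b n m r h → n ≤ b → r < m → (∀ ρ → mult (suc r) ρ ≡ 0 → h ρ ≡ 0#) →
      Σp n m h ≡ sub (suc r) n (λ n′ → Σp n′ m (h ∘ insert (suc r)))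
    Σp-insert-fuel b n (suc m) r h p r≤m v with ℕP.m≤n⇒m<n∨m≡n r≤m
    ... | inj₂ refl = begin
      Σp n (suc r) h
        ≡⟨ Σp-suc n r h ⟩
      sub (suc r) n (λ n′ → Σp n′ (suc r) (h ∘ (suc r ∷_))) + Σp n r h
        ≡⟨ cong₂ _+_ (sub-cong (suc r) n (λ n′ _ → Σp-cong n′ (suc r) (λ ρ _ qs _ → cong h (sym (insert-≥ (suc r) ρ qs)))))
             (trans (Σp-cong n r (λ ρ _ qs _ → v ρ (mult-∉ (suc r) ρ (All.map (λ q e → ℕP.<⇒≱ ℕP.≤-refl (subst (_≤ r) e q)) qs)))) (sumL-0 (partsF n n r))) ⟩
      sub (suc r) n (λ n′ → Σp n′ (suc r) (h ∘ insert (suc r))) + 0#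
        ≡⟨ +-identityʳ _ ⟩
      sub (suc r) n (λ n′ → Σp n′ (suc r) (h ∘ insert (suc r))) ∎
    ... | inj₁ (s≤s r<m) = begin
      Σp n (suc m) h
        ≡⟨ Σp-suc n m h ⟩
      sub (suc m) n (λ n′ → Σp n′ (suc m) (h ∘ (suc m ∷_))) + Σp n m h
        ≡⟨ cong₂ _+_ (sub-cong (suc m) n (λ n′ e → recurse b p n′ e)) (Σp-insert-fuel b n m r h p r<m v) ⟩
      sub (suc m) n (λ n′ → sub (suc r) n′ (λ n″ → Σp n″ (suc m) (λ ρ → h (suc m ∷ insert (suc r) ρ)))) + sub (suc r) n (λ n′ → Σp n′ m (h ∘ insert (suc r)))
        ≡⟨ +-congʳ (trans (sub-sub-comm (suc m) (suc r) n _) (sub-cong (suc r) n (λ n′ _ → sub-cong (suc m) n′ (λ n″ _ →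
             Σp-cong n″ (suc m) (λ ρ _ _ _ → cong h (sym (insert-< ρ (s≤s r<m)))))))) ⟩
      sub (suc r) n (λ n′ → sub (suc m) n′ (λ n″ → Σp n″ (suc m) (λ ρ → h (insert (suc r) (suc m ∷ ρ))))) + sub (suc r) n (λ n′ → Σp n′ m (h ∘ insert (suc r)))
        ≡⟨ trans (sym (sub-+ (suc r) n _ _)) (sub-cong (suc r) n (λ n′ _ → sym (Σp-suc n′ m _))) ⟩
      sub (suc r) n (λ n′ → Σp n′ (suc m) (h ∘ insert (suc r))) ∎
      where
      recurse : ∀ b → n ≤ b → ∀ n′ → suc m ℕ.+ n′ ≡ n → Σp n′ (suc m) (h ∘ (suc m ∷_))
        ≡ sub (suc r) n′ (λ n″ → Σp n″ (suc m) (λ ρ → h (suc m ∷ insert (suc r) ρ)))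
      recurse zero    z≤n n′ ()
      recurse (suc b) p   n′ refl = Σp-insert-fuel b n′ (suc m) r (h ∘ (suc m ∷_)) (ℕP.≤-trans (ℕP.m≤n+m n′ m) (ℕP.≤-pred p)) r≤m
        (λ ρ e → v (suc m ∷ ρ) (trans (mult-≢ ρ (λ q → ℕP.<-irrefl (sym (ℕP.suc-injective q)) r<m)) e))

  Σp-insert : ∀ n m r h → r < m → (∀ ρ → mult (suc r) ρ ≡ 0 → h ρ ≡ 0#) →
    Σp n m h ≡ sub (suc r) n (λ n′ → Σp n′ m (h ∘ insert (suc r)))
  Σp-insert n m r h = Σp-insert-fuel n n m r h ℕP.≤-refl

  Σp-saturated : ∀ n k g → Σp n (k ℕ.+ n) g ≡ Σp n n g
  Σp-saturated n zero    g = refl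
  Σp-saturated n (suc k) g = trans (Σp-suc n (k ℕ.+ n) g) (trans (cong₂ _+_ (sub-< {suc (k ℕ.+ n)} {n} _ (s≤s (ℕP.m≤n+m n k))) (Σp-saturated n k g)) (+-identityˡ _))

  nat-* : ∀ m n → nat (m ℕ.* n) ≡ nat m * nat n
  nat-* m n = trans (cong ι (ℤP.pos-* m n)) (ι-* _ _)

  sum-mult : ∀ R ρ → All (1 ≤_) ρ → All (_≤ R) ρ → nat (sum ρ) ≡ ∑ R (λ r → nat (suc r ℕ.* mult (suc r) ρ))
  sum-mult R []      _        _        = sym (trans (∑-cong R (λ r → trans (cong nat (ℕP.*-zeroʳ r)) ι-0)) (trans (∑-0 R) (sym ι-0)))
  sum-mult R (suc x ∷ ρ) (p ∷ ps) (q ∷ qs) = begin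
    nat (suc x ℕ.+ sum ρ)
      ≡⟨ nat-+ (suc x) (sum ρ) ⟩
    nat (suc x) + nat (sum ρ)
      ≡⟨ cong₂ _+_ (sym (trans (from-0-eq x (λ r → nat (suc r)) q) refl)) (sum-mult R ρ ps qs) ⟩
    ∑ R (λ r → eq x r * nat (suc r)) + ∑ R (λ r → nat (suc r ℕ.* mult (suc r) ρ))
      ≡⟨ ∑-+ R _ _ ⟨
    ∑ R (λ r → eq x r * nat (suc r) + nat (suc r ℕ.* mult (suc r) ρ))
      ≡⟨ ∑-cong R step ⟩
    ∑ R (λ r → nat (suc r ℕ.* mult (suc r) (suc x ∷ ρ))) ∎
    where
    from-0-eq : ∀ x h → x < R → ∑ R (λ r → eq x r * h r) ≡ h x
    from-0-eq x h p = from-eq 0 R x h z≤n p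
    step : ∀ r → eq x r * nat (suc r) + nat (suc r ℕ.* mult (suc r) ρ) ≡ nat (suc r ℕ.* mult (suc r) (suc x ∷ ρ))
    step r with x ℕ.≟ r
    ... | yes refl = trans (+-congʳ (trans (*-congʳ (eq-refl x)) (*-identityˡ _))) (trans (sym (nat-+ _ _))
          (cong nat (trans (sym (ℕP.*-suc (suc x) (mult (suc x) ρ))) (cong (suc x ℕ.*_) (sym (mult-≡ (suc x) ρ))))))
    ... | no n = trans (+-congʳ (trans (*-congʳ (eq-≢ n)) (zeroˡ _))) (trans (+-identityˡ _) (cong (λ t → nat (suc r ℕ.* t)) (sym (mult-≢ ρ (n ∘ ℕP.suc-injective)))))

  module _ (w : List ℕ → A) (nat-zee : ∀ ρ → All (1 ≤_) ρ → nat (zee ρ) * w ρ ≡ 1#) where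

    w-insert : ∀ r ρ → All (1 ≤_) ρ → nat (suc r ℕ.* mult (suc r) (insert (suc r) ρ)) * w (insert (suc r) ρ) ≡ w ρ
    w-insert r ρ ps = begin
      m′ * w ρ′                     ≡⟨ *-identityʳ _ ⟨
      m′ * w ρ′ * 1#                ≡⟨ *-congˡ (nat-zee ρ ps) ⟨
      m′ * w ρ′ * (nat (zee ρ) * w ρ) ≡⟨ solve 4 (λ a b c d → a :* b :* (c :* d) := a :* c :* b :* d) refl _ _ _ _ ⟩
      m′ * nat (zee ρ) * w ρ′ * w ρ ≡⟨ *-congʳ (trans (*-congʳ (trans (sym (nat-* _ (zee ρ))) (cong nat zee′))) (nat-zee ρ′ (PermP.All-resp-↭ (↭-sym (insert-↭ (suc r) ρ)) (s≤s z≤n ∷ ps)))) ⟩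
      1# * w ρ                      ≡⟨ *-identityˡ _ ⟩
      w ρ ∎
      where
      ρ′ = insert (suc r) ρ
      m′ = nat (suc r ℕ.* mult (suc r) ρ′)
      zee′ : suc r ℕ.* mult (suc r) ρ′ ℕ.* zee ρ ≡ zee ρ′
      zee′ = trans (cong (λ t → suc r ℕ.* t ℕ.* zee ρ) (mult-↭ (suc r) (insert-↭ (suc r) ρ))) (trans (sym (zee-∷ r ρ)) (zee-↭ (↭-sym (insert-↭ (suc r) ρ))))

    Lp : ℕ → (List ℕ → A) → A
    Lp n f = sumL (partitions n) (λ ρ → w ρ * f ρ)

    -- n = Σ r m_r(ρ), where m_r is the multiplicity of r, splits the left side by part sizes. Since
    -- r m_r(ρ)/z_ρ is the weight of ρ with one part r deleted, each piece becomes a sum over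
    -- partitions of n - r.
    Lp-suc : ∀ n R f → n ≤ R → Symmetric f → nat n * Lp n f ≡ ∑ R (λ r → sub (suc r) n (λ m → Lp m (f ∘ (suc r ∷_))))
    Lp-suc n R f n≤R s = begin
      nat n * Σp n n (λ ρ → w ρ * f ρ)
        ≡⟨ sumL-* (nat n) (partitions n) _ ⟨
      Σp n n (λ ρ → nat n * (w ρ * f ρ))
        ≡⟨ Σp-cong n n (λ ρ ps qs e → trans (*-congʳ (trans (cong nat (sym e)) (sum-mult R ρ ps (All.map (λ q → ℕP.≤-trans q n≤R) qs))))
             (trans (*-comm _ _) (sym (∑-* _ R _)))) ⟩
      Σp n n (λ ρ → ∑ R (λ r → w ρ * f ρ * nat (suc r ℕ.* mult (suc r) ρ)))
        ≡⟨ sumL-∑ (partitions n) R _ ⟩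
      ∑ R (λ r → Σp n n (λ ρ → w ρ * f ρ * nat (suc r ℕ.* mult (suc r) ρ)))
        ≡⟨ ∑-cong R term ⟩
      ∑ R (λ r → sub (suc r) n (λ m → Lp m (f ∘ (suc r ∷_)))) ∎
      where
      h : ℕ → List ℕ → A
      h r ρ = w ρ * f ρ * nat (suc r ℕ.* mult (suc r) ρ)
      h-0 : ∀ r ρ → mult (suc r) ρ ≡ 0 → h r ρ ≡ 0#
      h-0 r ρ e = trans (*-congˡ (trans (cong nat (trans (cong (suc r ℕ.*_) e) (ℕP.*-zeroʳ r))) ι-0)) (zeroʳ _)
      term : ∀ r → Σp n n (h r) ≡ sub (suc r) n (λ m → Lp m (f ∘ (suc r ∷_)))
      term r with suc r ℕ.≤? n
      ... | no r≰n = trans (trans (Σp-cong n n (λ ρ _ qs _ → h-0 r ρ (mult-∉ (suc r) ρ (All.map (λ q e → r≰n (subst (_≤ n) e q)) qs)))) (sumL-0 (partitions n)))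
                       (sym (sub-< {suc r} {n} _ (ℕP.≰⇒> r≰n)))
      ... | yes r<n = trans (Σp-insert n n r (h r) r<n (h-0 r)) (sub-cong (suc r) n (λ m e → begin
        Σp m n (h r ∘ insert (suc r))
          ≡⟨ cong (λ t → Σp m t (h r ∘ insert (suc r))) (sym e) ⟩
        Σp m (suc r ℕ.+ m) (h r ∘ insert (suc r))
          ≡⟨ Σp-saturated m (suc r) _ ⟩
        Σp m m (h r ∘ insert (suc r))
          ≡⟨ Σp-cong m m (λ ρ ps _ _ → trans (solve 3 (λ a b c → a :* b :* c := c :* a :* b) refl _ _ _)
               (cong₂ _*_ (w-insert r ρ ps) (s (insert-↭ (suc r) ρ)))) ⟩
        Lp m (f ∘ (suc r ∷_)) ∎))

    partitionIndex : CycleIndex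
    partitionIndex = record
      { L      = Lp
      ; L-cong = λ n h → Σp-cong n n (λ ρ ps _ e → *-congˡ (h ρ ps e))
      ; L-+    = λ n f g → trans (Σp-cong n n (λ ρ _ _ _ → distribˡ _ _ _)) (sumL-+ (partitions n) _ _)
      ; L-*    = λ c n f → trans (Σp-cong n n (λ ρ _ _ _ → solve 3 (λ a b c → a :* (b :* c) := b :* (a :* c)) refl _ _ _)) (sumL-* c (partitions n) _)
      ; L-zero = λ f → trans (+-identityʳ _) (trans (*-congʳ (trans (sym (*-identityˡ _)) (trans (*-congʳ (sym ι-1)) (nat-zee [] [])))) (*-identityˡ _))
      ; L-suc  = Lp-suc
      }

-- The Kronecker coefficients of padded rectangles

sum-replicate : ∀ a k → sum (replicate a k) ≡ a ℕ.* k
sum-replicate zero    k = refl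
sum-replicate (suc a) k = cong (k ℕ.+_) (sum-replicate a k)

length-beta : ∀ v → length (beta v) ≡ length v
length-beta []      = refl
length-beta (x ∷ v) = cong suc (length-beta v)

sum-beta : ∀ v → sum (beta v) ≡ sum v ℕ.+ tri (length v)
sum-beta []      = refl
sum-beta (x ∷ v) = trans (cong (x ℕ.+ length v ℕ.+_) (sum-beta v)) (arith x (length v) (sum v) (tri (length v)))
  where
  arith : ∀ x l s t → x ℕ.+ l ℕ.+ (s ℕ.+ t) ≡ x ℕ.+ s ℕ.+ (l ℕ.+ t)
  arith = solve-∀

beta-rect-bounds : ∀ a k → All (λ z → k ≤ z × z < k ℕ.+ a) (beta (replicate a k))
beta-rect-bounds zero    k = []
beta-rect-bounds (suc a) k = (ℕP.m≤m+n k _ , ℕP.≤-reflexive (trans (cong (λ t → suc (k ℕ.+ t)) (ListP.length-replicate a)) (sym (ℕP.+-suc k a))))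
  ∷ All.map (λ (p , q) → p , ℕP.≤-trans q (ℕP.+-monoʳ-≤ k (ℕP.n≤1+n a))) (beta-rect-bounds a k)

beta-rect-unique : ∀ a k → Unique (beta (replicate a k))
beta-rect-unique zero    k = []
beta-rect-unique (suc a) k = All.map (λ (p , q) e → ℕP.<-irrefl (trans (sym e) (cong (k ℕ.+_) (ListP.length-replicate a))) q) (beta-rect-bounds a k)
  ∷ beta-rect-unique a k

module KroneckerValues (K : CharZeroRing) where
  open PartitionSums K public
  open ≡-Reasoning

  -- For M = k + a - 1 the complement of (k + a - 1, ..., k) is (0, ..., a - 1); b is the offset
  -- that the induction over the rows produces.
  beta-rect-reflect : ∀ M b a k → suc M ≡ k ℕ.+ a ℕ.+ b → map (M ∸_) (beta (replicate a k)) ≡ iota b a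
  beta-rect-reflect M b zero    k e = refl
  beta-rect-reflect M b (suc a) k e = cong₂ _∷_
    (trans (cong (λ t → M ∸ (k ℕ.+ t)) (ListP.length-replicate a)) (trans (cong (_∸ (k ℕ.+ a)) M≡) (ℕP.m+n∸m≡n (k ℕ.+ a) b)))
    (beta-rect-reflect M (suc b) a k (trans (cong suc M≡) (sym (ℕP.+-suc (k ℕ.+ a) b))))
    where
    M≡ : M ≡ k ℕ.+ a ℕ.+ b
    M≡ = ℕP.suc-injective (trans e (cong (ℕ._+ b) (ℕP.+-suc k a)))

  module _ (I : CycleIndex) where
    open Functional I

    -- The bound on n makes the first entry of the beta-set at least 2k + a, whereas those of the
    -- rectangle are below k + a, so that k cells fit in between. It also gives n ≥ 2k for the
    -- two-row shape.
    kronecker : ∀ a k n → 1 ≤ a → a ℕ.* k ℕ.+ (k ℕ.+ (k ℕ.+ a)) ≤ n →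
      L n (λ ρ → ι (chi (pad n (k ∷ [])) ρ ℤ.* chi (pad n (rect k a)) ρ ℤ.* chi (pad n (rect k a)) ρ))
        ≡ P (interParts a) k + - sub 1 k (P (interParts a))
    kronecker a k n 1≤a big = begin
      L n (λ ρ → ι (chi (pad n (k ∷ [])) ρ ℤ.* chi (pad n (rect k a)) ρ ℤ.* chi (pad n (rect k a)) ρ))
        ≡⟨ L-cong n (λ ρ ps e → trans (trans (ι-* _ _) (*-congʳ (ι-* _ _))) (trans (*-assoc _ _ _) (cong₂ _*_ (two-row ρ ps e) (square ρ ps e)))) ⟩
      L n (λ ρ → (φ ρ k + - sub 1 k (φ ρ)) * XX ρ)
        ≡⟨ trans (L-cong′ n (λ ρ → trans (solve 3 (λ a b x → (a :+ :- b) :* x := a :* x :+ :- (x :* b)) refl _ _ _)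
             (+-congˡ (cong -_ (trans (sym (sub-* (XX ρ) 1 k (φ ρ))) (sub-cong 1 k (λ y _ → *-comm _ _))))))) (trans (L-+ n _ _) (+-congˡ (trans (L-neg n _) (cong -_ (L-sub n 1 k _))))) ⟩
      L n (λ ρ → φ ρ k * XX ρ) + - sub 1 k (λ y → L n (λ ρ → φ ρ y * XX ρ))
        ≡⟨ cong₂ (λ s t → s + - t) (value k ℕP.≤-refl) (sub-cong 1 k (λ y e → value y (ℕP.≤-trans (ℕP.n≤1+n y) (ℕP.≤-reflexive e)))) ⟩
      P (interParts a) k + - sub 1 k (P (interParts a)) ∎
      where
      β′ = beta (rect k a)
      x = (n ∸ sum (rect k a)) ℕ.+ length (rect k a)
      XX : List ℕ → A
      XX ρ = X (suc a) ρ (x ∷ β′) * X (suc a) ρ (x ∷ β′)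
      ak≤n : sum (rect k a) ≤ n
      ak≤n = ℕP.≤-trans (ℕP.≤-reflexive (sum-replicate a k)) (ℕP.≤-trans (ℕP.m≤m+n _ _) big)
      x-large : k ℕ.+ (k ℕ.+ a) ≤ x
      x-large = ℕP.≤-trans (ℕP.+-cancelˡ-≤ (sum (rect k a)) _ _
          (ℕP.≤-trans (ℕP.≤-reflexive (cong (ℕ._+ (k ℕ.+ (k ℕ.+ a))) (sum-replicate a k))) (ℕP.≤-trans big (ℕP.≤-reflexive (sym (ℕP.m+[n∸m]≡n ak≤n))))))
        (ℕP.m≤m+n _ _)
      lβ′ : length β′ ≡ a
      lβ′ = trans (length-beta (rect k a)) (ListP.length-replicate a)
      sum-β : sum (x ∷ β′) ≡ n ℕ.+ tri (suc a)
      sum-β = trans (sum-beta (pad n (rect k a))) (cong₂ (λ s t → s ℕ.+ tri (suc t)) (ℕP.m∸n+n≡m ak≤n) (ListP.length-replicate a))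
      unique-β : Unique (x ∷ β′)
      unique-β = All.map (λ (_ , q) e → ℕP.<-irrefl (sym e) (ℕP.<-≤-trans q (ℕP.≤-trans (ℕP.m≤n+m _ k) x-large))) (beta-rect-bounds a k) ∷ beta-rect-unique a k
      square : ∀ ρ → All (1 ≤_) ρ → sum ρ ≡ n → ι (chi (pad n (rect k a)) ρ) * ι (chi (pad n (rect k a)) ρ) ≡ XX ρ
      square ρ ps e = begin
        ι (chi (pad n (rect k a)) ρ) * ι (chi (pad n (rect k a)) ρ)
          ≡⟨ cong₂ _*_ ι-chi ι-chi ⟩
        (X (suc a) ρ (x ∷ β′) * ε (x ∷ β′)) * (X (suc a) ρ (x ∷ β′) * ε (x ∷ β′))
          ≡⟨ solve 2 (λ a b → a :* b :* (a :* b) := a :* a :* (b :* b)) refl _ _ ⟩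
        XX ρ * (ε (x ∷ β′) * ε (x ∷ β′))
          ≡⟨ trans (*-congˡ (ε² (x ∷ β′) unique-β)) (*-identityʳ _) ⟩
        XX ρ ∎
        where
        ι-chi : ι (chi (pad n (rect k a)) ρ) ≡ X (suc a) ρ (x ∷ β′) * ε (x ∷ β′)
        ι-chi = ι-chiβ (suc a) ρ (x ∷ β′) ps unique-β (cong suc lβ′) (trans sum-β (cong (ℕ._+ tri (suc a)) (sym e)))
      two-row : ∀ ρ → All (1 ≤_) ρ → sum ρ ≡ n → ι (chi (pad n (k ∷ [])) ρ) ≡ φ ρ k + - sub 1 k (φ ρ)
      two-row ρ ps e = begin
        ι (chi (pad n (k ∷ [])) ρ)
          ≡⟨ ι-chiβ 2 ρ (z ∷ (k ℕ.+ 0) ∷ []) ps (((λ e → ℕP.<-irrefl (trans (sym (ℕP.+-identityʳ k)) (sym e)) k<z) ∷ []) ∷ [] ∷ []) refl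
               (trans (cong (z ℕ.+_) (ℕP.+-identityʳ (k ℕ.+ 0))) (trans z+k (trans (cong (ℕ._+ 1) (sym e)) refl))) ⟩
        -- The beta-set of two rows is decreasing, so its sorting sign is -1, which restores the
        -- usual order of the difference.
        X 2 ρ (z ∷ k ℕ.+ 0 ∷ []) * (sg z (k ℕ.+ 0) * 1# * (1# * 1#))
          ≡⟨ cong₂ _*_ (trans (X-two-row I ρ z (k ℕ.+ 0) (trans z+k (cong (ℕ._+ 1) (sym e)))) (cong (λ t → sub 1 t (φ ρ) + - φ ρ t) (ℕP.+-identityʳ k)))
               (trans (cong₂ _*_ (trans (*-identityʳ _) (sg-> (subst (_< z) (sym (ℕP.+-identityʳ k)) k<z))) (*-identityʳ 1#)) (*-identityʳ _)) ⟩
        (sub 1 k (φ ρ) + - φ ρ k) * - 1#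
          ≡⟨ trans (solve 3 (λ a b o → (a :+ :- b) :* :- o := (b :+ :- a) :* o) refl _ _ _) (*-identityʳ _) ⟩
        φ ρ k + - sub 1 k (φ ρ) ∎
        where
        z = (n ∸ (k ℕ.+ 0)) ℕ.+ 1
        k≤n : k ≤ n
        k≤n = ℕP.≤-trans (ℕP.≤-trans (ℕP.m≤m+n k _) (ℕP.m≤n+m (k ℕ.+ (k ℕ.+ a)) (a ℕ.* k))) big
        k+0≤n : k ℕ.+ 0 ≤ n
        k+0≤n = ℕP.≤-trans (ℕP.≤-reflexive (ℕP.+-identityʳ k)) k≤n
        z+k : z ℕ.+ (k ℕ.+ 0) ≡ n ℕ.+ 1
        z+k = trans (arith (n ∸ (k ℕ.+ 0)) (k ℕ.+ 0)) (cong (ℕ._+ 1) (ℕP.m∸n+n≡m k+0≤n))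
          where
          arith : ∀ s t → s ℕ.+ 1 ℕ.+ t ≡ s ℕ.+ t ℕ.+ 1
          arith = solve-∀
        2k≤n : k ℕ.+ k ≤ n
        2k≤n = ℕP.≤-trans (ℕP.≤-trans (ℕP.+-monoʳ-≤ k (ℕP.m≤m+n k a)) (ℕP.m≤n+m (k ℕ.+ (k ℕ.+ a)) (a ℕ.* k))) big
        k<z : k < z
        k<z = ℕP.+-cancelʳ-< (k ℕ.+ 0) k z (ℕP.≤-<-trans (ℕP.≤-reflexive (cong (k ℕ.+_) (ℕP.+-identityʳ k)))
          (ℕP.≤-<-trans 2k≤n (ℕP.<-≤-trans (ℕP.m<m+n n (s≤s z≤n)) (ℕP.≤-reflexive (sym z+k)))))
      value : ∀ j → j ≤ k → L n (λ ρ → φ ρ j * XX ρ) ≡ P (interParts a) j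
      value j j≤k = trans (cong (λ t → L t (λ ρ → φ ρ j * XX ρ)) (sym n≡))
        (L-φ-X-X I a j (n ∸ j) (ℕ.pred (k ℕ.+ a)) x β′ lβ′
          (All.map (λ (p , q) → ℕP.≤-trans j≤k p , ℕP.≤-pred (ℕP.≤-trans q (ℕP.≤-reflexive (sym M≡)))) (beta-rect-bounds a k))
          (beta-rect-reflect (ℕ.pred (k ℕ.+ a)) 0 a k (trans M≡ (sym (ℕP.+-identityʳ _))))
          (ℕP.≤-trans j≤k (ℕP.≤-trans (ℕP.m≤m+n k _) x-large))
          (All.map (λ {z} (_ , q) → ℕP.<-≤-trans (ℕP.+-mono-<-≤ q j≤k) (ℕP.≤-trans (ℕP.≤-reflexive (ℕP.+-comm (k ℕ.+ a) k)) x-large)) (beta-rect-bounds a k))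
          (trans sum-β (trans (cong (ℕ._+ tri (suc a)) (sym n≡)) (ℕP.+-assoc j (n ∸ j) _))))
        where
        n≡ : j ℕ.+ (n ∸ j) ≡ n
        n≡ = ℕP.m+[n∸m]≡n (ℕP.≤-trans j≤k (ℕP.≤-trans (ℕP.≤-trans (ℕP.m≤m+n k _) (ℕP.m≤n+m (k ℕ.+ (k ℕ.+ a)) (a ℕ.* k))) big))
        M≡ : suc (ℕ.pred (k ℕ.+ a)) ≡ k ℕ.+ a
        M≡ = ℕP.suc-pred (k ℕ.+ a) {{ℕ.>-nonZero (ℕP.<-≤-trans 1≤a (ℕP.m≤n+m a k))}}

-- The rings ℤ and ℚ, and the value of the reduced Kronecker coefficient

ℤ-charZeroRing : CharZeroRing
ℤ-charZeroRing = record
  { A = ℤ ; _+_ = ℤ._+_ ; _*_ = ℤ._*_ ; -_ = ℤ.-_ ; 0# = ℤ.+ 0 ; 1# = ℤ.+ 1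
  ; isCommutativeRing = ℤP.+-*-isCommutativeRing
  ; ι = λ z → z ; ι-0 = refl ; ι-1 = refl ; ι-+ = λ _ _ → refl ; ι-* = λ _ _ → refl ; ι-neg = λ _ → refl
  ; ι-cancel = λ n x y → ℤP.*-cancelˡ-≡ (ℤ.+ suc n) x y
  }

fromℚᵘ-+ : ∀ p q → ℚ.fromℚᵘ (p ℚᵘ.+ q) ≡ ℚ.fromℚᵘ p ℚ.+ ℚ.fromℚᵘ q
fromℚᵘ-+ p q = ℚP.toℚᵘ-injective (ℚᵘP.≃-trans (ℚP.toℚᵘ-fromℚᵘ (p ℚᵘ.+ q))
  (ℚᵘP.≃-sym (ℚᵘP.≃-trans (ℚP.toℚᵘ-homo-+ (ℚ.fromℚᵘ p) (ℚ.fromℚᵘ q)) (ℚᵘP.+-cong (ℚP.toℚᵘ-fromℚᵘ p) (ℚP.toℚᵘ-fromℚᵘ q)))))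

fromℚᵘ-* : ∀ p q → ℚ.fromℚᵘ (p ℚᵘ.* q) ≡ ℚ.fromℚᵘ p ℚ.* ℚ.fromℚᵘ q
fromℚᵘ-* p q = ℚP.toℚᵘ-injective (ℚᵘP.≃-trans (ℚP.toℚᵘ-fromℚᵘ (p ℚᵘ.* q))
  (ℚᵘP.≃-sym (ℚᵘP.≃-trans (ℚP.toℚᵘ-homo-* (ℚ.fromℚᵘ p) (ℚ.fromℚᵘ q)) (ℚᵘP.*-cong (ℚP.toℚᵘ-fromℚᵘ p) (ℚP.toℚᵘ-fromℚᵘ q)))))

toℚ-+ : ∀ x y → toℚ (x ℤ.+ y) ≡ toℚ x ℚ.+ toℚ y
toℚ-+ x y = trans (ℚP.fromℚᵘ-cong {mkℚᵘ (x ℤ.+ y) 0} {mkℚᵘ x 0 ℚᵘ.+ mkℚᵘ y 0} (*≡* (arith x y))) (fromℚᵘ-+ (mkℚᵘ x 0) (mkℚᵘ y 0))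
  where
  arith : ∀ x y → (x ℤ.+ y) ℤ.* (ℤ.+ 1) ≡ (x ℤ.* (ℤ.+ 1) ℤ.+ y ℤ.* (ℤ.+ 1)) ℤ.* (ℤ.+ 1)
  arith = solve-∀-ℤ

toℚ-* : ∀ x y → toℚ (x ℤ.* y) ≡ toℚ x ℚ.* toℚ y
toℚ-* x y = trans (ℚP.fromℚᵘ-cong {mkℚᵘ (x ℤ.* y) 0} {mkℚᵘ x 0 ℚᵘ.* mkℚᵘ y 0} (*≡* refl)) (fromℚᵘ-* (mkℚᵘ x 0) (mkℚᵘ y 0))

toℚ-neg : ∀ x → toℚ (ℤ.- x) ≡ ℚ.- toℚ x
toℚ-neg x = begin
  toℚ (ℤ.- x)                                  ≡⟨ ℚP.+-identityʳ _ ⟨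
  toℚ (ℤ.- x) ℚ.+ ℚ.0ℚ                         ≡⟨ cong (toℚ (ℤ.- x) ℚ.+_) (ℚP.+-inverseʳ (toℚ x)) ⟨
  toℚ (ℤ.- x) ℚ.+ (toℚ x ℚ.+ ℚ.- toℚ x)        ≡⟨ ℚP.+-assoc (toℚ (ℤ.- x)) (toℚ x) _ ⟨
  (toℚ (ℤ.- x) ℚ.+ toℚ x) ℚ.+ ℚ.- toℚ x        ≡⟨ cong (ℚ._+ ℚ.- toℚ x) (trans (sym (toℚ-+ (ℤ.- x) x)) (cong toℚ (ℤP.+-inverseˡ x))) ⟩
  ℚ.0ℚ ℚ.+ ℚ.- toℚ x                           ≡⟨ ℚP.+-identityˡ _ ⟩
  ℚ.- toℚ x ∎
  where open ≡-Reasoning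

toℚ-inverse : ∀ d → toℚ (ℤ.+ suc d) ℚ.* ℚ.fromℚᵘ (mkℚᵘ (ℤ.+ 1) d) ≡ ℚ.1ℚ
toℚ-inverse d = trans (sym (fromℚᵘ-* (mkℚᵘ (ℤ.+ suc d) 0) (mkℚᵘ (ℤ.+ 1) d)))
  (ℚP.fromℚᵘ-cong {mkℚᵘ (ℤ.+ suc d) 0 ℚᵘ.* mkℚᵘ (ℤ.+ 1) d} {mkℚᵘ (ℤ.+ 1) 0}
    (*≡* (trans (ℤP.*-identityʳ _) (trans (ℤP.*-identityʳ _) (trans (cong (λ t → ℤ.+ suc t) (sym (ℕP.+-identityʳ d))) (sym (ℤP.*-identityˡ _)))))))

toℚ-cancel : ∀ n x y → toℚ (ℤ.+ suc n) ℚ.* x ≡ toℚ (ℤ.+ suc n) ℚ.* y → x ≡ y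
toℚ-cancel n x y e = trans (sym (undo x)) (trans (cong (i ℚ.*_) e) (undo y))
  where
  i = ℚ.fromℚᵘ (mkℚᵘ (ℤ.+ 1) n)
  undo : ∀ x → i ℚ.* (toℚ (ℤ.+ suc n) ℚ.* x) ≡ x
  undo x = trans (sym (ℚP.*-assoc i (toℚ (ℤ.+ suc n)) x)) (trans (cong (ℚ._* x) (trans (ℚP.*-comm i _) (toℚ-inverse n))) (ℚP.*-identityˡ x))

toℚ-injective : ∀ {x y} → toℚ x ≡ toℚ y → x ≡ y
toℚ-injective {x} {y} e with ℚP.fromℚᵘ-injective {mkℚᵘ x 0} {mkℚᵘ y 0} e
... | *≡* e′ = trans (sym (ℤP.*-identityʳ x)) (trans e′ (ℤP.*-identityʳ y))

ℚ-charZeroRing : CharZeroRing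
ℚ-charZeroRing = record
  { A = ℚ ; _+_ = ℚ._+_ ; _*_ = ℚ._*_ ; -_ = ℚ.-_ ; 0# = ℚ.0ℚ ; 1# = ℚ.1ℚ
  ; isCommutativeRing = ℚP.+-*-isCommutativeRing
  ; ι = toℚ ; ι-0 = refl ; ι-1 = refl ; ι-+ = toℚ-+ ; ι-* = toℚ-* ; ι-neg = toℚ-neg
  ; ι-cancel = toℚ-cancel
  }

module Z = Interlacing ℤ-charZeroRing

module Transfer (K : CharZeroRing) where
  open Interlacing K

  ι-sub : ∀ r x f → ι (Z.sub r x f) ≡ sub r x (ι ∘ f)
  ι-sub zero    x       f = refl
  ι-sub (suc r) zero    f = ι-0
  ι-sub (suc r) (suc x) f = ι-sub r x f

  ι-∑ : ∀ n f → ι (Z.∑ n f) ≡ ∑ n (ι ∘ f)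
  ι-∑ zero    f = ι-0
  ι-∑ (suc n) f = trans (ι-+ _ _) (+-congˡ (ι-∑ n (f ∘ suc)))

  ι-eq : ∀ x y → ι (Z.eq x y) ≡ eq x y
  ι-eq zero    zero    = ι-1
  ι-eq zero    (suc y) = ι-0
  ι-eq (suc x) zero    = ι-0
  ι-eq (suc x) (suc y) = ι-eq x y

  -- The Kronecker identity is obtained in ℚ, where the weights 1/z_ρ live, but the count is an
  -- integer; pushing the embedding through it brings the result back to ℤ.
  ι-P : ∀ js n → ι (Z.P js n) ≡ P js n
  ι-P []       n = ι-eq 0 n
  ι-P (j ∷ js) n = trans (ι-∑ (suc n) (λ m → Z.sub (m ℕ.* j) n (Z.P js))) (∑-cong (suc n) (λ m → trans (ι-sub (m ℕ.* j) n (Z.P js)) (sub-cong (m ℕ.* j) n (λ y _ → ι-P js y))))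

zeeUpTo-positive : ∀ R ρ → 1 ≤ zeeUpTo R ρ
zeeUpTo-positive zero    ρ = s≤s z≤n
zeeUpTo-positive (suc R) ρ = ℕP.*-mono-≤ (zeeUpTo-positive R ρ) (ℕP.*-mono-≤ (ℕP.m^n>0 (suc R) (mult (suc R) ρ)) (ℕP.1≤n! (mult (suc R) ρ)))

reducedKronecker : ∀ a k v → 1 ≤ a → IsReducedKron (rect k a) (rect k a) (k ∷ []) v →
  v ≡ Z.P (interParts a) k ℤ.+ ℤ.- Z.sub 1 k (Z.P (interParts a))
reducedKronecker a k v 1≤a (N , h) = toℚ-injective (begin
  toℚ v
    ≡⟨ ℚP.fromℚᵘ-cong (h n (ℕP.m≤m+n N _)) ⟨
  ℚ.fromℚᵘ (kron (pad n (k ∷ [])) (pad n (rect k a)) (pad n (rect k a)))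
    ≡⟨ sums (partitions (sum (pad n (k ∷ [])))) ⟩
  sumL (partitions (sum (pad n (k ∷ [])))) (λ ρ → w ρ ℚ.* c ρ)
    ≡⟨ cong (λ t → sumL (partitions t) (λ ρ → w ρ ℚ.* c ρ)) (ℕP.m∸n+n≡m k≤n) ⟩
  sumL (partitions n) (λ ρ → w ρ ℚ.* c ρ)
    ≡⟨ kronecker (partitionIndex w nat-zee) a k n 1≤a (ℕP.m≤n+m _ N) ⟩
  P (interParts a) k ℚ.+ ℚ.- sub 1 k (P (interParts a))
    ≡⟨ cong₂ (λ s t → s ℚ.+ ℚ.- t) (sym (ι-P (interParts a) k))
         (trans (sub-cong 1 k (λ y _ → sym (ι-P (interParts a) y))) (sym (ι-sub 1 k (Z.P (interParts a))))) ⟩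
  toℚ (Z.P (interParts a) k) ℚ.+ ℚ.- toℚ (Z.sub 1 k (Z.P (interParts a)))
    ≡⟨ trans (cong (toℚ (Z.P (interParts a) k) ℚ.+_) (sym (toℚ-neg p₁))) (sym (toℚ-+ (Z.P (interParts a) k) (ℤ.- p₁))) ⟩
  toℚ (Z.P (interParts a) k ℤ.+ ℤ.- Z.sub 1 k (Z.P (interParts a))) ∎)
  where
  open ≡-Reasoning
  open KroneckerValues ℚ-charZeroRing
  open Transfer ℚ-charZeroRing using (ι-P; ι-sub)
  -- Large enough for stability, which starts at N, and for the bound that `kronecker` requires.
  n = N ℕ.+ (a ℕ.* k ℕ.+ (k ℕ.+ (k ℕ.+ a)))
  k≤n : sum (k ∷ []) ≤ n
  k≤n = ℕP.≤-trans (ℕP.≤-reflexive (ℕP.+-identityʳ k)) (ℕP.≤-trans (ℕP.≤-trans (ℕP.m≤m+n k _) (ℕP.m≤n+m _ (a ℕ.* k))) (ℕP.m≤n+m _ N))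
  w : List ℕ → ℚ
  w ρ = ℚ.fromℚᵘ (invZee ρ)
  c : List ℕ → ℚ
  c ρ = toℚ (chi (pad n (k ∷ [])) ρ ℤ.* chi (pad n (rect k a)) ρ ℤ.* chi (pad n (rect k a)) ρ)
  cᵘ : List ℕ → ℚᵘ
  cᵘ ρ = mkℚᵘ (chi (pad n (k ∷ [])) ρ ℤ.* chi (pad n (rect k a)) ρ ℤ.* chi (pad n (rect k a)) ρ) 0
  p₁ : ℤ
  p₁ = Z.sub 1 k (Z.P (interParts a))
  nat-zee : ∀ ρ → All (1 ≤_) ρ → toℚ (ℤ.+ zee ρ) ℚ.* w ρ ≡ ℚ.1ℚ
  nat-zee ρ _ with zee ρ | subst (1 ≤_) (sym (zeeUpTo-range1 (sum ρ) ρ)) (zeeUpTo-positive (sum ρ) ρ)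
  ... | suc z | _ = toℚ-inverse z
  sums : ∀ ρs → ℚ.fromℚᵘ (foldr ℚᵘ._+_ ℚᵘ.0ℚᵘ (map (λ ρ → cᵘ ρ ℚᵘ.* invZee ρ) ρs))
    ≡ sumL ρs (λ ρ → w ρ ℚ.* c ρ)
  sums []       = refl
  sums (ρ ∷ ρs) = trans (fromℚᵘ-+ (cᵘ ρ ℚᵘ.* invZee ρ) (foldr ℚᵘ._+_ ℚᵘ.0ℚᵘ (map (λ ρ → cᵘ ρ ℚᵘ.* invZee ρ) ρs)))
    (cong₂ ℚ._+_ (trans (fromℚᵘ-* (cᵘ ρ) (invZee ρ)) (ℚP.*-comm (c ρ) (w ρ))) (sums ρs))

-- The ring of integer power series

module PowerSeries where
  open import Data.Integer using (_+_; _*_; -_)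

  Series : Set
  Series = ℕ → ℤ

  tail : Series → Series
  tail f n = f (suc n)

  infixl 6 _⊕_
  infixl 7 _⊛_
  infix  8 ⊝_

  _⊕_ : Series → Series → Series
  (f ⊕ g) n = f n + g n

  ⊝_ : Series → Series
  (⊝ f) n = - f n

  _⊛_ : Series → Series → Series
  (f ⊛ g) zero    = f 0 * g 0
  (f ⊛ g) (suc n) = f 0 * g (suc n) + (tail f ⊛ g) n

  constant : ℤ → Series
  constant c zero    = c
  constant c (suc _) = ℤ.+ 0

  zeroS oneS : Series
  zeroS _ = ℤ.+ 0
  oneS    = constant (ℤ.+ 1)

  -- Pointwise equality, wrapped so that both sides can be inferred.
  infix 4 _≈_
  record _≈_ (f g : Series) : Set where
    constructor pointwise
    field at : ∀ n → f n ≡ g n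
  open _≈_ public

  tail-cong : ∀ {f g} → f ≈ g → tail f ≈ tail g
  tail-cong p .at n = p .at (suc n)

  ⊛-cong : ∀ {f f′ g g′} → f ≈ f′ → g ≈ g′ → f ⊛ g ≈ f′ ⊛ g′
  ⊛-cong p q .at zero    = cong₂ _*_ (p .at 0) (q .at 0)
  ⊛-cong p q .at (suc n) = cong₂ _+_ (cong₂ _*_ (p .at 0) (q .at (suc n))) (⊛-cong (tail-cong p) q .at n)

  ⊛-zeroˡ : ∀ f g → (∀ i → f i ≡ ℤ.+ 0) → ∀ n → (f ⊛ g) n ≡ ℤ.+ 0
  ⊛-zeroˡ f g p zero    = cong (_* g 0) (p 0)
  ⊛-zeroˡ f g p (suc n) = cong₂ _+_ (cong (_* g (suc n)) (p 0)) (⊛-zeroˡ (tail f) g (p ∘ suc) n)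

  constant-⊛ : ∀ c g n → (constant c ⊛ g) n ≡ c * g n
  constant-⊛ c g zero    = refl
  constant-⊛ c g (suc n) = trans (cong (c * g (suc n) +_) (⊛-zeroˡ _ g (λ _ → refl) n)) (ℤP.+-identityʳ _)

  ⊛-distribʳ : ∀ h f g n → ((f ⊕ g) ⊛ h) n ≡ (f ⊛ h) n + (g ⊛ h) n
  ⊛-distribʳ h f g zero    = ℤP.*-distribʳ-+ (h 0) (f 0) (g 0)
  ⊛-distribʳ h f g (suc n) = trans (cong ((f 0 + g 0) * h (suc n) +_) (⊛-distribʳ h (tail f) (tail g) n)) (arith (f 0) (g 0) (h (suc n)) _ _)
    where
    arith : ∀ a b c x y → (a + b) * c + (x + y) ≡ a * c + x + (b * c + y)
    arith = solve-∀-ℤ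

  ⊛-scaleˡ : ∀ c f g n → ((λ i → c * f i) ⊛ g) n ≡ c * (f ⊛ g) n
  ⊛-scaleˡ c f g zero    = ℤP.*-assoc c (f 0) (g 0)
  ⊛-scaleˡ c f g (suc n) = trans (cong (c * f 0 * g (suc n) +_) (⊛-scaleˡ c (tail f) g n)) (arith c (f 0) (g (suc n)) _)
    where
    arith : ∀ c a b x → c * a * b + c * x ≡ c * (a * b + x)
    arith = solve-∀-ℤ

  ⊛-sucʳ : ∀ f g n → (f ⊛ g) (suc n) ≡ (f ⊛ tail g) n + f (suc n) * g 0
  ⊛-sucʳ f g zero    = refl
  ⊛-sucʳ f g (suc n) = trans (cong (f 0 * g (suc (suc n)) +_) (⊛-sucʳ (tail f) g n)) (sym (ℤP.+-assoc (f 0 * g (suc (suc n))) ((tail f ⊛ tail g) n) _))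

  ⊛-comm : ∀ f g n → (f ⊛ g) n ≡ (g ⊛ f) n
  ⊛-comm f g zero    = ℤP.*-comm (f 0) (g 0)
  ⊛-comm f g (suc n) = trans (cong (f 0 * g (suc n) +_) (⊛-comm (tail f) g n))
    (trans (arith (f 0) (g (suc n)) _) (sym (⊛-sucʳ g f n)))
    where
    arith : ∀ a b x → a * b + x ≡ x + b * a
    arith = solve-∀-ℤ

  ⊛-assoc : ∀ f g h n → ((f ⊛ g) ⊛ h) n ≡ (f ⊛ (g ⊛ h)) n
  ⊛-assoc f g h zero    = ℤP.*-assoc (f 0) (g 0) (h 0)
  ⊛-assoc f g h (suc n) = trans (cong (f 0 * g 0 * h (suc n) +_)
      (trans (⊛-distribʳ h (λ i → f 0 * g (suc i)) (tail f ⊛ g) n)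
             (cong₂ _+_ (⊛-scaleˡ (f 0) (tail g) h n) (⊛-assoc (tail f) g h n))))
    (arith (f 0) (g 0) (h (suc n)) _ _)
    where
    arith : ∀ a b c x y → a * b * c + (a * x + y) ≡ a * (b * c + x) + y
    arith = solve-∀-ℤ

  seriesRing : CommutativeRing _ _
  seriesRing = record
    { Carrier = Series ; _≈_ = _≈_ ; _+_ = _⊕_ ; _*_ = _⊛_ ; -_ = ⊝_ ; 0# = zeroS ; 1# = oneS
    ; isCommutativeRing = record
      { isRing = record
        { +-isAbelianGroup = record
          { isGroup = record
            { isMonoid = record
              { isSemigroup = record
                { isMagma = record
                  { isEquivalence = record
                    { refl = pointwise λ _ → refl ; sym = λ p → pointwise λ n → sym (p .at n) ; trans = λ p q → pointwise λ n → trans (p .at n) (q .at n) }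
                  ; ∙-cong = λ p q → pointwise λ n → cong₂ _+_ (p .at n) (q .at n) }
                ; assoc = λ f g h → pointwise λ n → ℤP.+-assoc (f n) (g n) (h n) }
              ; identity = (λ f → pointwise λ n → ℤP.+-identityˡ (f n)) , (λ f → pointwise λ n → ℤP.+-identityʳ (f n)) }
            ; inverse = (λ f → pointwise λ n → ℤP.+-inverseˡ (f n)) , (λ f → pointwise λ n → ℤP.+-inverseʳ (f n))
            ; ⁻¹-cong = λ p → pointwise λ n → cong -_ (p .at n) }
          ; comm = λ f g → pointwise λ n → ℤP.+-comm (f n) (g n) }
        ; *-cong = ⊛-cong
        ; *-assoc = λ f g h → pointwise (⊛-assoc f g h)
        ; *-identity = (λ f → pointwise λ n → trans (constant-⊛ (ℤ.+ 1) f n) (ℤP.*-identityˡ (f n)))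
                     , (λ f → pointwise λ n → trans (⊛-comm f oneS n) (trans (constant-⊛ (ℤ.+ 1) f n) (ℤP.*-identityˡ (f n))))
        ; distrib = (λ f g h → pointwise λ n → trans (⊛-comm f (g ⊕ h) n) (trans (⊛-distribʳ f g h n) (cong₂ _+_ (⊛-comm g f n) (⊛-comm h f n))))
                  , (λ f g h → pointwise (⊛-distribʳ f g h)) }
      ; *-comm = λ f g → pointwise (⊛-comm f g) } }

  open CommutativeRing seriesRing public using () renaming
    (+-cong to ⊕-cong; *-congˡ to ⊛-congˡ; *-congʳ to ⊛-congʳ; -‿cong to ⊝-cong;
     *-identityˡ to ⊛-identityˡ; *-identityʳ to ⊛-identityʳ; refl to ≈-refl; sym to ≈-sym; trans to ≈-trans; setoid to ≈-setoid; *-assoc to ⊛-associative; *-comm to ⊛-commutative;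
     zeroʳ to ⊛-zeroʳ; +-identityʳ to ⊕-identityʳ; +-identityˡ to ⊕-identityˡ; -‿inverseʳ to ⊝-inverseʳ)

  ⊕-congˡ : ∀ f {g h} → g ≈ h → f ⊕ g ≈ f ⊕ h
  ⊕-congˡ f p .at n = cong (λ t → f n + t) (p .at n)

  ⊕-congʳ : ∀ f {g h} → g ≈ h → g ⊕ f ≈ h ⊕ f
  ⊕-congʳ f p .at n = cong (λ t → t + f n) (p .at n)

  module ≈-Reasoning = Relation.Binary.Reasoning.Setoid ≈-setoid

  constant-morphism : CommutativeRing.rawRing ℤP.+-*-commutativeRing ACR.-Raw-AlmostCommutative⟶ ACR.fromCommutativeRing seriesRing
  constant-morphism = record
    { ⟦_⟧ = constant
    ; +-homo = λ x y → pointwise λ { zero → refl ; (suc n) → refl }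
    ; *-homo = λ x y → pointwise λ n → sym (trans (constant-⊛ x (constant y) n) (cc x y n))
    ; -‿homo = λ x → pointwise λ { zero → refl ; (suc n) → refl }
    ; 0-homo = pointwise λ { zero → refl ; (suc n) → refl }
    ; 1-homo = ≈-refl }
    where
    cc : ∀ x y n → x * constant y n ≡ constant (x * y) n
    cc x y zero    = refl
    cc x y (suc n) = ℤP.*-zeroʳ x

  constant-≟ : ∀ x y → Data.Maybe.Maybe (constant x ≈ constant y)
  constant-≟ x y = Data.Maybe.map (λ { refl → ≈-refl }) (dec⇒maybe (x ℤ.≟ y))

  open RingSolver (CommutativeRing.rawRing ℤP.+-*-commutativeRing) (ACR.fromCommutativeRing seriesRing) constant-morphism
    constant-≟ public
    using (solve; _:=_; _:+_; _:*_; :-_; con)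

  mono : ℕ → Series
  mono = Z.eq

  mono-0 : mono 0 ≈ oneS
  mono-0 .at zero    = refl
  mono-0 .at (suc _) = refl

  mono-⊛ : ∀ j g n → (mono j ⊛ g) n ≡ Z.sub j n g
  mono-⊛ zero    g n       = ≈-trans (⊛-cong mono-0 ≈-refl) (⊛-identityˡ g) .at n
  mono-⊛ (suc j) g zero    = refl
  mono-⊛ (suc j) g (suc n) = trans (ℤP.+-identityˡ _) (mono-⊛ j g n)

  mono-+ : ∀ i j → mono i ⊛ mono j ≈ mono (i ℕ.+ j)
  mono-+ i j .at n = trans (mono-⊛ i (mono j) n) (sym (trans (cong (λ t → Z.eq t n) (ℕP.+-comm i j)) (Z.eq-sub j i n)))

  E : ℕ → Series
  E j = oneS ⊕ ⊝ mono j

  E-⊛ : ∀ j g n → (E j ⊛ g) n ≡ g n + - Z.sub j n g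
  E-⊛ j g n = trans (solve 2 (λ m g → (con (ℤ.+ 1) :+ :- m) :* g := g :+ :- (m :* g)) ≈-refl (mono j) g .at n)
    (cong (λ t → g n + - t) (mono-⊛ j g n))

  -- geo j q = 1 + x^j + … + x^{(q−1)j}
  geo : ℕ → ℕ → Series
  geo j zero    = zeroS
  geo j (suc q) = oneS ⊕ mono j ⊛ geo j q

  E-geo : ∀ j q → E j ⊛ geo j q ≈ E (q ℕ.* j)
  E-geo j zero    = ≈-trans (⊛-zeroʳ (E j)) (≈-sym (≈-trans (⊕-congˡ oneS (⊝-cong mono-0)) (⊝-inverseʳ oneS)))
  E-geo j (suc q)   = begin
    E j ⊛ (oneS ⊕ mono j ⊛ geo j q)
      ≈⟨ solve 2 (λ m g → (con (ℤ.+ 1) :+ :- m) :* (con (ℤ.+ 1) :+ m :* g) := con (ℤ.+ 1) :+ :- m :+ m :* ((con (ℤ.+ 1) :+ :- m) :* g)) ≈-refl (mono j) (geo j q) ⟩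
    oneS ⊕ ⊝ mono j ⊕ mono j ⊛ (E j ⊛ geo j q)
      ≈⟨ ⊕-congˡ (oneS ⊕ ⊝ mono j) (⊛-congˡ (E-geo j q)) ⟩
    oneS ⊕ ⊝ mono j ⊕ mono j ⊛ (oneS ⊕ ⊝ mono (q ℕ.* j))
      ≈⟨ solve 2 (λ m k → con (ℤ.+ 1) :+ :- m :+ m :* (con (ℤ.+ 1) :+ :- k) := con (ℤ.+ 1) :+ :- (m :* k)) ≈-refl (mono j) (mono (q ℕ.* j)) ⟩
    oneS ⊕ ⊝ (mono j ⊛ mono (q ℕ.* j))
      ≈⟨ ⊕-congˡ oneS (⊝-cong (mono-+ j (q ℕ.* j))) ⟩
    E (suc q ℕ.* j) ∎
    where open ≈-Reasoning

  geo-⊛ : ∀ j q g n → (geo j q ⊛ g) n ≡ Z.∑ q (λ m → Z.sub (m ℕ.* j) n g)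
  geo-⊛ j zero    g n = ⊛-zeroˡ zeroS g (λ _ → refl) n
  geo-⊛ j (suc q) g n = trans (solve 3 (λ m h g → (con (ℤ.+ 1) :+ m :* h) :* g := g :+ m :* (h :* g)) ≈-refl (mono j) (geo j q) g .at n)
    (cong (g n +_) (trans (mono-⊛ j (geo j q ⊛ g) n) (trans (Z.sub-cong j n (λ y _ → geo-⊛ j q g y))
      (trans (sym (Z.∑-sub q j n (λ m y → Z.sub (m ℕ.* j) y g))) (Z.∑-cong q (λ m → Z.sub-sub j (m ℕ.* j) n g))))))

  +-cancelʳ : ∀ c {a b} → a + c ≡ b + c → a ≡ b
  +-cancelʳ c {a} {b} e = trans (sym (undo a)) (trans (cong (_+ - c) e) (undo b))
    where
    undo : ∀ a → a + c + - c ≡ a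
    undo a = trans (ℤP.+-assoc a c (- c)) (trans (cong (λ t → a + t) (ℤP.+-inverseʳ c)) (ℤP.+-identityʳ a))

  -- A constant term ±1, expressed by its square being 1, can be cancelled, and the coefficients
  -- follow one after the other. This covers both 1 - x^j and x^n - 1.
  unit-cancel : ∀ d f g → d 0 * d 0 ≡ ℤ.+ 1 → d ⊛ f ≈ d ⊛ g → f ≈ g
  unit-cancel d f g u e = pointwise λ n → go n f g (e .at)
    where
    cancel₀ : ∀ x y → d 0 * x ≡ d 0 * y → x ≡ y
    cancel₀ x y p = trans (undo x) (trans (cong (d 0 *_) p) (sym (undo y)))
      where
      undo : ∀ x → x ≡ d 0 * (d 0 * x)
      undo x = trans (sym (ℤP.*-identityˡ x)) (trans (cong (_* x) (sym u)) (ℤP.*-assoc (d 0) (d 0) x))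
    go : ∀ n f g → (∀ i → (d ⊛ f) i ≡ (d ⊛ g) i) → f n ≡ g n
    go zero    f g e = cancel₀ _ _ (e 0)
    go (suc n) f g e = go n (tail f) (tail g) (λ i → +-cancelʳ (d (suc i) * g 0)
      (trans (cong (λ t → (d ⊛ tail f) i + d (suc i) * t) (sym (cancel₀ _ _ (e 0)))) (trans (sym (⊛-sucʳ d f i)) (trans (e (suc i)) (⊛-sucʳ d g i)))))

  sumℤ-upTo : ∀ n h → sumℤ (map h (upTo n)) ≡ Z.∑ n h
  sumℤ-upTo n h = trans (cong sumℤ (ListP.map-upTo h n)) (go n h)
    where
    go : ∀ n h → sumℤ (applyUpTo h n) ≡ Z.∑ n h
    go zero    h = refl
    go (suc n) h = cong (h 0 +_) (go n (h ∘ suc))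

  convF-⊛ : ∀ c e → convF c e ≈ c ⊛ e
  convF-⊛ c e .at k = trans (sumℤ-upTo (suc k) (λ j → c j * e (k ∸ j))) (go k c)
    where
    go : ∀ k c → Z.∑ (suc k) (λ j → c j * e (k ∸ j)) ≡ (c ⊛ e) k
    go zero    c = ℤP.+-identityʳ _
    go (suc k) c = cong (c 0 * e (suc k) +_) (go k (c ∘ suc))

  coeffP-addP : ∀ p q → coeffP (addP p q) ≈ coeffP p ⊕ coeffP q
  coeffP-addP []      q       .at n       = sym (ℤP.+-identityˡ _)
  coeffP-addP (x ∷ p) []      .at n       = sym (ℤP.+-identityʳ _)
  coeffP-addP (x ∷ p) (y ∷ q) .at zero    = refl
  coeffP-addP (x ∷ p) (y ∷ q) .at (suc n) = coeffP-addP p q .at n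

  coeffP-scaleP : ∀ c p n → coeffP (scaleP c p) n ≡ c * coeffP p n
  coeffP-scaleP c []      n       = sym (ℤP.*-zeroʳ c)
  coeffP-scaleP c (x ∷ p) zero    = refl
  coeffP-scaleP c (x ∷ p) (suc n) = coeffP-scaleP c p n

  coeffP-mulP : ∀ p q → coeffP (mulP p q) ≈ coeffP p ⊛ coeffP q
  coeffP-mulP []      q .at n       = sym (⊛-zeroˡ (coeffP []) (coeffP q) (λ _ → refl) n)
  coeffP-mulP (x ∷ p) q .at zero    = trans (coeffP-addP (scaleP x q) (ℤ.+ 0 ∷ mulP p q) .at 0) (trans (ℤP.+-identityʳ _) (coeffP-scaleP x q 0))
  coeffP-mulP (x ∷ p) q .at (suc n) = trans (coeffP-addP (scaleP x q) (ℤ.+ 0 ∷ mulP p q) .at (suc n)) (cong₂ _+_ (coeffP-scaleP x q (suc n)) (coeffP-mulP p q .at n))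

  coeffP-one : coeffP (ℤ.+ 1 ∷ []) ≈ oneS
  coeffP-one .at zero    = refl
  coeffP-one .at (suc n) = refl

  coeffP-monomial : ∀ j c n → coeffP (monomial j c) n ≡ c * mono j n
  coeffP-monomial zero    c zero    = sym (ℤP.*-identityʳ c)
  coeffP-monomial zero    c (suc n) = sym (ℤP.*-zeroʳ c)
  coeffP-monomial (suc j) c zero    = sym (ℤP.*-zeroʳ c)
  coeffP-monomial (suc j) c (suc n) = coeffP-monomial j c n

  binomialP : ℕ → Poly
  binomialP j = addP (ℤ.+ 1 ∷ []) (monomial j (- (ℤ.+ 1)))

  coeffP-binomialP : ∀ j → coeffP (binomialP j) ≈ E j
  coeffP-binomialP j .at n = trans (coeffP-addP (ℤ.+ 1 ∷ []) (monomial j (- (ℤ.+ 1))) .at n)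
    (cong₂ _+_ (coeffP-one .at n) (trans (coeffP-monomial j (- (ℤ.+ 1)) n) (ℤP.-1*i≡-i (mono j n))))

  pow : Series → ℕ → Series
  pow f zero    = oneS
  pow f (suc n) = f ⊛ pow f n

  coeffP-powP : ∀ p n → coeffP (powP p n) ≈ pow (coeffP p) n
  coeffP-powP p zero    = coeffP-one
  coeffP-powP p (suc n) = ≈-trans (coeffP-mulP p (powP p n)) (⊛-congˡ (coeffP-powP p n))

  pow-cong : ∀ n {f g} → f ≈ g → pow f n ≈ pow g n
  pow-cong zero    e = ≈-refl
  pow-cong (suc n) e = ⊛-cong e (pow-cong n e)

  product : List Series → Series
  product = foldr _⊛_ oneS

  coeffP-prodP : ∀ {A : Set} (h : A → Poly) xs → coeffP (prodP (map h xs)) ≈ product (map (coeffP ∘ h) xs)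
  coeffP-prodP h []       = coeffP-one
  coeffP-prodP h (x ∷ xs) = ≈-trans (coeffP-mulP (h x) (prodP (map h xs))) (⊛-congˡ (coeffP-prodP h xs))

  product-++ : ∀ fs gs → product (fs ++ gs) ≈ product fs ⊛ product gs
  product-++ []       gs = ≈-sym (⊛-identityˡ _)
  product-++ (f ∷ fs) gs = ≈-trans (⊛-congˡ (product-++ fs gs)) (≈-sym (⊛-associative f (product fs) (product gs)))

  product-↭ : ∀ {fs gs} → fs ↭ gs → product fs ≈ product gs
  product-↭ Perm.refl         = ≈-refl
  product-↭ (Perm.prep f p)   = ⊛-congˡ (product-↭ p)
  product-↭ (Perm.swap {fs} {gs} f g p) = ≈-trans (⊛-congˡ (⊛-congˡ (product-↭ p)))
    (solve 3 (λ f g h → f :* (g :* h) := g :* (f :* h)) ≈-refl f g (product gs))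
  product-↭ (Perm.trans p q)  = ≈-trans (product-↭ p) (product-↭ q)

  product-map-cong : ∀ {A : Set} {f g : A → Series} xs → (∀ x → f x ≈ g x) → product (map f xs) ≈ product (map g xs)
  product-map-cong []       e = ≈-refl
  product-map-cong (x ∷ xs) e = ⊛-cong (e x) (product-map-cong xs e)

-- The least common multiple and the list of coloured parts

range1-all : ∀ {Q : ℕ → Set} n → All Q (range1 n) → ∀ j → 1 ≤ j → j ≤ n → Q j
range1-all {Q} zero    qs (suc j) _ ()
range1-all {Q} (suc n) qs j       p q with ℕP.m≤n⇒m<n∨m≡n q
... | inj₁ (s≤s j≤n) = range1-all n (AllP.++⁻ˡ (range1 n) (subst (All Q) (range1-suc n) qs)) j p j≤n
... | inj₂ refl      = All.head (AllP.++⁻ʳ (range1 n) (subst (All Q) (range1-suc n) qs))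

all-range1 : ∀ {Q : ℕ → Set} n → (∀ j → 1 ≤ j → j ≤ n → Q j) → All Q (range1 n)
all-range1     zero    h = []
all-range1 {Q} (suc n) h = subst (All Q) (sym (range1-suc n))
  (AllP.++⁺ (all-range1 n (λ j p q → h j p (ℕP.≤-trans q (ℕP.n≤1+n n)))) (h (suc n) (s≤s z≤n) ℕP.≤-refl ∷ []))

∣foldr-lcm : ∀ xs → All (_∣ foldr lcm 1 xs) xs
∣foldr-lcm []       = []
∣foldr-lcm (x ∷ xs) = m∣lcm[m,n] x _ ∷ All.map (λ d → Div.∣-trans d (n∣lcm[m,n] x _)) (∣foldr-lcm xs)

foldr-lcm-least : ∀ q xs → All (_∣ q) xs → foldr lcm 1 xs ∣ q
foldr-lcm-least q []       []       = Div.1∣ q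
foldr-lcm-least q (x ∷ xs) (d ∷ ds) = lcm-least d (foldr-lcm-least q xs ds)

∣lcmUpTo : ∀ a j → 1 ≤ j → j ≤ suc a → j ∣ lcmUpTo a
∣lcmUpTo a = range1-all (suc a) (∣foldr-lcm (range1 (suc a)))

lcmUpTo-positive : ∀ a → 1 ≤ lcmUpTo a
lcmUpTo-positive a = go (range1 (suc a)) (all-range1 (suc a) (λ j p _ → p))
  where
  go : ∀ xs → All (1 ≤_) xs → 1 ≤ foldr lcm 1 xs
  go []       []       = s≤s z≤n
  go (x ∷ xs) (p ∷ ps) = ℕP.n≢0⇒n>0 (λ e → nonzero x (foldr lcm 1 xs) p (go xs ps) e)
    where
    nonzero : ∀ x y → 1 ≤ x → 1 ≤ y → lcm x y ≢ 0
    nonzero x y p q e = ℕP.<⇒≱ (ℕP.*-mono-≤ p q) (ℕP.≤-reflexive (Div.0∣⇒≡0 (subst (_∣ x ℕ.* y) e (lcm-least {x} {y} {x ℕ.* y} (Div.m∣m*n y) (Div.n∣m*n x)))))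

middleParts : ℕ → List ℕ
middleParts b = concatMap (λ j → j ∷ j ∷ []) (map (λ i → 2 ℕ.+ i) (upTo b))

middleParts-suc : ∀ b → middleParts (suc b) ≡ middleParts b ++ 2 ℕ.+ b ∷ 2 ℕ.+ b ∷ []
middleParts-suc b = trans (cong (λ t → concatMap (λ j → j ∷ j ∷ []) (map (λ i → 2 ℕ.+ i) t)) (sym (ListP.upTo-∷ʳ b)))
  (trans (cong (concatMap (λ j → j ∷ j ∷ [])) (ListP.map-++ (λ i → 2 ℕ.+ i) (upTo b) (b ∷ [])))
    (ListP.concatMap-++ (λ j → j ∷ j ∷ []) (map (λ i → 2 ℕ.+ i) (upTo b)) (2 ℕ.+ b ∷ [])))

interParts′-↭ : ∀ b → interParts′ (suc b) ↭ 1 ∷ 1 ∷ middleParts b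
interParts′-↭ zero    = ↭-refl
interParts′-↭ (suc b) = ↭-trans (Perm.prep _ (Perm.prep _ (interParts′-↭ b)))
  (↭-trans (PermP.++-comm (2 ℕ.+ b ∷ 2 ℕ.+ b ∷ []) (1 ∷ 1 ∷ middleParts b)) (Perm.↭-reflexive (cong (λ t → 1 ∷ 1 ∷ t) (sym (middleParts-suc b)))))

interParts-↭ : ∀ a → 1 ≤ a → interParts a ↭ 1 ∷ colouredParts a
interParts-↭ (suc b) _ = ↭-trans (Perm.prep _ (interParts′-↭ b)) (PermP.++-comm (2 ℕ.+ b ∷ []) (1 ∷ 1 ∷ middleParts b))

sum-interParts : ∀ a → sum (interParts a) ≡ suc (a ℕ.* (a ℕ.+ 2))
sum-interParts zero    = refl
sum-interParts (suc a) = trans (cong (λ t → suc (suc a) ℕ.+ (suc a ℕ.+ t)) (sum-interParts a)) (arith a)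
  where
  arith : ∀ a → suc (suc a) ℕ.+ (suc a ℕ.+ suc (a ℕ.* (a ℕ.+ 2))) ≡ suc (suc a ℕ.* (suc a ℕ.+ 2))
  arith = solve-∀

length-interParts : ∀ a → length (interParts a) ≡ suc (2 ℕ.* a)
length-interParts zero    = refl
length-interParts (suc a) = trans (cong (suc ∘ suc) (length-interParts a)) (arith a)
  where
  arith : ∀ a → suc (suc (suc (2 ℕ.* a))) ≡ suc (2 ℕ.* suc a)
  arith = solve-∀

interParts-bounds : ∀ a → All (λ j → 1 ≤ j × j ≤ suc a) (interParts a)
interParts-bounds zero    = (s≤s z≤n , s≤s z≤n) ∷ []
interParts-bounds (suc a) = (s≤s z≤n , ℕP.≤-refl) ∷ (s≤s z≤n , ℕP.n≤1+n _) ∷ All.map (λ (p , q) → p , ℕP.≤-trans q (ℕP.n≤1+n _)) (interParts-bounds a)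

sum-coloured : ∀ a → 1 ≤ a → sum (colouredParts a) ≡ a ℕ.* (a ℕ.+ 2)
sum-coloured a p = ℕP.suc-injective (trans (sym (sum-↭ (interParts-↭ a p))) (sum-interParts a))

length-coloured : ∀ a → 1 ≤ a → length (colouredParts a) ≡ 2 ℕ.* a
length-coloured a p = ℕP.suc-injective (trans (sym (PermP.↭-length (interParts-↭ a p))) (length-interParts a))

coloured-bounds : ∀ a → 1 ≤ a → All (λ j → 1 ≤ j × j ≤ suc a) (colouredParts a)
coloured-bounds a p = All.tail (PermP.All-resp-↭ (interParts-↭ a p) (interParts-bounds a))

-- The generating function, its numerator and reversal

module GeneratingFunction where
  open PowerSeries public
  open import Data.Integer using (_+_; _*_; -_; _>_)
  open ≈-Reasoning

  Den : List ℕ → Series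
  Den js = product (map E js)

  E-P : ∀ j js → E (suc j) ⊛ Z.P (suc j ∷ js) ≈ Z.P js
  E-P j js .at n = trans (E-⊛ (suc j) (Z.P (suc j ∷ js)) n) (trans (cong (λ t → t + - Z.sub (suc j) n (Z.P (suc j ∷ js))) (Z.P-step j js n)) (arith (Z.P js n) _))
    where
    arith : ∀ x y → x + y + - y ≡ x
    arith = solve-∀-ℤ

  Den-P : ∀ js → All (1 ≤_) js → Den js ⊛ Z.P js ≈ oneS
  Den-P []           _        = ≈-trans (⊛-identityˡ _) mono-0
  Den-P (suc j ∷ js) (p ∷ ps) = begin
    E (suc j) ⊛ Den js ⊛ Z.P (suc j ∷ js)
      ≈⟨ solve 3 (λ a b c → a :* b :* c := b :* (a :* c)) ≈-refl (E (suc j)) (Den js) (Z.P (suc j ∷ js)) ⟩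
    Den js ⊛ (E (suc j) ⊛ Z.P (suc j ∷ js))
      ≈⟨ ⊛-congˡ (E-P j js) ⟩
    Den js ⊛ Z.P js
      ≈⟨ Den-P js ps ⟩
    oneS ∎

  -- The difference of consecutive counts is multiplication by 1 - x, which cancels one of the two
  -- parts 1 in `interParts a`; the other parts are the coloured ones.
  Den-reducedKronecker : ∀ a (f : ℕ → ℤ) → 1 ≤ a → (∀ k → IsReducedKron (rect k a) (rect k a) (k ∷ []) (f k)) →
    Den (colouredParts a) ⊛ f ≈ oneS
  Den-reducedKronecker a f 1≤a h = begin
    Den (colouredParts a) ⊛ f
      ≈⟨ ⊛-congˡ {Den (colouredParts a)} (pointwise λ k → trans (reducedKronecker a k (f k) 1≤a (h k)) (sym (E-⊛ 1 (Z.P (interParts a)) k))) ⟩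
    Den (colouredParts a) ⊛ (E 1 ⊛ Z.P (interParts a))
      ≈⟨ solve 3 (λ a b c → a :* (b :* c) := b :* a :* c) ≈-refl (Den (colouredParts a)) (E 1) (Z.P (interParts a)) ⟩
    Den (1 ∷ colouredParts a) ⊛ Z.P (interParts a)
      ≈⟨ ⊛-congʳ (product-↭ (PermP.map⁺ E (interParts-↭ a 1≤a))) ⟨
    Den (interParts a) ⊛ Z.P (interParts a)
      ≈⟨ Den-P (interParts a) (All.map proj₁ (interParts-bounds a)) ⟩
    oneS ∎

  quo : ℕ → ℕ → ℕ
  quo ℓ zero    = 0
  quo ℓ (suc j) = ℓ ℕ./ suc j

  quo-* : ∀ {ℓ j} → 1 ≤ j → j ∣ ℓ → quo ℓ j ℕ.* j ≡ ℓ
  quo-* {ℓ} {suc j} _ d = m/n*n≡m d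

  Num : ℕ → List ℕ → Series
  Num ℓ js = product (map (λ j → geo j (quo ℓ j)) js)

  Factors : ℕ → List ℕ → Set
  Factors ℓ = All (λ j → 1 ≤ j × j ∣ ℓ)

  Den-Num : ∀ ℓ js → Factors ℓ js → Den js ⊛ Num ℓ js ≈ pow (E ℓ) (length js)
  Den-Num ℓ []       _              = ⊛-identityˡ oneS
  Den-Num ℓ (j ∷ js) ((p , d) ∷ ps) = begin
    E j ⊛ Den js ⊛ (geo j (quo ℓ j) ⊛ Num ℓ js)
      ≈⟨ solve 4 (λ a b c d → a :* b :* (c :* d) := a :* c :* (b :* d)) ≈-refl (E j) (Den js) (geo j (quo ℓ j)) (Num ℓ js) ⟩
    E j ⊛ geo j (quo ℓ j) ⊛ (Den js ⊛ Num ℓ js)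
      ≈⟨ ⊛-cong (≈-trans (E-geo j (quo ℓ j)) (subst (λ t → E (quo ℓ j ℕ.* j) ≈ E t) (quo-* p d) ≈-refl)) (Den-Num ℓ js ps) ⟩
    E ℓ ⊛ pow (E ℓ) (length js) ∎

  coloured-factors : ∀ a → 1 ≤ a → Factors (lcmUpTo a) (colouredParts a)
  coloured-factors a 1≤a = All.map (λ (p , q) → p , ∣lcmUpTo a _ p q) (coloured-bounds a 1≤a)

  Pcoef-⊛ : ∀ f a → Pcoef f a ≈ pow (E (lcmUpTo a)) (2 ℕ.* a) ⊛ f
  Pcoef-⊛ f a = ≈-trans (convF-⊛ (coeffP (denom a)) f)
    (⊛-congʳ (≈-trans (coeffP-powP (binomialP (lcmUpTo a)) (2 ℕ.* a)) (pow-cong (2 ℕ.* a) (coeffP-binomialP (lcmUpTo a)))))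

  Pcoef-Num : ∀ f a → 1 ≤ a → Den (colouredParts a) ⊛ f ≈ oneS → Pcoef f a ≈ Num (lcmUpTo a) (colouredParts a)
  Pcoef-Num f a 1≤a e = begin
    Pcoef f a
      ≈⟨ Pcoef-⊛ f a ⟩
    pow (E (lcmUpTo a)) (2 ℕ.* a) ⊛ f
      ≈⟨ ⊛-congʳ (subst (λ t → Den (colouredParts a) ⊛ Num (lcmUpTo a) (colouredParts a) ≈ pow (E (lcmUpTo a)) t) (length-coloured a 1≤a) (Den-Num (lcmUpTo a) (colouredParts a) (coloured-factors a 1≤a))) ⟨
    Den (colouredParts a) ⊛ Num (lcmUpTo a) (colouredParts a) ⊛ f
      ≈⟨ solve 3 (λ a b c → a :* b :* c := a :* c :* b) ≈-refl (Den (colouredParts a)) (Num (lcmUpTo a) (colouredParts a)) f ⟩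
    Den (colouredParts a) ⊛ f ⊛ Num (lcmUpTo a) (colouredParts a)
      ≈⟨ ⊛-congʳ e ⟩
    oneS ⊛ Num (lcmUpTo a) (colouredParts a)
      ≈⟨ ⊛-identityˡ _ ⟩
    Num (lcmUpTo a) (colouredParts a) ∎

  <ᵇ-true : ∀ {m n} → m < n → (m ℕ.<ᵇ n) ≡ true
  <ᵇ-true {m} {n} p with m ℕ.<ᵇ n | ℕP.<⇒<ᵇ p
  ... | true | _ = refl

  <ᵇ-false : ∀ {m n} → n ≤ m → (m ℕ.<ᵇ n) ≡ false
  <ᵇ-false {m} {n} p with m ℕ.<ᵇ n | ℕP.<ᵇ⇒< m n
  ... | false | _ = refl
  ... | true  | h = ⊥-elim (ℕP.<⇒≱ (h _) p)

  sub-if : ∀ s k c → (if s ℕ.≤ᵇ k then c (k ∸ s) else ℤ.+ 0) ≡ Z.sub s k c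
  sub-if s k c with s ℕ.≤? k
  ... | yes p = trans (cong (if_then c (k ∸ s) else ℤ.+ 0) (≤ᵇ-true p)) (sym (Z.sub-at {s} {k} (sym (ℕP.m+[n∸m]≡n p))))
  ... | no p  = trans (cong (if_then c (k ∸ s) else ℤ.+ 0) (≤ᵇ-false (ℕP.≰⇒> p))) (sym (Z.sub-< {s} {k} c (ℕP.≰⇒> p)))

  sumℕ-upTo : ∀ n (h : ℕ → ℕ) → ℤ.+ sumℕ (map h (upTo n)) ≡ Z.∑ n (λ i → ℤ.+ h i)
  sumℕ-upTo n h = trans (cong (ℤ.+_ ∘ sumℕ) (ListP.map-upTo h n)) (go n h)
    where
    go : ∀ n h → ℤ.+ sumℕ (applyUpTo h n) ≡ Z.∑ n (λ i → ℤ.+ h i)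
    go zero    h = refl
    go (suc n) h = trans (ℤP.pos-+ (h 0) _) (cong (λ t → ℤ.+ h 0 + t) (go n (h ∘ suc)))

  countColoured-Num : ∀ ℓ js → Factors ℓ js → ∀ k → ℤ.+ countColoured ℓ js k ≡ Num ℓ js k
  countColoured-Num ℓ []       _              zero    = refl
  countColoured-Num ℓ []       _              (suc k) = refl
  countColoured-Num ℓ (j ∷ js) ((p , d) ∷ ps) k       = begin′
    where
    q = quo ℓ j
    cc : ℕ → ℤ
    cc n = ℤ.+ countColoured ℓ js n
    h : ℕ → ℕ
    h m = if (m ℕ.* j ℕ.≤ᵇ k) ∧ (m ℕ.* j ℕ.<ᵇ ℓ) then countColoured ℓ js (k ∸ m ℕ.* j) else 0
    h-small : ∀ m → m < q → ℤ.+ h m ≡ Z.sub (m ℕ.* j) k cc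
    h-small m m<q rewrite <ᵇ-true (subst (m ℕ.* j <_) (quo-* p d) (ℕP.*-monoˡ-< j {{ℕ.>-nonZero p}} m<q)) with m ℕ.* j ℕ.≤? k
    ... | yes r rewrite ≤ᵇ-true r = sym (Z.sub-at {m ℕ.* j} {k} (sym (ℕP.m+[n∸m]≡n r)))
    ... | no r  rewrite ≤ᵇ-false (ℕP.≰⇒> r) = sym (Z.sub-< {m ℕ.* j} {k} cc (ℕP.≰⇒> r))
    h-large : ∀ m → q ≤ m → ℤ.+ h m ≡ ℤ.+ 0
    h-large m q≤m rewrite <ᵇ-false (subst (_≤ m ℕ.* j) (quo-* p d) (ℕP.*-monoˡ-≤ j q≤m)) with m ℕ.* j ℕ.≤ᵇ k
    ... | true  = refl
    ... | false = refl
    h-far : ∀ m → k < m → ℤ.+ h m ≡ ℤ.+ 0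
    h-far m k<m rewrite ≤ᵇ-false {m ℕ.* j} {k} (ℕP.<-≤-trans k<m (ℕP.m≤m*n m j {{ℕ.>-nonZero p}})) = refl
    begin′ : ℤ.+ sumℕ (map h (upTo (suc k))) ≡ Num ℓ (j ∷ js) k
    -- The definition sums over m ≤ k and the geometric sum over m < ℓ/j. Both equal the sum over a
    -- common larger range, since the terms beyond either end are 0.
    begin′ = trans (sumℕ-upTo (suc k) h) (trans (sym (Z.∑-extend (suc k) (suc k ℕ.+ q) _ (ℕP.m≤m+n (suc k) q) h-far))
      (trans (Z.∑-extend q (suc k ℕ.+ q) _ (ℕP.m≤n+m q (suc k)) h-large) (trans (Z.∑-cong< q h-small)
        (trans (Z.∑-cong q (λ m → Z.sub-cong (m ℕ.* j) k (λ y _ → countColoured-Num ℓ js ps y))) (sym (geo-⊛ j q (Num ℓ js) k))))))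

  Bounded : ℕ → Series → Set
  Bounded d c = ∀ k → d < k → c k ≡ ℤ.+ 0

  Positive : ℕ → Series → Set
  Positive d c = ∀ k → k ≤ d → c k > ℤ.+ 0

  ≈-Positive : ∀ {d f g} → f ≈ g → Positive d f → Positive d g
  ≈-Positive e p k q = subst (_> ℤ.+ 0) (e .at k) (p k q)

  sub-nonneg : ∀ j k d c → Positive d c → Bounded d c → Z.sub j k c ℤ.≥ ℤ.+ 0
  sub-nonneg zero    k       d c p b with k ℕ.≤? d
  ... | yes q = ℤP.<⇒≤ (p k q)
  ... | no q  = ℤP.≤-reflexive (sym (b k (ℕP.≰⇒> q)))
  sub-nonneg (suc j) zero    d c p b = ℤP.≤-refl
  sub-nonneg (suc j) (suc k) d c p b = sub-nonneg j k d c p b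

  geo-suc-at : ∀ j q c k → (geo j (suc q) ⊛ c) k ≡ c k + Z.sub j k (geo j q ⊛ c)
  geo-suc-at j q c k = trans (solve 3 (λ m h g → (con (ℤ.+ 1) :+ m :* h) :* g := g :+ m :* (h :* g)) ≈-refl (mono j) (geo j q) c .at k)
    (cong (c k +_) (mono-⊛ j (geo j q ⊛ c) k))

  -- A window of length j ≤ d + 1 cannot fall into a gap of c.
  geo-Positive : ∀ j q d c → j ≤ suc d → Positive d c → Bounded d c →
    Positive (d ℕ.+ q ℕ.* j) (geo j (suc q) ⊛ c) × Bounded (d ℕ.+ q ℕ.* j) (geo j (suc q) ⊛ c)
  geo-Positive j zero    d c j≤ p b = subst (λ t → Positive t (geo j 1 ⊛ c) × Bounded t (geo j 1 ⊛ c)) (sym (ℕP.+-identityʳ d))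
    (≈-Positive (≈-sym one-c) p , λ k q → trans (one-c .at k) (b k q))
    where
    one-c : geo j 1 ⊛ c ≈ c
    one-c = ≈-trans (⊛-congʳ (≈-trans (⊕-congˡ oneS (⊛-zeroʳ (mono j))) (⊕-identityʳ oneS))) (⊛-identityˡ c)
  geo-Positive j (suc q) d c j≤ p b with geo-Positive j q d c j≤ p b
  ... | P′ , B′ = pos , bnd
    where
    g = geo j (suc q) ⊛ c
    pos : Positive (d ℕ.+ suc q ℕ.* j) (geo j (suc (suc q)) ⊛ c)
    pos k k≤ with k ℕ.≤? d
    ... | yes k≤d = subst (_> ℤ.+ 0) (sym (geo-suc-at j (suc q) c k)) (ℤP.+-mono-<-≤ (p k k≤d) (sub-nonneg j k _ g P′ B′))
    ... | no k≰d  = subst (_> ℤ.+ 0) (sym (trans (geo-suc-at j (suc q) c k) (trans (cong₂ _+_ (b k (ℕP.≰⇒> k≰d)) (Z.sub-at {j} {k} k≡)) (ℤP.+-identityˡ _))))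
        (P′ (k ∸ j) (ℕP.+-cancelˡ-≤ j _ _ (ℕP.≤-trans (ℕP.≤-reflexive (sym k≡)) (ℕP.≤-trans k≤ (ℕP.≤-reflexive (arith d j (q ℕ.* j)))))))
      where
      k≡ : k ≡ j ℕ.+ (k ∸ j)
      k≡ = sym (ℕP.m+[n∸m]≡n (ℕP.≤-trans j≤ (ℕP.≰⇒> k≰d)))
      arith : ∀ d j t → d ℕ.+ (j ℕ.+ t) ≡ j ℕ.+ (d ℕ.+ t)
      arith = solve-∀
    bnd : Bounded (d ℕ.+ suc q ℕ.* j) (geo j (suc (suc q)) ⊛ c)
    bnd k k> = trans (geo-suc-at j (suc q) c k) (cong₂ _+_ (b k (ℕP.≤-<-trans (ℕP.m≤m+n d _) k>))
      (trans (Z.sub-cong j k (λ y e → B′ y (ℕP.+-cancelˡ-< j _ _ (subst₂ _<_ (arith d j (q ℕ.* j)) (sym e) k>)))) (Z.sub-0 j k)))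
      where
      arith : ∀ d j t → d ℕ.+ (j ℕ.+ t) ≡ j ℕ.+ (d ℕ.+ t)
      arith = solve-∀

  excess : ℕ → List ℕ → ℕ
  excess ℓ js = sum (map (ℓ ∸_) js)

  -- Geometric sums are multiplied in one after another. The condition j ≤ d + 1 persists because d
  -- only grows, so no gap ever opens.
  Num-Positive : ∀ ℓ js d c → Factors ℓ js → All (_≤ suc d) js → 1 ≤ ℓ → Positive d c → Bounded d c →
    Positive (d ℕ.+ excess ℓ js) (Num ℓ js ⊛ c) × Bounded (d ℕ.+ excess ℓ js) (Num ℓ js ⊛ c)
  Num-Positive ℓ []       d c _              _        _   P′ B′ = subst (λ t → Positive t (oneS ⊛ c) × Bounded t (oneS ⊛ c)) (sym (ℕP.+-identityʳ d))
    (≈-Positive (≈-sym (⊛-identityˡ c)) P′ , λ k q → trans (⊛-identityˡ c .at k) (B′ k q))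
  Num-Positive ℓ (j ∷ js) d c ((p , e) ∷ fs) (q ∷ qs) 1≤ℓ P′ B′ = step (quo ℓ j) refl
    where
    step : ∀ m → quo ℓ j ≡ m → Positive (d ℕ.+ excess ℓ (j ∷ js)) (Num ℓ (j ∷ js) ⊛ c) × Bounded (d ℕ.+ excess ℓ (j ∷ js)) (Num ℓ (j ∷ js) ⊛ c)
    step zero    m≡ = ⊥-elim (ℕP.<⇒≱ 1≤ℓ (ℕP.≤-reflexive (sym (trans (cong (ℕ._* j) (sym m≡)) (quo-* p e)))))
    step (suc m) m≡ with geo-Positive j m d c q P′ B′
    ... | P₁ , B₁ with Num-Positive ℓ js (d ℕ.+ m ℕ.* j) (geo j (suc m) ⊛ c) fs (All.map (λ r → ℕP.≤-trans r (s≤s (ℕP.m≤m+n d _))) qs) 1≤ℓ P₁ B₁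
    ...   | P₂ , B₂ = subst (λ t → Positive t (Num ℓ (j ∷ js) ⊛ c) × Bounded t (Num ℓ (j ∷ js) ⊛ c)) degree
            (≈-Positive reorder P₂ , λ k r → trans (sym (reorder .at k)) (B₂ k r))
      where
      degree : d ℕ.+ m ℕ.* j ℕ.+ excess ℓ js ≡ d ℕ.+ (ℓ ∸ j ℕ.+ excess ℓ js)
      degree = trans (ℕP.+-assoc d (m ℕ.* j) _) (cong (λ t → d ℕ.+ (t ℕ.+ excess ℓ js))
        (sym (trans (cong (_∸ j) (sym (trans (cong (ℕ._* j) (sym m≡)) (quo-* p e)))) (ℕP.m+n∸m≡n j (m ℕ.* j)))))
      reorder : Num ℓ js ⊛ (geo j (suc m) ⊛ c) ≈ Num ℓ (j ∷ js) ⊛ c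
      reorder = ≈-trans (solve 3 (λ a b c → a :* (b :* c) := b :* a :* c) ≈-refl (Num ℓ js) (geo j (suc m)) c)
        (⊛-congʳ (⊛-congʳ (subst (λ t → geo j (suc m) ≈ geo j t) (sym m≡) ≈-refl)))

  excess-sum : ∀ ℓ js → All (_≤ ℓ) js → excess ℓ js ℕ.+ sum js ≡ length js ℕ.* ℓ
  excess-sum ℓ []       _        = refl
  excess-sum ℓ (j ∷ js) (p ∷ ps) = trans (arith (ℓ ∸ j) (excess ℓ js) j (sum js)) (cong₂ ℕ._+_ (ℕP.m∸n+n≡m p) (excess-sum ℓ js ps))
    where
    arith : ∀ a b c d → a ℕ.+ b ℕ.+ (c ℕ.+ d) ≡ a ℕ.+ c ℕ.+ (b ℕ.+ d)
    arith = solve-∀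

  -- rev M c = x^M c(1/x)
  rev : ℕ → Series → Series
  rev M c k = Z.sub k M c

  rev-cong : ∀ M {f g} → f ≈ g → rev M f ≈ rev M g
  rev-cong M e .at k = Z.sub-cong k M (λ y _ → e .at y)

  rev-shift : ∀ j M c → Bounded M c → rev (j ℕ.+ M) c ≈ mono j ⊛ rev M c
  rev-shift j M c b .at k = trans (go j k) (sym (mono-⊛ j (rev M c) k))
    where
    go : ∀ j k → Z.sub k (j ℕ.+ M) c ≡ Z.sub j k (rev M c)
    go zero    k       = refl
    go (suc j) zero    = b _ (s≤s (ℕP.m≤n+m M j))
    go (suc j) (suc k) = go j k

  rev-E : ∀ j M c → Bounded M c → rev (j ℕ.+ M) (E j ⊛ c) ≈ ⊝ (E j ⊛ rev M c)
  rev-E j M c b .at k = trans (Z.sub-cong k (j ℕ.+ M) (λ y _ → E-⊛ j c y))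
    (trans (Z.sub-+ k (j ℕ.+ M) c _) (trans (cong₂ _+_ (rev-shift j M c b .at k) (trans (Z.sub-neg k (j ℕ.+ M) _) (cong -_ (trans (Z.sub-sub-comm k j (j ℕ.+ M) c) (Z.sub-≡ j M (rev′))))))
      (trans (arith ((mono j ⊛ rev M c) k) (rev M c k)) (cong -_ (sym (trans (E-⊛ j (rev M c) k) (cong (λ t → rev M c k + - t) (sym (mono-⊛ j (rev M c) k)))))))))
    where
    rev′ : ℕ → ℤ
    rev′ y = Z.sub k y c
    arith : ∀ x y → x + - y ≡ - (y + - x)
    arith = solve-∀-ℤ

  E-Bounded : ∀ j M c → Bounded M c → Bounded (j ℕ.+ M) (E j ⊛ c)
  E-Bounded j M c b k p = trans (E-⊛ j c k) (cong₂ (λ s t → s + - t) (b k (ℕP.≤-<-trans (ℕP.m≤n+m M j) p))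
    (trans (Z.sub-cong j k (λ y e → b y (ℕP.+-cancelˡ-< j _ _ (subst (j ℕ.+ M <_) (sym e) p)))) (Z.sub-0 j k)))

  negs : ℕ → Series → Series
  negs zero    f = f
  negs (suc n) f = ⊝ negs n f

  negs-cong : ∀ n {f g} → f ≈ g → negs n f ≈ negs n g
  negs-cong zero    e = e
  negs-cong (suc n) e = ⊝-cong (negs-cong n e)

  negs-⊛ : ∀ n e f → e ⊛ negs n f ≈ negs n (e ⊛ f)
  negs-⊛ zero    e f = ≈-refl
  negs-⊛ (suc n) e f = ≈-trans (solve 2 (λ a b → a :* (:- b) := :- (a :* b)) ≈-refl e (negs n f)) (⊝-cong (negs-⊛ n e f))

  negs-even : ∀ a f → negs (2 ℕ.* a) f ≈ f
  negs-even zero    f = ≈-refl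
  negs-even (suc a) f = ≈-trans (subst (λ t → negs (2 ℕ.* suc a) f ≈ negs t f) (arith a) ≈-refl)
    (≈-trans (solve 1 (λ a → :- (:- a) := a) ≈-refl (negs (2 ℕ.* a) f)) (negs-even a f))
    where
    arith : ∀ a → 2 ℕ.* suc a ≡ suc (suc (2 ℕ.* a))
    arith = solve-∀

  Den-Bounded : ∀ js M c → Bounded M c → Bounded (sum js ℕ.+ M) (Den js ⊛ c)
  Den-Bounded []       M c b k p = trans (⊛-identityˡ c .at k) (b k p)
  Den-Bounded (j ∷ js) M c b k p = trans (⊛-associative (E j) (Den js) c .at k)
    (E-Bounded j (sum js ℕ.+ M) (Den js ⊛ c) (Den-Bounded js M c b) k (subst (_< k) (ℕP.+-assoc j (sum js) M) p))

  rev-Den : ∀ js M c → Bounded M c → rev (sum js ℕ.+ M) (Den js ⊛ c) ≈ negs (length js) (Den js ⊛ rev M c)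
  rev-Den []       M c b = ≈-trans (rev-cong M (⊛-identityˡ c)) (≈-sym (⊛-identityˡ _))
  rev-Den (j ∷ js) M c b = begin
    rev (j ℕ.+ sum js ℕ.+ M) (E j ⊛ Den js ⊛ c)
      ≈⟨ subst (λ t → rev t (E j ⊛ Den js ⊛ c) ≈ rev (j ℕ.+ (sum js ℕ.+ M)) (E j ⊛ Den js ⊛ c)) (sym (ℕP.+-assoc j (sum js) M)) ≈-refl ⟩
    rev (j ℕ.+ (sum js ℕ.+ M)) (E j ⊛ Den js ⊛ c)
      ≈⟨ rev-cong (j ℕ.+ (sum js ℕ.+ M)) (⊛-associative (E j) (Den js) c) ⟩
    rev (j ℕ.+ (sum js ℕ.+ M)) (E j ⊛ (Den js ⊛ c))
      ≈⟨ rev-E j (sum js ℕ.+ M) (Den js ⊛ c) (Den-Bounded js M c b) ⟩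
    ⊝ (E j ⊛ rev (sum js ℕ.+ M) (Den js ⊛ c))
      ≈⟨ ⊝-cong (⊛-congˡ {E j} (rev-Den js M c b)) ⟩
    ⊝ (E j ⊛ negs (length js) (Den js ⊛ rev M c))
      ≈⟨ ⊝-cong (negs-⊛ (length js) (E j) (Den js ⊛ rev M c)) ⟩
    ⊝ negs (length js) (E j ⊛ (Den js ⊛ rev M c))
      ≈⟨ ⊝-cong (negs-cong (length js) (⊛-associative (E j) (Den js) (rev M c))) ⟨
    ⊝ negs (length js) (E j ⊛ Den js ⊛ rev M c) ∎

  one-Bounded : Bounded 0 oneS
  one-Bounded (suc k) _ = refl

  rev-one : rev 0 oneS ≈ oneS
  rev-one .at zero    = refl
  rev-one .at (suc k) = refl

  Den-one : ∀ js → All (1 ≤_) js → Den js 0 ≡ ℤ.+ 1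
  Den-one []           _        = refl
  Den-one (suc j ∷ js) (_ ∷ ps) = trans (ℤP.*-identityˡ (Den js 0)) (Den-one js ps)

  Den-unit : ∀ js → All (1 ≤_) js → Den js 0 * Den js 0 ≡ ℤ.+ 1
  Den-unit js ps = cong (λ t → t * t) (Den-one js ps)

  rev-Den-even : ∀ a js → length js ≡ 2 ℕ.* a → rev (sum js) (Den js) ≈ Den js
  rev-Den-even a js l = begin
    rev (sum js) (Den js)
      ≈⟨ rev-cong (sum js) (CommutativeRing.*-identityʳ seriesRing (Den js)) ⟨
    rev (sum js) (Den js ⊛ oneS)
      ≈⟨ subst (λ t → rev (sum js) (Den js ⊛ oneS) ≈ rev t (Den js ⊛ oneS)) (sym (ℕP.+-identityʳ (sum js))) ≈-refl ⟩
    rev (sum js ℕ.+ 0) (Den js ⊛ oneS)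
      ≈⟨ rev-Den js 0 oneS one-Bounded ⟩
    negs (length js) (Den js ⊛ rev 0 oneS)
      ≈⟨ subst (λ t → negs (length js) (Den js ⊛ rev 0 oneS) ≈ negs t (Den js ⊛ rev 0 oneS)) l ≈-refl ⟩
    negs (2 ℕ.* a) (Den js ⊛ rev 0 oneS)
      ≈⟨ negs-even a (Den js ⊛ rev 0 oneS) ⟩
    Den js ⊛ rev 0 oneS
      ≈⟨ ⊛-congˡ {Den js} rev-one ⟩
    Den js ⊛ oneS
      ≈⟨ CommutativeRing.*-identityʳ seriesRing (Den js) ⟩
    Den js ∎

  Den-replicate : ∀ n ℓ → Den (replicate n ℓ) ≈ pow (E ℓ) n
  Den-replicate zero    ℓ = ≈-refl
  Den-replicate (suc n) ℓ = ⊛-congˡ {E ℓ} (Den-replicate n ℓ)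

  -- Reversal fixes (1 - x^ℓ)^(2a), a product of evenly many factors, and passes the 2a factors of
  -- `Den js` without a sign. Cancelling `Den js` leaves the reversal of the numerator.
  Num-palindromic : ∀ a ℓ js d → length js ≡ 2 ℕ.* a → Factors ℓ js → Bounded d (Num ℓ js) → sum js ℕ.+ d ≡ 2 ℕ.* a ℕ.* ℓ →
    rev d (Num ℓ js) ≈ Num ℓ js
  Num-palindromic a ℓ js d l fs b e = unit-cancel (Den js) _ _ (Den-unit js (All.map proj₁ fs)) (begin
    Den js ⊛ rev d (Num ℓ js)
      ≈⟨ negs-even a (Den js ⊛ rev d (Num ℓ js)) ⟨
    negs (2 ℕ.* a) (Den js ⊛ rev d (Num ℓ js))
      ≈⟨ subst (λ t → negs (length js) (Den js ⊛ rev d (Num ℓ js)) ≈ negs t (Den js ⊛ rev d (Num ℓ js))) l ≈-refl ⟨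
    negs (length js) (Den js ⊛ rev d (Num ℓ js))
      ≈⟨ rev-Den js d (Num ℓ js) b ⟨
    rev (sum js ℕ.+ d) (Den js ⊛ Num ℓ js)
      ≈⟨ subst (λ t → rev (sum js ℕ.+ d) (Den js ⊛ Num ℓ js) ≈ rev t (Den js ⊛ Num ℓ js)) (trans e (sym (sum-replicate (2 ℕ.* a) ℓ))) ≈-refl ⟩
    rev (sum (replicate (2 ℕ.* a) ℓ)) (Den js ⊛ Num ℓ js)
      ≈⟨ rev-cong (sum (replicate (2 ℕ.* a) ℓ)) power ⟩
    rev (sum (replicate (2 ℕ.* a) ℓ)) (Den (replicate (2 ℕ.* a) ℓ))
      ≈⟨ rev-Den-even a (replicate (2 ℕ.* a) ℓ) (ListP.length-replicate (2 ℕ.* a)) ⟩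
    Den (replicate (2 ℕ.* a) ℓ)
      ≈⟨ power ⟨
    Den js ⊛ Num ℓ js ∎)
    where
    power : Den js ⊛ Num ℓ js ≈ Den (replicate (2 ℕ.* a) ℓ)
    power = ≈-trans (Den-Num ℓ js fs) (≈-trans (subst (λ t → pow (E ℓ) (length js) ≈ pow (E ℓ) t) l ≈-refl) (≈-sym (Den-replicate (2 ℕ.* a) ℓ)))

  coeffP-length : ∀ p k → length p ≤ k → coeffP p k ≡ ℤ.+ 0
  coeffP-length []      k       q       = refl
  coeffP-length (x ∷ p) (suc k) (s≤s q) = coeffP-length p k q

  symmetry : ∀ a js g → length js ≡ 2 ℕ.* a → All (1 ≤_) js → Den js ⊛ g ≈ oneS → RatFunSymmetry g (sum js)
  symmetry a js g l ps e = (ℤ.+ 1 ∷ []) , D , (0 , D0) , (λ k → ≈-trans (convF-⊛ (coeffP D) g) (≈-trans (⊛-congʳ D≈) (≈-trans e (≈-sym coeffP-one))) .at k) , final .at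
    where
    D : Poly
    D = prodP (map binomialP js)
    D≈ : coeffP D ≈ Den js
    D≈ = ≈-trans (coeffP-prodP binomialP js) (product-map-cong js coeffP-binomialP)
    D0 : coeffP D 0 ≢ ℤ.+ 0
    D0 z = 1≢0 (trans (sym (Den-one js ps)) (trans (sym (D≈ .at 0)) z))
      where
      1≢0 : ℤ.+ 1 ≢ ℤ.+ 0
      1≢0 ()
    s = sum js
    top : Den js s ≡ ℤ.+ 1
    top = trans (rev-Den-even a js l .at 0) (Den-one js ps)
    s<len : s < length D
    s<len = ℕP.≰⇒> (λ q → 1≢0 (trans (sym top) (trans (sym (D≈ .at s)) (coeffP-length D s q))))
      where
      1≢0 : ℤ.+ 1 ≢ ℤ.+ 0
      1≢0 ()
    -- `revP` reverses at the sum of the two list lengths, which exceeds the degree s. The surplus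
    -- x^M′ from the denominator joins the factor x^s and gives x^M, the reversal of the numerator
    -- 1.
    M = suc (length D)
    M′ = M ∸ s
    M≡ : M ≡ M′ ℕ.+ s
    M≡ = sym (ℕP.m∸n+n≡m (ℕP.≤-trans (ℕP.<⇒≤ s<len) (ℕP.n≤1+n _)))
    DenB : Bounded s (Den js)
    DenB k p = trans (sym (CommutativeRing.*-identityʳ seriesRing (Den js) .at k)) (Den-Bounded js 0 oneS one-Bounded k (subst (_< k) (sym (ℕP.+-identityʳ s)) p))
    revD : revP M D ≈ mono M′ ⊛ Den js
    revD = ≈-trans (pointwise λ k → sub-if k M (coeffP D)) (≈-trans (rev-cong M D≈)
      (≈-trans (subst (λ t → rev M (Den js) ≈ rev t (Den js)) M≡ ≈-refl) (≈-trans (rev-shift M′ s (Den js) DenB) (⊛-congˡ {mono M′} (rev-Den-even a js l)))))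
    revN : revP M (ℤ.+ 1 ∷ []) ≈ mono M
    revN = ≈-trans (pointwise λ k → sub-if k M (coeffP (ℤ.+ 1 ∷ []))) (≈-trans (rev-cong M coeffP-one)
      (≈-trans (subst (λ t → rev M oneS ≈ rev t oneS) (sym (ℕP.+-identityʳ M)) ≈-refl) (≈-trans (rev-shift M 0 oneS one-Bounded)
        (≈-trans (⊛-congˡ {mono M} rev-one) (CommutativeRing.*-identityʳ seriesRing (mono M))))))
    shiftN : shiftF s (coeffP (ℤ.+ 1 ∷ [])) ≈ mono s
    shiftN = ≈-trans (pointwise λ k → trans (sub-if s k (coeffP (ℤ.+ 1 ∷ []))) (sym (mono-⊛ s _ k)))
      (≈-trans (⊛-congˡ {mono s} coeffP-one) (CommutativeRing.*-identityʳ seriesRing (mono s)))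
    final : convF (shiftF s (coeffP (ℤ.+ 1 ∷ []))) (revP M D) ≈ convF (revP M (ℤ.+ 1 ∷ [])) (coeffP D)
    final = begin
      convF (shiftF s (coeffP (ℤ.+ 1 ∷ []))) (revP M D) ≈⟨ convF-⊛ _ _ ⟩
      shiftF s (coeffP (ℤ.+ 1 ∷ [])) ⊛ revP M D         ≈⟨ ⊛-cong shiftN revD ⟩
      mono s ⊛ (mono M′ ⊛ Den js)                       ≈⟨ solve 3 (λ a b c → a :* (b :* c) := b :* a :* c) ≈-refl (mono s) (mono M′) (Den js) ⟩
      mono M′ ⊛ mono s ⊛ Den js                         ≈⟨ ⊛-congʳ (≈-trans (mono-+ M′ s) (subst (λ t → mono (M′ ℕ.+ s) ≈ mono t) (sym M≡) ≈-refl)) ⟩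
      mono M ⊛ Den js                                   ≈⟨ ⊛-cong revN D≈ ⟨
      revP M (ℤ.+ 1 ∷ []) ⊛ coeffP D                    ≈⟨ convF-⊛ _ _ ⟨
      convF (revP M (ℤ.+ 1 ∷ [])) (coeffP D) ∎

-- Divisors and the recursion defining cyclotomic polynomials

divisors : ℕ → List ℕ
divisors n = filter (_∣? n) (range1 n)

divisors-suc : ∀ n → divisors (suc n) ≡ properDivisors (suc n) ++ suc n ∷ []
divisors-suc n = trans (cong (filter (_∣? suc n)) (range1-suc n))
  (trans (ListP.filter-++ (_∣? suc n) (range1 n) (suc n ∷ [])) (cong (filter (_∣? suc n) (range1 n) ++_) (ListP.filter-accept (_∣? suc n) Div.∣-refl)))

filter-filter : ∀ {P Q : ℕ → Set} (P? : Decidable P) (Q? : Decidable Q) xs → (∀ x → P x → Q x) → filter P? (filter Q? xs) ≡ filter P? xs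
filter-filter P? Q? []       h = refl
filter-filter P? Q? (x ∷ xs) h = go (P? x) (Q? x)
  where
  go : Dec _ → Dec _ → filter P? (filter Q? (x ∷ xs)) ≡ filter P? (x ∷ xs)
  go _       (yes q) with P? x
  ... | yes p = trans (cong (filter P?) (ListP.filter-accept Q? q)) (trans (ListP.filter-accept P? p) (cong (x ∷_) (filter-filter P? Q? xs h)))
  ... | no ¬p = trans (cong (filter P?) (ListP.filter-accept Q? q)) (trans (ListP.filter-reject P? ¬p) (filter-filter P? Q? xs h))
  go (yes p) (no ¬q) = ⊥-elim (¬q (h x p))
  go (no ¬p) (no ¬q) = trans (cong (filter P?) (ListP.filter-reject Q? ¬q)) (trans (filter-filter P? Q? xs h) (sym (ListP.filter-reject P? ¬p)))

divisors-range1 : ∀ g k → 1 ≤ g → filter (_∣? g) (range1 (k ℕ.+ g)) ≡ divisors g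
divisors-range1 g zero    p = refl
divisors-range1 g (suc k) p = trans (cong (filter (_∣? g)) (range1-suc (k ℕ.+ g)))
  (trans (ListP.filter-++ (_∣? g) (range1 (k ℕ.+ g)) _)
    (trans (cong₂ _++_ (divisors-range1 g k p) (ListP.filter-reject (_∣? g) (λ d → ℕP.<⇒≱ (s≤s (ℕP.m≤n+m g k)) (Div.∣⇒≤ {{ℕ.>-nonZero p}} d))))
      (ListP.++-identityʳ _)))

divisors-of-divisor : ∀ {g n} m → 1 ≤ g → g ∣ n → g ≤ m → filter (_∣? g) (filter (_∣? n) (range1 m)) ≡ divisors g
divisors-of-divisor {g} {n} m p d q = trans (filter-filter (_∣? g) (_∣? n) (range1 m) (λ x e → Div.∣-trans e d))
  (trans (cong (λ t → filter (_∣? g) (range1 t)) (sym (ℕP.m∸n+n≡m q))) (divisors-range1 g (m ∸ g) p))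

properDivisors-< : ∀ n → All (λ d → 1 ≤ d × d < n) (properDivisors n)
properDivisors-< zero    = []
properDivisors-< (suc n) = AllP.filter⁺ (_∣? suc n) (all-range1 n (λ j p q → p , s≤s q))

cycF-fuel : ∀ f f′ n → 1 ≤ n → n ≤ f → n ≤ f′ → cycF f n ≡ cycF f′ n
cycF-fuel (suc f) (suc f′) n 1≤n p q = cong (λ t → seriesDiv (suc n) (addP (ℤ.- (ℤ.+ 1) ∷ []) (monomial n (ℤ.+ 1))) (prodP t))
  (same (properDivisors n) (All.map (λ (a , b) → a , ℕP.≤-pred (ℕP.≤-trans b p) , ℕP.≤-pred (ℕP.≤-trans b q)) (properDivisors-< n)))
  where
  same : ∀ xs → All (λ d → 1 ≤ d × d ≤ f × d ≤ f′) xs → map (cycF f) xs ≡ map (cycF f′) xs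
  same []       []                   = refl
  same (x ∷ xs) ((a , b , c) ∷ rest) = cong₂ _∷_ (cycF-fuel f f′ x a b c) (same xs rest)
cycF-fuel zero    f′       zero    () p q
cycF-fuel (suc f) zero     zero    () p q

cyclotomic-unfold : ∀ n → 1 ≤ n → cyclotomic n ≡ seriesDiv (suc n) (addP (ℤ.- (ℤ.+ 1) ∷ []) (monomial n (ℤ.+ 1))) (prodP (map cyclotomic (properDivisors n)))
cyclotomic-unfold (suc n) _ = cong (λ t → seriesDiv (suc (suc n)) (addP (ℤ.- (ℤ.+ 1) ∷ []) (monomial (suc n) (ℤ.+ 1))) (prodP t))
  (same (properDivisors (suc n)) (properDivisors-< (suc n)))
  where
  same : ∀ xs → All (λ d → 1 ≤ d × d < suc n) xs → map (cycF n) xs ≡ map cyclotomic xs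
  same []       []               = refl
  same (x ∷ xs) ((a , b) ∷ rest) = cong₂ _∷_ (cycF-fuel n x x a (ℕP.≤-pred b) ℕP.≤-refl) (same xs rest)

-- Factorisation of x^n - 1 into cyclotomic polynomials

module Cyclotomics where
  open GeneratingFunction public
  open import Data.Integer using (_+_; _*_; -_)
  open ≈-Reasoning

  ⊛-Bounded : ∀ t s {p q} → Bounded t p → Bounded s q → Bounded (t ℕ.+ s) (p ⊛ q)
  ⊛-Bounded zero    s {p} {q} b c (suc n) r = cong₂ _+_ (trans (cong (p 0 *_) (c (suc n) r)) (ℤP.*-zeroʳ (p 0)))
    (⊛-zeroˡ (tail p) q (λ i → b (suc i) (s≤s z≤n)) n)
  ⊛-Bounded (suc t) s {p} {q} b c (suc n) (s≤s r) = cong₂ _+_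
    (trans (cong (p 0 *_) (c (suc n) (ℕP.≤-<-trans (ℕP.m≤n+m s t) (ℕP.<-trans r ℕP.≤-refl)))) (ℤP.*-zeroʳ (p 0)))
    (⊛-Bounded t s (λ k u → b (suc k) (s≤s u)) c n r)

  ⊛-top : ∀ t s {p q} → Bounded t p → Bounded s q → (p ⊛ q) (t ℕ.+ s) ≡ p t * q s
  ⊛-top zero    zero    b c = refl
  ⊛-top zero    (suc s) {p} {q} b c = trans (cong (p 0 * q (suc s) +_) (⊛-zeroˡ (tail p) q (λ i → b (suc i) (s≤s z≤n)) s)) (ℤP.+-identityʳ _)
  ⊛-top (suc t) s {p} {q} b c = trans (cong₂ _+_ (trans (cong (p 0 *_) (c (suc (t ℕ.+ s)) (s≤s (ℕP.m≤n+m s t)))) (ℤP.*-zeroʳ (p 0)))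
    (⊛-top t s (λ k u → b (suc k) (s≤s u)) c)) (ℤP.+-identityˡ _)

  Finite : Series → Set
  Finite f = ∃[ d ] Bounded d f

  Finite-≈ : ∀ {f g} → f ≈ g → Finite f → Finite g
  Finite-≈ e (d , b) = d , λ k p → trans (sym (e .at k)) (b k p)

  Finite-⊛ : ∀ {f g} → Finite f → Finite g → Finite (f ⊛ g)
  Finite-⊛ (d , b) (e , c) = d ℕ.+ e , ⊛-Bounded d e b c

  Finite-⊕ : ∀ {f g} → Finite f → Finite g → Finite (f ⊕ g)
  Finite-⊕ (d , b) (e , c) = d ℕ.+ e , λ k p → cong₂ _+_ (b k (ℕP.≤-<-trans (ℕP.m≤m+n d e) p)) (c k (ℕP.≤-<-trans (ℕP.m≤n+m e d) p))

  Finite-⊝ : ∀ {f} → Finite f → Finite (⊝ f)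
  Finite-⊝ (d , b) = d , λ k p → cong -_ (b k p)

  Finite-constant : ∀ c → Finite (constant c)
  Finite-constant c = 0 , λ { (suc k) _ → refl }

  Finite-mono : ∀ j → Finite (mono j)
  Finite-mono j = j , λ k p → Z.eq-≢ (ℕP.<⇒≢ p)

  Finite-geo : ∀ j q → Finite (geo j q)
  Finite-geo j zero    = 0 , λ _ _ → refl
  Finite-geo j (suc q) = Finite-⊕ (Finite-constant (ℤ.+ 1)) (Finite-⊛ (Finite-mono j) (Finite-geo j q))

  Finite-coeffP : ∀ p → Finite (coeffP p)
  Finite-coeffP p = length p , λ k q → coeffP-length p k (ℕP.<⇒≤ q)

  Unit : Series → Set
  Unit d = d 0 * d 0 ≡ ℤ.+ 1

  Unit-⊛ : ∀ {f g} → Unit f → Unit g → Unit (f ⊛ g)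
  Unit-⊛ {f} {g} u v = trans (arith (f 0) (g 0)) (cong₂ _*_ u v)
    where
    arith : ∀ a b → a * b * (a * b) ≡ a * a * (b * b)
    arith = solve-∀-ℤ

  Unit-≈ : ∀ {f g} → f ≈ g → Unit f → Unit g
  Unit-≈ e u = trans (cong (λ t → t * t) (sym (e .at 0))) u

  -- Division without truncation. It always succeeds for a divisor with constant term ±1; the issue
  -- is whether the result is a polynomial.
  quotient : Series → Series → Series
  quotient r d zero    = r 0 * d 0
  quotient r d (suc k) = quotient (λ i → r (suc i) + - (r 0 * d 0 * d (suc i))) d k

  quotient-⊛ : ∀ r d → Unit d → quotient r d ⊛ d ≈ r
  quotient-⊛ r d u = pointwise λ k → go k r
    where
    go : ∀ k r → (quotient r d ⊛ d) k ≡ r k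
    go zero    r = trans (ℤP.*-assoc (r 0) (d 0) (d 0)) (trans (cong (r 0 *_) u) (ℤP.*-identityʳ (r 0)))
    go (suc k) r = trans (cong (r 0 * d 0 * d (suc k) +_) (go k (λ i → r (suc i) + - (r 0 * d 0 * d (suc i))))) (arith (r 0 * d 0 * d (suc k)) (r (suc k)))
      where
      arith : ∀ a b → a + (b + - a) ≡ b
      arith = solve-∀-ℤ

  seriesDiv-quotient : ∀ f R D s → Unit (coeffP D) → s ⊛ coeffP D ≈ coeffP R → ∀ k → k < f → coeffP (seriesDiv f R D) k ≡ s k
  seriesDiv-quotient (suc f) R D s u e zero    _       = trans (cong (_* coeffP D 0) (sym (e .at 0)))
    (trans (ℤP.*-assoc (s 0) _ _) (trans (cong (s 0 *_) u) (ℤP.*-identityʳ (s 0))))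
  seriesDiv-quotient (suc f) R D s u e (suc k) (s≤s p) = seriesDiv-quotient f R′ D (tail s) u (pointwise step) k p
    where
    c = coeffP R 0 * coeffP D 0
    R′ = dropHead (addP R (scaleP (- c) D))
    c≡ : c ≡ s 0
    c≡ = trans (cong (_* coeffP D 0) (sym (e .at 0))) (trans (ℤP.*-assoc (s 0) _ _) (trans (cong (s 0 *_) u) (ℤP.*-identityʳ (s 0))))
    dropHead-coeff : ∀ p i → coeffP (dropHead p) i ≡ coeffP p (suc i)
    dropHead-coeff []      i = refl
    dropHead-coeff (x ∷ p) i = refl
    step : ∀ i → (tail s ⊛ coeffP D) i ≡ coeffP R′ i
    step i = sym (trans (dropHead-coeff (addP R (scaleP (- c) D)) i) (trans (coeffP-addP R (scaleP (- c) D) .at (suc i))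
      (trans (cong₂ _+_ (sym (e .at (suc i))) (trans (coeffP-scaleP (- c) D (suc i)) (cong (λ t → - t * coeffP D (suc i)) c≡)))
        (arith (s 0) (coeffP D (suc i)) _))))
      where
      arith : ∀ a b x → a * b + x + - a * b ≡ x
      arith = solve-∀-ℤ

  Divides : Series → Series → Set
  Divides p n = ∃[ s ] Finite s × p ⊛ s ≈ n

  -- Coprime over ℚ: some nonzero integer is a polynomial combination of p and q.
  Coprime : Series → Series → Set
  Coprime p q = ∃[ c ] c ≢ ℤ.+ 0 × ∃[ a ] ∃[ b ] Finite a × Finite b × a ⊛ p ⊕ b ⊛ q ≈ constant c

  -- The quotient series s of n by p q is integral because the constant terms are ±1, and c s = a v
  -- + b u is a polynomial. As c ≠ 0 is an integer, s is a polynomial too.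
  coprime-product-divides : ∀ {p q n} → Unit p → Unit q → Coprime p q → Divides p n → Divides q n → Divides (p ⊛ q) n
  coprime-product-divides {p} {q} {n} up uq (c , c≢0 , a , b , fa , fb , e) (u , fu , pu) (v , fv , qv) = s , fs , ps
    where
    s = quotient n (p ⊛ q)
    sp : s ⊛ (p ⊛ q) ≈ n
    sp = quotient-⊛ n (p ⊛ q) (Unit-⊛ {p} {q} up uq)
    ps : p ⊛ q ⊛ s ≈ n
    ps = ≈-trans (⊛-commutative (p ⊛ q) s) sp
    r = a ⊛ v ⊕ b ⊛ u
    cs : constant c ⊛ s ≈ r
    cs = unit-cancel (p ⊛ q) _ _ (Unit-⊛ {p} {q} up uq) (begin
      p ⊛ q ⊛ (constant c ⊛ s)
        ≈⟨ solve 4 (λ p q c s → p :* q :* (c :* s) := c :* (p :* q :* s)) ≈-refl p q (constant c) s ⟩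
      constant c ⊛ (p ⊛ q ⊛ s)
        ≈⟨ ⊛-cong (≈-sym e) ps ⟩
      (a ⊛ p ⊕ b ⊛ q) ⊛ n
        ≈⟨ solve 5 (λ a p b q n → (a :* p :+ b :* q) :* n := a :* p :* n :+ b :* q :* n) ≈-refl a p b q n ⟩
      a ⊛ p ⊛ n ⊕ b ⊛ q ⊛ n
        ≈⟨ ⊕-cong (⊛-congˡ {a ⊛ p} qv) (⊛-congˡ {b ⊛ q} pu) ⟨
      a ⊛ p ⊛ (q ⊛ v) ⊕ b ⊛ q ⊛ (p ⊛ u)
        ≈⟨ solve 6 (λ a p b q u v → a :* p :* (q :* v) :+ b :* q :* (p :* u) := p :* q :* (a :* v :+ b :* u)) ≈-refl a p b q u v ⟩
      p ⊛ q ⊛ r ∎)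
    fs : Finite s
    fs with Finite-⊕ (Finite-⊛ fa fv) (Finite-⊛ fb fu)
    ... | d , bd = d , λ k k> → ℤP.*-cancelˡ-≡ c (s k) (ℤ.+ 0) {{ℤ.≢-nonZero c≢0}}
          (trans (sym (constant-⊛ c s k)) (trans (cs .at k) (trans (bd k k>) (sym (ℤP.*-zeroʳ c)))))

  coprime-one : ∀ p → Coprime p oneS
  coprime-one p = ℤ.+ 1 , (λ ()) , zeroS , oneS , (0 , λ _ _ → refl) , Finite-constant (ℤ.+ 1) ,
    ≈-trans (⊕-cong (pointwise (⊛-zeroˡ zeroS p (λ _ → refl))) (⊛-identityˡ oneS)) (⊕-identityˡ oneS)

  coprime-⊛ : ∀ {p q r} → Finite p → Finite q → Coprime p q → Coprime p r → Coprime p (q ⊛ r)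
  coprime-⊛ {p} {q} {r} fp fq (c , c≢0 , a , b , fa , fb , e) (c′ , c′≢0 , a′ , b′ , fa′ , fb′ , e′) =
    c * c′ , (λ z → nonzero (ℤP.i*j≡0⇒i≡0∨j≡0 c z)) , a ⊛ (a′ ⊛ p ⊕ b′ ⊛ r) ⊕ b ⊛ q ⊛ a′ , b ⊛ b′ ,
    Finite-⊕ (Finite-≈ (⊛-congˡ {a} (≈-sym e′)) (Finite-⊛ fa (Finite-constant c′))) (Finite-⊛ (Finite-⊛ fb fq) fa′) , Finite-⊛ fb fb′ , (begin
      (a ⊛ (a′ ⊛ p ⊕ b′ ⊛ r) ⊕ b ⊛ q ⊛ a′) ⊛ p ⊕ b ⊛ b′ ⊛ (q ⊛ r)
        ≈⟨ solve 7 (λ p q r a b a′ b′ → (a :* (a′ :* p :+ b′ :* r) :+ b :* q :* a′) :* p :+ b :* b′ :* (q :* r) := (a :* p :+ b :* q) :* (a′ :* p :+ b′ :* r)) ≈-refl p q r a b a′ b′ ⟩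
      (a ⊛ p ⊕ b ⊛ q) ⊛ (a′ ⊛ p ⊕ b′ ⊛ r)
        ≈⟨ ⊛-cong e e′ ⟩
      constant c ⊛ constant c′
        ≈⟨ ACR._-Raw-AlmostCommutative⟶_.*-homo constant-morphism c c′ ⟨
      constant (c * c′) ∎)
    where
    nonzero : ¬ (c ≡ ℤ.+ 0 ⊎ c′ ≡ ℤ.+ 0)
    nonzero (inj₁ z) = c≢0 z
    nonzero (inj₂ z) = c′≢0 z

  coprime-factor : ∀ {p q r s} → q ⊛ s ≈ r → Finite s → Coprime p r → Coprime p q
  coprime-factor {p} {q} {r} {s} qs fs (c , c≢0 , a , b , fa , fb , e) = c , c≢0 , a , b ⊛ s , fa , Finite-⊛ fb fs , (begin
    a ⊛ p ⊕ b ⊛ s ⊛ q   ≈⟨ solve 5 (λ a p b s q → a :* p :+ b :* s :* q := a :* p :+ b :* (q :* s)) ≈-refl a p b s q ⟩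
    a ⊛ p ⊕ b ⊛ (q ⊛ s) ≈⟨ ⊕-congˡ (a ⊛ p) (⊛-congˡ {b} qs) ⟩
    a ⊛ p ⊕ b ⊛ r       ≈⟨ e ⟩
    constant c ∎)

  Monic : ℕ → Series → Set
  Monic d f = f d ≡ ℤ.+ 1 × Bounded d f

  Monic-⊛ : ∀ {t s p q} → Monic t p → Monic s q → Monic (t ℕ.+ s) (p ⊛ q)
  Monic-⊛ {t} {s} {p} {q} (a , b) (c , d) = trans (⊛-top t s b d) (cong₂ _*_ a c) , ⊛-Bounded t s {p} {q} b d

  -- The coefficient of f at t + b is that of s at b. So the bound b is exact if t + b = n, can be
  -- lowered if t + b > n, and is impossible if t + b < n.
  monic-quotient : ∀ {t n p f} s → Monic t p → Monic n f → p ⊛ s ≈ f → Finite s → ∃[ e ] t ℕ.+ e ≡ n × Monic e s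
  monic-quotient {t} {n} {p} {f} s (pt , bp) (fn , bf) e (b , bs) = go b bs
    where
    1≢0 : ℤ.+ 1 ≢ ℤ.+ 0
    1≢0 ()
    top : ∀ b → Bounded b s → f (t ℕ.+ b) ≡ s b
    top b bs = trans (sym (e .at (t ℕ.+ b))) (trans (⊛-top t b bp bs) (trans (cong (_* s b) pt) (ℤP.*-identityˡ (s b))))
    go : ∀ b → Bounded b s → ∃[ e ] t ℕ.+ e ≡ n × Monic e s
    go b bs with ℕP.<-cmp (t ℕ.+ b) n
    ... | tri< lt _ _  = ⊥-elim (1≢0 (trans (sym fn) (trans (sym (e .at n)) (⊛-Bounded t b {p} {s} bp bs n lt))))
    ... | tri≈ _ eq _  = b , eq , trans (sym (top b bs)) (trans (cong f eq) fn) , bs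
    ... | tri> _ _ gt  = lower b bs (trans (sym (top b bs)) (bf (t ℕ.+ b) gt))
      where
      lower : ∀ b → Bounded b s → s b ≡ ℤ.+ 0 → ∃[ e ] t ℕ.+ e ≡ n × Monic e s
      lower zero    bs z = ⊥-elim (1≢0 (trans (sym fn) (trans (sym (e .at n)) (trans (⊛-comm p s n) (⊛-zeroˡ s p (λ { zero → z ; (suc i) → bs (suc i) (s≤s z≤n) }) n)))))
      lower (suc b) bs z = go b (λ k b<k → by k (ℕP.m≤n⇒m<n∨m≡n b<k))
        where
        by : ∀ k → suc b < k ⊎ suc b ≡ k → s k ≡ ℤ.+ 0
        by k (inj₁ q)    = bs k q
        by k (inj₂ refl) = z

  T : ℕ → Series
  T n = mono n ⊕ ⊝ oneS

  T-E : ∀ n → T n ≈ ⊝ E n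
  T-E n = solve 1 (λ m → m :+ :- con (ℤ.+ 1) := :- (con (ℤ.+ 1) :+ :- m)) ≈-refl (mono n)

  T-geo : ∀ j q → T j ⊛ geo j q ≈ T (q ℕ.* j)
  T-geo j q = begin
    T j ⊛ geo j q     ≈⟨ ⊛-congʳ (T-E j) ⟩
    ⊝ E j ⊛ geo j q   ≈⟨ solve 2 (λ a b → :- a :* b := :- (a :* b)) ≈-refl (E j) (geo j q) ⟩
    ⊝ (E j ⊛ geo j q) ≈⟨ ⊝-cong (E-geo j q) ⟩
    ⊝ E (q ℕ.* j)     ≈⟨ T-E (q ℕ.* j) ⟨
    T (q ℕ.* j) ∎

  T-+ : ∀ g w → T (g ℕ.+ w) ≈ mono g ⊛ T w ⊕ T g
  T-+ g w = begin
    mono (g ℕ.+ w) ⊕ ⊝ oneS    ≈⟨ ⊕-congʳ (⊝ oneS) (mono-+ g w) ⟨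
    mono g ⊛ mono w ⊕ ⊝ oneS   ≈⟨ solve 2 (λ g w → g :* w :+ :- con (ℤ.+ 1) := g :* (w :+ :- con (ℤ.+ 1)) :+ (g :+ :- con (ℤ.+ 1))) ≈-refl (mono g) (mono w) ⟩
    mono g ⊛ T w ⊕ T g ∎

  Unit-T : ∀ n → 1 ≤ n → Unit (T n)
  Unit-T (suc n) _ = refl

  Monic-T : ∀ n → 1 ≤ n → Monic n (T n)
  Monic-T (suc n) _ = trans (cong (_+ ℤ.+ 0) (Z.eq-refl (suc n))) refl , λ { (suc k) p → trans (cong (_+ ℤ.+ 0) (Z.eq-≢ (ℕP.<⇒≢ p))) refl }

  constant-zero : ∀ k → constant (ℤ.+ 0) k ≡ ℤ.+ 0
  constant-zero zero    = refl
  constant-zero (suc k) = refl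

  -- Evaluating 1 + x^g + … + x^{(m−1)g} at x^g = 1 gives m.
  geo-mod-T : ∀ g m → ∃[ s ] Finite s × geo g m ≈ constant (ℤ.+ m) ⊕ T g ⊛ s
  geo-mod-T g zero    = zeroS , (0 , λ _ _ → refl) , pointwise λ k → sym (trans (cong₂ _+_ (constant-zero k) (⊛-zeroʳ (T g) .at k)) refl)
  geo-mod-T g (suc m) with geo-mod-T g m
  ... | s , fs , e = constant (ℤ.+ m) ⊕ T g ⊛ s ⊕ s ,
    Finite-⊕ (Finite-⊕ (Finite-constant (ℤ.+ m)) (Finite-⊛ (Finite-⊕ (Finite-mono g) (Finite-⊝ (Finite-constant (ℤ.+ 1)))) fs)) fs , (begin
      oneS ⊕ mono g ⊛ geo g m
        ≈⟨ ⊕-congˡ oneS (⊛-congˡ {mono g} e) ⟩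
      oneS ⊕ mono g ⊛ (constant (ℤ.+ m) ⊕ T g ⊛ s)
        ≈⟨ solve 3 (λ x c s → con (ℤ.+ 1) :+ x :* (c :+ (x :+ :- con (ℤ.+ 1)) :* s)
             := (con (ℤ.+ 1) :+ c) :+ (x :+ :- con (ℤ.+ 1)) :* (c :+ (x :+ :- con (ℤ.+ 1)) :* s :+ s)) ≈-refl (mono g) (constant (ℤ.+ m)) s ⟩
      (oneS ⊕ constant (ℤ.+ m)) ⊕ T g ⊛ (constant (ℤ.+ m) ⊕ T g ⊛ s ⊕ s)
        ≈⟨ ⊕-congʳ (T g ⊛ (constant (ℤ.+ m) ⊕ T g ⊛ s ⊕ s)) (≈-sym (ACR._-Raw-AlmostCommutative⟶_.+-homo constant-morphism (ℤ.+ 1) (ℤ.+ m))) ⟩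
      constant (ℤ.+ suc m) ⊕ T g ⊛ (constant (ℤ.+ m) ⊕ T g ⊛ s ⊕ s) ∎)

  -- Abstract, since unfolding cyclotomic during conversion checking is very expensive.
  abstract
    Φ : ℕ → Series
    Φ n = coeffP (cyclotomic n)

    Φ-coeffP : ∀ n → Φ n ≈ coeffP (cyclotomic n)
    Φ-coeffP n = ≈-refl

  Finite-Φ : ∀ n → Finite (Φ n)
  Finite-Φ n = Finite-≈ (≈-sym (Φ-coeffP n)) (Finite-coeffP (cyclotomic n))

  ∏Φ : List ℕ → Series
  ∏Φ ns = product (map Φ ns)

  ∏Φ-++ : ∀ ms ns → ∏Φ (ms ++ ns) ≈ ∏Φ ms ⊛ ∏Φ ns
  ∏Φ-++ ms ns = subst (λ t → product t ≈ ∏Φ ms ⊛ ∏Φ ns) (sym (ListP.map-++ Φ ms ns)) (product-++ (map Φ ms) (map Φ ns))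

  ∏Φ-filter : ∀ {Q : ℕ → Set} (Q? : Decidable Q) ns → ∏Φ ns ≈ ∏Φ (filter Q? ns) ⊛ ∏Φ (filter (¬? ∘ Q?) ns)
  ∏Φ-filter Q? []       = ≈-sym (⊛-identityˡ oneS)
  ∏Φ-filter Q? (n ∷ ns) with Q? n
  ... | yes _ = ≈-trans (⊛-congˡ {Φ n} (∏Φ-filter Q? ns)) (≈-sym (⊛-associative (Φ n) _ _))
  ... | no _  = ≈-trans (⊛-congˡ {Φ n} (∏Φ-filter Q? ns))
      (solve 3 (λ a b c → a :* (b :* c) := b :* (a :* c)) ≈-refl (Φ n) (∏Φ (filter Q? ns)) (∏Φ (filter (¬? ∘ Q?) ns)))

  Finite-∏Φ : ∀ ns → Finite (∏Φ ns)
  Finite-∏Φ []       = Finite-constant (ℤ.+ 1)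
  Finite-∏Φ (n ∷ ns) = Finite-⊛ (Finite-Φ n) (Finite-∏Φ ns)

  ∏Φ-coeffP : ∀ ns → coeffP (prodP (map cyclotomic ns)) ≈ ∏Φ ns
  ∏Φ-coeffP ns = ≈-trans (coeffP-prodP cyclotomic ns) (product-map-cong ns (λ n → ≈-sym (Φ-coeffP n)))

  -- What the induction needs at once: the division defining Φ_n is exact, Φ_n can be cancelled, and
  -- it is monic, which bounds the degree of later quotients.
  record Good (n : ℕ) : Set where
    field
      factorisation : Φ n ⊛ ∏Φ (properDivisors n) ≈ T n
      unit          : Unit (Φ n)
      degree        : ℕ
      monic         : Monic degree (Φ n)
  open Good

  ∏Φ-divisors : ∀ n → 1 ≤ n → Good n → ∏Φ (divisors n) ≈ T n
  ∏Φ-divisors (suc n) _ g = begin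
    ∏Φ (divisors (suc n))
      ≈⟨ subst (λ t → ∏Φ (divisors (suc n)) ≈ ∏Φ t) (divisors-suc n) ≈-refl ⟩
    ∏Φ (properDivisors (suc n) ++ suc n ∷ [])
      ≈⟨ ∏Φ-++ (properDivisors (suc n)) (suc n ∷ []) ⟩
    ∏Φ (properDivisors (suc n)) ⊛ (Φ (suc n) ⊛ oneS)
      ≈⟨ solve 2 (λ a b → a :* (b :* con (ℤ.+ 1)) := b :* a) ≈-refl (∏Φ (properDivisors (suc n))) (Φ (suc n)) ⟩
    Φ (suc n) ⊛ ∏Φ (properDivisors (suc n))
      ≈⟨ g .factorisation ⟩
    T (suc n) ∎

  Unit-∏Φ : ∀ ns → All Good ns → Unit (∏Φ ns)
  Unit-∏Φ []       []       = refl
  Unit-∏Φ (n ∷ ns) (g ∷ gs) = Unit-⊛ {Φ n} {∏Φ ns} (g .unit) (Unit-∏Φ ns gs)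

  Monic-∏Φ : ∀ ns → All Good ns → ∃[ d ] Monic d (∏Φ ns)
  Monic-∏Φ []       []       = 0 , refl , one-Bounded
  Monic-∏Φ (n ∷ ns) (g ∷ gs) with Monic-∏Φ ns gs
  ... | d , m = g .degree ℕ.+ d , Monic-⊛ {p = Φ n} {∏Φ ns} (g .monic) m

  -- If g + y e = x d then X^g - 1 = (X^(x d) - 1) - X^g (X^(y e) - 1), and the brackets are
  -- multiples of X^d - 1 and X^e - 1. The other sign of the Bézout identity exchanges d and e.
  T-gcd : ∀ d e → ∃[ α ] ∃[ β ] Finite α × Finite β × T (GCD.gcd d e) ≈ T d ⊛ α ⊕ T e ⊛ β
  T-gcd d e with GCD.Bézout.identity (GCD.gcd-GCD d e)
  ... | GCD.Bézout.+- x y eq = geo d x , ⊝ (mono g ⊛ geo e y) , Finite-geo d x , Finite-⊝ (Finite-⊛ (Finite-mono g) (Finite-geo e y)) , combine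
    where
    g = GCD.gcd d e
    combine : T g ≈ T d ⊛ geo d x ⊕ T e ⊛ ⊝ (mono g ⊛ geo e y)
    combine = ≈-sym (begin
      T d ⊛ geo d x ⊕ T e ⊛ ⊝ (mono g ⊛ geo e y)
        ≈⟨ solve 4 (λ a t m h → a :+ t :* (:- (m :* h)) := a :+ :- (m :* (t :* h))) ≈-refl (T d ⊛ geo d x) (T e) (mono g) (geo e y) ⟩
      T d ⊛ geo d x ⊕ ⊝ (mono g ⊛ (T e ⊛ geo e y))
        ≈⟨ ⊕-cong (≈-trans (T-geo d x) (subst (λ t → T (x ℕ.* d) ≈ T t) (sym eq) ≈-refl)) (⊝-cong (⊛-congˡ {mono g} (T-geo e y))) ⟩
      T (g ℕ.+ y ℕ.* e) ⊕ ⊝ (mono g ⊛ T (y ℕ.* e))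
        ≈⟨ ⊕-congʳ (⊝ (mono g ⊛ T (y ℕ.* e))) (T-+ g (y ℕ.* e)) ⟩
      mono g ⊛ T (y ℕ.* e) ⊕ T g ⊕ ⊝ (mono g ⊛ T (y ℕ.* e))
        ≈⟨ solve 2 (λ a b → a :+ b :+ :- a := b) ≈-refl (mono g ⊛ T (y ℕ.* e)) (T g) ⟩
      T g ∎)
  ... | GCD.Bézout.-+ x y eq = ⊝ (mono g ⊛ geo d x) , geo e y , Finite-⊝ (Finite-⊛ (Finite-mono g) (Finite-geo d x)) , Finite-geo e y , combine
    where
    g = GCD.gcd d e
    combine : T g ≈ T d ⊛ ⊝ (mono g ⊛ geo d x) ⊕ T e ⊛ geo e y
    combine = ≈-sym (begin
      T d ⊛ ⊝ (mono g ⊛ geo d x) ⊕ T e ⊛ geo e y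
        ≈⟨ solve 4 (λ a t m h → t :* (:- (m :* h)) :+ a := a :+ :- (m :* (t :* h))) ≈-refl (T e ⊛ geo e y) (T d) (mono g) (geo d x) ⟩
      T e ⊛ geo e y ⊕ ⊝ (mono g ⊛ (T d ⊛ geo d x))
        ≈⟨ ⊕-cong (≈-trans (T-geo e y) (subst (λ t → T (y ℕ.* e) ≈ T t) (sym eq) ≈-refl)) (⊝-cong (⊛-congˡ {mono g} (T-geo d x))) ⟩
      T (g ℕ.+ x ℕ.* d) ⊕ ⊝ (mono g ⊛ T (x ℕ.* d))
        ≈⟨ ⊕-congʳ (⊝ (mono g ⊛ T (x ℕ.* d))) (T-+ g (x ℕ.* d)) ⟩
      mono g ⊛ T (x ℕ.* d) ⊕ T g ⊕ ⊝ (mono g ⊛ T (x ℕ.* d))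
        ≈⟨ solve 2 (λ a b → a :+ b :+ :- a := b) ≈-refl (mono g ⊛ T (x ℕ.* d)) (T g) ⟩
      T g ∎)

  -- With g = gcd d e < d, the cofactor (x^d−1)/(x^g−1) is divisible by Φ_d and congruent to d/g modulo x^g − 1.
  coprime-Φ-T : ∀ d e → 1 ≤ d → 1 ≤ e → ¬ d ∣ e → (∀ m → 1 ≤ m → m ≤ d → Good m) → Coprime (Φ d) (T e)
  coprime-Φ-T d e 1≤d 1≤e d∤e good with GCD.gcd[m,n]∣m d e
  ... | divides m d≡mg with geo-mod-T (GCD.gcd d e) m | T-gcd d e
  ... | s , fs , geo≈ | α , β , fα , fβ , Tg≈ =
    -- Φ_d · rest = (x^d - 1)/(x^g - 1) = m + (x^g - 1) s and x^g - 1 = Φ_d · pd · α + (x^e - 1) β;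
    -- solving for m yields the two coefficients.
    ℤ.+ m , (λ z → m≢0 (ℤP.+-injective z)) , rest ⊕ ⊝ (pd ⊛ α ⊛ s) , ⊝ (β ⊛ s) ,
    Finite-⊕ frest (Finite-⊝ (Finite-⊛ (Finite-⊛ (Finite-∏Φ (properDivisors d)) fα) fs)) , Finite-⊝ (Finite-⊛ fβ fs) , (begin
      (rest ⊕ ⊝ (pd ⊛ α ⊛ s)) ⊛ Φ d ⊕ ⊝ (β ⊛ s) ⊛ T e
        ≈⟨ solve 7 (λ r p a s f b t → (r :+ :- (p :* a :* s)) :* f :+ :- (b :* s) :* t := f :* r :+ :- (((f :* p) :* a :+ t :* b) :* s)) ≈-refl rest pd α s (Φ d) β (T e) ⟩
      Φ d ⊛ rest ⊕ ⊝ ((Φ d ⊛ pd ⊛ α ⊕ T e ⊛ β) ⊛ s)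
        ≈⟨ ⊕-cong Φrest (⊝-cong (⊛-congʳ (≈-trans (⊕-congʳ (T e ⊛ β) (⊛-congʳ (good d 1≤d ℕP.≤-refl .factorisation))) (≈-sym Tg≈)))) ⟩
      geo g m ⊕ ⊝ (T g ⊛ s)
        ≈⟨ ⊕-congʳ (⊝ (T g ⊛ s)) geo≈ ⟩
      constant (ℤ.+ m) ⊕ T g ⊛ s ⊕ ⊝ (T g ⊛ s)
        ≈⟨ solve 2 (λ a b → a :+ b :+ :- b := a) ≈-refl (constant (ℤ.+ m)) (T g ⊛ s) ⟩
      constant (ℤ.+ m) ∎)
    where
    g = GCD.gcd d e
    pd = ∏Φ (properDivisors d)
    rest = ∏Φ (filter (¬? ∘ (_∣? g)) (properDivisors d))
    frest : Finite rest
    frest = Finite-∏Φ (filter (¬? ∘ (_∣? g)) (properDivisors d))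
    m≢0 : m ≢ 0
    m≢0 refl = ℕP.<⇒≢ 1≤d (sym d≡mg)
    1≤g : 1 ≤ g
    1≤g = ℕP.n≢0⇒n>0 (λ z → ℕP.<⇒≢ 1≤d (sym (trans d≡mg (trans (cong (m ℕ.*_) z) (ℕP.*-zeroʳ m)))))
    g≤d : g ≤ d
    g≤d = Div.∣⇒≤ {{ℕ.>-nonZero 1≤d}} (GCD.gcd[m,n]∣m d e)
    g<d : g < d
    g<d = ℕP.≤∧≢⇒< g≤d (λ z → d∤e (subst (_∣ e) z (GCD.gcd[m,n]∣n d e)))
    -- Since g < d, the divisors of g are among the proper divisors of d, and their Φ multiply to
    -- x^g - 1.
    pd≈ : pd ≈ T g ⊛ rest
    pd≈ = ≈-trans (∏Φ-filter (_∣? g) (properDivisors d)) (⊛-congʳ (≈-trans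
      (subst (λ t → ∏Φ (filter (_∣? g) (properDivisors d)) ≈ ∏Φ t) (divisors-of-divisor (d ∸ 1) 1≤g (GCD.gcd[m,n]∣m d e) (ℕP.≤-pred (ℕP.≤-trans g<d (ℕP.≤-reflexive (sym (ℕP.m+[n∸m]≡n 1≤d)))))) ≈-refl)
      (∏Φ-divisors g 1≤g (good g 1≤g g≤d))))
    Φrest : Φ d ⊛ rest ≈ geo g m
    Φrest = unit-cancel (T g) _ _ (Unit-T g 1≤g) (begin
      T g ⊛ (Φ d ⊛ rest)  ≈⟨ solve 3 (λ a b c → a :* (b :* c) := b :* (a :* c)) ≈-refl (T g) (Φ d) rest ⟩
      Φ d ⊛ (T g ⊛ rest)  ≈⟨ ⊛-congˡ {Φ d} pd≈ ⟨
      Φ d ⊛ pd            ≈⟨ good d 1≤d ℕP.≤-refl .factorisation ⟩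
      T d                 ≈⟨ subst (λ t → T d ≈ T t) d≡mg ≈-refl ⟩
      T (m ℕ.* g)         ≈⟨ T-geo g m ⟨
      T g ⊛ geo g m ∎)

  module Step (n : ℕ) (1≤n : 1 ≤ n) (good : ∀ m → 1 ≤ m → m < n → Good m) where

    upTo-divisors : ℕ → List ℕ
    upTo-divisors m = filter (_∣? n) (range1 m)

    upTo-divisors-suc : ∀ m → upTo-divisors (suc m) ≡ upTo-divisors m ++ filter (_∣? n) (suc m ∷ [])
    upTo-divisors-suc m = trans (cong (filter (_∣? n)) (range1-suc m)) (ListP.filter-++ (_∣? n) (range1 m) (suc m ∷ []))

    all-good : ∀ m → m < n → All Good (upTo-divisors m)
    all-good m m<n = AllP.filter⁺ (_∣? n) (all-range1 m (λ j p q → good j p (ℕP.≤-<-trans q m<n)))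

    -- For m < d the polynomial Φ_m divides x^m - 1 and d does not divide m, so `coprime-Φ-T`
    -- applies; coprimality is then collected over the factors.
    coprime-upTo : ∀ d m → m < d → d < n → Coprime (Φ d) (∏Φ (upTo-divisors m))
    coprime-upTo d zero    _   _   = coprime-one (Φ d)
    coprime-upTo d (suc m) m<d d<n = subst (λ t → Coprime (Φ d) (∏Φ t)) (sym (upTo-divisors-suc m)) (go (suc m ∣? n))
      where
      previous = coprime-upTo d m (ℕP.<-trans ℕP.≤-refl m<d) d<n
      1≤d : 1 ≤ d
      1≤d = ℕP.≤-trans (s≤s z≤n) m<d
      go : Dec (suc m ∣ n) → Coprime (Φ d) (∏Φ (upTo-divisors m ++ filter (_∣? n) (suc m ∷ [])))
      go (no ¬p) = subst (λ t → Coprime (Φ d) (∏Φ t)) (sym (trans (cong (upTo-divisors m ++_) (ListP.filter-reject (_∣? n) ¬p)) (ListP.++-identityʳ _))) previous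
      go (yes p) = coprime-factor {Φ d} {∏Φ (upTo-divisors m ++ filter (_∣? n) (suc m ∷ []))} {∏Φ (upTo-divisors m) ⊛ Φ (suc m)} {oneS} same (Finite-constant (ℤ.+ 1))
        (coprime-⊛ {Φ d} {∏Φ (upTo-divisors m)} {Φ (suc m)} (Finite-Φ d) (Finite-∏Φ (upTo-divisors m)) previous
          (coprime-factor {Φ d} {Φ (suc m)} {T (suc m)} {∏Φ (properDivisors (suc m))} (good (suc m) (s≤s z≤n) (ℕP.<-trans m<d d<n) .factorisation) (Finite-∏Φ (properDivisors (suc m)))
            (coprime-Φ-T d (suc m) 1≤d (s≤s z≤n) (λ e → ℕP.<⇒≱ m<d (Div.∣⇒≤ e)) (λ k a b → good k a (ℕP.≤-<-trans b d<n)))))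
        where
        same : ∏Φ (upTo-divisors m ++ filter (_∣? n) (suc m ∷ [])) ⊛ oneS ≈ ∏Φ (upTo-divisors m) ⊛ Φ (suc m)
        same = ≈-trans (⊛-congʳ (≈-trans (subst (λ t → ∏Φ (upTo-divisors m ++ filter (_∣? n) (suc m ∷ [])) ≈ ∏Φ (upTo-divisors m ++ t)) (ListP.filter-accept (_∣? n) p) ≈-refl)
            (∏Φ-++ (upTo-divisors m) (suc m ∷ []))))
          (solve 2 (λ a b → a :* (b :* con (ℤ.+ 1)) :* con (ℤ.+ 1) := a :* b) ≈-refl (∏Φ (upTo-divisors m)) (Φ (suc m)))

    -- Divisors are added one at a time: the new Φ divides x^n - 1 and is coprime to the product so
    -- far, so the larger product divides as well.
    divides-upTo : ∀ m → m < n → Divides (∏Φ (upTo-divisors m)) (T n)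
    divides-upTo zero    _   = T n , Finite-⊕ (Finite-mono n) (Finite-⊝ (Finite-constant (ℤ.+ 1))) , ⊛-identityˡ (T n)
    divides-upTo (suc m) m<n = subst (λ t → Divides (∏Φ t) (T n)) (sym (upTo-divisors-suc m)) (go (suc m ∣? n))
      where
      previous = divides-upTo m (ℕP.<-trans ℕP.≤-refl m<n)
      current = good (suc m) (s≤s z≤n) m<n
      go : Dec (suc m ∣ n) → Divides (∏Φ (upTo-divisors m ++ filter (_∣? n) (suc m ∷ []))) (T n)
      go (no ¬p) = subst (λ t → Divides (∏Φ t) (T n)) (sym (trans (cong (upTo-divisors m ++_) (ListP.filter-reject (_∣? n) ¬p)) (ListP.++-identityʳ _))) previous
      go (yes p@(divides q n≡)) = reorder (coprime-product-divides {Φ (suc m)} {∏Φ (upTo-divisors m)} {T n} (current .unit)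
          (Unit-∏Φ (upTo-divisors m) (all-good m (ℕP.<-trans ℕP.≤-refl m<n))) (coprime-upTo (suc m) m ℕP.≤-refl m<n) Φ-divides previous)
        where
        Φ-divides : Divides (Φ (suc m)) (T n)
        Φ-divides = ∏Φ (properDivisors (suc m)) ⊛ geo (suc m) q , Finite-⊛ (Finite-∏Φ (properDivisors (suc m))) (Finite-geo (suc m) q) ,
          ≈-trans (≈-sym (⊛-associative (Φ (suc m)) _ _)) (≈-trans (⊛-congʳ (current .factorisation)) (≈-trans (T-geo (suc m) q) (subst (λ t → T (q ℕ.* suc m) ≈ T t) (sym n≡) ≈-refl)))
        same : ∏Φ (upTo-divisors m ++ filter (_∣? n) (suc m ∷ [])) ≈ Φ (suc m) ⊛ ∏Φ (upTo-divisors m)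
        same = ≈-trans (≈-trans (subst (λ t → ∏Φ (upTo-divisors m ++ filter (_∣? n) (suc m ∷ [])) ≈ ∏Φ (upTo-divisors m ++ t)) (ListP.filter-accept (_∣? n) p) ≈-refl)
            (∏Φ-++ (upTo-divisors m) (suc m ∷ [])))
          (solve 2 (λ a b → a :* (b :* con (ℤ.+ 1)) := b :* a) ≈-refl (∏Φ (upTo-divisors m)) (Φ (suc m)))
        reorder : Divides (Φ (suc m) ⊛ ∏Φ (upTo-divisors m)) (T n) → Divides (∏Φ (upTo-divisors m ++ filter (_∣? n) (suc m ∷ []))) (T n)
        reorder (s , fs , e) = s , fs , ≈-trans (⊛-congʳ same) e

    n∸1<n : n ∸ 1 < n
    n∸1<n = ℕP.≤-reflexive (ℕP.m+[n∸m]≡n 1≤n)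

    pd : Series
    pd = ∏Φ (properDivisors n)

    Unit-pd : Unit pd
    Unit-pd = Unit-∏Φ (properDivisors n) (all-good (n ∸ 1) n∸1<n)

    from-quotient : ∀ s → pd ⊛ s ≈ T n → ∃[ d ] d ≤ n × Monic d s → Good n
    from-quotient s e (d , d≤n , ms) = record { factorisation = fac ; unit = unit′ ; degree = d ; monic = trans (Φ≈s .at d) (proj₁ ms) , λ k q → trans (Φ≈s .at k) (proj₂ ms k q) }
      where
      D = prodP (map cyclotomic (properDivisors n))
      R = addP (- (ℤ.+ 1) ∷ []) (monomial n (ℤ.+ 1))
      D≈ : coeffP D ≈ pd
      D≈ = ∏Φ-coeffP (properDivisors n)
      R≈ : coeffP R ≈ T n
      R≈ = ≈-trans (coeffP-addP (- (ℤ.+ 1) ∷ []) (monomial n (ℤ.+ 1)))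
        (pointwise λ k → trans (cong₂ _+_ (minus k) (trans (coeffP-monomial n (ℤ.+ 1) k) (ℤP.*-identityˡ _))) (ℤP.+-comm (- oneS k) (mono n k)))
        where
        minus : ∀ k → coeffP (- (ℤ.+ 1) ∷ []) k ≡ - oneS k
        minus zero    = refl
        minus (suc k) = refl
      -- The truncated division returns n + 1 coefficients of the quotient; as s has degree at most
      -- n, nothing is cut off.
      Φ≈s : Φ n ≈ s
      Φ≈s .at k = trans (Φ-coeffP n .at k) (trans (cong (λ t → coeffP t k) (cyclotomic-unfold n 1≤n)) (agree (k ℕ.<? suc n)))
        where
        sd-length : ∀ f R D → length (seriesDiv f R D) ≡ f
        sd-length zero    R D = refl
        sd-length (suc f) R D = cong suc (sd-length f _ D)
        agree : Dec (k < suc n) → coeffP (seriesDiv (suc n) R D) k ≡ s k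
        agree (yes p) = seriesDiv-quotient (suc n) R D s (Unit-≈ (≈-sym D≈) Unit-pd)
          (≈-trans (⊛-commutative s (coeffP D)) (≈-trans (⊛-congʳ D≈) (≈-trans e (≈-sym R≈)))) k p
        agree (no p)  = trans (coeffP-length (seriesDiv (suc n) R D) k (ℕP.≤-trans (ℕP.≤-reflexive (sd-length (suc n) R D)) (ℕP.≮⇒≥ p)))
          (sym (proj₂ ms k (ℕP.≤-trans (s≤s d≤n) (ℕP.≮⇒≥ p))))
      fac : Φ n ⊛ pd ≈ T n
      fac = ≈-trans (⊛-congʳ Φ≈s) (≈-trans (⊛-commutative s pd) e)
      unit′ : Unit (Φ n)
      unit′ = trans (arith (Φ n 0) (pd 0) Unit-pd) (trans (cong (λ t → t * t) (fac .at 0)) (Unit-T n 1≤n))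
        where
        arith : ∀ x y → y * y ≡ ℤ.+ 1 → x * x ≡ x * y * (x * y)
        arith x y u = trans (sym (ℤP.*-identityʳ (x * x))) (trans (cong (x * x *_) (sym u)) (rearrange x y))
          where
          rearrange : ∀ x y → x * x * (y * y) ≡ x * y * (x * y)
          rearrange = solve-∀-ℤ

    step : Good n
    step = combine (divides-upTo (n ∸ 1) n∸1<n) (Monic-∏Φ (properDivisors n) (all-good (n ∸ 1) n∸1<n))
      where
      combine : Divides pd (T n) → ∃[ t ] Monic t pd → Good n
      combine (s , fs , e) (t , mt) = bounded (monic-quotient {t} {n} {pd} {T n} s mt (Monic-T n 1≤n) e fs)
        where
        bounded : ∃[ d ] t ℕ.+ d ≡ n × Monic d s → Good n
        bounded (d , t+d , ms) = from-quotient s e (d , ℕP.≤-trans (ℕP.m≤n+m d t) (ℕP.≤-reflexive t+d) , ms)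

  good : ∀ n → 1 ≤ n → Good n
  good n = go n n ℕP.≤-refl
    where
    go : ∀ b n → n ≤ b → 1 ≤ n → Good n
    go zero    zero p ()
    go (suc b) n p q = Step.step n q (λ m 1≤m m<n → go b m (ℕP.≤-pred (ℕP.≤-trans m<n p)) 1≤m)

  -- (1 - x^ℓ)/(1 - x^j) is the product of the Φ_d over all d that divide ℓ but not j.
  cyclotomicIndices : ℕ → List ℕ → List ℕ
  cyclotomicIndices ℓ = concatMap (λ j → filter (¬? ∘ (_∣? j)) (divisors ℓ))

  cyclotomicIndices-positive : ∀ ℓ js → All (1 ≤_) (cyclotomicIndices ℓ js)
  cyclotomicIndices-positive ℓ []       = []
  cyclotomicIndices-positive ℓ (j ∷ js) = AllP.++⁺ (AllP.filter⁺ (¬? ∘ (_∣? j)) (AllP.filter⁺ (_∣? ℓ) (all-range1 ℓ (λ _ p _ → p)))) (cyclotomicIndices-positive ℓ js)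

  ∏Φ-Num : ∀ ℓ js → 1 ≤ ℓ → Factors ℓ js → ∏Φ (cyclotomicIndices ℓ js) ≈ Num ℓ js
  ∏Φ-Num ℓ []       1≤ℓ _              = ≈-refl
  ∏Φ-Num ℓ (j ∷ js) 1≤ℓ ((p , d) ∷ fs) = ≈-trans (∏Φ-++ (filter (¬? ∘ (_∣? j)) (divisors ℓ)) (cyclotomicIndices ℓ js)) (⊛-cong one-part (∏Φ-Num ℓ js 1≤ℓ fs))
    where
    one-part : ∏Φ (filter (¬? ∘ (_∣? j)) (divisors ℓ)) ≈ geo j (quo ℓ j)
    one-part = unit-cancel (T j) _ _ (Unit-T j p) (begin
      T j ⊛ ∏Φ (filter (¬? ∘ (_∣? j)) (divisors ℓ))
        ≈⟨ ⊛-congʳ (≈-trans (subst (λ t → ∏Φ (filter (_∣? j) (divisors ℓ)) ≈ ∏Φ t) (divisors-of-divisor ℓ p d (Div.∣⇒≤ {{ℕ.>-nonZero 1≤ℓ}} d)) ≈-refl) (∏Φ-divisors j p (good j p))) ⟨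
      ∏Φ (filter (_∣? j) (divisors ℓ)) ⊛ ∏Φ (filter (¬? ∘ (_∣? j)) (divisors ℓ))
        ≈⟨ ∏Φ-filter (_∣? j) (divisors ℓ) ⟨
      ∏Φ (divisors ℓ)
        ≈⟨ ∏Φ-divisors ℓ 1≤ℓ (good ℓ 1≤ℓ) ⟩
      T ℓ
        ≈⟨ subst (λ t → T ℓ ≈ T t) (sym (quo-* p d)) ≈-refl ⟩
      T (quo ℓ j ℕ.* j)
        ≈⟨ T-geo j (quo ℓ j) ⟨
      T j ⊛ geo j (quo ℓ j) ∎)

-- Finite differences and interpolation

binom : ℕ → ℕ → ℕ
binom i       zero    = 1
binom zero    (suc j) = 0
binom (suc i) (suc j) = binom i j ℕ.+ binom i (suc j)

module Differences (K : CharZeroRing) where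
  open Alternants K
  open ≡-Reasoning

  Δ : ℕ → (ℕ → A) → ℕ → A
  Δ s u k = u (k ℕ.+ s) + - u k

  iter : ℕ → ℕ → (ℕ → A) → ℕ → A
  iter s zero    u = u
  iter s (suc n) u = Δ s (iter s n u)

  Δ-cong : ∀ s {u v} → (∀ k → u k ≡ v k) → ∀ k → Δ s u k ≡ Δ s v k
  Δ-cong s e k = cong₂ (λ a b → a + - b) (e (k ℕ.+ s)) (e k)

  iter-Δ : ∀ s n u k → iter s n (Δ s u) k ≡ iter s (suc n) u k
  iter-Δ s zero    u k = refl
  iter-Δ s (suc n) u k = Δ-cong s (iter-Δ s n u) k

  Periodic : ℕ → (ℕ → A) → Set
  Periodic p u = ∀ k → u (k ℕ.+ p) ≡ u k

  Δ-periodic : ∀ p s {u} → Periodic p u → Periodic p (Δ s u)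
  Δ-periodic p s {u} h k = cong₂ (λ a b → a + - b) (trans (cong u (arith k p s)) (h (k ℕ.+ s))) (h k)
    where
    arith : ∀ k p s → k ℕ.+ p ℕ.+ s ≡ k ℕ.+ s ℕ.+ p
    arith = solve-∀

  iter-periodic : ∀ p s n {u} → Periodic p u → Periodic p (iter s n u)
  iter-periodic p s zero    h = h
  iter-periodic p s (suc n) {u} h = Δ-periodic p s {iter s n u} (iter-periodic p s n h)

  linear : ∀ u c → (∀ k → Δ 1 u k ≡ c) → ∀ k → u k ≡ u 0 + nat k * c
  linear u c h zero    = sym (trans (+-congˡ (trans (*-congʳ ι-0) (zeroˡ c))) (+-identityʳ _))
  linear u c h (suc k) = begin
    u (suc k)                   ≡⟨ cong u (ℕP.+-comm k 1) ⟨
    u (k ℕ.+ 1)                 ≡⟨ solve 2 (λ a b → a := b :+ (a :+ :- b)) refl (u (k ℕ.+ 1)) (u k) ⟩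
    u k + Δ 1 u k               ≡⟨ cong₂ _+_ (linear u c h k) (h k) ⟩
    u 0 + nat k * c + c         ≡⟨ solve 3 (λ a n c → a :+ n :* c :+ c := a :+ (con (ℤ.+ 1) :+ n) :* c) refl (u 0) (nat k) c ⟩
    u 0 + (ι (ℤ.+ 1) + nat k) * c ≡⟨ +-congˡ (*-congʳ (sym (nat-+ 1 k))) ⟩
    u 0 + nat (suc k) * c ∎

  -- If the (N + 1)-st difference is a constant c, the N-th one is linear with slope c, and its
  -- periodicity forces c = 0. In this way the order of the vanishing difference descends to one.
  periodic-polynomial : ∀ m N u → Periodic (suc m) u → (∀ k → iter 1 (suc N) u k ≡ 0#) → ∀ k → iter 1 1 u k ≡ 0#
  periodic-polynomial m zero    u p h = h
  periodic-polynomial m (suc N) u p h = periodic-polynomial m N u p (λ k → trans (constant k) c≡0)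
    where
    w = iter 1 (suc N) u
    v = iter 1 N u
    constant : ∀ k → w k ≡ w 0
    constant k = trans (linear w 0# h k) (trans (+-congˡ (zeroʳ _)) (+-identityʳ _))
    c≡0 : w 0 ≡ 0#
    c≡0 = ι-cancel m _ _ (begin
      nat (suc m) * w 0              ≡⟨ solve 2 (λ a b → b := (a :+ b) :+ :- a) refl (v 0) _ ⟩
      (v 0 + nat (suc m) * w 0) + - v 0 ≡⟨ +-congʳ (linear v (w 0) constant (suc m)) ⟨
      v (suc m) + - v 0              ≡⟨ +-congʳ (iter-periodic (suc m) 1 N {u} p 0) ⟩
      v 0 + - v 0                    ≡⟨ -‿inverseʳ (v 0) ⟩
      0#                             ≡⟨ zeroʳ _ ⟨
      nat (suc m) * 0# ∎)

  iter-step : ∀ q n u K i → iter 1 n (λ i → u (K ℕ.+ i ℕ.* q)) i ≡ iter q n u (K ℕ.+ i ℕ.* q)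
  iter-step q zero    u K i = refl
  iter-step q (suc n) u K i = cong₂ (λ a b → a + - b) (trans (iter-step q n u K (i ℕ.+ 1)) (cong (iter q n u) (arith K i q))) (iter-step q n u K i)
    where
    arith : ∀ K i q → K ℕ.+ (i ℕ.+ 1) ℕ.* q ≡ K ℕ.+ i ℕ.* q ℕ.+ q
    arith = solve-∀

  newton : ∀ ℓ d u → (∀ k → iter ℓ (suc d) u k ≡ 0#) → ∀ r i → u (r ℕ.+ i ℕ.* ℓ) ≡ ∑ (suc d) (λ j → iter ℓ j u r * nat (binom i j))
  newton ℓ d u h r zero = trans (cong u (ℕP.+-identityʳ r)) (sym (trans (cong₂ _+_ (trans (*-congˡ ι-1) (*-identityʳ _))
    (trans (∑-cong d (λ j → trans (*-congˡ ι-0) (zeroʳ _))) (∑-0 d))) (+-identityʳ _)))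
  newton ℓ d u h r (suc i) = begin
    u (r ℕ.+ (ℓ ℕ.+ i ℕ.* ℓ))
      ≡⟨ cong u (arith r ℓ (i ℕ.* ℓ)) ⟩
    u (r ℕ.+ i ℕ.* ℓ ℕ.+ ℓ)
      ≡⟨ solve 2 (λ a b → a := b :+ (a :+ :- b)) refl _ (u (r ℕ.+ i ℕ.* ℓ)) ⟩
    u (r ℕ.+ i ℕ.* ℓ) + Δ ℓ u (r ℕ.+ i ℕ.* ℓ)
      ≡⟨ cong₂ _+_ (newton ℓ d u h r i) (difference d h) ⟩
    u r * nat 1 + ∑ d (λ j → iter ℓ (suc j) u r * nat (binom i (suc j))) + ∑ d (λ j → iter ℓ (suc j) u r * nat (binom i j))
      ≡⟨ trans (+-assoc _ _ _) (+-congˡ (trans (sym (∑-+ d _ _)) (∑-cong d (λ j → trans (sym (distribˡ _ _ _))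
           (*-congˡ (trans (+-comm _ _) (sym (nat-+ (binom i j) _)))))))) ⟩
    ∑ (suc d) (λ j → iter ℓ j u r * nat (binom (suc i) j)) ∎
    where
    arith : ∀ r l t → r ℕ.+ (l ℕ.+ t) ≡ r ℕ.+ t ℕ.+ l
    arith = solve-∀
    difference : ∀ d → (∀ k → iter ℓ (suc d) u k ≡ 0#) → Δ ℓ u (r ℕ.+ i ℕ.* ℓ) ≡ ∑ d (λ j → iter ℓ (suc j) u r * nat (binom i j))
    difference zero    h = h (r ℕ.+ i ℕ.* ℓ)
    difference (suc d) h = trans (newton ℓ d (Δ ℓ u) (λ k → trans (iter-Δ ℓ (suc d) u k) (h k)) r i)
      (∑-cong (suc d) (λ j → *-congʳ {nat (binom i j)} (iter-Δ ℓ j u r)))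

  absorption : ∀ i j → nat (suc j) * nat (binom i (suc j)) ≡ (nat i + - nat j) * nat (binom i j)
  absorption zero    zero    = trans (trans (*-congˡ ι-0) (zeroʳ _)) (sym (trans (*-congʳ (-‿inverseʳ _)) (zeroˡ _)))
  absorption zero    (suc j) = trans (trans (*-congˡ ι-0) (zeroʳ _)) (sym (trans (*-congˡ ι-0) (zeroʳ _)))
  absorption (suc i) j = begin
    nat (suc j) * nat (binom i j ℕ.+ binom i (suc j))
      ≡⟨ trans (*-congˡ (nat-+ (binom i j) _)) (distribˡ _ _ _) ⟩
    nat (suc j) * nat (binom i j) + nat (suc j) * nat (binom i (suc j))
      ≡⟨ cong₂ _+_ (*-congʳ (nat-suc j)) (absorption i j) ⟩
    (1# + nat j) * nat (binom i j) + (nat i + - nat j) * nat (binom i j)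
      ≡⟨ solve 4 (λ o j b i → (o :+ j) :* b :+ (i :+ :- j) :* b := (o :+ i) :* b) refl 1# (nat j) (nat (binom i j)) (nat i) ⟩
    (1# + nat i) * nat (binom i j)
      ≡⟨ by j ⟩
    (nat (suc i) + - nat j) * nat (binom (suc i) j) ∎
    where
    by : ∀ j → (1# + nat i) * nat (binom i j) ≡ (nat (suc i) + - nat j) * nat (binom (suc i) j)
    by zero    = *-congʳ (trans (sym (nat-suc i)) (sym (trans (+-congˡ (trans (cong -_ ι-0) -0≡0)) (+-identityʳ _))))
    by (suc j) = sym (begin
      (nat (suc i) + - nat (suc j)) * nat (binom i j ℕ.+ binom i (suc j))
        ≡⟨ cong₂ _*_ (cong₂ (λ a b → a + - b) (nat-suc i) (nat-suc j)) (nat-+ (binom i j) _) ⟩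
      ((1# + nat i) + - (1# + nat j)) * (nat (binom i j) + nat (binom i (suc j)))
        ≡⟨ solve 5 (λ o i j b c → ((o :+ i) :+ :- (o :+ j)) :* (b :+ c) := (i :+ :- j) :* b :+ (i :+ :- j) :* c) refl 1# (nat i) (nat j) _ _ ⟩
      (nat i + - nat j) * nat (binom i j) + (nat i + - nat j) * nat (binom i (suc j))
        ≡⟨ +-congʳ (absorption i j) ⟨
      nat (suc j) * nat (binom i (suc j)) + (nat i + - nat j) * nat (binom i (suc j))
        ≡⟨ +-congʳ (*-congʳ (nat-suc j)) ⟩
      (1# + nat j) * nat (binom i (suc j)) + (nat i + - nat j) * nat (binom i (suc j))
        ≡⟨ solve 4 (λ o j b i → (o :+ j) :* b :+ (i :+ :- j) :* b := (o :+ i) :* b) refl 1# (nat j) (nat (binom i (suc j))) (nat i) ⟩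
      (1# + nat i) * nat (binom i (suc j)) ∎)

  infixr 8 _^′_
  _^′_ : A → ℕ → A
  x ^′ zero  = 1#
  x ^′ suc n = x * x ^′ n

  -- Quasi-polynomials of period q and degree < n, in Horner form.
  data Horner (q : ℕ) : ℕ → (ℕ → A) → Set where
    nil  : ∀ {g} → (∀ k → g k ≡ 0#) → Horner q 0 g
    cons : ∀ {n g} c {h} → Periodic q c → Horner q n h → (∀ k → g k ≡ c k + nat k * h k) → Horner q (suc n) g

  Horner-weaken : ∀ {q n g} → Horner q n g → Horner q (suc n) g
  Horner-weaken (nil e)        = cons (λ _ → 0#) (λ _ → refl) (nil {g = λ _ → 0#} (λ _ → refl)) (λ k → trans (e k) (sym (trans (+-identityˡ _) (zeroʳ _))))
  Horner-weaken (cons c p h e) = cons c p (Horner-weaken h) e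

  Horner-ext : ∀ {q n f g} → (∀ k → f k ≡ g k) → Horner q n f → Horner q n g
  Horner-ext e (nil e′)        = nil (λ k → trans (sym (e k)) (e′ k))
  Horner-ext e (cons c p h e′) = cons c p h (λ k → trans (sym (e k)) (e′ k))

  Horner-+ : ∀ {q n f g} → Horner q n f → Horner q n g → Horner q n (λ k → f k + g k)
  Horner-+ (nil e)        (nil e′)          = nil (λ k → trans (cong₂ _+_ (e k) (e′ k)) (+-identityˡ 0#))
  Horner-+ (cons c {h} p hh e) (cons c′ {h′} p′ hh′ e′) = cons (λ k → c k + c′ k) (λ k → cong₂ _+_ (p k) (p′ k)) (Horner-+ hh hh′)
    (λ k → trans (cong₂ _+_ (e k) (e′ k)) (solve 5 (λ a n h b i → (a :+ n :* h) :+ (b :+ n :* i) := (a :+ b) :+ n :* (h :+ i)) refl (c k) (nat k) (h k) (c′ k) (h′ k)))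

  Horner-* : ∀ {q n f} x → Horner q n f → Horner q n (λ k → x * f k)
  Horner-* x (nil e)            = nil (λ k → trans (*-congˡ (e k)) (zeroʳ x))
  Horner-* x (cons c {h} p hh e) = cons (λ k → x * c k) (λ k → *-congˡ (p k)) (Horner-* x hh)
    (λ k → trans (*-congˡ (e k)) (solve 4 (λ x a n h → x :* (a :+ n :* h) := x :* a :+ n :* (x :* h)) refl x (c k) (nat k) (h k)))

  Horner-nat : ∀ {q n f} → Horner q n f → Horner q (suc n) (λ k → nat k * f k)
  Horner-nat h = cons (λ _ → 0#) (λ _ → refl) h (λ k → sym (+-identityˡ _))

  Horner-shift : ∀ {q n f} → Horner q n f → Horner q n (λ k → f (k ℕ.+ q))
  Horner-shift {q} (nil e)             = nil (λ k → e (k ℕ.+ q))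
  Horner-shift {q} (cons c {h} p hh e) = Horner-ext
    (λ k → sym (trans (e (k ℕ.+ q)) (trans (cong₂ (λ a b → a + b * h (k ℕ.+ q)) (p k) (nat-+ k q))
      (solve 4 (λ a n m h → a :+ (n :+ m) :* h := (a :+ n :* h) :+ m :* h) refl (c k) (nat k) (nat q) (h (k ℕ.+ q))))))
    (Horner-+ (cons c p (Horner-shift hh) (λ _ → refl)) (Horner-weaken (Horner-* (nat q) (Horner-shift hh))))

  -- The periodic term cancels and Δ(k h) = k Δh + q h(k + q). By induction Δh has smaller degree
  -- than h, so both summands stay below the degree of g.
  Horner-Δ : ∀ {q n g} → Horner q (suc n) g → Horner q n (Δ q g)
  Horner-Δ {q} {n} {g} (cons c {h} p hh e) = go n hh
    where
    Δg : ∀ k → Δ q g k ≡ nat k * Δ q h k + nat q * h (k ℕ.+ q)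
    Δg k = begin
      g (k ℕ.+ q) + - g k
        ≡⟨ cong₂ (λ a b → a + - b) (trans (e (k ℕ.+ q)) (cong₂ (λ a b → a + b * h (k ℕ.+ q)) (p k) (nat-+ k q))) (e k) ⟩
      (c k + (nat k + nat q) * h (k ℕ.+ q)) + - (c k + nat k * h k)
        ≡⟨ solve 5 (λ a n m h′ h → (a :+ (n :+ m) :* h′) :+ :- (a :+ n :* h) := n :* (h′ :+ :- h) :+ m :* h′) refl (c k) (nat k) (nat q) (h (k ℕ.+ q)) (h k) ⟩
      nat k * Δ q h k + nat q * h (k ℕ.+ q) ∎
    go : ∀ n → Horner q n h → Horner q n (Δ q g)
    go zero    (nil z) = nil (λ k → trans (Δg k) (trans (cong₂ _+_
      (trans (*-congˡ (trans (cong₂ (λ a b → a + - b) (z (k ℕ.+ q)) (z k)) (-‿inverseʳ 0#))) (zeroʳ _)) (trans (*-congˡ (z (k ℕ.+ q))) (zeroʳ _))) (+-identityˡ 0#)))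
    go (suc n) hh      = Horner-ext (λ k → sym (Δg k)) (Horner-+ (Horner-nat (Horner-Δ hh)) (Horner-* (nat q) (Horner-shift hh)))

  Horner-iter : ∀ {q} n {g} → Horner q n g → ∀ k → iter q n g k ≡ 0#
  Horner-iter     zero    (nil e) k = e k
  Horner-iter {q} (suc n) {g} h   k = trans (sym (iter-Δ q n g k)) (Horner-iter n (Horner-Δ h) k)

  Horner-∑ : ∀ {q} n (c : ℕ → ℕ → A) → (∀ i → Periodic q (c i)) → Horner q n (λ k → ∑ n (λ i → c i k * nat k ^′ i))
  Horner-∑ zero    c p = nil (λ _ → refl)
  Horner-∑ (suc n) c p = cons (c 0) (p 0) (Horner-∑ n (c ∘ suc) (p ∘ suc)) (λ k → cong₂ _+_ (*-identityʳ _)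
    (trans (∑-cong n (λ i → solve 3 (λ a x y → a :* (x :* y) := x :* (a :* y)) refl (c (suc i) k) (nat k) (nat k ^′ i))) (∑-* (nat k) n _)))

  module Interpolation (inv : ℕ → A) (nat-inv : ∀ n → nat (suc n) * inv n ≡ 1#) (ℓ′ : ℕ) where
    ℓ = suc ℓ′

    -- 1/(ℓ(j + 1)): `inv n` is 1/(n + 1), and ℓ(j + 1) = 1 + (j + ℓ′(j + 1)).
    scale : ℕ → A
    scale j = inv (j ℕ.+ ℓ′ ℕ.* suc j)

    nat-scale : ∀ j → nat ℓ * nat (suc j) * scale j ≡ 1#
    nat-scale j = trans (*-congʳ (trans (sym (ι-* _ _)) (cong ι (sym (ℤP.pos-* ℓ (suc j)))))) (nat-inv (j ℕ.+ ℓ′ ℕ.* suc j))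

    -- Coefficients of the polynomial in k whose value at k = r + iℓ is binom i j.
    coef : ℕ → ℕ → ℕ → A
    coef r zero    i       = eq₀ i
      where
      eq₀ : ℕ → A
      eq₀ zero    = 1#
      eq₀ (suc _) = 0#
    coef r (suc j) zero    = scale j * (- (nat (r ℕ.+ j ℕ.* ℓ) * coef r j 0))
    coef r (suc j) (suc i) = scale j * (coef r j i + - (nat (r ℕ.+ j ℕ.* ℓ) * coef r j (suc i)))

    coef-0 : ∀ r j i → j < i → coef r j i ≡ 0#
    coef-0 r zero    (suc i) _       = refl
    coef-0 r (suc j) (suc i) (s≤s p) = trans (*-congˡ (trans (cong₂ (λ a b → a + - (nat (r ℕ.+ j ℕ.* ℓ) * b)) (coef-0 r j i p) (coef-0 r j (suc i) (ℕP.<-trans p ℕP.≤-refl)))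
      (trans (+-identityˡ _) (trans (cong -_ (zeroʳ _)) -0≡0)))) (zeroʳ _)

    -- The leading coefficient is 1/(ℓ^j j!), so the witness z is ℓ^j j!.
    coef-top : ∀ r j → ∃[ z ] z * coef r j j ≡ 1#
    coef-top r zero    = 1# , *-identityˡ 1#
    coef-top r (suc j) with coef-top r j
    ... | z , e = nat ℓ * nat (suc j) * z , (begin
      nat ℓ * nat (suc j) * z * (scale j * (coef r j j + - (nat (r ℕ.+ j ℕ.* ℓ) * coef r j (suc j))))
        ≡⟨ *-congˡ (*-congˡ (trans (+-congˡ (trans (cong -_ (trans (*-congˡ (coef-0 r j (suc j) ℕP.≤-refl)) (zeroʳ _))) -0≡0)) (+-identityʳ _))) ⟩
      nat ℓ * nat (suc j) * z * (scale j * coef r j j)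
        ≡⟨ solve 4 (λ a z s c → a :* z :* (s :* c) := a :* s :* (z :* c)) refl (nat ℓ * nat (suc j)) z (scale j) (coef r j j) ⟩
      nat ℓ * nat (suc j) * scale j * (z * coef r j j)
        ≡⟨ cong₂ _*_ (nat-scale j) e ⟩
      1# * 1# ≡⟨ *-identityˡ 1# ⟩
      1# ∎)

    ev : ℕ → (ℕ → A) → A → A
    ev d c x = ∑ (suc d) (λ i → c i * x ^′ i)

    ev-extend : ∀ {j d} c x → j ≤ d → (∀ i → j < i → c i ≡ 0#) → ev d c x ≡ ev j c x
    ev-extend {j} {d} c x p z = ∑-extend (suc j) (suc d) _ (s≤s p) (λ i q → trans (*-congʳ {x ^′ i} (z i q)) (zeroˡ _))

    ev-suc : ∀ r j x → ev (suc j) (coef r (suc j)) x ≡ scale j * ((x + - nat (r ℕ.+ j ℕ.* ℓ)) * ev j (coef r j) x)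
    ev-suc r j x = begin
      s * (- (t * c 0)) * 1# + ∑ (suc j) (λ i → s * (c i + - (t * c (suc i))) * (x * x ^′ i))
        ≡⟨ cong₂ _+_ (solve 4 (λ s t c o → s :* (:- (t :* c)) :* o := s :* (:- t :* (c :* o))) refl s t (c 0) 1#)
             (trans (∑-cong (suc j) (λ i → solve 6 (λ s c t c′ x y → s :* (c :+ :- (t :* c′)) :* (x :* y) := s :* (x :* (c :* y)) :+ s :* (:- t :* (c′ :* (x :* y)))) refl s (c i) t (c (suc i)) x (x ^′ i)))
               (trans (∑-+ (suc j) (λ i → s * (x * f₁ i)) (λ i → s * (- t * f₂ i))) (cong₂ _+_
                 (trans (∑-* s (suc j) (λ i → x * f₁ i)) (*-congˡ (∑-* x (suc j) f₁)))
                 (trans (∑-* s (suc j) (λ i → - t * f₂ i)) (*-congˡ (∑-* (- t) (suc j) f₂)))))) ⟩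
      s * (- t * (c 0 * 1#)) + (s * (x * ev j c x) + s * (- t * ∑ (suc j) (λ i → c (suc i) * (x * x ^′ i))))
        ≡⟨ solve 5 (λ s t a e b → s :* (:- t :* a) :+ (s :* e :+ s :* (:- t :* b)) := s :* (e :+ :- t :* (a :+ b))) refl s t (c 0 * 1#) (x * ev j c x) _ ⟩
      s * (x * ev j c x + - t * ev (suc j) c x)
        ≡⟨ *-congˡ (trans (+-congˡ (*-congˡ (ev-extend c x (ℕP.n≤1+n j) (coef-0 r j)))) (sym (distribʳ _ _ _))) ⟩
      s * ((x + - t) * ev j c x) ∎
      where
      s = scale j
      t = nat (r ℕ.+ j ℕ.* ℓ)
      c = coef r j
      f₁ f₂ : ℕ → A
      f₁ i = c i * x ^′ i
      f₂ i = c (suc i) * (x * x ^′ i)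

    -- At x = r + iℓ the factor x - (r + jℓ) equals ℓ(i - j), so the recursion of the coefficients
    -- turns into `absorption`.
    ev-binom : ∀ r i j → ev j (coef r j) (nat (r ℕ.+ i ℕ.* ℓ)) ≡ nat (binom i j)
    ev-binom r i zero    = trans (+-identityʳ _) (trans (*-identityˡ _) (sym ι-1))
    ev-binom r i (suc j) = begin
      ev (suc j) (coef r (suc j)) x
        ≡⟨ ev-suc r j x ⟩
      scale j * ((x + - nat (r ℕ.+ j ℕ.* ℓ)) * ev j (coef r j) x)
        ≡⟨ *-congˡ (cong₂ _*_ gap (ev-binom r i j)) ⟩
      scale j * (nat ℓ * (nat i + - nat j) * nat (binom i j))
        ≡⟨ *-congˡ (trans (*-assoc _ _ _) (*-congˡ (sym (absorption i j)))) ⟩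
      scale j * (nat ℓ * (nat (suc j) * nat (binom i (suc j))))
        ≡⟨ solve 4 (λ s l n b → s :* (l :* (n :* b)) := l :* n :* s :* b) refl (scale j) (nat ℓ) (nat (suc j)) _ ⟩
      nat ℓ * nat (suc j) * scale j * nat (binom i (suc j))
        ≡⟨ trans (*-congʳ (nat-scale j)) (*-identityˡ _) ⟩
      nat (binom i (suc j)) ∎
      where
      x = nat (r ℕ.+ i ℕ.* ℓ)
      nat-affine : ∀ i → nat (r ℕ.+ i ℕ.* ℓ) ≡ nat r + nat i * nat ℓ
      nat-affine i = trans (nat-+ r _) (+-congˡ (trans (cong ι (ℤP.pos-* i ℓ)) (ι-* _ _)))
      gap : x + - nat (r ℕ.+ j ℕ.* ℓ) ≡ nat ℓ * (nat i + - nat j)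
      gap = trans (cong₂ (λ a b → a + - b) (nat-affine i) (nat-affine j))
        (solve 4 (λ r i j l → (r :+ i :* l) :+ :- (r :+ j :* l) := l :* (i :+ :- j)) refl (nat r) (nat i) (nat j) (nat ℓ))

    module _ (d : ℕ) (u : ℕ → A) where

      quasiCoef : ℕ → ℕ → A
      quasiCoef i k = ∑ (suc d) (λ j → iter ℓ j u (k % ℓ) * coef (k % ℓ) j i)

      quasiCoef-periodic : ∀ i k → quasiCoef i (k ℕ.+ ℓ) ≡ quasiCoef i k
      quasiCoef-periodic i k = cong (λ r → ∑ (suc d) (λ j → iter ℓ j u r * coef r j i)) ([m+n]%n≡m%n k ℓ)

      quasiCoef-expansion : (∀ k → iter ℓ (suc d) u k ≡ 0#) → ∀ k → u k ≡ ∑ (suc d) (λ i → quasiCoef i k * nat k ^′ i)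
      quasiCoef-expansion h k = begin
        u k
          ≡⟨ cong u k≡ ⟩
        u (r ℕ.+ q ℕ.* ℓ)
          ≡⟨ newton ℓ d u h r q ⟩
        ∑ (suc d) (λ j → iter ℓ j u r * nat (binom q j))
          ≡⟨ ∑-cong< (suc d) (λ j p → *-congˡ {iter ℓ j u r} (trans (sym (trans (cong (ev j (coef r j) ∘ nat) k≡) (ev-binom r q j))) (sym (ev-extend (coef r j) (nat k) (ℕP.≤-pred p) (coef-0 r j))))) ⟩
        ∑ (suc d) (λ j → iter ℓ j u r * ev d (coef r j) (nat k))
          ≡⟨ ∑-cong (suc d) (λ j → sym (∑-* (iter ℓ j u r) (suc d) (λ i → coef r j i * nat k ^′ i))) ⟩
        ∑ (suc d) (λ j → ∑ (suc d) (λ i → iter ℓ j u r * (coef r j i * nat k ^′ i)))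
          ≡⟨ ∑-swap (suc d) (suc d) (λ j i → iter ℓ j u r * (coef r j i * nat k ^′ i)) ⟩
        ∑ (suc d) (λ i → ∑ (suc d) (λ j → iter ℓ j u r * (coef r j i * nat k ^′ i)))
          ≡⟨ ∑-cong (suc d) (λ i → trans (∑-cong (suc d) (λ j → solve 3 (λ a b x → a :* (b :* x) := x :* (a :* b)) refl (iter ℓ j u r) (coef r j i) (nat k ^′ i)))
               (trans (∑-* (nat k ^′ i) (suc d) (λ j → iter ℓ j u r * coef r j i)) (*-comm _ _))) ⟩
        ∑ (suc d) (λ i → quasiCoef i k * nat k ^′ i) ∎
        where
        r = k % ℓ
        q = k / ℓ
        k≡ : k ≡ r ℕ.+ q ℕ.* ℓ
        k≡ = m≡m%n+[m/n]*n k ℓ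

      -- The polynomial interpolating binom i j has degree j, so only j = d reaches degree d.
      quasiCoef-top : ∀ k → quasiCoef d k ≡ iter ℓ d u (k % ℓ) * coef (k % ℓ) d d
      quasiCoef-top k = last d (λ j → iter ℓ j u (k % ℓ) * coef (k % ℓ) j d) (λ j p → trans (*-congˡ (coef-0 (k % ℓ) j d p)) (zeroʳ _))
        where
        last : ∀ d f → (∀ j → j < d → f j ≡ 0#) → ∑ (suc d) f ≡ f d
        last zero    f z = +-identityʳ _
        last (suc d) f z = trans (+-congʳ (z 0 (s≤s z≤n))) (trans (+-identityˡ _) (last d (f ∘ suc) (λ j p → z (suc j) (s≤s p))))

      quasiCoef-nonzero : ∀ k → iter ℓ d u (k % ℓ) ≢ 0# → quasiCoef d k ≢ 0#
      quasiCoef-nonzero k n e with coef-top (k % ℓ) d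
      ... | z , ze = n (begin
        i                              ≡⟨ *-identityʳ i ⟨
        i * 1#                         ≡⟨ *-congˡ ze ⟨
        i * (z * coef (k % ℓ) d d)     ≡⟨ solve 3 (λ i z c → i :* (z :* c) := z :* (i :* c)) refl i z _ ⟩
        z * (i * coef (k % ℓ) d d)     ≡⟨ *-congˡ (trans (sym (quasiCoef-top k)) e) ⟩
        z * 0#                         ≡⟨ zeroʳ z ⟩
        0# ∎)
        where
        i = iter ℓ d u (k % ℓ)

-- Quasipolynomials and their periods

module Quasipolynomials where
  open Cyclotomics public
  module ΔZ = Differences ℤ-charZeroRing
  module ΔQ = Differences ℚ-charZeroRing
  module Q = Alternants ℚ-charZeroRing
  open import Data.Integer using (_+_; _*_; -_; _>_)

  -- Multiplication by 1 - x^s is a backward difference; the forward difference reads the same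
  -- series n s places further on.
  iter-pow : ∀ s n g k → ΔZ.iter s n g k ≡ (pow (E s) n ⊛ g) (k ℕ.+ n ℕ.* s)
  iter-pow s zero    g k = trans (sym (⊛-identityˡ g .at k)) (cong (oneS ⊛ g) (sym (ℕP.+-identityʳ k)))
  iter-pow s (suc n) g k = trans (cong₂ (λ a b → a + - b) (trans (iter-pow s n g (k ℕ.+ s)) (cong h (arith₁ k s (n ℕ.* s)))) (iter-pow s n g k))
    (sym (trans (⊛-associative (E s) (pow (E s) n) g .at N) (trans (E-⊛ s h N)
      (cong (λ t → h N + - t) (Z.sub-at {s} {N} {f = h} (arith₂ k s (n ℕ.* s)))))))
    where
    h = pow (E s) n ⊛ g
    N = k ℕ.+ (s ℕ.+ n ℕ.* s)
    arith₁ : ∀ k s t → k ℕ.+ s ℕ.+ t ≡ k ℕ.+ (s ℕ.+ t)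
    arith₁ = solve-∀
    arith₂ : ∀ k s t → k ℕ.+ (s ℕ.+ t) ≡ s ℕ.+ (k ℕ.+ t)
    arith₂ = solve-∀

  toℚ-iter : ∀ s n g k → ΔQ.iter s n (toℚ ∘ g) k ≡ toℚ (ΔZ.iter s n g k)
  toℚ-iter s zero    g k = refl
  toℚ-iter s (suc n) g k = sym (trans (toℚ-+ (ΔZ.iter s n g (k ℕ.+ s)) (- ΔZ.iter s n g k)) (cong₂ ℚ._+_ (sym (toℚ-iter s n g (k ℕ.+ s)))
    (trans (toℚ-neg (ΔZ.iter s n g k)) (cong ℚ.-_ (sym (toℚ-iter s n g k))))))

  sumℚ-upTo : ∀ n h → sumℚ (map h (upTo n)) ≡ Q.∑ n h
  sumℚ-upTo n h = trans (cong sumℚ (ListP.map-upTo h n)) (go n h)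
    where
    go : ∀ n h → sumℚ (applyUpTo h n) ≡ Q.∑ n h
    go zero    h = refl
    go (suc n) h = cong (h 0 ℚ.+_) (go n (h ∘ suc))

  powℚ-^ : ∀ x n → powℚ x n ≡ x ΔQ.^′ n
  powℚ-^ x zero    = refl
  powℚ-^ x (suc n) = cong (x ℚ.*_) (powℚ-^ x n)

  quasi-sum : ∀ n (c : ℕ → ℕ → ℚ) k → sumℚ (map (λ i → c i k ℚ.* powℚ (ℤ.+ k ℚ./ 1) i) (upTo n)) ≡ Q.∑ n (λ i → c i k ℚ.* (Q.nat k ΔQ.^′ i))
  quasi-sum n c k = trans (sumℚ-upTo n _) (Q.∑-cong n (λ i → cong (c i k ℚ.*_) (powℚ-^ (ℤ.+ k ℚ./ 1) i)))

  -- With b < (d + 1)ℓ the numerator has smaller degree than the denominator, so the (d + 1)-st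
  -- difference vanishes from k = 0 on and there is no exceptional initial segment. The last
  -- hypothesis makes the top coefficient nonzero on the residue class of 0.
  isQuasiPoly : ∀ ℓ d g b → 1 ≤ ℓ → Bounded b (pow (E ℓ) (suc d) ⊛ g) → b < suc d ℕ.* ℓ → (pow (E ℓ) d ⊛ g) (d ℕ.* ℓ) ≢ ℤ.+ 0 →
    IsQuasiPoly (toℚ ∘ g) d ℓ
  isQuasiPoly (suc ℓ′) d g b 1≤ℓ bd b< nz = 1≤ℓ , quasiCoef d u , quasiCoef-periodic d u , (0 , quasiCoef-nonzero d u 0 top) ,
    λ k → trans (quasiCoef-expansion d u vanish k) (sym (quasi-sum (suc d) (quasiCoef d u) k))
    where
    open ΔQ.Interpolation (λ n → ℚ.fromℚᵘ (mkℚᵘ (ℤ.+ 1) n)) toℚ-inverse ℓ′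
    u : ℕ → ℚ
    u = toℚ ∘ g
    vanish : ∀ k → ΔQ.iter (suc ℓ′) (suc d) u k ≡ ℚ.0ℚ
    vanish k = trans (toℚ-iter (suc ℓ′) (suc d) g k) (cong toℚ (trans (iter-pow (suc ℓ′) (suc d) g k)
      (bd (k ℕ.+ suc d ℕ.* suc ℓ′) (ℕP.<-≤-trans b< (ℕP.m≤n+m _ k)))))
    top : ΔQ.iter (suc ℓ′) d u 0 ≢ ℚ.0ℚ
    top e = nz (trans (sym (iter-pow (suc ℓ′) d g 0)) (toℚ-injective (trans (sym (toℚ-iter (suc ℓ′) d g 0)) e)))

  -- Each difference of step q lowers the degree of a quasipolynomial of period q, so d + 1 of them
  -- annihilate it.
  quasiPoly-vanish : ∀ g d q → IsQuasiPoly (toℚ ∘ g) d q → Bounded (suc d ℕ.* q) (pow (E q) (suc d) ⊛ g)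
  quasiPoly-vanish g d q (_ , c , periodic , _ , e) k k> = trans (cong (pow (E q) (suc d) ⊛ g) (sym (ℕP.m∸n+n≡m (ℕP.<⇒≤ k>))))
    (trans (sym (iter-pow q (suc d) g k′)) (toℚ-injective (trans (sym (toℚ-iter q (suc d) g k′))
      (ΔQ.Horner-iter (suc d) (ΔQ.Horner-ext (λ k → sym (trans (e k) (quasi-sum (suc d) c k))) (ΔQ.Horner-∑ (suc d) c periodic)) k′))))
    where
    k′ = k ∸ suc d ℕ.* q

  -- If E m ⊛ h = 1 then h is the indicator of the multiples of m.
  module Indicator (m′ : ℕ) (h : Series) (Eh : E (suc m′) ⊛ h ≈ oneS) where
    m = suc m′

    periodic : ∀ k → h (k ℕ.+ m) ≡ h k
    periodic k = minus-zero (h (k ℕ.+ m)) (h k) (trans (cong (λ t → h (k ℕ.+ m) + - t) (sym (Z.sub-at {m} {k ℕ.+ m} (ℕP.+-comm k m))))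
      (trans (sym (E-⊛ m h (k ℕ.+ m))) (trans (Eh .at (k ℕ.+ m)) (cong oneS (ℕP.+-suc k m′)))))
      where
      minus-zero : ∀ x y → x + - y ≡ ℤ.+ 0 → x ≡ y
      minus-zero = Z.x-y≡0⇒x≡y

    periodic* : ∀ t k → h (k ℕ.+ t ℕ.* m) ≡ h k
    periodic* zero    k = cong h (ℕP.+-identityʳ k)
    periodic* (suc t) k = trans (cong h (arith k m (t ℕ.* m))) (trans (periodic (k ℕ.+ t ℕ.* m)) (periodic* t k))
      where
      arith : ∀ k m t → k ℕ.+ (m ℕ.+ t) ≡ k ℕ.+ t ℕ.+ m
      arith = solve-∀

    below : ∀ s → s < m → h s ≡ oneS s
    below s p = trans (sym (trans (cong (λ t → h s + - t) (Z.sub-< {m} {s} h p)) (ℤP.+-identityʳ (h s)))) (trans (sym (E-⊛ m h s)) (Eh .at s))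

    divides-of-one : ∀ k → h k ≡ ℤ.+ 1 → m ∣ k
    divides-of-one k e = go (k % m) refl
      where
      k≡ : k ≡ k % m ℕ.+ (k / m) ℕ.* m
      k≡ = m≡m%n+[m/n]*n k m
      value : h k ≡ oneS (k % m)
      value = trans (cong h k≡) (trans (periodic* (k / m) (k % m)) (below (k % m) (m%n<n k m)))
      go : ∀ s → k % m ≡ s → m ∣ k
      go zero    z = divides (k / m) (trans k≡ (cong (ℕ._+ (k / m) ℕ.* m) z))
      go (suc s) z = ⊥-elim (0≢1 (trans (sym (cong oneS z)) (trans (sym value) e)))
        where
        0≢1 : ℤ.+ 0 ≢ ℤ.+ 1
        0≢1 ()

    -- Along a progression of step q the periodic h is eventually polynomial, hence constant.
    divides-period : ∀ q N b → Bounded b (pow (E q) (suc N) ⊛ h) → m ∣ q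
    divides-period q N b bd = Div.∣m+n∣m⇒∣n (divides-of-one (K ℕ.+ q) (trans (cong (λ t → h (K ℕ.+ t)) (sym (ℕP.+-identityʳ q))) (trans step (trans (cong h (ℕP.+-identityʳ K)) hK)))) (divides (suc b) refl)
      where
      -- A multiple of m beyond the bound b: there h is 1, and the differences along K + i q already
      -- vanish.
      K = suc b ℕ.* m
      u : ℕ → ℤ
      u i = h (K ℕ.+ i ℕ.* q)
      hK : h K ≡ ℤ.+ 1
      hK = trans (periodic* (suc b) 0) (below 0 (s≤s z≤n))
      u-periodic : ∀ i → u (i ℕ.+ m) ≡ u i
      u-periodic i = trans (cong h (arith K i m q)) (periodic* q (K ℕ.+ i ℕ.* q))
        where
        arith : ∀ K i m q → K ℕ.+ (i ℕ.+ m) ℕ.* q ≡ K ℕ.+ i ℕ.* q ℕ.+ q ℕ.* m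
        arith = solve-∀
      vanish : ∀ i → ΔZ.iter 1 (suc N) u i ≡ ℤ.+ 0
      vanish i = trans (ΔZ.iter-step q (suc N) h K i) (trans (iter-pow q (suc N) h (K ℕ.+ i ℕ.* q))
        (bd _ (ℕP.≤-trans (ℕP.≤-trans (ℕP.m≤m*n (suc b) m) (ℕP.m≤m+n K (i ℕ.* q))) (ℕP.m≤m+n _ (suc N ℕ.* q)))))
      step : u 1 ≡ u 0
      step = Z.x-y≡0⇒x≡y (u 1) (u 0) (ΔZ.periodic-polynomial m′ N u u-periodic vanish 0)

  interParts-∈ : ∀ a m → 1 ≤ m → m ≤ suc a → m ∈ interParts a
  interParts-∈ a       m p q with ℕP.m≤n⇒m<n∨m≡n q
  interParts-∈ a       m p q | inj₂ refl = here refl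
  interParts-∈ zero    m p q | inj₁ (s≤s r) = ⊥-elim (ℕP.<⇒≱ p r)
  interParts-∈ (suc a) m p q | inj₁ (s≤s r) = there (there (interParts-∈ a m p r))

  coloured-∈ : ∀ a m → 1 ≤ a → 1 ≤ m → m ≤ suc a → m ∈ colouredParts a
  coloured-∈ a m 1≤a p q with PermP.∈-resp-↭ (interParts-↭ a 1≤a) (interParts-∈ a m p q)
  ... | here refl = here refl
  ... | there i   = i

  period-divisible : ∀ a f d q → 1 ≤ a → Den (colouredParts a) ⊛ f ≈ oneS → IsQuasiPoly (toℚ ∘ f) d q → ∀ m → 1 ≤ m → m ≤ suc a → m ∣ q
  period-divisible a f d q 1≤a e quasi (suc m′) p r with ∈-∃++ (coloured-∈ a (suc m′) 1≤a p r)
  ... | ps , ss , split = Indicator.divides-period m′ h Eh q d (sum rest ℕ.+ suc d ℕ.* q) bounded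
    where
    rest = ps ++ ss
    h = Den rest ⊛ f
    Eh : E (suc m′) ⊛ h ≈ oneS
    Eh = ≈-trans (≈-sym (⊛-associative (E (suc m′)) (Den rest) f)) (≈-trans (⊛-congʳ (≈-sym (product-↭ (PermP.map⁺ E
      (↭-trans (Perm.↭-reflexive split) (PermP.shift (suc m′) ps ss)))))) e)
    bounded : Bounded (sum rest ℕ.+ suc d ℕ.* q) (pow (E q) (suc d) ⊛ h)
    bounded k k> = trans (solve 3 (λ a b c → a :* (b :* c) := b :* (a :* c)) ≈-refl (pow (E q) (suc d)) (Den rest) f .at k)
      (Den-Bounded rest (suc d ℕ.* q) (pow (E q) (suc d) ⊛ f) (quasiPoly-vanish f d q quasi) k k>)

-- Degree, positivity, symmetry and exact period for fixed a

module Consequences (a : ℕ) (1≤a : 1 ≤ a) (f : ℕ → ℤ) (e : PowerSeries._≈_ (PowerSeries._⊛_ (GeneratingFunction.Den (colouredParts a)) f) PowerSeries.oneS) where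
  open Quasipolynomials
  open import Data.Integer using (_+_; _*_; -_; _>_)
  open ≈-Reasoning

  ℓ : ℕ
  ℓ = lcmUpTo a

  js rest : List ℕ
  js   = colouredParts a
  rest = drop 1 js

  1≤ℓ : 1 ≤ ℓ
  1≤ℓ = lcmUpTo-positive a

  factors : Factors ℓ js
  factors = coloured-factors a 1≤a

  ≤ℓ : All (_≤ ℓ) js
  ≤ℓ = All.map (λ (_ , d) → Div.∣⇒≤ {{ℕ.>-nonZero 1≤ℓ}} d) factors

  P≈Num : Pcoef f a ≈ Num ℓ js
  P≈Num = Pcoef-Num f a 1≤a e

  degree-sum : degP a ℕ.+ a ℕ.* (a ℕ.+ 2) ≡ 2 ℕ.* a ℕ.* ℓ
  excess≡degP : excess ℓ js ≡ degP a

  excess-total : excess ℓ js ℕ.+ a ℕ.* (a ℕ.+ 2) ≡ 2 ℕ.* a ℕ.* ℓ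
  excess-total = trans (cong (excess ℓ js ℕ.+_) (sym (sum-coloured a 1≤a))) (trans (excess-sum ℓ js ≤ℓ) (cong (ℕ._* ℓ) (length-coloured a 1≤a)))

  excess≡degP = trans (sym (ℕP.m+n∸n≡m (excess ℓ js) (a ℕ.* (a ℕ.+ 2)))) (cong₂ _∸_ (trans excess-total (arith a ℓ)) (ℕP.*-comm a (a ℕ.+ 2)))
    where
    arith : ∀ a l → 2 ℕ.* a ℕ.* l ≡ 2 ℕ.* l ℕ.* a
    arith = solve-∀

  degree-sum = trans (cong (ℕ._+ a ℕ.* (a ℕ.+ 2)) (sym excess≡degP)) excess-total

  degP+2≤ : suc (suc (degP a)) ≤ 2 ℕ.* a ℕ.* ℓ
  degP+2≤ = ℕP.≤-trans (ℕP.≤-reflexive (ℕP.+-comm 2 (degP a)))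
    (ℕP.≤-trans (ℕP.+-monoʳ-≤ (degP a) (ℕP.≤-trans (ℕP.m≤n+m 2 a) (ℕP.m≤n*m (a ℕ.+ 2) a {{ℕ.>-nonZero 1≤a}}))) (ℕP.≤-reflexive degree-sum))

  -- The part 1 is taken first: its geometric sum 1 + x + ... + x^(ℓ-1) has no gaps and degree ℓ -
  -- 1, so every further part j ≤ ℓ meets the window condition of `geo-Positive`.
  positive-bounded : Positive (degP a) (Num ℓ js) × Bounded (degP a) (Num ℓ js)
  positive-bounded = go (quo ℓ 1) refl
    where
    go : ∀ q → quo ℓ 1 ≡ q → Positive (degP a) (Num ℓ js) × Bounded (degP a) (Num ℓ js)
    go zero    q≡ = ⊥-elim (ℕP.<⇒≱ 1≤ℓ (ℕP.≤-reflexive (sym (trans (cong (ℕ._* 1) (sym q≡)) (quo-* {ℓ} {1} ℕP.≤-refl (Div.1∣ ℓ))))))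
    go (suc q) q≡ = subst (λ t → Positive t (Num ℓ js) × Bounded t (Num ℓ js)) degree
        (≈-Positive reorder (proj₁ result) , λ k p → trans (sym (reorder .at k)) (proj₂ result k p))
      where
      suc-q : suc (q ℕ.* 1) ≡ ℓ
      suc-q = trans (cong (ℕ._* 1) (sym q≡)) (quo-* {ℓ} {1} ℕP.≤-refl (Div.1∣ ℓ))
      first : Positive (q ℕ.* 1) (geo 1 (suc q) ⊛ oneS) × Bounded (q ℕ.* 1) (geo 1 (suc q) ⊛ oneS)
      first = geo-Positive 1 q 0 oneS ℕP.≤-refl (λ { zero _ → ℤ.+<+ (s≤s z≤n) }) one-Bounded
      result = Num-Positive ℓ rest (q ℕ.* 1) (geo 1 (suc q) ⊛ oneS) (All.tail factors) (All.map (λ p → ℕP.≤-trans p (ℕP.≤-reflexive (sym suc-q))) (All.tail ≤ℓ)) 1≤ℓ (proj₁ first) (proj₂ first)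
      degree : q ℕ.* 1 ℕ.+ excess ℓ rest ≡ degP a
      degree = trans (cong (λ t → t ∸ 1 ℕ.+ excess ℓ rest) suc-q) excess≡degP
      reorder : Num ℓ rest ⊛ (geo 1 (suc q) ⊛ oneS) ≈ Num ℓ js
      reorder = ≈-trans (solve 2 (λ r g → r :* (g :* con (ℤ.+ 1)) := g :* r) ≈-refl (Num ℓ rest) (geo 1 (suc q)))
        (⊛-congʳ (subst (λ t → geo 1 (suc q) ≈ geo 1 t) (sym q≡) ≈-refl))

  P-positive : ∀ k → k ≤ degP a → Pcoef f a k > ℤ.+ 0
  P-positive k p = subst (_> ℤ.+ 0) (sym (P≈Num .at k)) (proj₁ positive-bounded k p)

  P-bounded : Bounded (degP a) (Pcoef f a)
  P-bounded k p = trans (P≈Num .at k) (proj₂ positive-bounded k p)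

  P-degree : IsDegree (Pcoef f a) (degP a)
  P-degree = (λ z → ℤP.<-irrefl (sym z) (P-positive (degP a) ℕP.≤-refl)) , P-bounded

  P-palindromic : ∀ k → k ≤ degP a → Pcoef f a k ≡ Pcoef f a (degP a ∸ k)
  P-palindromic k p = trans (P≈Num .at k) (trans (sym (palindrome .at k)) (trans (Z.sub-at {k} {degP a} (sym (ℕP.m+[n∸m]≡n p))) (sym (P≈Num .at (degP a ∸ k)))))
    where
    palindrome : rev (degP a) (Num ℓ js) ≈ Num ℓ js
    palindrome = Num-palindromic a ℓ js (degP a) (length-coloured a 1≤a) factors (proj₂ positive-bounded)
      (trans (ℕP.+-comm (sum js) (degP a)) (trans (cong (degP a ℕ.+_) (sum-coloured a 1≤a)) degree-sum))

  P-countColoured : ∀ k → Pcoef f a k ≡ ℤ.+ countColoured ℓ js k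
  P-countColoured k = trans (P≈Num .at k) (sym (countColoured-Num ℓ js factors k))

  P-cyclotomic : ∀ k → Pcoef f a k ≡ coeffP (prodP (map cyclotomic (cyclotomicIndices ℓ js))) k
  P-cyclotomic k = ≈-trans P≈Num (≈-sym (≈-trans (∏Φ-coeffP (cyclotomicIndices ℓ js)) (∏Φ-Num ℓ js 1≤ℓ factors))) .at k

  d : ℕ
  d = 2 ℕ.* a ∸ 1

  suc-d : suc d ≡ 2 ℕ.* a
  suc-d = ℕP.m+[n∸m]≡n (ℕP.≤-trans 1≤a (ℕP.m≤m+n a _))

  length-rest : length rest ≡ d
  length-rest = ℕP.suc-injective (trans (length-coloured a 1≤a) (sym suc-d))

  Num-0 : ∀ is → Factors ℓ is → Num ℓ is 0 ≡ ℤ.+ 1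
  Num-0 []           _                    = refl
  Num-0 (suc i ∷ is) ((p , dv) ∷ fs) = trans (cong₂ _*_ (first (quo ℓ (suc i)) refl) (Num-0 is fs)) refl
    where
    first : ∀ q → quo ℓ (suc i) ≡ q → geo (suc i) q 0 ≡ ℤ.+ 1
    first zero    q≡ = ⊥-elim (ℕP.<⇒≱ 1≤ℓ (ℕP.≤-reflexive (sym (trans (cong (ℕ._* suc i) (sym q≡)) (quo-* {ℓ} {suc i} p dv)))))
    first (suc q) q≡ = refl

  -- (1 − x) times this series is Num ℓ rest, so its coefficients are increasing partial sums.
  partial : Series
  partial = pow (E ℓ) d ⊛ f

  E-partial : E 1 ⊛ partial ≈ Num ℓ rest
  E-partial = begin
    E 1 ⊛ (pow (E ℓ) d ⊛ f)
      ≈⟨ ⊛-congˡ {E 1} (⊛-congʳ (≈-trans (subst (λ t → pow (E ℓ) d ≈ pow (E ℓ) t) (sym length-rest) ≈-refl) (≈-sym (Den-Num ℓ rest (All.tail factors))))) ⟩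
    E 1 ⊛ (Den rest ⊛ Num ℓ rest ⊛ f)
      ≈⟨ solve 4 (λ a b c d → a :* (b :* c :* d) := a :* b :* d :* c) ≈-refl (E 1) (Den rest) (Num ℓ rest) f ⟩
    Den js ⊛ f ⊛ Num ℓ rest
      ≈⟨ ⊛-congʳ e ⟩
    oneS ⊛ Num ℓ rest
      ≈⟨ ⊛-identityˡ (Num ℓ rest) ⟩
    Num ℓ rest ∎

  partial-positive : ∀ k → partial k > ℤ.+ 0
  partial-positive zero    = subst (_> ℤ.+ 0) (sym (trans (sym (ℤP.+-identityʳ (partial 0))) (trans (sym (E-⊛ 1 partial 0)) (trans (E-partial .at 0) (Num-0 rest (All.tail factors)))))) (ℤ.+<+ (s≤s z≤n))
  partial-positive (suc k) = subst (_> ℤ.+ 0) (sym (trans (arith (partial (suc k)) (partial k)) (cong (partial k +_) (trans (sym (E-⊛ 1 partial (suc k))) (E-partial .at (suc k))))))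
    (ℤP.+-mono-<-≤ (partial-positive k) (subst (ℤ._≥ ℤ.+ 0) (countColoured-Num ℓ rest (All.tail factors) (suc k)) (ℤ.+≤+ z≤n)))
    where
    arith : ∀ x y → x ≡ y + (x + - y)
    arith = solve-∀-ℤ

  -- The numerator has degree at most 2aℓ - 2, and the d-th difference at 0 is a coefficient of
  -- `partial`, all of which are positive.
  quasi : IsQuasiPoly (toℚ ∘ f) d ℓ
  quasi = isQuasiPoly ℓ d f (degP a) 1≤ℓ
    (λ k p → trans (subst (λ t → (pow (E ℓ) t ⊛ f) k ≡ Pcoef f a k) (sym suc-d) (sym (Pcoef-⊛ f a .at k))) (P-bounded k p))
    (subst (λ t → degP a < t ℕ.* ℓ) (sym suc-d) (ℕP.≤-trans (ℕP.n≤1+n _) degP+2≤))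
    (λ z → ℤP.<-irrefl (sym z) (partial-positive (d ℕ.* ℓ)))

  hasPeriod : HasPeriod (toℚ ∘ f) d ℓ
  hasPeriod = quasi , λ q quasi-q → Div.∣⇒≤ {{ℕ.>-nonZero (proj₁ quasi-q)}} (foldr-lcm-least q (range1 (suc a))
    (all-range1 (suc a) (period-divisible a f d q 1≤a e quasi-q)))

  functional-equation : RatFunSymmetry f (a ℕ.* (a ℕ.+ 2))
  functional-equation = subst (RatFunSymmetry f) (sum-coloured a 1≤a) (symmetry a js f (length-coloured a 1≤a) (All.map proj₁ factors) e)

-- The parts 1, 2, 2̄, 3 give 1, 1 and 3 coloured partitions of 0, 1 and 2, and 1 + 3 > 2 · 1.
not-concave : ∀ f → (∀ k → Pcoef f 2 k ≡ ℤ.+ countColoured (lcmUpTo 2) (colouredParts 2) k) → ¬ Concave (Pcoef f 2) (degP 2)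
not-concave f h concave = absurd (subst₂ ℤ._≤_ (cong₂ ℤ._+_ (h 0) (h 2)) (cong (ℤ.+ 2 ℤ.*_) (h 1)) (concave 1 (s≤s z≤n) (s≤s (s≤s z≤n))))
  where
  absurd : ¬ (ℤ.+ 4 ℤ.≤ ℤ.+ 2)
  absurd (ℤ.+≤+ (s≤s (s≤s ())))

open import Data.Nat using (ℕ; _+_; _*_; _∸_; _≤_; _<_)
open import Data.Nat.Divisibility using (_∣_)
open import Data.Integer using (ℤ; +_; _>_)
open import Data.List using (List; _∷_; []; map)
open import Data.List.Relation.Unary.All using (All)
open import Data.Product using (Σ; Σ-syntax; ∃; ∃-syntax; _×_)
open import Relation.Nullary using (¬_)
open import Relation.Binary.PropositionalEquality using (_≡_)

theorem4p2 :
  (F : ℕ → ℕ → ℤ) →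
  (∀ a k → 1 ≤ a → IsReducedKron (rect k a) (rect k a) (k ∷ []) (F a k)) →
  (∀ a → 1 ≤ a →
    -- (1)
    (Σ[ ns ∈ List ℕ ] (All (1 ≤_) ns × (∀ k → Pcoef (F a) a k ≡ coeffP (prodP (map cyclotomic ns)) k)))
    × IsDegree (Pcoef (F a) a) (degP a)
    × degP a ≡ 2 * lcmUpTo a * a ∸ (a + 2) * a
    × degP a < 2 * a * lcmUpTo a ∸ 1
    -- (2)
    × (∀ k → Pcoef (F a) a k ≡ + countColoured (lcmUpTo a) (colouredParts a) k)
    -- (3)
    × (∀ k → k ≤ degP a → Pcoef (F a) a k > + 0)
    × (∀ k → k ≤ degP a → Pcoef (F a) a k ≡ Pcoef (F a) a (degP a ∸ k))
    -- (4)
    × (∃[ p ] (HasPeriod (λ k → toℚ (F a k)) (2 * a ∸ 1) p × p ∣ lcmUpTo a))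
    × (a < 10 → HasPeriod (λ k → toℚ (F a k)) (2 * a ∸ 1) (lcmUpTo a))
    -- (5)
    × RatFunSymmetry (F a) (a * (a + 2)))
  × (∃[ a ] (1 ≤ a × ¬ Concave (Pcoef (F a) a) (degP a)))
theorem4p2 F h = all-a , 2 , s≤s z≤n , not-concave (F 2) (C.P-countColoured 2 (s≤s z≤n))
  where
  module C (a : ℕ) (1≤a : 1 ≤ a) = Consequences a 1≤a (F a) (GeneratingFunction.Den-reducedKronecker a (F a) 1≤a (λ k → h a k 1≤a))
  all-a : _
  all-a a 1≤a = (Cyclotomics.cyclotomicIndices ℓ js , Cyclotomics.cyclotomicIndices-positive ℓ js , P-cyclotomic)
    , P-degree , refl , ℕP.≤-pred (ℕP.≤-trans degP+2≤ (ℕP.≤-reflexive (sym (ℕP.m+[n∸m]≡n (ℕP.≤-trans (s≤s z≤n) degP+2≤)))))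
    , P-countColoured , P-positive , P-palindromic , (ℓ , hasPeriod , Div.∣-refl) , (λ _ → hasPeriod) , functional-equation
    where open C a 1≤a
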